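{- If ZFC is consistent, then so is ZFC together with the statement: there exists a MAD family $\mathcal{A}\subseteq[\omega]^\omega$ which is also a Q-set, where $\mathcal{A}$ carries the subspace topology inherited from $P(\omega)\cong 2^\omega$ (each subset of $\omega$ identified with its characteristic function).
   Context: $[\omega]^\omega$ denotes the set of infinite subsets of $\omega=\{0,1,2,\dots\}$. A MAD (maximal almost disjoint) family is an infinite set $\mathcal{A}\subseteq[\omega]^\omega$ such that any two distinct elements of $\mathcal{A}$ have finite intersection, and every infinite subset of $\omega$ has infinite intersection with some element of $\mathcal{A}$. A Q-set is an uncountable topological space (here, an uncountable subset of $2^\omega$ with the subspace topology) in which every subset is a relative $G_\delta$ set. -}

module Defs where

open import Data.Fin.Base using (Fin; zero; suc; lift; _↑ʳ_)
open import Data.Fin.Patterns using (0F; 1F; 2F; 3F; 4F)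
open import Data.List.Base using (List; []; _∷_; map)
import Data.List.Membership.Propositional as List
open import Data.Nat.Base using (ℕ; zero; suc)
open import Level using (0ℓ)
open import Relation.Nullary.Negation using (¬_)
open import Relation.Unary using (Pred)

infix  8 _∈_ _≐_ _⊆_
infix  7 ~_
infixr 6 _∧_
infixr 5 _∨_
infixr 4 _⇒_
infix  3 _⇔_

-- Well-scoped de Bruijn syntax: the free variables of a Formula n are
-- Fin n, and 0F is the innermost bound one.  There are no function
-- symbols, so variables are the only terms and substitution is renaming.

data Formula (n : ℕ) : Set where
  _∈_ _≐_ : Fin n → Fin n → Formula n
  ⊥       : Formula n
  _⇒_     : Formula n → Formula n → Formula n
  all     : Formula (suc n) → Formula n

Sentence : Set
Sentence = Formula 0

Theory : Set₁
Theory = Pred Sentence 0ℓ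

private variable
  m n : ℕ

~_ : Formula n → Formula n
~ φ = φ ⇒ ⊥

_∧_ _∨_ _⇔_ : Formula n → Formula n → Formula n
φ ∧ ψ = ~ (φ ⇒ ~ ψ)
φ ∨ ψ = ~ φ ⇒ ψ
φ ⇔ ψ = (φ ⇒ ψ) ∧ (ψ ⇒ φ)

ex : Formula (suc n) → Formula n
ex φ = ~ all (~ φ)

all∈ ex∈ : Fin n → Formula (suc n) → Formula n
all∈ a φ = all (0F ∈ suc a ⇒ φ)
ex∈  a φ = ex (0F ∈ suc a ∧ φ)

rename : (Fin m → Fin n) → Formula m → Formula n
rename ρ (x ∈ y) = ρ x ∈ ρ y
rename ρ (x ≐ y) = ρ x ≐ ρ y
rename ρ ⊥       = ⊥
rename ρ (φ ⇒ ψ) = rename ρ φ ⇒ rename ρ ψ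
rename ρ (all φ) = all (rename (lift 1 ρ) φ)

_[_] : Formula (suc n) → Fin n → Formula n
φ [ t ] = rename (λ { zero → t ; (suc i) → i }) φ

closure : Formula n → Sentence
closure {zero}  φ = φ
closure {suc n} φ = closure (all φ)

-- Natural deduction from a theory T and a list of hypotheses Γ.  The
-- derivation is relative to the n variables in scope; with n = 0 this does
-- not by itself assume a nonempty domain, but the axiom of infinity of ZFC
-- is existential, so for ZFC this agrees with the usual calculus.

infix 2 _∣_⊢_

data _∣_⊢_ (T : Theory) {n : ℕ} (Γ : List (Formula n)) : Formula n → Set where
  axiom : ∀ {σ} → T σ → T ∣ Γ ⊢ rename (λ ()) σ
  hyp   : ∀ {φ} → φ List.∈ Γ → T ∣ Γ ⊢ φ
  ⇒I    : ∀ {φ ψ} → T ∣ φ ∷ Γ ⊢ ψ → T ∣ Γ ⊢ φ ⇒ ψ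
  ⇒E    : ∀ {φ ψ} → T ∣ Γ ⊢ φ ⇒ ψ → T ∣ Γ ⊢ φ → T ∣ Γ ⊢ ψ
  raa   : ∀ {φ} → T ∣ ~ φ ∷ Γ ⊢ ⊥ → T ∣ Γ ⊢ φ
  allI  : ∀ {φ} → T ∣ map (rename suc) Γ ⊢ φ → T ∣ Γ ⊢ all φ
  allE  : ∀ {φ} → T ∣ Γ ⊢ all φ → ∀ t → T ∣ Γ ⊢ φ [ t ]
  ≐I    : ∀ {t} → T ∣ Γ ⊢ t ≐ t
  ≐E    : ∀ {s t} φ → T ∣ Γ ⊢ s ≐ t → T ∣ Γ ⊢ φ [ s ] → T ∣ Γ ⊢ φ [ t ]

Consistent : Theory → Set
Consistent T = ¬ (T ∣ [] ⊢ ⊥ {0})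

_⊆_ : Fin n → Fin n → Formula n
x ⊆ y = all∈ x (0F ∈ suc y)

IsEmpty : Fin n → Formula n
IsEmpty x = all (~ 0F ∈ suc x)

-- s = x ∪ {x}
IsSucc : Fin n → Fin n → Formula n
IsSucc s x = all (0F ∈ suc s ⇔ 0F ∈ suc x ∨ 0F ≐ suc x)

-- z = {x , y}
IsUPair : Fin n → Fin n → Fin n → Formula n
IsUPair z x y = all (0F ∈ suc z ⇔ 0F ≐ suc x ∨ 0F ≐ suc y)

-- z = x ∩ y
IsInter : Fin n → Fin n → Fin n → Formula n
IsInter z x y = all (0F ∈ suc z ⇔ 0F ∈ suc x ∧ 0F ∈ suc y)

Disjoint : Fin n → Fin n → Formula n
Disjoint x y = ~ ex∈ x (0F ∈ suc y)

Inductive : Fin n → Formula n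
Inductive w = ex∈ w (IsEmpty 0F) ∧ all∈ w (ex∈ (suc w) (IsSucc 0F 1F))

extensionality foundation pairing union powerset infinity choice : Sentence

extensionality = all (all (all (0F ∈ 1F ⇔ 0F ∈ 2F) ⇒ 0F ≐ 1F))

foundation = all (ex (0F ∈ 1F) ⇒ ex∈ 0F (Disjoint 0F 1F))

pairing = all (all (ex (IsUPair 0F 1F 2F)))

union = all (ex (all (0F ∈ 1F ⇔ ex∈ 2F (1F ∈ 0F))))

powerset = all (ex (all (0F ∈ 1F ⇔ 0F ⊆ 2F)))

infinity = ex (Inductive 0F)

-- A family of nonempty pairwise disjoint sets has a set c meeting each
-- member in exactly one point.
choice = all
  (  all∈ 0F (ex (0F ∈ 1F))
   ∧ all∈ 0F (all∈ 1F (~ 0F ≐ 1F ⇒ Disjoint 0F 1F))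
   ⇒ ex (all∈ 1F (ex (all (0F ∈ 2F ∧ 0F ∈ 3F ⇔ 0F ≐ 1F)))))

-- ∀ p⃗ a ∃ b ∀ x (x ∈ b ⇔ x ∈ a ∧ φ(x , a , p⃗)); the renaming skips b.
separation : Formula (suc (suc n)) → Sentence
separation φ = closure (all (ex (all
  (0F ∈ 1F ⇔ 0F ∈ 2F ∧ rename (lift 1 suc) φ))))

-- ∀ p⃗ a, if φ(x , y , a , p⃗) is functional in x ∈ a, then
-- ∃ b ∀ y (y ∈ b ⇔ ∃ x ∈ a φ(x , y , a , p⃗)).
-- In the premise the variables in scope are x , y′ , y , a , p⃗, and the two
-- renamings give φ(x , y) and φ(x , y′); in the conclusion they are
-- x , y , b , a , p⃗.
replacement : Formula (suc (suc (suc n))) → Sentence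
replacement φ = closure (all
  (  all (all (all∈ 2F
       (rename (lift 1 suc) φ ⇒ rename (lift 2 suc) φ ⇒ 2F ≐ 1F)))
   ⇒ ex (all (0F ∈ 1F ⇔ ex∈ 2F (rename (lift 2 suc) φ)))))

data ZFC : Theory where
  extensionality-ax : ZFC extensionality
  foundation-ax     : ZFC foundation
  pairing-ax        : ZFC pairing
  union-ax          : ZFC union
  powerset-ax       : ZFC powerset
  infinity-ax       : ZFC infinity
  choice-ax         : ZFC choice
  separation-ax     : (φ : Formula (suc (suc n))) → ZFC (separation φ)
  replacement-ax    : (φ : Formula (suc (suc (suc n)))) → ZFC (replacement φ)

-- From here on, an argument w stands for ω and t for 2 = {0 , 1}.

IsOmega IsOne IsTwo : Fin n → Formula n
IsOmega w = Inductive w ∧ all (Inductive 0F ⇒ suc w ⊆ 0F)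
IsOne o = ex (IsEmpty 0F ∧ IsSucc (suc o) 0F)
IsTwo t = ex (IsOne 0F ∧ IsSucc (suc t) 0F)

-- p = (x , y) = {{x} , {x , y}}
IsPair : Fin n → Fin n → Fin n → Formula n
IsPair p x y = ex (ex
  (  IsUPair 1F (2 ↑ʳ x) (2 ↑ʳ x)
   ∧ IsUPair 0F (2 ↑ʳ x) (2 ↑ʳ y)
   ∧ IsUPair (2 ↑ʳ p) 1F 0F))

-- (x , y) ∈ f
Maps : Fin n → Fin n → Fin n → Formula n
Maps f x y = ex∈ f (IsPair 0F (suc x) (suc y))

-- f : a → b
Function : Fin n → Fin n → Fin n → Formula n
Function f a b =
    all∈ f (ex∈ (1 ↑ʳ a) (ex∈ (2 ↑ʳ b) (IsPair 2F 1F 0F)))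
  ∧ all∈ a (ex (all (Maps (3 ↑ʳ f) 2F 0F ⇔ 0F ≐ 1F)))

Injection : Fin n → Fin n → Fin n → Formula n
Injection f a b =
    Function f a b
  ∧ all∈ a (all∈ (1 ↑ʳ a) (all
      (Maps (3 ↑ʳ f) 2F 0F ∧ Maps (3 ↑ʳ f) 1F 0F ⇒ 2F ≐ 1F)))

Bijection : Fin n → Fin n → Fin n → Formula n
Bijection f a b =
  Injection f a b ∧ all∈ b (ex∈ (1 ↑ʳ a) (Maps (2 ↑ʳ f) 0F 1F))

module _ (w : Fin n) where

  Finite Infinite Countable : Fin n → Formula n
  Finite a = ex∈ w (ex (Bijection 0F 1F (2 ↑ʳ a)))
  Infinite a = ~ Finite a
  Countable a = ex (Injection 0F (1 ↑ʳ a) (1 ↑ʳ w))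

-- x ∈ [ω]^ω
InfiniteSubset : (w x : Fin n) → Formula n
InfiniteSubset w x = x ⊆ w ∧ Infinite w x

MAD : (w A : Fin n) → Formula n
MAD w A =
    Infinite w A
  ∧ all∈ A (InfiniteSubset (1 ↑ʳ w) 0F)
  ∧ all∈ A (all∈ (1 ↑ʳ A)
      (~ 1F ≐ 0F ⇒ ex (IsInter 0F 2F 1F ∧ Finite (3 ↑ʳ w) 0F)))
  ∧ all (InfiniteSubset (1 ↑ʳ w) 0F ⇒
      ex∈ (1 ↑ʳ A) (ex (IsInter 0F 2F 1F ∧ Infinite (3 ↑ʳ w) 0F)))

-- U is open in the product topology: U ⊆ 2^ω, and each f ∈ U has a finite
-- F ⊆ ω such that every g ∈ 2^ω agreeing with f on F lies in U.
Open : (w t U : Fin n) → Formula n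
Open w t U =
    all∈ U (Function 0F (1 ↑ʳ w) (1 ↑ʳ t))
  ∧ all∈ U (ex
      (  0F ⊆ (2 ↑ʳ w)
       ∧ Finite (2 ↑ʳ w) 0F
       ∧ all (  Function 0F (3 ↑ʳ w) (3 ↑ʳ t)
              ∧ all∈ 1F (ex (Maps 4F 1F 0F ∧ Maps 2F 1F 0F))
              ⇒ 0F ∈ (3 ↑ʳ U))))

RelativelyOpen : (w t X O : Fin n) → Formula n
RelativelyOpen w t X O =
  ex (Open (1 ↑ʳ w) (1 ↑ʳ t) 0F ∧ IsInter (1 ↑ʳ O) (1 ↑ʳ X) 0F)

-- Y is the intersection, within X, of a countable set of relatively open
-- subsets of X.
RelativelyGδ : (w t X Y : Fin n) → Formula n
RelativelyGδ w t X Y = ex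
  (  Countable (1 ↑ʳ w) 0F
   ∧ all∈ 0F (RelativelyOpen (2 ↑ʳ w) (2 ↑ʳ t) (2 ↑ʳ X) 0F)
   ∧ all (0F ∈ (2 ↑ʳ Y) ⇔ 0F ∈ (2 ↑ʳ X) ∧ all∈ 1F (1F ∈ 0F)))

QSet : (w t X : Fin n) → Formula n
QSet w t X =
    all∈ X (Function 0F (1 ↑ʳ w) (1 ↑ʳ t))
  ∧ ~ Countable w X
  ∧ all (0F ⊆ (1 ↑ʳ X) ⇒ RelativelyGδ (1 ↑ʳ w) (1 ↑ʳ t) (1 ↑ʳ X) 0F)

-- f : ω → 2 is the characteristic function of x ⊆ ω
IsCharFun : (w t f x : Fin n) → Formula n
IsCharFun w t f x =
    Function f w t
  ∧ all∈ w (0F ∈ (1 ↑ʳ x) ⇔ ex (IsOne 0F ∧ Maps (2 ↑ʳ f) 1F 0F))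

-- X is the copy in 2^ω of the family A ⊆ P(ω)
IsCharImage : (w t X A : Fin n) → Formula n
IsCharImage w t X A =
  all (0F ∈ (1 ↑ʳ X) ⇔ ex∈ (1 ↑ʳ A) (IsCharFun (2 ↑ʳ w) (2 ↑ʳ t) 1F 0F))

-- The quantified variables are, in order, ω, 2, A and X.
existsMADQSet : Sentence
existsMADQSet = ex (ex (ex (ex
  (  IsOmega 3F
   ∧ IsTwo 2F
   ∧ MAD 3F 1F
   ∧ IsCharImage 3F 2F 0F 1F
   ∧ QSet 3F 2F 0F))))

{-# OPTIONS --safe #-}
module Submission where

-- One finite support forcing suffices, without iteration.  Over a countable
-- Henkin model of ZFC take a limit level B of the cumulative hierarchy,
-- I = 𝒫(B), and finite conditions describing sets a_i ⊆ ω (i ∈ I) by facts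
-- m ∈ a_i and promises a_i ∩ a_j ⊆ n, labels (sign , t) of natural numbers,
-- where t ranges over basic clopen sets of 2^B, and for every code α open
-- sets U_k^α ⊆ I by facts [t] ⊆ U_k^α and i ∉ U_k^α.  The fact i ∉ U_k^α may
-- only be used by conditions including some q with ⟨i,q⟩ ∈ α, so α codes a
-- name for a subset of I, and genericity turns ⋂_k U_k^α into that subset.
-- A Δ-system argument on coordinates shows that antichains have size at most
-- |B|, whence every subset of I in the extension has a code, and that the
-- family of the a_i is maximal almost disjoint.
--
-- In a model of the resulting combinatorial statement Ψ, split a_i into the
-- part of those m labelled (1 , t) with i ∈ [t] or (0 , t) with i ∉ [t], and
-- the rest.  The parts still form a MAD family, and now the labels occurring
-- in a part reveal the t with i ∈ [t], so that the relation "some element is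
-- labelled t", which is open, recovers every subset of the family as a G_δ.

open import Defs as D using (Formula; ZFC; rename)
open import Data.Bool.Base using (Bool; true; false; not)
open import Data.Empty using (⊥-elim) renaming (⊥ to 𝟘)
open import Data.Fin.Base using (Fin; zero; suc; lift)
open import Data.Fin.Patterns using (0F; 1F; 2F; 3F; 4F; 5F; 6F; 7F; 8F; 9F)
open import Data.Nat.Base using (ℕ; zero; suc; _+_; _⊔_)
open import Data.Sum.Base using (_⊎_; inj₁; inj₂)
open import Data.Vec.Base using (Vec; []; _∷_; lookup)
open import Relation.Binary.PropositionalEquality using (_≡_; refl; sym; trans; subst)
import Relation.Unary as Unary

infix  3 ¬_
infixr 4 _,_
infixr 2 _×_

-- The metatheory has no excluded middle, so statements about a model are kept stable under double
-- negation, and existence is read as `¬ ¬ Σ`. Countability provides the generic filter: the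
-- elements of the Henkin model are natural numbers, so all its sets of conditions can be treated
-- one by one.
--
-- An iteration is the usual answer to a circle: the conditions should have facts about every name,
-- while names are made of conditions. Here legality breaks the circle. Whether i ∉ U_k^α may occur
-- in p depends only on `q ⊆ p` and `⟨ i , q ⟩ ∈ α`, not on a forcing relation, so every α in a set
-- `H` fixed in advance serves as an index, meaningful or not; the chain condition then brings codes
-- for all subsets of `I` into `H`.
--
-- The indices are subsets of B for two reasons: there are more than |B| of them, which drives the
-- pigeonhole behind maximality, and an index is separated from finitely many others by its trace on
-- a single F ∈ B. Finiteness, countability and open sets are never evaluated in the extension; this
-- is why the combinatorial statement is isolated.

¬_ : Set → Set
¬ A = A → 𝟘

record Σ (A : Set) (B : A → Set) : Set where
  constructor _,_
  field
    proj₁ : A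
    proj₂ : B proj₁
open Σ

_×_ : Set → Set → Set
A × B = Σ A λ _ → B

-- Double-negation reasoning, structures and soundness

module Logic where
  open D
  open import Data.List.Base using (List; []; _∷_; map)
  open import Data.List.Relation.Unary.All as All using (All; []; _∷_)
  import Data.List.Relation.Unary.All.Properties as All

  record Stable (A : Set) : Set where
    constructor mkStable
    field stable : ¬ ¬ A → A
  open Stable {{...}} public

  instance
    stable-𝟘 : Stable 𝟘
    stable-𝟘 = mkStable λ h → h λ z → z

    stable-Π : ∀ {A : Set} {B : A → Set} {{_ : ∀ {x} → Stable (B x)}} → Stable ((x : A) → B x)
    stable-Π = mkStable λ h x → stable λ k → h λ f → k (f x)

    stable-× : ∀ {A B : Set} {{_ : Stable A}} {{_ : Stable B}} → Stable (A × B)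
    stable-× = mkStable λ h → stable (λ k → h λ p → k (proj₁ p)) , stable (λ k → h λ p → k (proj₂ p))

  -- The ¬¬-monad, run into stable goals.
  infixl 1 _>>=_
  _>>=_ : ∀ {A C : Set} {{_ : Stable C}} → ¬ ¬ A → (A → C) → C
  h >>= f = stable λ k → h λ a → k (f a)

  infixl 1 _>>¬_
  _>>¬_ : ∀ {A B : Set} → ¬ ¬ A → (A → ¬ B) → ¬ B
  (h >>¬ f) b = h λ a → f a b

  η : ∀ {A : Set} → A → ¬ ¬ A
  η a k = k a

  lem : ∀ {A : Set} → ¬ ¬ (A ⊎ ¬ A)
  lem k = k (inj₂ λ a → k (inj₁ a))

  cases : ∀ {A C : Set} {{_ : Stable C}} → (A → C) → (¬ A → C) → C
  cases {A} f g = lem {A} >>= λ { (inj₁ a) → f a ; (inj₂ b) → g b }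

  infix 1 _↔_
  _↔_ : Set → Set → Set
  A ↔ B = (A → B) × (B → A)

  ↔-refl : ∀ {A} → A ↔ A
  ↔-refl = (λ a → a) , (λ a → a)

  ↔-sym : ∀ {A B} → A ↔ B → B ↔ A
  ↔-sym (f , g) = g , f

  ↔-trans : ∀ {A B C} → A ↔ B → B ↔ C → A ↔ C
  ↔-trans (f , g) (f′ , g′) = (λ a → f′ (f a)) , (λ c → g (g′ c))

  ↔-→ : ∀ {A A′ B B′} → A ↔ A′ → B ↔ B′ → (A → B) ↔ (A′ → B′)
  ↔-→ (f , g) (f′ , g′) = (λ h a → f′ (h (g a))) , (λ h a → g′ (h (f a)))

  -- Equality is interpreted by a congruence `Q` instead of identity: in the term model and in the
  -- forcing extension it is a derived relation, and no quotient has to be formed.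
  record Structure : Set₁ where
    field
      M   : Set
      E Q : M → M → Set
      {{stable-E}} : ∀ {x y} → Stable (E x y)
      {{stable-Q}} : ∀ {x y} → Stable (Q x y)
      Q-refl  : ∀ {x} → Q x x
      Q-sym   : ∀ {x y} → Q x y → Q y x
      Q-trans : ∀ {x y z} → Q x y → Q y z → Q x z
      E-cong  : ∀ {x x′ y y′} → Q x x′ → Q y y′ → E x y → E x′ y′

  module Semantics (S : Structure) where
    open Structure S

    ⟦_⟧ : ∀ {n} → Formula n → Vec M n → Set
    ⟦ x ∈ y ⟧ e = E (lookup e x) (lookup e y)
    ⟦ x ≐ y ⟧ e = Q (lookup e x) (lookup e y)
    ⟦ ⊥ ⟧ e     = 𝟘
    ⟦ φ ⇒ ψ ⟧ e = ⟦ φ ⟧ e → ⟦ ψ ⟧ e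
    ⟦ all φ ⟧ e = ∀ x → ⟦ φ ⟧ (x ∷ e)

    stable-⟦⟧ : ∀ {n} (φ : Formula n) e → Stable (⟦ φ ⟧ e)
    stable-⟦⟧ (x ∈ y) e = stable-E
    stable-⟦⟧ (x ≐ y) e = stable-Q
    stable-⟦⟧ ⊥ e       = stable-𝟘
    stable-⟦⟧ (φ ⇒ ψ) e = stable-Π {{stable-⟦⟧ ψ e}}
    stable-⟦⟧ (all φ) e = stable-Π {{λ {x} → stable-⟦⟧ φ (x ∷ e)}}

    -- Renaming and congruence for the interpreted equality at once.
    ⟦rename⟧ : ∀ {m n} (φ : Formula m) (ρ : Fin m → Fin n) {e : Vec M n} {e′ : Vec M m} →
               (∀ i → Q (lookup e′ i) (lookup e (ρ i))) → ⟦ rename ρ φ ⟧ e ↔ ⟦ φ ⟧ e′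
    ⟦rename⟧ (x ∈ y) ρ h = E-cong (Q-sym (h x)) (Q-sym (h y)) , E-cong (h x) (h y)
    ⟦rename⟧ (x ≐ y) ρ h = (λ q → Q-trans (h x) (Q-trans q (Q-sym (h y))))
                         , (λ q → Q-trans (Q-sym (h x)) (Q-trans q (h y)))
    ⟦rename⟧ ⊥ ρ h = ↔-refl
    ⟦rename⟧ (φ ⇒ ψ) ρ h = ↔-→ (⟦rename⟧ φ ρ h) (⟦rename⟧ ψ ρ h)
    ⟦rename⟧ (all φ) ρ {e} {e′} h = (λ f x → proj₁ (ih x) (f x)) , (λ f x → proj₂ (ih x) (f x))
      where
      ih : ∀ x → ⟦ rename (lift 1 ρ) φ ⟧ (x ∷ e) ↔ ⟦ φ ⟧ (x ∷ e′)
      ih x = ⟦rename⟧ φ (lift 1 ρ) λ { zero → Q-refl ; (suc i) → h i }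

    ≡⇒Q : ∀ {x y} → x ≡ y → Q x y
    ≡⇒Q refl = Q-refl

    ⟦closure⟧ : ∀ {n} (φ : Formula n) → ⟦ closure φ ⟧ [] ↔ (∀ e → ⟦ φ ⟧ e)
    ⟦closure⟧ {zero} φ = (λ { h [] → h }) , (λ h → h [])
    ⟦closure⟧ {suc n} φ with ⟦closure⟧ (all φ)
    ... | f , g = (λ { h (x ∷ e) → f h e x }) , (λ h → g λ e x → h (x ∷ e))

    module _ {T : Theory} (holds : ∀ {σ} → T σ → ⟦ σ ⟧ []) where

      sound : ∀ {n} {Γ : List (Formula n)} {φ} → T ∣ Γ ⊢ φ → ∀ e → All (λ ψ → ⟦ ψ ⟧ e) Γ → ⟦ φ ⟧ e
      sound (axiom {σ} t) e γ = proj₂ (⟦rename⟧ σ (λ ()) (λ ())) (holds t)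
      sound (hyp i) e γ = All.lookup γ i
      sound (⇒I d) e γ = λ a → sound d e (a ∷ γ)
      sound (⇒E d d′) e γ = sound d e γ (sound d′ e γ)
      sound (raa {φ} d) e γ = stable {{stable-⟦⟧ φ e}} λ k → sound d e (k ∷ γ)
      sound (allI d) e γ x = sound d (x ∷ e) (All.map⁺ (All.map (λ {ψ} → proj₂ (⟦rename⟧ ψ suc (λ i → Q-refl))) γ))
      sound (allE {φ} d t) e γ = proj₂ (⟦rename⟧ φ _ λ { zero → Q-refl ; (suc i) → Q-refl }) (sound d e γ (lookup e t))
      sound ≐I e γ = Q-refl
      sound (≐E {s} {t} φ d d′) e γ =
        proj₂ (⟦rename⟧ φ _ {e′ = lookup e s ∷ e} λ { zero → sound d e γ ; (suc i) → Q-refl })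
          (proj₁ (⟦rename⟧ φ _ λ { zero → Q-refl ; (suc i) → Q-refl }) (sound d′ e γ))

      sound⇒consistent : Consistent T
      sound⇒consistent d = sound d [] []

  -- `ε` turns existence, which is only a double negation, into an element, so that pairing, union
  -- and the other axioms become functions on `M`. The Henkin construction supplies it; the forcing
  -- extension is built as a bare `Structure` and serves soundness only.
  record Model (T : Theory) : Set₁ where
    field structure : Structure
    open Structure structure public
    open Semantics structure public
    field
      holds : ∀ {σ} → T σ → ⟦ σ ⟧ []
      -- Hilbert's choice operator for formulas with parameters.
      ε      : ∀ {n} → Formula (suc n) → Vec M n → M
      ε-spec : ∀ {n} (φ : Formula (suc n)) e → ⟦ ex φ ⟧ e → ⟦ φ ⟧ (ε φ e ∷ e)

open Logic

-- Henkin's completeness theorem, with a term model on the natural numbers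

module Completeness where
  open D
  open import Data.Fin.Base using (toℕ)
  open import Data.List.Base using (List; []; _∷_; map; _++_)
  open import Data.List.Relation.Unary.All as All using (All; []; _∷_)
  import Data.List.Relation.Unary.All.Properties as All
  open import Data.List.Relation.Unary.Any using (here; there)
  open import Data.List.Relation.Binary.Subset.Propositional using () renaming (_⊆_ to _⊑_)
  open import Data.List.Relation.Binary.Subset.Propositional.Properties using (map⁺; ∷⁺ʳ; xs⊆xs++ys; xs⊆ys++xs)
  import Data.List.Membership.Propositional as List
  open import Data.List.Membership.Propositional.Properties using (∈-map⁺)
  open import Data.List.Properties using (map-∘; map-cong)
  open import Data.Nat.Base using (_≤_; z≤n; s≤s)
  open import Data.Nat.Properties using (≤-refl; ≤-trans; m≤m⊔n; m≤n⊔m; m≤n⇒m≤1+n; +-suc; +-identityʳ; ≤-reflexive; suc-injective; _≤?_; 1+n≰n; m⊔n≤o⇒m≤o; m⊔n≤o⇒n≤o)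
  open import Function.Base using (_∘_)
  open import Relation.Binary.PropositionalEquality using (_≗_; cong; cong₂)
  open import Relation.Nullary.Decidable using (yes; no)

  lift-cong : ∀ {m n} {ρ σ : Fin m → Fin n} → ρ ≗ σ → lift 1 ρ ≗ lift 1 σ
  lift-cong h zero    = refl
  lift-cong h (suc i) = cong suc (h i)

  rename-cong : ∀ {m n} {ρ σ : Fin m → Fin n} → ρ ≗ σ → rename ρ ≗ rename σ
  rename-cong h (x ∈ y) = cong₂ _∈_ (h x) (h y)
  rename-cong h (x ≐ y) = cong₂ _≐_ (h x) (h y)
  rename-cong h ⊥       = refl
  rename-cong h (φ ⇒ ψ) = cong₂ _⇒_ (rename-cong h φ) (rename-cong h ψ)
  rename-cong h (all φ) = cong all (rename-cong (lift-cong h) φ)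

  rename-∘ : ∀ {l m n} {ρ : Fin m → Fin n} {σ : Fin l → Fin m} {τ : Fin l → Fin n} →
             ρ ∘ σ ≗ τ → rename ρ ∘ rename σ ≗ rename τ
  rename-∘ h (x ∈ y) = cong₂ _∈_ (h x) (h y)
  rename-∘ h (x ≐ y) = cong₂ _≐_ (h x) (h y)
  rename-∘ h ⊥       = refl
  rename-∘ h (φ ⇒ ψ) = cong₂ _⇒_ (rename-∘ h φ) (rename-∘ h ψ)
  rename-∘ h (all φ) = cong all (rename-∘ (λ { zero → refl ; (suc i) → cong suc (h i) }) φ)

  -- φ [ t ] = rename (inst t) φ up to pointwise equality
  inst : ∀ {n} → Fin n → Fin (suc n) → Fin n
  inst t zero    = t
  inst t (suc i) = i

  rename-[] : ∀ {m n} (ρ : Fin m → Fin n) (φ : Formula (suc m)) t →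
              rename ρ (φ [ t ]) ≡ rename (lift 1 ρ) φ [ ρ t ]
  rename-[] ρ φ t =
    trans (rename-∘ {τ = λ i → ρ (inst t i)} (λ { zero → refl ; (suc i) → refl }) φ)
      (sym (rename-∘ (λ { zero → refl ; (suc i) → refl }) φ))

  module _ {T : Theory} where

    weaken : ∀ {n} {Γ Δ : List (Formula n)} {φ} → Γ ⊑ Δ → T ∣ Γ ⊢ φ → T ∣ Δ ⊢ φ
    weaken s (axiom t)     = axiom t
    weaken s (hyp i)       = hyp (s i)
    weaken s (⇒I d)        = ⇒I (weaken (∷⁺ʳ _ s) d)
    weaken s (⇒E d d′)     = ⇒E (weaken s d) (weaken s d′)
    weaken s (raa d)       = raa (weaken (∷⁺ʳ _ s) d)
    weaken s (allI d)      = allI (weaken (map⁺ _ s) d)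
    weaken s (allE d t)    = allE (weaken s d) t
    weaken s ≐I            = ≐I
    weaken s (≐E φ d d′)   = ≐E φ (weaken s d) (weaken s d′)

    rename-⊢ : ∀ {m n} {Γ : List (Formula m)} {φ} (ρ : Fin m → Fin n) →
               T ∣ Γ ⊢ φ → T ∣ map (rename ρ) Γ ⊢ rename ρ φ
    rename-⊢ ρ (axiom {σ} t) = subst (T ∣ _ ⊢_) (sym (rename-∘ (λ ()) σ)) (axiom t)
    rename-⊢ ρ (hyp i)       = hyp (∈-map⁺ (rename ρ) i)
    rename-⊢ ρ (⇒I d)        = ⇒I (rename-⊢ ρ d)
    rename-⊢ ρ (⇒E d d′)     = ⇒E (rename-⊢ ρ d) (rename-⊢ ρ d′)
    rename-⊢ ρ (raa d)       = raa (rename-⊢ ρ d)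
    rename-⊢ {Γ = Γ} ρ (allI {φ} d) = allI (subst (T ∣_⊢ _) eq (rename-⊢ (lift 1 ρ) d))
      where
      eq : map (rename (lift 1 ρ)) (map (rename suc) Γ) ≡ map (rename suc) (map (rename ρ) Γ)
      eq = trans (sym (map-∘ Γ)) (trans (map-cong (λ ψ → trans (rename-∘ (λ i → refl) ψ) (sym (rename-∘ (λ i → refl) ψ))) Γ) (map-∘ Γ))
    rename-⊢ ρ (allE {φ} d t) = subst (T ∣ _ ⊢_) (sym (rename-[] ρ φ t)) (allE (rename-⊢ ρ d) (ρ t))
    rename-⊢ ρ ≐I            = ≐I
    rename-⊢ ρ (≐E {s} {t} φ d d′) = subst (T ∣ _ ⊢_) (sym (rename-[] ρ φ t))
      (≐E (rename (lift 1 ρ) φ) (rename-⊢ ρ d) (subst (T ∣ _ ⊢_) (rename-[] ρ φ s) (rename-⊢ ρ d′)))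

    ex-falso : ∀ {n} {Γ : List (Formula n)} {φ} → T ∣ Γ ⊢ ⊥ → T ∣ Γ ⊢ φ
    ex-falso d = raa (weaken there d)

  step : ℕ × ℕ → ℕ × ℕ
  step (zero  , y) = suc y , zero
  step (suc x , y) = x , suc y

  unpair : ℕ → ℕ × ℕ
  unpair zero    = zero , zero
  unpair (suc n) = step (unpair n)

  unpair-≤ : ∀ n → proj₁ (unpair n) + proj₂ (unpair n) ≤ n
  unpair-≤ zero = z≤n
  unpair-≤ (suc n) with unpair n | unpair-≤ n
  ... | zero  , y | h = s≤s (≤-trans (≤-reflexive (+-identityʳ y)) h)
  ... | suc x , y | h = ≤-trans (≤-reflexive (+-suc x y)) (m≤n⇒m≤1+n h)

  unpair-onto : ∀ x y → Σ ℕ λ n → unpair n ≡ (x , y)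
  unpair-onto x y = go (x + y) y x refl
    where
    go : ∀ s y x → x + y ≡ s → Σ ℕ λ n → unpair n ≡ (x , y)
    go s (suc y) x h with go s y (suc x) (trans (sym (+-suc x y)) h)
    ... | n , eq = suc n , cong step eq
    go s zero zero h = zero , refl
    go (suc s) zero (suc x) h with go s x zero (suc-injective (trans (cong suc (sym (+-identityʳ x))) h))
    ... | n , eq = suc n , cong step eq

  clamp : ∀ {n} → ℕ → Fin (suc n)
  clamp {zero}  _       = zero
  clamp {suc n} zero    = zero
  clamp {suc n} (suc a) = suc (clamp a)

  clamp-toℕ : ∀ {n} (i : Fin (suc n)) → clamp (toℕ i) ≡ i
  clamp-toℕ {zero}  zero    = refl
  clamp-toℕ {suc n} zero    = refl
  clamp-toℕ {suc n} (suc i) = cong suc (clamp-toℕ i)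

  toℕ-clamp : ∀ {n a} → a ≤ n → toℕ (clamp {n} a) ≡ a
  toℕ-clamp {zero}  z≤n     = refl
  toℕ-clamp {suc n} z≤n     = refl
  toℕ-clamp {suc n} (s≤s h) = cong suc (toℕ-clamp h)

  -- Only surjectivity onto formulas is wanted. `fuel` makes the recursion structural, and `clamp`
  -- forces variables into scope, so every number decodes to some formula.
  decode : (fuel code n : ℕ) → Formula (suc n)
  decodeBy : (fuel n : ℕ) → ℕ × ℕ → Formula (suc n)
  decode zero    c n = ⊥
  decode (suc f) c n = decodeBy f n (unpair c)
  decodeBy f n (0 , r) = ⊥
  decodeBy f n (1 , r) = clamp (proj₁ (unpair r)) ∈ clamp (proj₂ (unpair r))
  decodeBy f n (2 , r) = clamp (proj₁ (unpair r)) ≐ clamp (proj₂ (unpair r))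
  decodeBy f n (3 , r) = decode f (proj₁ (unpair r)) n ⇒ decode f (proj₂ (unpair r)) n
  decodeBy f n (_ , r) = all (decode f r (suc n))

  depth : ∀ {n} → Formula n → ℕ
  depth (x ∈ y) = 1
  depth (x ≐ y) = 1
  depth ⊥       = 1
  depth (φ ⇒ ψ) = suc (depth φ ⊔ depth ψ)
  depth (all φ) = suc (depth φ)

  decode-onto : ∀ {n} (φ : Formula (suc n)) f → depth φ ≤ f → Σ ℕ λ c → decode f c n ≡ φ
  decode-onto (x ∈ y) zero ()
  decode-onto (x ≐ y) zero ()
  decode-onto ⊥ zero ()
  decode-onto (φ ⇒ ψ) zero ()
  decode-onto (all φ) zero ()
  decode-onto {n} φ (suc f) h with φ
  decode-onto {n} φ (suc f) h | x ∈ y with unpair-onto (toℕ x) (toℕ y)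
  ... | r , e with unpair-onto 1 r
  ... | c , e′ = c , trans (cong (decodeBy f n) e′)
    (cong₂ _∈_ (trans (cong (clamp ∘ proj₁) e) (clamp-toℕ x)) (trans (cong (clamp ∘ proj₂) e) (clamp-toℕ y)))
  decode-onto {n} φ (suc f) h | x ≐ y with unpair-onto (toℕ x) (toℕ y)
  ... | r , e with unpair-onto 2 r
  ... | c , e′ = c , trans (cong (decodeBy f n) e′)
    (cong₂ _≐_ (trans (cong (clamp ∘ proj₁) e) (clamp-toℕ x)) (trans (cong (clamp ∘ proj₂) e) (clamp-toℕ y)))
  decode-onto {n} φ (suc f) h | ⊥ with unpair-onto 0 0
  ... | c , e = c , cong (decodeBy f n) e
  decode-onto {n} φ (suc f) (s≤s h) | ψ ⇒ χ
    with decode-onto ψ f (m⊔n≤o⇒m≤o _ _ h) | decode-onto χ f (m⊔n≤o⇒n≤o (depth ψ) _ h)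
  ... | a , ea | b , eb with unpair-onto a b
  ... | r , e with unpair-onto 3 r
  ... | c , e′ = c , trans (cong (decodeBy f n) e′)
    (cong₂ _⇒_ (trans (cong (λ p → decode f (proj₁ p) n) e) ea) (trans (cong (λ p → decode f (proj₂ p) n) e) eb))
  decode-onto {n} φ (suc f) (s≤s h) | all ψ with decode-onto ψ f h
  ... | a , ea with unpair-onto 4 a
  ... | c , e′ = c , trans (cong (decodeBy f n) e′) (cong all ea)

  -- The constants of stage N are 0 , … , N; constant k is the variable const k N.

  const : ℕ → (N : ℕ) → Fin (suc N)
  const k zero = zero
  const k (suc N) with k ≤? N
  ... | yes _ = suc (const k N)
  ... | no  _ = zero

  const-old : ∀ {k N} → k ≤ N → const k (suc N) ≡ suc (const k N)
  const-old {k} {N} h with k ≤? N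
  ... | yes _ = refl
  ... | no ¬h = ⊥-elim (¬h h)

  const-new : ∀ N → const (suc N) (suc N) ≡ zero
  const-new N with suc N ≤? N
  ... | yes h = ⊥-elim (1+n≰n h)
  ... | no _  = refl

  closeAt : ∀ {m} → Vec ℕ m → (N : ℕ) → Fin m → Fin (suc N)
  closeAt ρ N i = const (lookup ρ i) N

  bound : ∀ {m} (ρ : Vec ℕ m) → Σ ℕ λ n → ∀ i → lookup ρ i ≤ n
  bound [] = 0 , λ ()
  bound (k ∷ ρ) with bound ρ
  ... | n , h = k ⊔ n , λ { zero → m≤m⊔n k n ; (suc i) → ≤-trans (h i) (m≤n⊔m k n) }

  -- Stage N treats the task numbered N. By `unpair-≤` the scope of that task is at most N, so all
  -- constants that its formula can mention already exist.
  taskScope taskFuel taskCode : ℕ → ℕ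
  taskScope N = proj₁ (unpair N)
  taskFuel N = proj₁ (unpair (proj₂ (unpair N)))
  taskCode N = proj₂ (unpair (proj₂ (unpair N)))

  witnessTask decisionTask : (N : ℕ) → Formula (suc (suc N))
  witnessTask N = rename (lift 1 (λ i → const (toℕ i) N)) (decode (taskFuel N) (taskCode N) (suc (taskScope N)))
  decisionTask N = rename (λ i → const (toℕ i) (suc N)) (decode (taskFuel N) (taskCode N) (taskScope N))

  task : ∀ n f c → Σ ℕ λ N → (taskScope N ≡ n × taskFuel N ≡ f) × (taskCode N ≡ c × n ≤ N)
  task n f c with unpair-onto f c
  ... | r , e with unpair-onto n r
  ... | N , e′ = N , (cong proj₁ e′ , trans (cong (proj₁ ∘ unpair ∘ proj₂) e′) (cong proj₁ e))
    , trans (cong (proj₂ ∘ unpair ∘ proj₂) e′) (cong proj₂ e)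
    , ≤-trans (≤-trans (≤-reflexive (sym (cong proj₁ e′))) (m≤m+n _ _)) (unpair-≤ N)
    where open import Data.Nat.Properties using (m≤m+n)

  witness-onto : ∀ {m} (φ : Formula (suc m)) (ρ : Vec ℕ m) →
    Σ ℕ λ N → (∀ i → lookup ρ i ≤ N) × witnessTask N ≡ rename (lift 1 (closeAt ρ N)) φ
  witness-onto {m} φ ρ with bound ρ
  ... | n , h with decode-onto (rename (lift 1 λ i → clamp {n} (lookup ρ i)) φ) _ ≤-refl
  ... | c , e with task n (depth (rename (lift 1 λ i → clamp {n} (lookup ρ i)) φ)) c
  ... | N , (refl , e₂) , (e₃ , n≤N) = N , (λ i → ≤-trans (h i) n≤N) ,
    trans (cong (rename _) (trans (cong₂ (λ f c → decode f c _) e₂ e₃) e))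
      (rename-∘ (λ { zero → refl ; (suc i) → cong (λ k → suc (const k N)) (toℕ-clamp (h i)) }) φ)

  decision-onto : ∀ {m} (φ : Formula m) (ρ : Vec ℕ m) →
    Σ ℕ λ N → (∀ i → lookup ρ i ≤ N) × decisionTask N ≡ rename (closeAt ρ (suc N)) φ
  decision-onto {m} φ ρ with bound ρ
  ... | n , h with decode-onto (rename (λ i → clamp {n} (lookup ρ i)) φ) _ ≤-refl
  ... | c , e with task n (depth (rename (λ i → clamp {n} (lookup ρ i)) φ)) c
  ... | N , (refl , e₂) , (e₃ , n≤N) = N , (λ i → ≤-trans (h i) n≤N) ,
    trans (cong (rename _) (trans (cong₂ (λ f c → decode f c _) e₂ e₃) e))
      (rename-∘ (λ i → cong (λ k → const k (suc N)) (toℕ-clamp (h i))) φ)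

  module Henkin (T : Theory) (T∋infinity : T infinity) (con : Consistent T) where

    Ctx : ℕ → Set₁
    Ctx n = Formula n → Set

    Prov : ∀ {n} → Ctx n → Formula n → Set
    Prov C φ = Σ (List _) λ Δ → All C Δ × (T ∣ Δ ⊢ φ)

    Cons : ∀ {n} → Ctx n → Set
    Cons C = ¬ Prov C ⊥

    _⊕_ : ∀ {n} → Ctx n → Formula n → Ctx n
    (C ⊕ χ) ψ = C ψ ⊎ ψ ≡ χ

    prov-mono : ∀ {n} {C D : Ctx n} {φ} → (∀ {ψ} → C ψ → D ψ) → Prov C φ → Prov D φ
    prov-mono h (Δ , a , d) = Δ , All.map h a , d

    prov-⇒E : ∀ {n} {C : Ctx n} {φ ψ} → Prov C (φ ⇒ ψ) → Prov C φ → Prov C ψ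
    prov-⇒E (Δ , a , d) (Δ′ , a′ , d′) =
      Δ ++ Δ′ , All.++⁺ a a′ , ⇒E (weaken (xs⊆xs++ys Δ Δ′) d) (weaken (xs⊆ys++xs Δ′ Δ) d′)

    prov-⊢ : ∀ {n} {C : Ctx n} {φ ψ} → T ∣ φ ∷ [] ⊢ ψ → Prov C φ → Prov C ψ
    prov-⊢ d = prov-⇒E ([] , [] , ⇒I d)

    split : ∀ {n} {C : Ctx n} {χ} Δ → All (C ⊕ χ) Δ → Σ (List _) λ Δ₀ → All C Δ₀ × Δ ⊑ (χ ∷ Δ₀)
    split [] [] = [] , [] , λ ()
    split (ψ ∷ Δ) (inj₁ c ∷ a) with split Δ a
    ... | Δ₀ , a₀ , s = ψ ∷ Δ₀ , c ∷ a₀ , λ { (here e) → there (here e) ; (there i) → skip (s i) }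
      where
      skip : ∀ {ψ χ φ} {Δ : List (Formula _)} → φ List.∈ (χ ∷ Δ) → φ List.∈ (χ ∷ ψ ∷ Δ)
      skip (here e)  = here e
      skip (there i) = there (there i)
    split (ψ ∷ Δ) (inj₂ refl ∷ a) with split Δ a
    ... | Δ₀ , a₀ , s = Δ₀ , a₀ , λ { (here e) → here e ; (there i) → s i }

    deduction : ∀ {n} {C : Ctx n} {χ ψ} → Prov (C ⊕ χ) ψ → Prov C (χ ⇒ ψ)
    deduction (Δ , a , d) with split Δ a
    ... | Δ₀ , a₀ , s = Δ₀ , a₀ , ⇒I (weaken s d)

    henkin : ∀ N → Formula (suc (suc N))
    henkin N = rename suc (ex (witnessTask N)) ⇒ witnessTask N

    Shift : ∀ {n} → Ctx n → Ctx (suc n)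
    Shift C ψ = Σ _ λ φ → C φ × ψ ≡ rename suc φ

    -- Constants are free variables: stage N is a theory in N + 1 of them, and the newest one is the
    -- witness in the Henkin axiom added last. Consistency of the decision formula cannot be decided
    -- here, so the formula is made a member on condition of being consistent, and a proof of
    -- membership contains the proof of consistency.
    stage half : (N : ℕ) → Ctx (suc N)
    half zero ψ = 𝟘
    half (suc N) = Shift (stage N) ⊕ henkin N
    stage zero ψ = 𝟘
    stage (suc N) ψ = half (suc N) ψ ⊎ (ψ ≡ decisionTask N × Cons (half (suc N) ⊕ decisionTask N))

    -- The axiom of infinity provides an element, so a fresh variable is harmless.
    inhabited : ∀ {n} {Γ : List (Formula n)} → T ∣ Γ ⊢ all ⊥ → T ∣ Γ ⊢ ⊥
    inhabited d = ⇒E (axiom T∋infinity) (⇒E (⇒I (allI (⇒I (allE (hyp (there (here refl))) zero)))) d)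

    unshift : ∀ {n} {C : Ctx n} Δ → All (Shift C) Δ → Σ (List _) λ Δ₀ → All C Δ₀ × map (rename suc) Δ₀ ≡ Δ
    unshift [] [] = [] , [] , refl
    unshift (ψ ∷ Δ) ((φ , c , refl) ∷ a) with unshift Δ a
    ... | Δ₀ , a₀ , refl = φ ∷ Δ₀ , c ∷ a₀ , refl

    prov-shift : ∀ {n} {C : Ctx n} {φ} → Prov C φ → Prov (Shift C) (rename suc φ)
    prov-shift (Δ , a , d) = map (rename suc) Δ , All.map⁺ (All.map (λ c → _ , c , refl) a) , rename-⊢ suc d

    prov-all : ∀ {n} {C : Ctx n} {φ} → Prov (Shift C) φ → Prov C (all φ)
    prov-all (Δ , a , d) with unshift Δ a
    ... | Δ₀ , a₀ , refl = Δ₀ , a₀ , allI d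

    -- Refuting the Henkin axiom yields both `ex θ` and, for the fresh variable, `~ θ`; generalizing
    -- the latter contradicts the former. The contradiction still lives in the larger scope and is
    -- brought down by `inhabited`.
    cons-half : ∀ N → Cons (stage N) → Cons (half (suc N))
    cons-half N c p = c (prov-⊢′ (prov-all (prov-⇒E notAll (prov-shift (prov-all noWitness)))))
      where
      prov-⊢′ : Prov (stage N) (all ⊥) → Prov (stage N) ⊥
      prov-⊢′ (Δ , a , d) = Δ , a , inhabited d
      θ = witnessTask N
      ¬henkin = deduction p
      notAll : Prov (Shift (stage N)) (rename suc (ex θ))
      notAll = prov-⊢ (raa (⇒E (hyp (there (here refl))) (⇒I (ex-falso (⇒E (hyp (there (here refl))) (hyp (here refl))))))) ¬henkin
      noWitness : Prov (Shift (stage N)) (~ θ)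
      noWitness = prov-⊢ (⇒I (⇒E (hyp (there (here refl))) (⇒I (hyp (there (here refl)))))) ¬henkin

    cons-stage : ∀ N → Cons (stage N)
    cons-stage zero ([] , [] , d) = con (rescope d)
      where
      rescope : T ∣ [] ⊢ ⊥ {1} → T ∣ [] ⊢ ⊥ {0}
      rescope d = inhabited (allI d)
    cons-stage zero (ψ ∷ Δ , () ∷ _ , d)
    cons-stage (suc N) (Δ , a , d) with sift Δ a
      where
      sift : ∀ Δ → All (stage (suc N)) Δ → All (half (suc N)) Δ ⊎ Cons (half (suc N) ⊕ decisionTask N)
      sift [] [] = inj₁ []
      sift (ψ ∷ Δ) (inj₂ (_ , c) ∷ a) = inj₂ c
      sift (ψ ∷ Δ) (inj₁ h ∷ a) with sift Δ a
      ... | inj₁ hs = inj₁ (h ∷ hs)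
      ... | inj₂ c  = inj₂ c
    ... | inj₁ hs = cons-half N (cons-stage N) (Δ , hs , d)
    ... | inj₂ c  = c (Δ , All.map (λ { (inj₁ h) → inj₁ h ; (inj₂ (e , _)) → inj₂ e }) a , d)

    record True {m} (φ : Formula m) (ρ : Vec ℕ m) : Set where
      constructor holdsAt
      field
        level  : ℕ
        below  : ∀ i → lookup ρ i ≤ level
        proof  : Prov (stage level) (rename (closeAt ρ level) φ)

    raise : ∀ {m} (φ : Formula m) ρ {N N′} → (∀ i → lookup ρ i ≤ N) → N ≤ N′ →
            Prov (stage N) (rename (closeAt ρ N) φ) → Prov (stage N′) (rename (closeAt ρ N′) φ)
    raise φ ρ {N} {N′} h le p = go (≤⇒≤′ le)
      where
      open import Data.Nat.Base using (_≤′_; ≤′-refl; ≤′-step)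
      open import Data.Nat.Properties using (≤⇒≤′; ≤′⇒≤)
      go : ∀ {N′} → N ≤′ N′ → Prov (stage N′) (rename (closeAt ρ N′) φ)
      go ≤′-refl = p
      go (≤′-step {K} le) = subst (Prov (stage (suc K)))
        (rename-∘ (λ i → sym (const-old (≤-trans (h i) (≤′⇒≤ le)))) φ)
        (prov-mono (λ s → inj₁ (inj₁ s)) (prov-shift (go le)))

    True-⇒E : ∀ {m} {φ ψ : Formula m} {ρ} → True (φ ⇒ ψ) ρ → True φ ρ → True ψ ρ
    True-⇒E {φ = φ} {ψ} {ρ} (holdsAt N h p) (holdsAt N′ h′ p′) = holdsAt
      (N ⊔ N′) (λ i → ≤-trans (h i) (m≤m⊔n N N′))
      (prov-⇒E (raise (φ ⇒ ψ) ρ h (m≤m⊔n N N′) p) (raise φ ρ h′ (m≤n⊔m N N′) p′))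

    True-⊢ : ∀ {m} {φ ψ : Formula m} {ρ} → (∀ {n} (σ : Fin m → Fin n) → T ∣ rename σ φ ∷ [] ⊢ rename σ ψ) →
             True φ ρ → True ψ ρ
    True-⊢ d (holdsAt N h p) = holdsAt N h (prov-⊢ (d _) p)

    True-consistent : ∀ {m} {ρ : Vec ℕ m} → ¬ True ⊥ ρ
    True-consistent (holdsAt N _ p) = cons-stage N p

    decide : ∀ {m} (φ : Formula m) ρ → ¬ True (~ φ) ρ → True φ ρ
    decide φ ρ ¬t with decision-onto φ ρ
    ... | N , h , e = holdsAt (suc N) h′ (_ ∷ [] , inj₂ (sym e , consistent) ∷ [] , hyp (here refl))
      where
      h′ : ∀ i → lookup ρ i ≤ suc N
      h′ i = m≤n⇒m≤1+n (h i)
      consistent : Cons (half (suc N) ⊕ decisionTask N)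
      consistent p = ¬t (holdsAt (suc N) h′ (subst (λ δ → Prov (stage (suc N)) (~ δ)) e (prov-mono inj₁ (deduction p))))

    True-stable : ∀ {m} {φ : Formula m} {ρ} → Stable (True φ ρ)
    True-stable {φ = φ} {ρ} = mkStable λ h → decide φ ρ λ n → h λ t → True-consistent (True-⇒E n t)

    True-⇒I : ∀ {m} {φ ψ : Formula m} {ρ} → (True φ ρ → True ψ ρ) → True (φ ⇒ ψ) ρ
    True-⇒I f = decide _ _ λ n → True-consistent (True-⇒E
      (True-⊢ (λ σ → ⇒I (⇒E (hyp (there (here refl))) (⇒I (hyp (there (here refl)))))) n)
      (f (True-⊢ (λ σ → raa (⇒E (hyp (there (here refl))) (⇒I (ex-falso (⇒E (hyp (there (here refl))) (hyp (here refl))))))) n)))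

    choose : ∀ {m} → Formula (suc m) → Vec ℕ m → ℕ
    choose φ ρ = suc (proj₁ (witness-onto φ ρ))

    choose-spec : ∀ {m} (φ : Formula (suc m)) ρ → True (ex φ) ρ → True φ (choose φ ρ ∷ ρ)
    choose-spec φ ρ t with witness-onto φ ρ
    ... | N , h , e = True-at
      where
      h₁ : ∀ i → lookup ρ i ≤ suc N
      h₁ i = m≤n⇒m≤1+n (h i)
      h₂ : ∀ i → lookup (suc N ∷ ρ) i ≤ suc N
      h₂ zero    = ≤-refl
      h₂ (suc i) = h₁ i
      eq : rename (lift 1 (closeAt ρ N)) φ ≡ rename (closeAt (suc N ∷ ρ) (suc N)) φ
      eq = rename-cong (λ { zero → sym (const-new N) ; (suc i) → sym (const-old (h i)) }) φ
      imp : True (rename suc (ex φ) ⇒ φ) (suc N ∷ ρ)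
      imp = holdsAt (suc N) h₂ (_ ∷ [] , inj₁ (inj₂ (cong₂ _⇒_
        (trans (rename-∘ (λ i → refl) (ex φ)) (trans (rename-cong (λ i → const-old (h i)) (ex φ))
          (trans (sym (rename-∘ (λ i → refl) (ex φ))) (cong (rename suc ∘ ex) (sym e)))))
        (trans (sym eq) (sym e)))) ∷ [] , hyp (here refl))
      shifted : True (ex φ) ρ → True (rename suc (ex φ)) (suc N ∷ ρ)
      shifted (holdsAt K hK p) = holdsAt N′ (λ { zero → m≤n⊔m K (suc N) ; (suc i) → ≤-trans (hK i) (m≤m⊔n K (suc N)) })
        (subst (Prov (stage N′)) (sym (rename-∘ (λ i → refl) (ex φ))) (raise (ex φ) ρ hK (m≤m⊔n K (suc N)) p))
        where N′ = K ⊔ suc N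
      True-at : True φ (suc N ∷ ρ)
      True-at = True-⇒E imp (shifted t)

    -- If `all φ` were false, the Henkin witness of `~ φ` would be a counterexample among the
    -- constants.
    True-allI : ∀ {m} {φ : Formula (suc m)} {ρ} → (∀ k → True φ (k ∷ ρ)) → True (all φ) ρ
    True-allI {φ = φ} {ρ} f = decide _ _ λ n → True-consistent (True-⇒E
      (choose-spec (~ φ) ρ (True-⊢ (λ σ → ⇒I (⇒E (hyp (there (here refl))) (allI (raa
        (⇒E (subst (T ∣ (~ rename (lift 1 σ) φ ∷ map (rename suc) (rename σ (all (~ ~ φ)) ∷ rename σ (~ all φ) ∷ [])) ⊢_) (lemma (rename (lift 1 σ) φ)) (allE (hyp (there (here refl))) zero)) (hyp (here refl))))))) n))
      (f _))
      where
      lemma : ∀ {n} (φ : Formula (suc n)) → rename (lift 1 suc) (~ ~ φ) [ zero ] ≡ ~ ~ φ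
      lemma φ = trans (rename-∘ (λ { zero → refl ; (suc i) → refl }) (~ ~ φ)) (rename-id (~ ~ φ))
        where
        rename-id : ∀ {n} (φ : Formula n) → rename (λ i → i) φ ≡ φ
        rename-id (x ∈ y) = refl
        rename-id (x ≐ y) = refl
        rename-id ⊥ = refl
        rename-id (φ ⇒ ψ) = cong₂ _⇒_ (rename-id φ) (rename-id ψ)
        rename-id (all φ) = cong all (trans (rename-cong (λ { zero → refl ; (suc i) → refl }) φ) (rename-id φ))

    True-allE : ∀ {m} {φ : Formula (suc m)} {ρ} → True (all φ) ρ → ∀ k → True φ (k ∷ ρ)
    True-allE {φ = φ} {ρ} (holdsAt N h p) k = holdsAt N′
      (λ { zero → m≤n⊔m N k ; (suc i) → ≤-trans (h i) (m≤m⊔n N k) })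
      (subst (Prov (stage N′)) (rename-∘ (λ { zero → refl ; (suc i) → refl }) φ)
        (at (raise (all φ) ρ h (m≤m⊔n N k) p)))
      where
      N′ = N ⊔ k
      at : ∀ {C : Ctx (suc N′)} {ψ} → Prov C (all ψ) → Prov C (ψ [ const k N′ ])
      at (Δ , a , d) = Δ , a , allE d (const k N′)

    at-atom : ∀ {m} (R : ∀ {n} → Fin n → Fin n → Formula n) →
              (∀ {m n} (σ : Fin m → Fin n) x y → rename σ (R x y) ≡ R (σ x) (σ y)) →
              ∀ (x y : Fin m) ρ → True (R zero (suc zero)) (lookup ρ x ∷ lookup ρ y ∷ []) ↔ True (R x y) ρ
    at-atom R eq x y ρ = to , from
      where
      to : True (R zero (suc zero)) (lookup ρ x ∷ lookup ρ y ∷ []) → True (R x y) ρ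
      to (holdsAt N h p) with bound ρ
      ... | n , hn = holdsAt (N ⊔ n) (λ i → ≤-trans (hn i) (m≤n⊔m N n))
        (subst (Prov _) (trans (eq _ _ _) (sym (eq _ _ _)))
          (raise (R zero (suc zero)) (lookup ρ x ∷ lookup ρ y ∷ []) h (m≤m⊔n N n) p))
      from : True (R x y) ρ → True (R zero (suc zero)) (lookup ρ x ∷ lookup ρ y ∷ [])
      from (holdsAt N h p) = holdsAt N (λ { zero → h x ; (suc zero) → h y }) (subst (Prov _) (trans (eq _ _ _) (sym (eq _ _ _))) p)

    taut : ∀ {m} {φ : Formula m} {ρ} → (∀ {n} (σ : Fin m → Fin n) → T ∣ [] ⊢ rename σ φ) → True φ ρ
    taut {ρ = ρ} d with bound ρ
    ... | N , h = holdsAt N h ([] , [] , d _)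

    structure : Structure
    structure = record
      { M = ℕ
      ; E = λ x y → True (zero ∈ suc zero) (x ∷ y ∷ [])
      ; Q = λ x y → True (zero ≐ suc zero) (x ∷ y ∷ [])
      ; stable-E = True-stable
      ; stable-Q = True-stable
      ; Q-refl = λ {x} → proj₁ (at≐ zero zero (x ∷ [])) ≐-refl
      ; Q-sym = λ {x} {y} q → proj₁ (at≐ (suc zero) zero (x ∷ y ∷ []))
          (True-⊢ (λ σ → ≐E (zero ≐ suc (σ zero)) (hyp (here refl)) ≐I) q)
      ; Q-trans = λ {x} {y} {z} p q → proj₁ (at≐ zero (suc (suc zero)) (x ∷ y ∷ z ∷ []))
          (True-⇒E (True-⇒E (taut {φ = suc zero ≐ suc (suc zero) ⇒ zero ≐ suc zero ⇒ zero ≐ suc (suc zero)}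
            λ σ → ⇒I (⇒I (≐E (suc (σ zero) ≐ zero) (hyp (there (here refl))) (hyp (here refl)))))
            (proj₂ (at≐ (suc zero) (suc (suc zero)) (x ∷ y ∷ z ∷ [])) q)) (proj₂ (at≐ zero (suc zero) (x ∷ y ∷ z ∷ [])) p))
      ; E-cong = λ {x} {x′} {y} {y′} p q r →
          let ρ = x ∷ x′ ∷ y ∷ y′ ∷ [] in
          proj₁ (at∈ (suc zero) (suc (suc (suc zero))) ρ)
          (True-⇒E (True-⇒E (True-⇒E (taut {φ = zero ≐ suc zero ⇒ suc (suc zero) ≐ suc (suc (suc zero)) ⇒ zero ∈ suc (suc zero) ⇒ suc zero ∈ suc (suc (suc zero))}
            λ σ → ⇒I (⇒I (⇒I (≐E (suc (σ (suc zero)) ∈ zero) (hyp (there (here refl)))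
                    (≐E (zero ∈ suc (σ (suc (suc zero)))) (hyp (there (there (here refl)))) (hyp (here refl)))))))
            (proj₂ (at≐ zero (suc zero) ρ) p)) (proj₂ (at≐ (suc (suc zero)) (suc (suc (suc zero))) ρ) q))
            (proj₂ (at∈ zero (suc (suc zero)) ρ) r))
      }
      where
      at≐ : ∀ {m} (x y : Fin m) ρ → True (x ≐ y) ρ ↔ True (zero ≐ suc zero) (lookup ρ x ∷ lookup ρ y ∷ [])
      at≐ x y ρ = ↔-sym (at-atom _≐_ (λ σ x y → refl) x y ρ)
      at∈ : ∀ {m} (x y : Fin m) ρ → True (x ∈ y) ρ ↔ True (zero ∈ suc zero) (lookup ρ x ∷ lookup ρ y ∷ [])
      at∈ x y ρ = ↔-sym (at-atom _∈_ (λ σ x y → refl) x y ρ)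
      ≐-refl : ∀ {x} → True (zero ≐ zero) (x ∷ [])
      ≐-refl = taut λ σ → ≐I

    open Semantics structure

    truth : ∀ {m} (φ : Formula m) ρ → ⟦ φ ⟧ ρ ↔ True φ ρ
    truth (x ∈ y) ρ = at-atom _∈_ (λ σ x y → refl) x y ρ
    truth (x ≐ y) ρ = at-atom _≐_ (λ σ x y → refl) x y ρ
    truth ⊥ ρ = ⊥-elim , True-consistent
    truth (φ ⇒ ψ) ρ = (λ f → True-⇒I λ t → proj₁ (truth ψ ρ) (f (proj₂ (truth φ ρ) t)))
                    , (λ t a → proj₂ (truth ψ ρ) (True-⇒E t (proj₁ (truth φ ρ) a)))
    truth (all φ) ρ = (λ f → True-allI λ k → proj₁ (truth φ (k ∷ ρ)) (f k))
                    , (λ t k → proj₂ (truth φ (k ∷ ρ)) (True-allE t k))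

    model : Model T
    model = record
      { structure = structure
      ; holds = λ {σ} t → proj₂ (truth σ []) (holdsAt 0 (λ ()) ([] , [] , subst (T ∣ [] ⊢_) (rename-cong (λ ()) σ) (axiom t)))
      ; ε = choose
      ; ε-spec = λ φ e h → proj₂ (truth φ _) (choose-spec φ e (proj₁ (truth (ex φ) e) h))
      }

open Completeness using (module Henkin)

-- Classical readings of the defined connectives

module Classical where

  ∧↔ : ∀ {A B : Set} {{_ : Stable A}} {{_ : Stable B}} → ¬ (A → ¬ B) ↔ (A × B)
  ∧↔ = (λ h → stable (λ k → h λ a _ → k a) , stable (λ k → h λ _ b → k b)) , (λ p k → k (proj₁ p) (proj₂ p))

  ∨↔ : ∀ {A B : Set} {{_ : Stable B}} → (¬ A → B) ↔ ¬ ¬ (A ⊎ B)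
  ∨↔ = (λ f k → k (inj₂ (f λ a → k (inj₁ a)))) , (λ h na → h >>= λ { (inj₁ a) → ⊥-elim (na a) ; (inj₂ b) → b })

open Classical

module Connectives (𝒮 : Structure) where
  open Structure 𝒮
  open Semantics 𝒮

  ⟦∧⟧ : ∀ {n} (φ ψ : Formula n) {e} → ⟦ φ D.∧ ψ ⟧ e ↔ (⟦ φ ⟧ e × ⟦ ψ ⟧ e)
  ⟦∧⟧ φ ψ {e} = ∧↔ {{stable-⟦⟧ φ e}} {{stable-⟦⟧ ψ e}}

  ⟦⇔⟧ : ∀ {n} (φ ψ : Formula n) {e} → ⟦ φ D.⇔ ψ ⟧ e ↔ (⟦ φ ⟧ e ↔ ⟦ ψ ⟧ e)
  ⟦⇔⟧ φ ψ = ⟦∧⟧ (φ D.⇒ ψ) (ψ D.⇒ φ)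

  ⟦∨⟧ : ∀ {n} (φ ψ : Formula n) {e} → ⟦ φ D.∨ ψ ⟧ e ↔ ¬ ¬ (⟦ φ ⟧ e ⊎ ⟦ ψ ⟧ e)
  ⟦∨⟧ φ ψ {e} = ∨↔ {{stable-⟦⟧ ψ e}}

  ⟦ex∈⟧ : ∀ {n} (a : Fin n) (φ : Formula (suc n)) {e} → ⟦ D.ex∈ a φ ⟧ e ↔ ¬ ¬ Σ M (λ x → E x (lookup e a) × ⟦ φ ⟧ (x ∷ e))
  ⟦ex∈⟧ a φ {e} = (λ h k → h λ x p → k (x , proj₁ (⟦∧⟧ (0F D.∈ suc a) φ {x ∷ e}) p)) , (λ h k → h λ { (x , p) → k x (proj₂ (⟦∧⟧ (0F D.∈ suc a) φ {x ∷ e}) p) })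

-- The combinatorial statement forced below, with free variables
-- 0 = L₀, 1 = L₁, 2 = a, 3 = R, 4 = J, 5 = I, 6 = ω.  Membership in binary
-- relations is expressed by Maps, and only ⇒, ⊥ and all are used.
module Ψ where
  open D

  10F : ∀ {n} → Fin (11 + n)
  10F = suc 9F

  least minimal nat⊆I topLabel ad mad coded : Formula 7
  least = Inductive 6F
  minimal = all (Inductive 0F ⇒ 7F ⊆ 0F)
  nat⊆I = all (0F ∈ 7F ⇒ 0F ∈ 6F)

  module _ (L : Fin 7) where
    labelFun₃ : Formula 10
    labelFun₃ = Maps (suc (suc (suc L))) 2F 1F ⇒ Maps (suc (suc (suc L))) 2F 0F ⇒ 1F ≐ 0F
    labelFun₂ : Formula 9
    labelFun₂ = all (0F ∈ 7F ⇒ labelFun₃)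
    labelFun₁ : Formula 8
    labelFun₁ = all (0F ∈ 6F ⇒ labelFun₂)
    labelFun : Formula 7
    labelFun = all (0F ∈ 7F ⇒ labelFun₁)

  labelDisj₃ : Formula 10
  labelDisj₃ = Maps 4F 2F 1F ⇒ Maps 3F 2F 0F ⇒ ⊥
  labelDisj₂ : Formula 9
  labelDisj₂ = all (0F ∈ 7F ⇒ labelDisj₃)
  labelDisj₁ : Formula 8
  labelDisj₁ = all (0F ∈ 6F ⇒ labelDisj₂)
  labelDisj : Formula 7
  labelDisj = all (0F ∈ 7F ⇒ labelDisj₁)

  -- a_i contains arbitrarily large m labelled t
  module _ (L : Fin 7) where
    meets₃ : Formula 10
    meets₃ = ~ all (0F ∈ 10F ⇒ ~ 0F ∈ 1F ⇒ Maps 6F 3F 0F ⇒ Maps (suc (suc (suc (suc L)))) 0F 2F ⇒ ⊥)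
    meets₂ : Formula 9
    meets₂ = all (0F ∈ 9F ⇒ meets₃)
    meets₁ : Formula 8
    meets₁ = all (0F ∈ 6F ⇒ meets₂)
    meets : Formula 7
    meets = all (0F ∈ 6F ⇒ meets₁)

  ad₄ : Formula 11
  ad₄ = Maps 6F 3F 0F ⇒ Maps 6F 2F 0F ⇒ 0F ∈ 1F
  ad₂ : Formula 9
  ad₂ = ~ 1F ≐ 0F ⇒ ~ all (0F ∈ 9F ⇒ all (0F ∈ 10F ⇒ ad₄) ⇒ ⊥)
  ad₁ : Formula 8
  ad₁ = all (0F ∈ 7F ⇒ ad₂)
  ad = all (0F ∈ 6F ⇒ ad₁)

  -- Infinite subsets of ω are described as unbounded ones, which spares the extension any
  -- evaluation of bijections.
  mad₃ : Formula 10
  mad₃ = ~ all (0F ∈ 3F ⇒ ~ 0F ∈ 1F ⇒ Maps 6F 2F 0F ⇒ ⊥)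
  mad = all (0F ⊆ 7F ⇒ all (0F ∈ 8F ⇒ ~ all (0F ∈ 2F ⇒ ~ 0F ∈ 1F ⇒ ⊥)) ⇒
    ~ all (0F ∈ 7F ⇒ all (0F ∈ 9F ⇒ mad₃) ⇒ ⊥))

  -- A label t with R(i,t) for every i. An element of a_i labelled t with sign c always falls into
  -- part c, so these labels make the sign of a part visible.
  topLabel = ~ all (0F ∈ 5F ⇒ all (0F ∈ 7F ⇒ Maps 5F 0F 1F) ⇒ ⊥)

  -- ∀ k ∃ t (R(i,t) and u(k,t)), in the scope i , u , Y , …
  covered₄ : Formula 11
  covered₄ = ~ all (0F ∈ 9F ⇒ Maps 8F 2F 0F ⇒ Maps 3F 1F 0F ⇒ ⊥)
  covered : Formula 10
  covered = all (0F ∈ 10F ⇒ covered₄)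

  -- The set of all i with R(i,t) for some t such that u(k,t) is open in the topology generated by
  -- the labels, so every Y ⊆ I is a countable intersection of open sets.
  coded = all (0F ⊆ 6F ⇒ ~ all (all (0F ∈ 8F ⇒ 0F ∈ 2F ⇒ covered) ⇒ all (0F ∈ 8F ⇒ covered ⇒ 0F ∈ 2F) ⇒ ⊥))

  Ψ : Sentence
  Ψ = ~ all (all (all (all (all (all (all
    (least ⇒ minimal ⇒ nat⊆I ⇒ labelFun 1F ⇒ labelFun 0F ⇒ labelDisj ⇒ meets 1F ⇒ meets 0F ⇒
     ad ⇒ mad ⇒ topLabel ⇒ coded ⇒ ⊥)))))))

_＋_ : D.Theory → D.Sentence → D.Theory
T ＋ σ = T Unary.∪ Unary.｛ σ ｝

module SetTheory (𝔐 : Model ZFC) where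

  -- Definable classes: formulas with parameters and function symbols

  module Syntax where
    open import Data.Fin.Base using (_↑ˡ_; _↑ʳ_; splitAt)
    open import Data.Sum.Base using ([_,_]′)
    open import Data.Vec.Base using (_++_; map)
    open import Data.Vec.Properties using (lookup-++ˡ; lookup-++ʳ; lookup-map; lookup-splitAt)
    open Model 𝔐 public using (M; ε; ε-spec; Q-refl; Q-sym; Q-trans; E-cong; holds; stable-E; stable-Q; structure)
    open Model 𝔐 using (E; Q; stable-⟦⟧; ⟦rename⟧; ⟦closure⟧; ≡⇒Q)
    module S = Semantics structure

    infix 4 _∈_ _≈_ _∉_ _⊆_
    _∈_ _≈_ _∉_ _⊆_ : M → M → Set
    _∈_ = E
    _≈_ = Q
    x ∉ y = ¬ x ∈ y
    x ⊆ y = ∀ z → z ∈ x → z ∈ y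

    -- As a double negation this is a continuation-passing type. A proof receives a refutation, in
    -- later proofs often called `ret`, and may call it more than once; this is how classical case
    -- distinctions are expressed.
    ∃ : (M → Set) → Set
    ∃ P = ¬ ¬ Σ M P

    infixr 2 _or_
    _or_ : Set → Set → Set
    A or B = ¬ ¬ (A ⊎ B)

    infix  8 _∈̇_ _≈̇_
    infixr 6 _∧̇_
    infixr 5 _∨̇_
    infixr 4 _⇒̇_
    infix  3 _⇔̇_

    -- Formulas with parameters from M, definable function symbols and the
    -- connectives interpreted by their Agda counterparts.
    data Fm (n : ℕ) : Set₁
    data Tm (n : ℕ) : Set₁
    Sat : ∀ {n} → Fm n → Vec M n → Set
    val : ∀ {n} → Tm n → Vec M n → M

    data Tm n where
      var : Fin n → Tm n
      con : M → Tm n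
      app : (f : M → M → M) (g : Fm 3) → (∀ x y z → Sat g (z ∷ x ∷ y ∷ []) ↔ (z ≈ f x y)) → Tm n → Tm n → Tm n

    data Fm n where
      _∈̇_ _≈̇_ : Tm n → Tm n → Fm n
      ⊥̇ : Fm n
      _⇒̇_ _∧̇_ _∨̇_ : Fm n → Fm n → Fm n
      ∀̇ ∃̇ : Fm (suc n) → Fm n
      sub : ∀ {k} → Fm k → Vec (Fin n) k → Fm n
      -- `prd` lets `Sat` compute to a possibly opaque predicate `R` in place of its defining
      -- formula; `lt` binds the value of a term, and `clo` fills the last variables with
      -- parameters.
      prd : ∀ {k} (R : Vec M k → Set) (φ : Fm k) → (∀ v → R v ↔ Sat φ v) → Vec (Fin n) k → Fm n
      lt  : Tm n → Fm (suc n) → Fm n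
      clo : ∀ {k} → Fm (n + k) → Vec M k → Fm n

    val (var i) e = lookup e i
    val (con a) e = a
    val (app f g _ s t) e = f (val s e) (val t e)

    Sat (s ∈̇ t) e = val s e ∈ val t e
    Sat (s ≈̇ t) e = val s e ≈ val t e
    Sat ⊥̇ e = 𝟘
    Sat (φ ⇒̇ ψ) e = Sat φ e → Sat ψ e
    Sat (φ ∧̇ ψ) e = Sat φ e × Sat ψ e
    Sat (φ ∨̇ ψ) e = Sat φ e or Sat ψ e
    Sat (∀̇ φ) e = ∀ x → Sat φ (x ∷ e)
    Sat (∃̇ φ) e = ∃ λ x → Sat φ (x ∷ e)
    Sat (sub φ is) e = Sat φ (map (lookup e) is)
    Sat (prd R φ _ is) e = R (map (lookup e) is)
    Sat (lt t φ) e = Sat φ (val t e ∷ e)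
    Sat (clo φ c) e = Sat φ (e ++ c)

    _⇔̇_ : ∀ {n} → Fm n → Fm n → Fm n
    φ ⇔̇ ψ = (φ ⇒̇ ψ) ∧̇ (ψ ⇒̇ φ)

    ¬̇_ : ∀ {n} → Fm n → Fm n
    ¬̇ φ = φ ⇒̇ ⊥̇
    infix 7 ¬̇_

    v0 : ∀ {n} → Tm (suc n)
    v0 = var 0F
    v1 : ∀ {n} → Tm (suc (suc n))
    v1 = var 1F
    v2 : ∀ {n} → Tm (suc (suc (suc n)))
    v2 = var 2F
    v3 : ∀ {n} → Tm (suc (suc (suc (suc n))))
    v3 = var 3F
    v4 : ∀ {n} → Tm (suc (suc (suc (suc (suc n)))))
    v4 = var 4F
    v5 : ∀ {n} → Tm (suc (suc (suc (suc (suc (suc n))))))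
    v5 = var 5F

    Sat-stable : ∀ {n} (φ : Fm n) e → Stable (Sat φ e)
    Sat-stable (s ∈̇ t) e = stable-E
    Sat-stable (s ≈̇ t) e = stable-Q
    Sat-stable ⊥̇ e = stable-𝟘
    Sat-stable (φ ⇒̇ ψ) e = stable-Π {{Sat-stable ψ e}}
    Sat-stable (φ ∧̇ ψ) e = stable-× {{Sat-stable φ e}} {{Sat-stable ψ e}}
    Sat-stable (φ ∨̇ ψ) e = stable-Π
    Sat-stable (∀̇ φ) e = stable-Π {{λ {x} → Sat-stable φ (x ∷ e)}}
    Sat-stable (∃̇ φ) e = stable-Π
    Sat-stable (sub φ is) e = Sat-stable φ _
    Sat-stable (prd R φ ok is) e = mkStable λ h → proj₂ (ok _) (stable {{Sat-stable φ _}} λ k → h λ r → k (proj₁ (ok _) r))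
    Sat-stable (lt t φ) e = Sat-stable φ _
    Sat-stable (clo φ c) e = Sat-stable φ _

    size  : ∀ {n} → Fm n → ℕ
    sizeᵗ : ∀ {n} → Tm n → ℕ
    sizeᵗ (var i) = 0
    sizeᵗ (con a) = 1
    sizeᵗ (app f g _ s t) = sizeᵗ s + (sizeᵗ t + size g)
    size (s ∈̇ t) = sizeᵗ s + sizeᵗ t
    size (s ≈̇ t) = sizeᵗ s + sizeᵗ t
    size ⊥̇ = 0
    size (φ ⇒̇ ψ) = size φ + size ψ
    size (φ ∧̇ ψ) = size φ + size ψ
    size (φ ∨̇ ψ) = size φ + size ψ
    size (∀̇ φ) = size φ
    size (∃̇ φ) = size φ
    size (sub φ is) = size φ
    size (prd R φ _ is) = size φ
    size (lt t φ) = sizeᵗ t + size φ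
    size (clo {k} φ c) = k + size φ

    params  : ∀ {n} (φ : Fm n) → Vec M (size φ)
    paramsᵗ : ∀ {n} (t : Tm n) → Vec M (sizeᵗ t)
    paramsᵗ (var i) = []
    paramsᵗ (con a) = a ∷ []
    paramsᵗ (app f g _ s t) = paramsᵗ s ++ (paramsᵗ t ++ params g)
    params (s ∈̇ t) = paramsᵗ s ++ paramsᵗ t
    params (s ≈̇ t) = paramsᵗ s ++ paramsᵗ t
    params ⊥̇ = []
    params (φ ⇒̇ ψ) = params φ ++ params ψ
    params (φ ∧̇ ψ) = params φ ++ params ψ
    params (φ ∨̇ ψ) = params φ ++ params ψ
    params (∀̇ φ) = params φ
    params (∃̇ φ) = params φ
    params (sub φ is) = params φ
    params (prd R φ _ is) = params φ
    params (lt t φ) = paramsᵗ t ++ params φ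
    params (clo φ c) = c ++ params φ

    triple : ∀ {K} → Fin K → Fin 3 → Fin (suc (suc K))
    triple z zero             = suc (suc z)
    triple z (suc zero)       = 1F
    triple z (suc (suc zero)) = 0F

    -- The official language has variables as its only terms. Hence a term is translated as the
    -- formula `z = t`, a function symbol through its graph, and the parameters become extra
    -- variables located by `κ`.
    tr  : ∀ {n K} (φ : Fm n) → (Fin n → Fin K) → (Fin (size φ) → Fin K) → Formula K
    trᵗ : ∀ {n K} (t : Tm n) → (Fin n → Fin K) → (Fin (sizeᵗ t) → Fin K) → Fin K → Formula K
    trᵃ : ∀ {n K} (R : ∀ {k} → Fin k → Fin k → Formula k) (s t : Tm n) →
          (Fin n → Fin K) → (Fin (sizeᵗ s + sizeᵗ t) → Fin K) → Formula K
    trᵗ (var i) σ κ z = z D.≐ σ i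
    trᵗ (con a) σ κ z = z D.≐ κ zero
    trᵗ (app f g _ s t) σ κ z = D.ex (D.ex (
      trᵗ s (λ i → suc (suc (σ i))) (λ i → suc (suc (κ (i ↑ˡ _)))) 1F D.∧
      (trᵗ t (λ i → suc (suc (σ i))) (λ i → suc (suc (κ (sizeᵗ s ↑ʳ (i ↑ˡ _))))) 0F D.∧
      tr g (triple z) (λ i → suc (suc (κ (sizeᵗ s ↑ʳ (sizeᵗ t ↑ʳ i))))))))
    trᵃ R s t σ κ = D.ex (D.ex (
      trᵗ s (λ i → suc (suc (σ i))) (λ i → suc (suc (κ (i ↑ˡ _)))) 1F D.∧
      (trᵗ t (λ i → suc (suc (σ i))) (λ i → suc (suc (κ (sizeᵗ s ↑ʳ i)))) 0F D.∧ R 1F 0F)))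
    tr (s ∈̇ t) σ κ = trᵃ D._∈_ s t σ κ
    tr (s ≈̇ t) σ κ = trᵃ D._≐_ s t σ κ
    tr ⊥̇ σ κ = D.⊥
    tr (φ ⇒̇ ψ) σ κ = tr φ σ (λ i → κ (i ↑ˡ _)) D.⇒ tr ψ σ (λ i → κ (size φ ↑ʳ i))
    tr (φ ∧̇ ψ) σ κ = tr φ σ (λ i → κ (i ↑ˡ _)) D.∧ tr ψ σ (λ i → κ (size φ ↑ʳ i))
    tr (φ ∨̇ ψ) σ κ = tr φ σ (λ i → κ (i ↑ˡ _)) D.∨ tr ψ σ (λ i → κ (size φ ↑ʳ i))
    tr (∀̇ φ) σ κ = D.all (tr φ (lift 1 σ) (λ i → suc (κ i)))
    tr (∃̇ φ) σ κ = D.ex (tr φ (lift 1 σ) (λ i → suc (κ i)))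
    tr (sub φ is) σ κ = tr φ (λ j → σ (lookup is j)) κ
    tr (prd R φ _ is) σ κ = tr φ (λ j → σ (lookup is j)) κ
    tr (lt t φ) σ κ = D.ex (
      trᵗ t (λ i → suc (σ i)) (λ i → suc (κ (i ↑ˡ _))) 0F D.∧
      tr φ (lift 1 σ) (λ i → suc (κ (sizeᵗ t ↑ʳ i))))
    tr {n} (clo {k} φ c) σ κ = tr φ (λ i → [ σ , (λ j → κ (j ↑ˡ size φ)) ]′ (splitAt n i)) (λ i → κ (k ↑ʳ i))

    S-∧ : ∀ {n} (φ ψ : Formula n) {e} → S.⟦ φ D.∧ ψ ⟧ e ↔ (S.⟦ φ ⟧ e × S.⟦ ψ ⟧ e)
    S-∧ φ ψ {e} = ∧↔ {{stable-⟦⟧ φ e}} {{stable-⟦⟧ ψ e}}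

    _≋_ : ∀ {n} → Vec M n → (Fin n → M) → Set
    c ≋ f = ∀ i → f i ≈ lookup c i

    left : ∀ {m n} (c : Vec M m) (d : Vec M n) {f : Fin (m + n) → M} → (c ++ d) ≋ f → c ≋ (λ i → f (i ↑ˡ n))
    left c d h i = Q-trans (h (i ↑ˡ _)) (≡⇒Q (lookup-++ˡ c d i))

    right : ∀ {m n} (c : Vec M m) (d : Vec M n) {f : Fin (m + n) → M} → (c ++ d) ≋ f → d ≋ (λ i → f (m ↑ʳ i))
    right c d h i = Q-trans (h (_ ↑ʳ i)) (≡⇒Q (lookup-++ʳ c d i))

    ≈₂ : ∀ {x y x′ y′} → x ≈ x′ → y ≈ y′ → (x ≈ y) ↔ (x′ ≈ y′)
    ≈₂ p q = (λ r → Q-trans (Q-sym p) (Q-trans r q)) , (λ r → Q-trans p (Q-trans r (Q-sym q)))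

    f-cong : ∀ (f : M → M → M) (g : Fm 3) → (∀ x y z → Sat g (z ∷ x ∷ y ∷ []) ↔ (z ≈ f x y)) →
      (∀ {e e′} → e ≋ lookup e′ → Sat g e → Sat g e′) → ∀ {x x′ y y′} → x ≈ x′ → y ≈ y′ → f x y ≈ f x′ y′
    f-cong f g ok c {x} {x′} {y} {y′} p q = proj₁ (ok x′ y′ (f x y))
      (c (λ { zero → Q-refl ; (suc zero) → Q-sym p ; (suc (suc zero)) → Q-sym q }) (proj₂ (ok x y (f x y)) Q-refl))

    tr-spec : ∀ {n K} (φ : Fm n) (σ : Fin n → Fin K) κ {e e′} → e ≋ (λ i → lookup e′ (σ i)) →
              params φ ≋ (λ i → lookup e′ (κ i)) → Sat φ e ↔ S.⟦ tr φ σ κ ⟧ e′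
    trᵗ-spec : ∀ {n K} (t : Tm n) (σ : Fin n → Fin K) κ z {e e′} → e ≋ (λ i → lookup e′ (σ i)) →
               paramsᵗ t ≋ (λ i → lookup e′ (κ i)) → (lookup e′ z ≈ val t e) ↔ S.⟦ trᵗ t σ κ z ⟧ e′
    trᵃ-spec : ∀ {n K} (R : ∀ {k} → Fin k → Fin k → Formula k) (R′ : M → M → Set) →
               (∀ {x x′ y y′} → x ≈ x′ → y ≈ y′ → R′ x y → R′ x′ y′) →
               (∀ {k} (e : Vec M k) x y → S.⟦ R x y ⟧ e ↔ R′ (lookup e x) (lookup e y)) →
               (s t : Tm n) (σ : Fin n → Fin K) → ∀ κ {e e′} → e ≋ (λ i → lookup e′ (σ i)) →
               (paramsᵗ s ++ paramsᵗ t) ≋ (λ i → lookup e′ (κ i)) → R′ (val s e) (val t e) ↔ S.⟦ trᵃ R s t σ κ ⟧ e′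

    -- Both environments match the same official environment up to `≈`, so congruence is a
    -- by-product of the translation. It is mutual with `tr-spec`, whose case `app` needs that the
    -- function symbol respects `≈`.
    Sat-cong : ∀ {n} (φ : Fm n) {e e′ : Vec M n} → e ≋ lookup e′ → Sat φ e → Sat φ e′
    Sat-cong {n} φ {e} {e′} h s = proj₂ (spec e′ λ i → ≡⇒Q (lookup-++ˡ e′ c i)) (proj₁ (spec e λ i → Q-trans (≡⇒Q (lookup-++ˡ e′ c i)) (h i)) s)
      where
      c = params φ
      spec : ∀ d → d ≋ (λ i → lookup (e′ ++ c) (i ↑ˡ _)) → Sat φ d ↔ S.⟦ tr φ (_↑ˡ _) (n ↑ʳ_) ⟧ (e′ ++ c)
      spec d h = tr-spec φ (_↑ˡ _) (n ↑ʳ_) h (λ i → ≡⇒Q (lookup-++ʳ e′ c i))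

    trᵗ-spec (var i) σ κ z h k = ≈₂ Q-refl (Q-sym (h i))
    trᵗ-spec (con a) σ κ z h k = ≈₂ Q-refl (Q-sym (k zero))
    trᵗ-spec (app f g ok s t) σ κ z {e} {e′} h k = to , from
      where
      ks = left (paramsᵗ s) (paramsᵗ t ++ params g) k
      kt = left (paramsᵗ t) (params g) (right (paramsᵗ s) (paramsᵗ t ++ params g) k)
      kg = right (paramsᵗ t) (params g) (right (paramsᵗ s) (paramsᵗ t ++ params g) k)
      fs = λ x y → trᵗ-spec s (λ i → suc (suc (σ i))) _ 1F {e} {y ∷ x ∷ e′} h ks
      ft = λ x y → trᵗ-spec t (λ i → suc (suc (σ i))) _ 0F {e} {y ∷ x ∷ e′} h kt
      fg = λ x y → tr-spec g (triple z) _
             {lookup e′ z ∷ x ∷ y ∷ []} {y ∷ x ∷ e′} (λ { zero → Q-refl ; (suc zero) → Q-refl ; (suc (suc zero)) → Q-refl }) kg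
      F₁ = trᵗ s (λ i → suc (suc (σ i))) (λ i → suc (suc (κ (i ↑ˡ _)))) 1F
      F₂ = trᵗ t (λ i → suc (suc (σ i))) (λ i → suc (suc (κ (sizeᵗ s ↑ʳ (i ↑ˡ _))))) 0F
      F₃ = tr g (triple z) (λ i → suc (suc (κ (sizeᵗ s ↑ʳ (sizeᵗ t ↑ʳ i)))))
      body : ∀ x y → (x ≈ val s e × y ≈ val t e × Sat g (lookup e′ z ∷ x ∷ y ∷ [])) ↔ S.⟦ F₁ D.∧ (F₂ D.∧ F₃) ⟧ (y ∷ x ∷ e′)
      body x y = ↔-trans
        ( (λ { (a , b , c) → proj₁ (fs x y) a , proj₂ (S-∧ F₂ F₃) (proj₁ (ft x y) b , proj₁ (fg x y) c) })
        , (λ { (a , bc) → let (b , c) = proj₁ (S-∧ F₂ F₃) bc in proj₂ (fs x y) a , proj₂ (ft x y) b , proj₂ (fg x y) c }) )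
        (↔-sym (S-∧ F₁ (F₂ D.∧ F₃)))
      to : lookup e′ z ≈ f (val s e) (val t e) → S.⟦ trᵗ (app f g ok s t) σ κ z ⟧ e′
      to q k₁ = k₁ (val s e) λ k₂ → k₂ (val t e) (proj₁ (body _ _) (Q-refl , Q-refl , proj₂ (ok _ _ _) q))
      from : S.⟦ trᵗ (app f g ok s t) σ κ z ⟧ e′ → lookup e′ z ≈ f (val s e) (val t e)
      from k₁ = stable λ n → k₁ λ x k₂ → k₂ λ y b → let (p , q , r) = proj₂ (body x y) b in
        n (Q-trans (proj₁ (ok _ _ _) r) (f-cong f g ok (Sat-cong g) p q))

    trᵃ-spec R R′ R′-cong eq s t σ κ {e} {e′} h k = to , from
      where
      ks = left (paramsᵗ s) (paramsᵗ t) k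
      kt = right (paramsᵗ s) (paramsᵗ t) k
      fs = λ x y → trᵗ-spec s (λ i → suc (suc (σ i))) _ 1F {e} {y ∷ x ∷ e′} h ks
      ft = λ x y → trᵗ-spec t (λ i → suc (suc (σ i))) _ 0F {e} {y ∷ x ∷ e′} h kt
      F₁ = trᵗ s (λ i → suc (suc (σ i))) (λ i → suc (suc (κ (i ↑ˡ _)))) 1F
      F₂ = trᵗ t (λ i → suc (suc (σ i))) (λ i → suc (suc (κ (sizeᵗ s ↑ʳ i)))) 0F
      to : R′ (val s e) (val t e) → S.⟦ trᵃ R s t σ κ ⟧ e′
      to r k₁ = k₁ (val s e) λ k₂ → k₂ (val t e) (proj₂ (S-∧ F₁ (F₂ D.∧ R 1F 0F))
        (proj₁ (fs _ _) Q-refl , proj₂ (S-∧ F₂ (R 1F 0F)) (proj₁ (ft _ _) Q-refl , proj₂ (eq _ 1F 0F) r)))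
      from : S.⟦ trᵃ R s t σ κ ⟧ e′ → R′ (val s e) (val t e)
      from k₁ = proj₁ (eq (val t e ∷ val s e ∷ []) 1F 0F) (stable {{stable-⟦⟧ (R 1F 0F) _}} λ n → k₁ λ x k₂ → k₂ λ y b →
        let (p , qr) = proj₁ (S-∧ F₁ (F₂ D.∧ R 1F 0F)) b ; (q , r) = proj₁ (S-∧ F₂ (R 1F 0F)) qr in
        n (proj₂ (eq (val t e ∷ val s e ∷ []) 1F 0F) (R′-cong (proj₂ (fs x y) p) (proj₂ (ft x y) q) (proj₁ (eq (y ∷ x ∷ e′) 1F 0F) r))))

    tr-spec (s ∈̇ t) σ κ h k = trᵃ-spec D._∈_ E E-cong (λ e x y → ↔-refl) s t σ κ h k
    tr-spec (s ≈̇ t) σ κ h k = trᵃ-spec D._≐_ Q (λ p q → proj₁ (≈₂ p q)) (λ e x y → ↔-refl) s t σ κ h k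
    tr-spec ⊥̇ σ κ h k = ↔-refl
    tr-spec (φ ⇒̇ ψ) σ κ h k = ↔-→ (tr-spec φ σ _ h (left (params φ) (params ψ) k)) (tr-spec ψ σ _ h (right (params φ) (params ψ) k))
    tr-spec (φ ∧̇ ψ) σ κ h k = ↔-trans ((λ { (a , b) → proj₁ f a , proj₁ g b }) , (λ { (a , b) → proj₂ f a , proj₂ g b })) (↔-sym (S-∧ (tr φ σ _) (tr ψ σ _)))
      where
      f = tr-spec φ σ _ h (left (params φ) (params ψ) k)
      g = tr-spec ψ σ _ h (right (params φ) (params ψ) k)
    tr-spec (φ ∨̇ ψ) σ κ {e} {e′} h k = ↔-trans ((λ { n m → n λ { (inj₁ a) → m (inj₁ (proj₁ f a)) ; (inj₂ b) → m (inj₂ (proj₁ g b)) } })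
        , (λ { n m → n λ { (inj₁ a) → m (inj₁ (proj₂ f a)) ; (inj₂ b) → m (inj₂ (proj₂ g b)) } }))
        (↔-sym (∨↔ {{stable-⟦⟧ (tr ψ σ _) e′}}))
      where
      f = tr-spec φ σ _ h (left (params φ) (params ψ) k)
      g = tr-spec ψ σ _ h (right (params φ) (params ψ) k)
    tr-spec (∀̇ φ) σ κ {e} {e′} h k = (λ s x → proj₁ (f x) (s x)) , (λ s x → proj₂ (f x) (s x))
      where f = λ x → tr-spec φ (lift 1 σ) (λ i → suc (κ i)) {x ∷ e} {x ∷ e′} (λ { zero → Q-refl ; (suc i) → h i }) k
    tr-spec (∃̇ φ) σ κ {e} {e′} h k = (λ s n → s λ { (x , p) → n x (proj₁ (f x) p) }) , (λ s n → s λ x p → n (x , proj₂ (f x) p))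
      where f = λ x → tr-spec φ (lift 1 σ) (λ i → suc (κ i)) {x ∷ e} {x ∷ e′} (λ { zero → Q-refl ; (suc i) → h i }) k
    tr-spec (sub φ is) σ κ {e} h k = tr-spec φ (λ j → σ (lookup is j)) κ
      (λ j → Q-trans (h (lookup is j)) (≡⇒Q (sym (lookup-map j (lookup e) is)))) k
    tr-spec (prd R φ ok is) σ κ {e} h k = ↔-trans (ok _) (tr-spec φ (λ j → σ (lookup is j)) κ
      (λ j → Q-trans (h (lookup is j)) (≡⇒Q (sym (lookup-map j (lookup e) is)))) k)
    tr-spec (lt t φ) σ κ {e} {e′} h k = to , from
      where
      kt = left (paramsᵗ t) (params φ) k
      kφ = right (paramsᵗ t) (params φ) k
      ft = λ x → trᵗ-spec t (λ i → suc (σ i)) _ 0F {e} {x ∷ e′} h kt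
      fφ = λ x y (q : y ≈ x) → tr-spec φ (lift 1 σ) _ {x ∷ e} {y ∷ e′} (λ { zero → q ; (suc i) → h i }) kφ
      F₁ = trᵗ t (λ i → suc (σ i)) (λ i → suc (κ (i ↑ˡ _))) 0F
      F₂ = tr φ (lift 1 σ) (λ i → suc (κ (sizeᵗ t ↑ʳ i)))
      to : Sat φ (val t e ∷ e) → S.⟦ D.ex (F₁ D.∧ F₂) ⟧ e′
      to s n = n (val t e) (proj₂ (S-∧ F₁ F₂) (proj₁ (ft (val t e)) Q-refl , proj₁ (fφ _ _ Q-refl) s))
      from : S.⟦ D.ex (F₁ D.∧ F₂) ⟧ e′ → Sat φ (val t e ∷ e)
      from n = stable {{Sat-stable φ _}} λ m → n λ x b → let (p , q) = proj₁ (S-∧ F₁ F₂) b in m (proj₂ (fφ _ x (proj₂ (ft x) p)) q)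

    tr-spec {n} (clo {k} φ c) σ κ {e} {e′} h ks = tr-spec φ _ _
      (λ i → Q-trans (both (splitAt n i)) (≡⇒Q (sym (lookup-splitAt n e c i)))) (right c (params φ) ks)
      where
      both : ∀ s → lookup e′ ([ σ , (λ j → κ (j ↑ˡ size φ)) ]′ s) ≈ [ lookup e , lookup c ]′ s
      both (inj₁ i) = h i
      both (inj₂ j) = left c (params φ) ks j

    code : ∀ {n} (φ : Fm n) → Formula (n + size φ)
    code {n} φ = tr φ (_↑ˡ _) (n ↑ʳ_)

    code-spec : ∀ {n} (φ : Fm n) e → Sat φ e ↔ S.⟦ code φ ⟧ (e ++ params φ)
    code-spec {n} φ e = tr-spec φ (_↑ˡ _) (n ↑ʳ_)
      (λ i → ≡⇒Q (lookup-++ˡ e (params φ) i)) (λ i → ≡⇒Q (lookup-++ʳ e (params φ) i))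

    opaque
      -- Description without uniqueness: some element satisfying `φ`, if there is one. The generic
      -- sequence later takes its steps this way.
      the : Fm 1 → M
      the φ = ε (code φ) (params φ)

      the-spec : ∀ (φ : Fm 1) → ∃ (λ x → Sat φ (x ∷ [])) → Sat φ (the φ ∷ [])
      the-spec φ h = proj₂ (code-spec φ (the φ ∷ [])) (ε-spec (code φ) (params φ) λ n → h λ { (x , s) → n x (proj₁ (code-spec φ (x ∷ [])) s) })

  -- The axioms as operations; pairs, products and foundation

  module Basic where
    open Syntax public
    open Model 𝔐 using (stable-⟦⟧; ⟦rename⟧; ⟦closure⟧; ≡⇒Q; E; Q)

    ∈ˡ : ∀ {x x′ y} → x ≈ x′ → x ∈ y → x′ ∈ y
    ∈ˡ p = E-cong p Q-refl

    ∈ʳ : ∀ {x y y′} → y ≈ y′ → x ∈ y → x ∈ y′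
    ∈ʳ p = E-cong Q-refl p

    cong₁ : ∀ (φ : Fm 1) {x y} → x ≈ y → Sat φ (x ∷ []) → Sat φ (y ∷ [])
    cong₁ φ p = Sat-cong φ λ { zero → Q-sym p }

    cong₂ : ∀ (φ : Fm 2) {x y x′ y′} → x ≈ x′ → y ≈ y′ → Sat φ (x ∷ y ∷ []) → Sat φ (x′ ∷ y′ ∷ [])
    cong₂ φ p q = Sat-cong φ λ { zero → Q-sym p ; (suc zero) → Q-sym q }

    cong₃ : ∀ (φ : Fm 3) {x y z x′ y′ z′} → x ≈ x′ → y ≈ y′ → z ≈ z′ → Sat φ (x ∷ y ∷ z ∷ []) → Sat φ (x′ ∷ y′ ∷ z′ ∷ [])
    cong₃ φ p q r = Sat-cong φ λ { zero → Q-sym p ; (suc zero) → Q-sym q ; (suc (suc zero)) → Q-sym r }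

    S-⇔ : ∀ {n} (φ ψ : Formula n) {e} → S.⟦ φ D.⇔ ψ ⟧ e ↔ (S.⟦ φ ⟧ e ↔ S.⟦ ψ ⟧ e)
    S-⇔ φ ψ = S-∧ (φ D.⇒ ψ) (ψ D.⇒ φ)

    ext : ∀ {x y} → (∀ z → z ∈ x ↔ z ∈ y) → x ≈ y
    ext {x} {y} h = holds D.extensionality-ax y x λ z → proj₂ (S-⇔ (0F D.∈ 1F) (0F D.∈ 2F) {z ∷ x ∷ y ∷ []}) (h z)

    ext⊆ : ∀ {x y} → x ⊆ y → y ⊆ x → x ≈ y
    ext⊆ f g = ext λ z → f z , g z

    S-IsUPair : ∀ {n} (z x y : Fin n) {e} → S.⟦ D.IsUPair z x y ⟧ e ↔ (∀ u → u ∈ lookup e z ↔ (u ≈ lookup e x or u ≈ lookup e y))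
    S-IsUPair z x y {e} = (λ h u → ↔-trans (proj₁ (S-⇔ (0F D.∈ suc z) (0F D.≐ suc x D.∨ 0F D.≐ suc y) {u ∷ e}) (h u)) ∨↔)
      , (λ h u → proj₂ (S-⇔ (0F D.∈ suc z) (0F D.≐ suc x D.∨ 0F D.≐ suc y) {u ∷ e}) (↔-trans (h u) (↔-sym ∨↔)))

    opaque
      upair : M → M → M
      upair x y = ε (D.IsUPair 0F 1F 2F) (x ∷ y ∷ [])

      ∈-upair : ∀ {x y} u → u ∈ upair x y ↔ (u ≈ x or u ≈ y)
      ∈-upair {x} {y} = proj₁ (S-IsUPair 0F 1F 2F {upair x y ∷ x ∷ y ∷ []}) (ε-spec (D.IsUPair 0F 1F 2F) _ (holds D.pairing-ax y x))

    S-ex∈ : ∀ {n} (a : Fin n) (φ : Formula (suc n)) {e} → S.⟦ D.ex∈ a φ ⟧ e ↔ ∃ (λ x → x ∈ lookup e a × S.⟦ φ ⟧ (x ∷ e))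
    S-ex∈ a φ = (λ h k → h λ x p → k (x , proj₁ (S-∧ (0F D.∈ suc a) φ) p)) , (λ h k → h λ { (x , p) → k x (proj₂ (S-∧ (0F D.∈ suc a) φ) p) })

    opaque
      ⋃ : M → M
      ⋃ a = ε (D.all (0F D.∈ 1F D.⇔ D.ex∈ 2F (1F D.∈ 0F))) (a ∷ [])

      ∈-⋃ : ∀ {a} u → u ∈ ⋃ a ↔ ∃ (λ y → y ∈ a × u ∈ y)
      ∈-⋃ {a} u = ↔-trans (proj₁ (S-⇔ (0F D.∈ 1F) (D.ex∈ 2F (1F D.∈ 0F)) {u ∷ ⋃ a ∷ a ∷ []})
        (ε-spec (D.all (0F D.∈ 1F D.⇔ D.ex∈ 2F (1F D.∈ 0F))) (a ∷ []) (holds D.union-ax a) u)) (S-ex∈ 2F (1F D.∈ 0F) {u ∷ ⋃ a ∷ a ∷ []})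

    opaque
      𝒫 : M → M
      𝒫 a = ε (D.all (0F D.∈ 1F D.⇔ 0F D.⊆ 2F)) (a ∷ [])

      ∈-𝒫 : ∀ {a} u → u ∈ 𝒫 a ↔ u ⊆ a
      ∈-𝒫 {a} u = proj₁ (S-⇔ (0F D.∈ 1F) (0F D.⊆ 2F) {u ∷ 𝒫 a ∷ a ∷ []}) (ε-spec (D.all (0F D.∈ 1F D.⇔ 0F D.⊆ 2F)) (a ∷ []) (holds D.powerset-ax a) u)

    sepF : M → Fm 1 → Fm 1
    sepF a φ = ∀̇ (v0 ∈̇ v1 ⇔̇ v0 ∈̇ con a ∧̇ sub φ (0F ∷ []))

    opaque
      sep : M → Fm 1 → M
      sep a φ = the (sepF a φ)

      ∈-sep : ∀ {a} (φ : Fm 1) u → u ∈ sep a φ ↔ (u ∈ a × Sat φ (u ∷ []))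
      ∈-sep {a} φ = the-spec (sepF a φ) λ k → proj₁ (⟦closure⟧ axF) (holds (D.separation-ax ψ)) (params φ) a λ b h → k (b , λ u →
        ↔-trans (proj₁ (S-⇔ (0F D.∈ 1F) (0F D.∈ 2F D.∧ rename (lift 1 suc) ψ)) (h u)) (↔-trans (S-∧ (0F D.∈ 2F) (rename (lift 1 suc) ψ))
          ((λ { (p , q) → p , proj₂ (spec u b) q }) , (λ { (p , q) → p , proj₁ (spec u b) q }))))
        where
        ψ : Formula (suc (suc (size φ)))
        ψ = rename (λ { zero → zero ; (suc i) → suc (suc i) }) (code φ)
        axF : Formula (size φ)
        axF = D.all (D.ex (D.all (0F D.∈ 1F D.⇔ 0F D.∈ 2F D.∧ rename (lift 1 suc) ψ)))
        spec : ∀ u b → Sat φ (u ∷ []) ↔ S.⟦ rename (lift 1 suc) ψ ⟧ (u ∷ b ∷ a ∷ params φ)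
        spec u b = ↔-trans (code-spec φ (u ∷ [])) (↔-sym (↔-trans
          (⟦rename⟧ ψ (lift 1 suc) {e′ = u ∷ a ∷ params φ} λ { zero → Q-refl ; (suc zero) → Q-refl ; (suc (suc i)) → Q-refl })
          (⟦rename⟧ (code φ) _ λ { zero → Q-refl ; (suc i) → Q-refl })))

    replF : M → Fm 2 → Fm 1
    replF a φ = ∀̇ (v0 ∈̇ v1 ⇔̇ ∃̇ (v0 ∈̇ con a ∧̇ sub φ (0F ∷ 1F ∷ [])))

    opaque
      repl : M → Fm 2 → M
      repl a φ = the (replF a φ)

      ∈-repl : ∀ {a} (φ : Fm 2) → (∀ x y y′ → x ∈ a → Sat φ (x ∷ y ∷ []) → Sat φ (x ∷ y′ ∷ []) → y ≈ y′) →
               ∀ u → u ∈ repl a φ ↔ ∃ (λ x → x ∈ a × Sat φ (x ∷ u ∷ []))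
      ∈-repl {a} φ fun = the-spec (replF a φ) λ k → proj₁ (⟦closure⟧ axF) (holds (D.replacement-ax ψ)) (params φ) a
        (λ y y′ x x∈a p q → fun x y y′ x∈a (proj₂ (spec₁ x y′ y) p) (proj₂ (spec₂ x y′ y) q))
        λ b h → k (b , λ u → ↔-trans (proj₁ (S-⇔ (0F D.∈ 1F) (D.ex∈ 2F (rename (lift 2 suc) ψ))) (h u)) (↔-trans (S-ex∈ 2F (rename (lift 2 suc) ψ) {u ∷ b ∷ a ∷ params φ})
          ((λ s m → s λ { (x , p , q) → m (x , p , proj₂ (spec₃ x u b) q) }) , (λ s m → s λ { (x , p , q) → m (x , p , proj₁ (spec₃ x u b) q) }))))
        where
        ψ : Formula (suc (suc (suc (size φ))))
        ψ = rename (λ { zero → zero ; (suc zero) → suc zero ; (suc (suc i)) → suc (suc (suc i)) }) (code φ)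
        axF : Formula (size φ)
        axF = D.all (D.all (D.all (D.all∈ 2F (rename (lift 1 suc) ψ D.⇒ rename (lift 2 suc) ψ D.⇒ 2F D.≐ 1F)))
              D.⇒ D.ex (D.all (0F D.∈ 1F D.⇔ D.ex∈ 2F (rename (lift 2 suc) ψ))))
        ψ-spec : ∀ x y → Sat φ (x ∷ y ∷ []) ↔ S.⟦ ψ ⟧ (x ∷ y ∷ a ∷ params φ)
        ψ-spec x y = ↔-trans (code-spec φ (x ∷ y ∷ [])) (↔-sym (⟦rename⟧ (code φ) _ λ { zero → Q-refl ; (suc zero) → Q-refl ; (suc (suc i)) → Q-refl }))
        spec₁ : ∀ x y′ y → Sat φ (x ∷ y ∷ []) ↔ S.⟦ rename (lift 1 suc) ψ ⟧ (x ∷ y′ ∷ y ∷ a ∷ params φ)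
        spec₁ x y′ y = ↔-trans (ψ-spec x y) (↔-sym (⟦rename⟧ ψ (lift 1 suc) λ { zero → Q-refl ; (suc zero) → Q-refl ; (suc (suc i)) → Q-refl }))
        spec₂ : ∀ x y′ y → Sat φ (x ∷ y′ ∷ []) ↔ S.⟦ rename (lift 2 suc) ψ ⟧ (x ∷ y′ ∷ y ∷ a ∷ params φ)
        spec₂ x y′ y = ↔-trans (ψ-spec x y′) (↔-sym (⟦rename⟧ ψ (lift 2 suc) λ { zero → Q-refl ; (suc zero) → Q-refl ; (suc (suc i)) → Q-refl }))
        spec₃ : ∀ x u b → Sat φ (x ∷ u ∷ []) ↔ S.⟦ rename (lift 2 suc) ψ ⟧ (x ∷ u ∷ b ∷ a ∷ params φ)
        spec₃ x u b = ↔-trans (ψ-spec x u) (↔-sym (⟦rename⟧ ψ (lift 2 suc) λ { zero → Q-refl ; (suc zero) → Q-refl ; (suc (suc i)) → Q-refl }))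

    foundation : ∀ {a x} → x ∈ a → ∃ λ y → y ∈ a × (∀ z → z ∈ y → z ∉ a)
    foundation {a} {x} x∈a k = holds D.foundation-ax a (λ n → n x x∈a) λ y p →
      let (y∈a , q) = proj₁ (S-∧ (0F D.∈ 1F) (D.Disjoint 0F 1F) {y ∷ a ∷ []}) p in
      k (y , y∈a , λ z z∈y z∈a → q λ n → n z (proj₂ (S-∧ (0F D.∈ 1F) (0F D.∈ 2F) {z ∷ y ∷ a ∷ []}) (z∈y , z∈a)))

    -- Function symbols given by the members of their values.
    infixl 9 _[_·_]
    record Op : Set₁ where
      field
        fun  : M → M → M
        body : Fm 3
        spec : ∀ x y u → u ∈ fun x y ↔ Sat body (u ∷ x ∷ y ∷ [])
      graph : Fm 3
      graph = ∀̇ (v0 ∈̇ v1 ⇔̇ sub body (0F ∷ 2F ∷ 3F ∷ []))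
      ok : ∀ x y z → Sat graph (z ∷ x ∷ y ∷ []) ↔ (z ≈ fun x y)
      ok x y z = (λ h → ext λ u → ↔-trans (h u) (↔-sym (spec x y u)))
               , (λ q u → ↔-trans (∈ʳ q , ∈ʳ (Q-sym q)) (spec x y u))
      cong : ∀ {x x′ y y′} → x ≈ x′ → y ≈ y′ → fun x y ≈ fun x′ y′
      cong = f-cong fun graph ok λ {e} {e′} → Sat-cong graph {e} {e′}

    _[_·_] : ∀ {n} → Op → Tm n → Tm n → Tm n
    F [ s · t ] = app (Op.fun F) (Op.graph F) (Op.ok F) s t

    upair-op : Op
    upair-op = record { fun = upair ; body = v0 ≈̇ v1 ∨̇ v0 ≈̇ v2 ; spec = λ x y u → ∈-upair u }

    ⋃-op : Op
    ⋃-op = record { fun = λ a _ → ⋃ a ; body = ∃̇ (v0 ∈̇ v2 ∧̇ v1 ∈̇ v0) ; spec = λ x y u → ∈-⋃ u }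

    opaque
      sing : M → M
      sing x = upair x x

      ∈-sing : ∀ {x} u → u ∈ sing x ↔ (u ≈ x)
      ∈-sing u = ↔-trans (∈-upair u) ((λ h → h >>= λ { (inj₁ p) → p ; (inj₂ p) → p }) , (λ p → η (inj₁ p)))

    infixl 7 _∪_ _∩_ _∖_

    opaque
      _∪_ _∩_ _∖_ : M → M → M
      x ∪ y = ⋃ (upair x y)
      x ∩ y = sep x (v0 ∈̇ con y)
      x ∖ y = sep x (¬̇ v0 ∈̇ con y)

      ∈-∪ : ∀ {x y} u → u ∈ x ∪ y ↔ (u ∈ x or u ∈ y)
      ∈-∪ {x} {y} u = ↔-trans (∈-⋃ u)
        ( (λ h → h >>¬ λ { (z , p , q) → proj₁ (∈-upair z) p >>¬ λ { (inj₁ e) → η (inj₁ (∈ʳ e q)) ; (inj₂ e) → η (inj₂ (∈ʳ e q)) } })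
        , (λ h → h >>¬ λ { (inj₁ p) → η (x , proj₂ (∈-upair x) (η (inj₁ Q-refl)) , p)
                         ; (inj₂ p) → η (y , proj₂ (∈-upair y) (η (inj₂ Q-refl)) , p) }) )

      ∈-∩ : ∀ {x y} u → u ∈ x ∩ y ↔ (u ∈ x × u ∈ y)
      ∈-∩ {x} {y} = ∈-sep (v0 ∈̇ con y)

      ∈-∖ : ∀ {x y} u → u ∈ x ∖ y ↔ (u ∈ x × u ∉ y)
      ∈-∖ {x} {y} = ∈-sep (¬̇ v0 ∈̇ con y)

    ∪-op ∩-op : Op
    ∪-op = record { fun = _∪_ ; body = v0 ∈̇ v1 ∨̇ v0 ∈̇ v2 ; spec = λ x y u → ∈-∪ u }
    ∩-op = record { fun = _∩_ ; body = v0 ∈̇ v1 ∧̇ v0 ∈̇ v2 ; spec = λ x y u → ∈-∩ u }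

    infixl 7 _+̂_
    opaque
      _+̂_ : M → M → M
      x +̂ y = x ∪ sing y

      ∈-+̂ : ∀ {x y} u → u ∈ x +̂ y ↔ (u ∈ x or u ≈ y)
      ∈-+̂ {x} {y} u = ↔-trans (∈-∪ u)
        ( (λ h k → h λ { (inj₁ p) → k (inj₁ p) ; (inj₂ p) → k (inj₂ (proj₁ (∈-sing u) p)) })
        , (λ h k → h λ { (inj₁ p) → k (inj₁ p) ; (inj₂ p) → k (inj₂ (proj₂ (∈-sing u) p)) }) )

    +̂-op : Op
    +̂-op = record { fun = _+̂_ ; body = v0 ∈̇ v1 ∨̇ v0 ≈̇ v2 ; spec = λ x y u → ∈-+̂ u }

    +̂-old : ∀ {x y u} → u ∈ x → u ∈ x +̂ y
    +̂-old p = proj₂ (∈-+̂ _) (η (inj₁ p))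

    +̂-new : ∀ {x y} → y ∈ x +̂ y
    +̂-new = proj₂ (∈-+̂ _) (η (inj₂ Q-refl))

    upairˡ : ∀ {x y} → x ∈ upair x y
    upairˡ = proj₂ (∈-upair _) (η (inj₁ Q-refl))

    upairʳ : ∀ {x y} → y ∈ upair x y
    upairʳ = proj₂ (∈-upair _) (η (inj₂ Q-refl))

    opaque
      ⟨_,_⟩ : M → M → M
      ⟨ x , y ⟩ = upair (upair x x) (upair x y)

      ∈-pair : ∀ {x y} u → u ∈ ⟨ x , y ⟩ ↔ (u ≈ upair x x or u ≈ upair x y)
      ∈-pair u = ∈-upair u

      pair-def : ∀ {x y} → ⟨ x , y ⟩ ≈ upair (upair x x) (upair x y)
      pair-def = Q-refl

    pair-op : Op
    pair-op = record
      { fun = ⟨_,_⟩ ; body = v0 ≈̇ upair-op [ v1 · v1 ] ∨̇ v0 ≈̇ upair-op [ v1 · v2 ] ; spec = λ x y u → ∈-pair u }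

    ⟨_,_⟩ᵗ : ∀ {n} → Tm n → Tm n → Tm n
    ⟨ s , t ⟩ᵗ = pair-op [ s · t ]

    pair-cong : ∀ {x x′ y y′} → x ≈ x′ → y ≈ y′ → ⟨ x , y ⟩ ≈ ⟨ x′ , y′ ⟩
    pair-cong = Op.cong pair-op

    upair-injʳ : ∀ {x y y′} → upair x y ≈ upair x y′ → y ≈ y′
    upair-injʳ {x} {y} {y′} q = do
      inj₁ y≈x ← proj₁ (∈-upair y) (∈ʳ q upairʳ)
        where inj₂ e → e
      inj₁ y′≈x ← proj₁ (∈-upair y′) (∈ʳ (Q-sym q) upairʳ)
        where inj₂ e → Q-sym e
      Q-trans y≈x (Q-sym y′≈x)

    ∈-upair-same : ∀ {x u} → u ∈ upair x x → u ≈ x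
    ∈-upair-same m = proj₁ (∈-upair _) m >>= λ { (inj₁ e) → e ; (inj₂ e) → e }

    pair-inj : ∀ {x x′ y y′} → ⟨ x , y ⟩ ≈ ⟨ x′ , y′ ⟩ → x ≈ x′ × y ≈ y′
    pair-inj {x} {x′} {y} {y′} q = x≈x′ , upair-injʳ (upair-injʳ eq)
      where
      x≈x′ : x ≈ x′
      x≈x′ = proj₁ (∈-pair _) (∈ʳ q (proj₂ (∈-pair _) (η (inj₁ Q-refl)))) >>= λ
        { (inj₁ e) → ∈-upair-same (∈ʳ e upairˡ) ; (inj₂ e) → Q-sym (∈-upair-same (∈ʳ (Q-sym e) upairˡ)) }
      eq : upair (upair x′ x′) (upair x′ y) ≈ upair (upair x′ x′) (upair x′ y′)
      eq = Q-trans (Op.cong upair-op (Op.cong upair-op (Q-sym x≈x′) (Q-sym x≈x′)) (Op.cong upair-op (Q-sym x≈x′) Q-refl))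
        (Q-trans (Q-sym pair-def) (Q-trans q pair-def))

    fst∈∈ : ∀ {x y} → ∃ λ u → u ∈ ⟨ x , y ⟩ × x ∈ u
    fst∈∈ {x} {y} = η (upair x y , proj₂ (∈-pair _) (η (inj₂ Q-refl)) , upairˡ)

    snd∈∈ : ∀ {x y} → ∃ λ u → u ∈ ⟨ x , y ⟩ × y ∈ u
    snd∈∈ {x} {y} = η (upair x y , proj₂ (∈-pair _) (η (inj₂ Q-refl)) , upairʳ)

    infixr 8 _×ˢ_

    opaque
      _×ˢ_ : M → M → M
      a ×ˢ b = sep (𝒫 (𝒫 (a ∪ b))) (∃̇ (∃̇ (v2 ≈̇ ⟨ v1 , v0 ⟩ᵗ ∧̇ v1 ∈̇ con a ∧̇ v0 ∈̇ con b)))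

      ∈-× : ∀ {a b} u → u ∈ a ×ˢ b ↔ ∃ (λ x → ∃ (λ y → u ≈ ⟨ x , y ⟩ × x ∈ a × y ∈ b))
      ∈-× {a} {b} u = ↔-trans (∈-sep (∃̇ (∃̇ (v2 ≈̇ ⟨ v1 , v0 ⟩ᵗ ∧̇ v1 ∈̇ con a ∧̇ v0 ∈̇ con b))) u) (proj₂ , λ h → (do
        (x , h) ← h
        (y , q , p , r) ← h
        ∈ˡ (Q-sym q) (proj₂ (∈-𝒫 _) λ z z∈ → proj₂ (∈-𝒫 _) λ w w∈ → (do
          inj₁ e ← proj₁ (∈-pair z) z∈
            where inj₂ e → proj₁ (∈-upair w) (∈ʳ e w∈) >>= λ { (inj₁ e) → l (∈ˡ (Q-sym e) p) ; (inj₂ e) → r′ (∈ˡ (Q-sym e) r) }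
          l (∈ˡ (Q-sym (∈-upair-same (∈ʳ e w∈))) p)))) , h)
        where
        l : ∀ {w} → w ∈ a → w ∈ a ∪ b
        l p = proj₂ (∈-∪ _) (η (inj₁ p))
        r′ : ∀ {w} → w ∈ b → w ∈ a ∪ b
        r′ p = proj₂ (∈-∪ _) (η (inj₂ p))

    pair∈× : ∀ {a b x y} → ⟨ x , y ⟩ ∈ a ×ˢ b ↔ (x ∈ a × y ∈ b)
    pair∈× = (λ h → proj₁ (∈-× _) h >>= λ { (x , h) → h >>= λ { (y , q , p , r) → let (e , e′) = pair-inj q in ∈ˡ (Q-sym e) p , ∈ˡ (Q-sym e′) r } })
           , (λ { (p , q) → proj₂ (∈-× _) (η (_ , η (_ , Q-refl , p , q))) })

    x∉x : ∀ {x} → x ∉ x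
    x∉x {x} h = foundation (proj₂ (∈-sing x) Q-refl) λ { (y , p , q) → q x (∈ʳ (Q-sym (proj₁ (∈-sing y) p)) h) (proj₂ (∈-sing x) Q-refl) }

    no-2-cycle : ∀ {x y} → x ∈ y → y ∉ x
    no-2-cycle {x} {y} p q = foundation (upairˡ {x} {y}) λ { (z , r , s) → proj₁ (∈-upair z) r
      λ { (inj₁ e) → s y (∈ʳ (Q-sym e) q) upairʳ ; (inj₂ e) → s x (∈ʳ (Q-sym e) p) upairˡ } }

    opaque
      ∅ : M
      ∅ = sep (upair (ε (D.Inductive 0F) []) (ε (D.Inductive 0F) [])) ⊥̇

      ∉∅ : ∀ {x} → x ∉ ∅
      ∉∅ h = proj₂ (proj₁ (∈-sep ⊥̇ _) h)

    empty : ∀ {x} → (∀ z → z ∉ x) → x ≈ ∅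
    empty h = ext⊆ (λ z p → ⊥-elim (h z p)) (λ z p → ⊥-elim (∉∅ p))

    suc̆ : M → M
    suc̆ x = x +̂ x

  -- Natural numbers, finite sets and transitive closure

  module Sets where
    open Basic public

    infix 8 _⊆̇_
    _⊆̇_ : ∀ {n} → Fin n → Fin n → Fm n
    s ⊆̇ t = ∀̇ (v0 ∈̇ var (suc s) ⇒̇ v0 ∈̇ var (suc t))

    Ind : M → Set
    Ind w = ∅ ∈ w × (∀ x → x ∈ w → suc̆ x ∈ w)

    IndF : Fm 1
    IndF = con ∅ ∈̇ v0 ∧̇ ∀̇ (v0 ∈̇ v1 ⇒̇ +̂-op [ v0 · v0 ] ∈̇ v1)

    S-IsEmpty : ∀ {n} (x : Fin n) {e} → S.⟦ D.IsEmpty x ⟧ e ↔ (lookup e x ≈ ∅)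
    S-IsEmpty x = empty , (λ q z p → ∉∅ (∈ʳ q p))

    S-IsSucc : ∀ {n} (s x : Fin n) {e} → S.⟦ D.IsSucc s x ⟧ e ↔ (lookup e s ≈ suc̆ (lookup e x))
    S-IsSucc s x {e} = (λ h → ext λ u → ↔-trans (to u (h u)) (↔-sym (∈-+̂ u)))
      , (λ q u → proj₂ (S-⇔ (0F D.∈ suc s) (0F D.∈ suc x D.∨ 0F D.≐ suc x) {u ∷ e})
          (↔-trans (∈ʳ q , ∈ʳ (Q-sym q)) (↔-trans (∈-+̂ u) (↔-sym ∨↔))))
      where
      to : ∀ u → _ → u ∈ lookup e s ↔ (u ∈ lookup e x or u ≈ lookup e x)
      to u h = ↔-trans (proj₁ (S-⇔ (0F D.∈ suc s) (0F D.∈ suc x D.∨ 0F D.≐ suc x) {u ∷ e}) h) ∨↔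

    S-Inductive : ∀ {n} (w : Fin n) {e} → S.⟦ D.Inductive w ⟧ e ↔ Ind (lookup e w)
    S-Inductive w {e} = to , from
      where
      A = D.ex∈ w (D.IsEmpty 0F)
      C = D.ex∈ (suc w) (D.IsSucc 0F 1F)
      to : S.⟦ D.Inductive w ⟧ e → Ind (lookup e w)
      to h with proj₁ (S-∧ A (D.all∈ w C) {e}) h
      ... | a , b = (proj₁ (S-ex∈ w (D.IsEmpty 0F) {e}) a >>= λ { (x , p , q) → ∈ˡ (proj₁ (S-IsEmpty 0F {x ∷ e}) q) p })
          , (λ x p → proj₁ (S-ex∈ (suc w) (D.IsSucc 0F 1F) {x ∷ e}) (b x p) >>= λ { (s , p , q) → ∈ˡ (proj₁ (S-IsSucc 0F 1F {s ∷ x ∷ e}) q) p })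
      from : Ind (lookup e w) → S.⟦ D.Inductive w ⟧ e
      from (a , b) = proj₂ (S-∧ A (D.all∈ w C) {e})
        ( proj₂ (S-ex∈ w (D.IsEmpty 0F) {e}) (η (∅ , a , proj₂ (S-IsEmpty 0F {∅ ∷ e}) Q-refl))
        , λ x p → proj₂ (S-ex∈ (suc w) (D.IsSucc 0F 1F) {x ∷ e}) (η (suc̆ x , b x p , proj₂ (S-IsSucc 0F 1F {suc̆ x ∷ x ∷ e}) Q-refl)) )

    ωF : Fm 1
    ωF = ∀̇ (sub IndF (0F ∷ []) ⇒̇ v1 ∈̇ v0)

    opaque
      ω : M
      ω = sep (ε (D.Inductive 0F) []) ωF

      ω-least : ∀ {w} → Ind w → ω ⊆ w
      ω-least h x p = proj₂ (proj₁ (∈-sep ωF x) p) _ h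

      ω-Ind : Ind ω
      ω-Ind = proj₂ (∈-sep ωF _) (proj₁ i₀ , λ w i → proj₁ i)
            , λ x p → let (p , h) = proj₁ (∈-sep ωF x) p in proj₂ (∈-sep ωF _) (proj₂ i₀ x p , λ w i → proj₂ i x (h w i))
        where
        i₀ : Ind (ε (D.Inductive 0F) [])
        i₀ = proj₁ (S-Inductive 0F {ε (D.Inductive 0F) [] ∷ []}) (ε-spec (D.Inductive 0F) [] (holds D.infinity-ax))

    0∈ω : ∅ ∈ ω
    0∈ω = proj₁ ω-Ind

    suc∈ω : ∀ {n} → n ∈ ω → suc̆ n ∈ ω
    suc∈ω = proj₂ ω-Ind _

    ω-ind : (φ : Fm 1) → Sat φ (∅ ∷ []) → (∀ n → n ∈ ω → Sat φ (n ∷ []) → Sat φ (suc̆ n ∷ [])) → ∀ n → n ∈ ω → Sat φ (n ∷ [])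
    ω-ind φ z s n p = proj₂ (proj₁ (∈-sep φ n) (ω-least
      ( proj₂ (∈-sep φ _) (0∈ω , z)
      , λ x q → let (q , r) = proj₁ (∈-sep φ x) q in proj₂ (∈-sep φ _) (suc∈ω q , s x q r) ) n p))

    ω-down : ∀ n → n ∈ ω → n ⊆ ω
    ω-down = ω-ind (∀̇ (v0 ∈̇ v1 ⇒̇ v0 ∈̇ con ω)) (λ m p → ⊥-elim (∉∅ p))
      λ n n∈ h m p → proj₁ (∈-+̂ m) p >>= λ { (inj₁ q) → h m q ; (inj₂ e) → ∈ˡ (Q-sym e) n∈ }

    ω-trans : ∀ n → n ∈ ω → ∀ m → m ∈ n → m ⊆ n
    ω-trans = ω-ind (∀̇ (v0 ∈̇ v1 ⇒̇ 0F ⊆̇ 1F)) (λ m p → ⊥-elim (∉∅ p))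
      λ n n∈ h m p k q → proj₁ (∈-+̂ m) p >>= λ { (inj₁ r) → +̂-old (h m r k q) ; (inj₂ e) → +̂-old (∈ʳ e q) }

    suc-cong : ∀ {x y} → x ≈ y → suc̆ x ≈ suc̆ y
    suc-cong e = Op.cong +̂-op e e

    suc-inj : ∀ {x y} → suc̆ x ≈ suc̆ y → x ≈ y
    suc-inj {x} {y} e = do
      inj₁ p ← proj₁ (∈-+̂ x) (∈ʳ e +̂-new)
        where inj₂ q → q
      inj₁ q ← proj₁ (∈-+̂ y) (∈ʳ (Q-sym e) +̂-new)
        where inj₂ q → Q-sym q
      ⊥-elim (no-2-cycle p q)

    suc≢∅ : ∀ {x} → ¬ suc̆ x ≈ ∅
    suc≢∅ e = ∉∅ (∈ʳ e +̂-new)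

    ω-suc-≤ : ∀ m → m ∈ ω → ∀ n → n ∈ m → suc̆ n ∈ m or suc̆ n ≈ m
    ω-suc-≤ = ω-ind (∀̇ (v0 ∈̇ v1 ⇒̇ (+̂-op [ v0 · v0 ] ∈̇ v1 ∨̇ +̂-op [ v0 · v0 ] ≈̇ v1))) (λ m p → ⊥-elim (∉∅ p))
      λ m m∈ h n p → proj₁ (∈-+̂ n) p >>¬ λ
        { (inj₁ q) → h n q >>¬ λ { (inj₁ r) → η (inj₁ (+̂-old r)) ; (inj₂ e) → η (inj₁ (∈ˡ (Q-sym e) +̂-new)) }
        ; (inj₂ e) → η (inj₂ (suc-cong e)) }

    ω-lin : ∀ n → n ∈ ω → ∀ m → m ∈ ω → m ∈ n or (m ≈ n or n ∈ m)
    ω-lin = ω-ind (∀̇ (v0 ∈̇ con ω ⇒̇ (v0 ∈̇ v1 ∨̇ (v0 ≈̇ v1 ∨̇ v1 ∈̇ v0)))) base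
      λ n n∈ h m m∈ → h m m∈ >>¬ λ
        { (inj₁ p) → η (inj₁ (+̂-old p))
        ; (inj₂ q) → q >>¬ λ
          { (inj₁ e) → η (inj₁ (∈ˡ (Q-sym e) +̂-new))
          ; (inj₂ p) → ω-suc-≤ m m∈ n p >>¬ λ { (inj₁ p) → η (inj₂ (η (inj₂ p))) ; (inj₂ e) → η (inj₂ (η (inj₁ (Q-sym e)))) } } }
      where
      base : ∀ m → m ∈ ω → m ∈ ∅ or (m ≈ ∅ or ∅ ∈ m)
      base = ω-ind (v0 ∈̇ con ∅ ∨̇ (v0 ≈̇ con ∅ ∨̇ con ∅ ∈̇ v0)) (η (inj₂ (η (inj₁ Q-refl))))
        λ m m∈ h → h >>¬ λ
          { (inj₁ p) → ⊥-elim (∉∅ p)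
          ; (inj₂ q) → q >>¬ λ { (inj₁ e) → η (inj₂ (η (inj₂ (∈ˡ e +̂-new)))) ; (inj₂ p) → η (inj₂ (η (inj₂ (+̂-old p)))) } }

    ω-max : ∀ {m n} → m ∈ ω → n ∈ ω → ∃ λ k → k ∈ ω × m ⊆ k × n ⊆ k
    ω-max {m} {n} p q = ω-lin n q m p >>¬ λ
      { (inj₁ r) → η (n , q , ω-trans n q m r , λ z s → s)
      ; (inj₂ h) → h >>¬ λ { (inj₁ e) → η (n , q , (λ z → ∈ʳ e) , λ z s → s) ; (inj₂ r) → η (m , p , (λ z s → s) , ω-trans m p n r) } }

    -- Kuratowski finiteness

    finF : Fm 1
    finF = ∀̇ (con ∅ ∈̇ v0 ⇒̇ ∀̇ (v0 ∈̇ v1 ⇒̇ ∀̇ (v0 ∈̇ v3 ⇒̇ +̂-op [ v1 · v0 ] ∈̇ v2)) ⇒̇ v1 ∈̇ v0)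

    opaque
      Fin′ : M → Set
      Fin′ p = Sat finF (p ∷ [])

      instance
        stable-Fin : ∀ {p} → Stable (Fin′ p)
        stable-Fin {p} = Sat-stable finF (p ∷ [])

      Fin-def : ∀ (v : Vec M 1) → Fin′ (lookup v 0F) ↔ Sat finF v
      Fin-def (p ∷ []) = ↔-refl

      fin-≈ : ∀ {p q} → p ≈ q → Fin′ p → Fin′ q
      fin-≈ = cong₁ finF

      fin-ind : (φ : Fm 1) → ∀ {p} → Fin′ p → Sat φ (∅ ∷ []) →
                (∀ q x → q ⊆ p → x ∈ p → Sat φ (q ∷ []) → Sat φ (q +̂ x ∷ [])) → Sat φ (p ∷ [])
      fin-ind φ {p} f z s = proj₂ (proj₁ (∈-sep φ p) (f (sep (𝒫 p) φ) (proj₂ (∈-sep φ _) (proj₂ (∈-𝒫 _) (λ z q → ⊥-elim (∉∅ q)) , z))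
        λ q q∈ x x∈ → let (a , b) = proj₁ (∈-sep φ q) q∈ ; q⊆ = proj₁ (∈-𝒫 q) a in proj₂ (∈-sep φ _)
          ( proj₂ (∈-𝒫 _) (λ z r → proj₁ (∈-+̂ z) r >>= λ { (inj₁ r) → q⊆ z r ; (inj₂ e) → ∈ˡ (Q-sym e) x∈ })
          , s q x q⊆ x∈ b )))

      fin-∅ : Fin′ ∅
      fin-∅ F z s = z

      fin-+̂ : ∀ {p x} → Fin′ p → Fin′ (p +̂ x)
      fin-+̂ f F z s = s _ (f F z λ q q∈ y y∈ → s q q∈ y (+̂-old y∈)) _ +̂-new

    finP : ∀ {n} → Fin n → Fm n
    finP i = prd (λ v → Fin′ (lookup v 0F)) finF Fin-def (i ∷ [])

    fin-sing : ∀ {x} → Fin′ (sing x)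
    fin-sing {x} = fin-≈ (ext λ u → (λ h → proj₁ (∈-+̂ u) h >>= λ { (inj₁ p) → ⊥-elim (∉∅ p) ; (inj₂ e) → proj₂ (∈-sing u) e })
      , (λ h → ∈ˡ (Q-sym (proj₁ (∈-sing u) h)) +̂-new)) (fin-+̂ {∅} {x} fin-∅)

    fin-⊆ : ∀ {p s} → Fin′ p → s ⊆ p → Fin′ s
    fin-⊆ {p} {s} f h = fin-ind (∀̇ (0F ⊆̇ 1F ⇒̇ finP 0F)) f
      (λ s h → fin-≈ (Q-sym (empty λ z p → ∉∅ (h z p))) fin-∅)
      (λ q x q⊆ x∈ ih s h → cases {A = x ∈ s}
        (λ x∈s → fin-≈ (ext λ u → (λ m → proj₁ (∈-+̂ u) m >>= λ { (inj₁ m) → proj₁ (proj₁ (∈-∖ u) m) ; (inj₂ e) → ∈ˡ (Q-sym e) x∈s })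
            , λ m → cases {A = u ≈ x} (λ e → ∈ˡ (Q-sym e) +̂-new) (λ n → +̂-old (proj₂ (∈-∖ u) (m , λ r → n (proj₁ (∈-sing u) r)))))
          (fin-+̂ {s ∖ sing x} {x} (ih (s ∖ sing x) λ z m → let (a , b) = proj₁ (∈-∖ z) m in
            proj₁ (∈-+̂ z) (h z a) >>= λ { (inj₁ r) → r ; (inj₂ e) → ⊥-elim (b (proj₂ (∈-sing z) e)) })))
        (λ x∉s → ih s λ z m → proj₁ (∈-+̂ z) (h z m) >>= λ { (inj₁ r) → r ; (inj₂ e) → ⊥-elim (x∉s (∈ˡ e m)) }))
      s h

    ∪-assoc-+̂ : ∀ {p q x} → (p ∪ q) +̂ x ≈ p ∪ (q +̂ x)
    ∪-assoc-+̂ = ext λ u →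
      (λ h → proj₁ (∈-+̂ u) h >>= λ { (inj₁ h) → proj₁ (∈-∪ u) h >>= λ { (inj₁ a) → proj₂ (∈-∪ u) (η (inj₁ a)) ; (inj₂ b) → proj₂ (∈-∪ u) (η (inj₂ (+̂-old b))) }
                                   ; (inj₂ e) → proj₂ (∈-∪ u) (η (inj₂ (∈ˡ (Q-sym e) +̂-new))) })
      , (λ h → proj₁ (∈-∪ u) h >>= λ { (inj₁ a) → +̂-old (proj₂ (∈-∪ u) (η (inj₁ a)))
                                   ; (inj₂ b) → proj₁ (∈-+̂ u) b >>= λ { (inj₁ c) → +̂-old (proj₂ (∈-∪ u) (η (inj₂ c))) ; (inj₂ e) → ∈ˡ (Q-sym e) +̂-new } })

    ∪ˡ : ∀ {x y} → x ⊆ x ∪ y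
    ∪ˡ z p = proj₂ (∈-∪ z) (η (inj₁ p))

    ∪ʳ : ∀ {x y} → y ⊆ x ∪ y
    ∪ʳ z p = proj₂ (∈-∪ z) (η (inj₂ p))

    ∪-elim : ∀ {x y u} {C : Set} {{_ : Stable C}} → u ∈ x ∪ y → (u ∈ x → C) → (u ∈ y → C) → C
    ∪-elim h f g = proj₁ (∈-∪ _) h >>= λ { (inj₁ a) → f a ; (inj₂ b) → g b }

    fin-∪ : ∀ {p q} → Fin′ p → Fin′ q → Fin′ (p ∪ q)
    fin-∪ {p} {q} f g = fin-ind (lt (∪-op [ con p · v0 ]) (finP 0F)) g
      (fin-≈ (ext⊆ ∪ˡ λ z h → ∪-elim h (λ a → a) λ b → ⊥-elim (∉∅ b)) f)
      λ q x _ _ h → fin-≈ ∪-assoc-+̂ (fin-+̂ h)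

    fin-repl : ∀ (φ : Fm 2) {p} → (∀ x y y′ → x ∈ p → Sat φ (x ∷ y ∷ []) → Sat φ (x ∷ y′ ∷ []) → y ≈ y′) → Fin′ p → Fin′ (repl p φ)
    fin-repl φ {p} fun f = proj₂ (fin-ind (0F ⊆̇′ p ∧̇ ∃̇ (finP 0F ∧̇ ∀̇ (v0 ∈̇ v1 ⇔̇ ∃̇ (v0 ∈̇ v3 ∧̇ sub φ (0F ∷ 1F ∷ []))))) f
        ((λ z h → ⊥-elim (∉∅ h)) , η (∅ , fin-∅ , λ u → (λ h → ⊥-elim (∉∅ h)) , λ h → h >>= λ { (x , m , _) → ⊥-elim (∉∅ m) }))
        λ q x q⊆ x∈ ih → (λ z h → proj₁ (∈-+̂ z) h >>= λ { (inj₁ h) → q⊆ z h ; (inj₂ e) → ∈ˡ (Q-sym e) x∈ }) , step q x q⊆ x∈ (proj₂ ih))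
        >>= λ { (r , fr , h) → fin-≈ (ext λ u → ↔-trans (h u) (↔-sym (∈-repl φ fun u))) fr }
      where
      _⊆̇′_ : ∀ {n} → Fin n → M → Fm n
      s ⊆̇′ t = ∀̇ (v0 ∈̇ var (suc s) ⇒̇ v0 ∈̇ con t)
      step : ∀ q x → q ⊆ p → x ∈ p → ∃ (λ r → Fin′ r × (∀ u → u ∈ r ↔ ∃ (λ x → x ∈ q × Sat φ (x ∷ u ∷ [])))) →
             ∃ (λ r → Fin′ r × (∀ u → u ∈ r ↔ ∃ (λ y → y ∈ q +̂ x × Sat φ (y ∷ u ∷ []))))
      step q x q⊆ x∈ ih = do
        (r , fr , h) ← ih
        cases {A = ∃ λ y → Sat φ (x ∷ y ∷ [])}
          (λ ey → ey >>¬ λ { (y , s) → η (r +̂ y , fin-+̂ fr , λ u →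
              (λ m → proj₁ (∈-+̂ u) m >>¬ λ { (inj₁ m) → proj₁ (h u) m >>¬ λ { (z , z∈ , t) → η (z , +̂-old z∈ , t) } ; (inj₂ e) → η (x , +̂-new , cong₂ φ Q-refl (Q-sym e) s) })
              , λ m → m >>= λ { (z , z∈ , t) → proj₁ (∈-+̂ z) z∈ >>= λ
                  { (inj₁ z∈) → +̂-old (proj₂ (h u) (η (z , z∈ , t)))
                  ; (inj₂ e) → ∈ˡ (fun x _ _ x∈ s (cong₂ φ e Q-refl t)) +̂-new } }) })
          λ ne → η (r , fr , λ u → (λ m → proj₁ (h u) m >>¬ λ { (z , z∈ , t) → η (z , +̂-old z∈ , t) })
              , λ m → m >>= λ { (z , z∈ , t) → proj₁ (∈-+̂ z) z∈ >>= λ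
                  { (inj₁ z∈) → proj₂ (h u) (η (z , z∈ , t))
                  ; (inj₂ e) → ⊥-elim (ne (η (u , cong₂ φ e Q-refl t))) } })

    fin-bounded : ∀ {p} → Fin′ p → p ⊆ ω → ∃ λ n → n ∈ ω × p ⊆ n
    fin-bounded {p} f h = fin-ind (∃̇ (v0 ∈̇ con ω ∧̇ 1F ⊆̇ 0F)) f (η (∅ , 0∈ω , λ z q → q))
      λ q x q⊆ x∈ ih → do
        (n , n∈ , q⊆n) ← ih
        (k , k∈ , n⊆k , sx⊆k) ← ω-max n∈ (suc∈ω (h x x∈))
        η (k , k∈ , λ z m → proj₁ (∈-+̂ z) m >>= λ { (inj₁ m) → n⊆k z (q⊆n z m) ; (inj₂ e) → ∈ˡ (Q-sym e) (sx⊆k x +̂-new) })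

    -- Iterated unions are obtained from histories. A history need be neither a function nor total
    -- on an initial segment: every entry is merely justified by another one, which suffices for
    -- uniqueness by induction on n.
    module TC (a : M) where
      chainF : Fm 2 -- n, y : some g is a history of iterated unions of {a} containing ⟨n,y⟩
      chainF = ∃̇ (∀̇ (∀̇ (⟨ v1 , v0 ⟩ᵗ ∈̇ v2 ⇒̇ (v1 ≈̇ con ∅ ∧̇ v0 ≈̇ con (sing a))
                   ∨̇ ∃̇ (∃̇ (v3 ≈̇ +̂-op [ v1 · v1 ] ∧̇ ⟨ v1 , v0 ⟩ᵗ ∈̇ v4 ∧̇ v2 ≈̇ ⋃-op [ v0 · v0 ])))) ∧̇ ⟨ v1 , v2 ⟩ᵗ ∈̇ v0)

      History : M → Set
      History g = ∀ k u → ⟨ k , u ⟩ ∈ g → (k ≈ ∅ × u ≈ sing a) or ∃ (λ k′ → ∃ (λ u′ → k ≈ suc̆ k′ × ⟨ k′ , u′ ⟩ ∈ g × u ≈ ⋃ u′))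

      Chain : M → M → Set
      Chain n y = ∃ λ g → History g × ⟨ n , y ⟩ ∈ g

      chain-0 : Chain ∅ (sing a)
      chain-0 = η (sing ⟨ ∅ , sing a ⟩ , (λ k u m → η (inj₁ (pair-inj (proj₁ (∈-sing _) m)))) , proj₂ (∈-sing _) Q-refl)

      chain-suc : ∀ {n y} → Chain n y → Chain (suc̆ n) (⋃ y)
      chain-suc {n} {y} c = do
        (g , h , m) ← c
        η (g +̂ ⟨ suc̆ n , ⋃ y ⟩ , (λ k u m′ → proj₁ (∈-+̂ _) m′ >>¬ λ
            { (inj₁ o) → h k u o >>¬ λ { (inj₁ b) → η (inj₁ b) ; (inj₂ s) → s >>¬ λ { (k′ , s) → s >>¬ λ { (u′ , e , o , e′) → η (inj₂ (η (k′ , η (u′ , e , +̂-old o , e′)))) } } }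
            ; (inj₂ e) → let (e₁ , e₂) = pair-inj e in η (inj₂ (η (n , η (y , e₁ , +̂-old m , e₂)))) }) , +̂-new)

      chain-fun : ∀ n → n ∈ ω → ∀ y y′ → Chain n y → Chain n y′ → y ≈ y′
      chain-fun = ω-ind (∀̇ (∀̇ (sub chainF (2F ∷ 1F ∷ []) ⇒̇ sub chainF (2F ∷ 0F ∷ []) ⇒̇ v1 ≈̇ v0)))
        (λ y y′ c c′ → Q-trans (zero-case c) (Q-sym (zero-case c′)))
        λ n n∈ ih y y′ c c′ → do
          (u , d , e) ← suc-case c
          (u′ , d′ , e′) ← suc-case c′
          Q-trans e (Q-trans (Op.cong ⋃-op (ih u u′ d d′) (Q-refl {∅})) (Q-sym e′))
        where
        zero-case : ∀ {y} → Chain ∅ y → y ≈ sing a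
        zero-case c = do
          (g , h , m) ← c
          inj₁ (_ , e) ← h _ _ m
            where inj₂ s → s >>= λ { (_ , s) → s >>= λ { (_ , e , _) → ⊥-elim (suc≢∅ (Q-sym e)) } }
          e
        suc-case : ∀ {n y} → Chain (suc̆ n) y → ∃ λ u → Chain n u × y ≈ ⋃ u
        suc-case c = do
          (g , h , m) ← c
          inj₂ s ← h _ _ m
            where inj₁ (e , _) → ⊥-elim (suc≢∅ e)
          (k , s) ← s
          (u , e , o , e′) ← s
          η (u , η (g , h , ∈ˡ (pair-cong (Q-sym (suc-inj e)) Q-refl) o) , e′)

      opaque
        closure : M
        closure = ⋃ (repl ω chainF)

        ∈-closure : ∀ u → u ∈ closure ↔ ∃ (λ n → ∃ (λ y → n ∈ ω × Chain n y × u ∈ y))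
        ∈-closure u =
          (λ h → proj₁ (∈-⋃ u) h >>¬ λ { (y , y∈ , u∈) → proj₁ (∈-repl chainF (λ x y y′ p → chain-fun x p y y′) y) y∈ >>¬ λ { (n , n∈ , c) → η (n , η (y , n∈ , c , u∈)) } })
          , (λ h → h >>= λ { (n , h) → h >>= λ { (y , n∈ , c , u∈) →
              proj₂ (∈-⋃ u) (η (y , proj₂ (∈-repl chainF (λ x y y′ p → chain-fun x p y y′) y) (η (n , n∈ , c)) , u∈)) } })

      self∈ : a ∈ closure
      self∈ = proj₂ (∈-closure a) (η (∅ , η (sing a , 0∈ω , chain-0 , proj₂ (∈-sing a) Q-refl)))

      closure-trans : ∀ x → x ∈ closure → x ⊆ closure
      closure-trans x h z z∈ = proj₁ (∈-closure x) h >>= λ { (n , h) → h >>= λ { (y , n∈ , c , x∈) →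
        proj₂ (∈-closure z) (η (suc̆ n , η (⋃ y , suc∈ω n∈ , chain-suc c , proj₂ (∈-⋃ z) (η (x , x∈ , z∈))))) } }

    ∈-ind : (φ : Fm 1) → (∀ x → (∀ y → y ∈ x → Sat φ (y ∷ [])) → Sat φ (x ∷ [])) → ∀ x → Sat φ (x ∷ [])
    ∈-ind φ step x = stable {{Sat-stable φ _}} λ n → foundation {sep closure (¬̇ φ)} (proj₂ (∈-sep (¬̇ φ) x) (self∈ , n))
      λ { (y , y∈ , min) → let (y∈c , ¬φy) = proj₁ (∈-sep (¬̇ φ) y) y∈ in
        ¬φy (step y λ z z∈ → stable {{Sat-stable φ _}} λ m → min z z∈ (proj₂ (∈-sep (¬̇ φ) z) (closure-trans y y∈c z z∈ , m))) }
      where open TC x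

  -- The cumulative hierarchy, collection and the universe B

  module Levels where
    open Sets public

    opaque
      pot : M → M
      pot h = sep (𝒫 (⋃ h)) (∃̇ (v0 ∈̇ con h ∧̇ 1F ⊆̇ 0F))

      ∈-pot : ∀ {h} u → u ∈ pot h ↔ ∃ (λ y → y ∈ h × u ⊆ y)
      ∈-pot {h} u = ↔-trans (∈-sep (∃̇ (v0 ∈̇ con h ∧̇ 1F ⊆̇ 0F)) u)
        (proj₂ , λ s → (s >>= λ { (y , p , q) → proj₂ (∈-𝒫 u) λ z z∈ → proj₂ (∈-⋃ z) (η (y , p , q z z∈)) }) , s)

    pot-op : Op
    pot-op = record { fun = λ h _ → pot h ; body = ∃̇ (v0 ∈̇ v2 ∧̇ 1F ⊆̇ 0F) ; spec = λ x y u → ∈-pot u }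

    pot-cong : ∀ {h h′} → h ≈ h′ → pot h ≈ pot h′
    pot-cong e = Op.cong pot-op e (Q-refl {∅})

    HistF LevF : Fm 1
    HistF = ∀̇ (v0 ∈̇ v1 ⇒̇ v0 ≈̇ pot-op [ ∩-op [ v0 · v1 ] · v0 ])
    LevF = ∃̇ (sub HistF (0F ∷ []) ∧̇ v1 ≈̇ pot-op [ v0 · v0 ])

    -- Levels of the cumulative hierarchy without ordinals, in the style of Scott and Button: every
    -- member of a history is generated by those of its own members that lie in the history, and a
    -- level is what a history generates.
    Hist Lev Trans : M → Set
    Hist h = ∀ x → x ∈ h → x ≈ pot (x ∩ h)
    Lev s = ∃ λ h → Hist h × s ≈ pot h
    Trans t = ∀ x → x ∈ t → x ⊆ t

    lev-≈ : ∀ {s t} → s ≈ t → Lev s → Lev t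
    lev-≈ = cong₁ LevF

    hist-trans : ∀ {h} → Hist h → ∀ s → s ∈ h → Trans s
    hist-trans {h} H s s∈ = stable λ n → foundation {sep h (¬̇ TransF)} (proj₂ (∈-sep (¬̇ TransF) s) (s∈ , n)) λ { (t , t∈ , min) →
      let (t∈h , ¬tr) = proj₁ (∈-sep (¬̇ TransF) t) t∈ in ¬tr λ x x∈ z z∈ → do
        (y , y∈ , x⊆y) ← proj₁ (∈-pot x) (∈ʳ (H t t∈h) x∈)
        let (y∈t , y∈h) = proj₁ (∈-∩ y) y∈
        let y-trans = stable λ m → min y y∈t (proj₂ (∈-sep (¬̇ TransF) y) (y∈h , m))
        ∈ʳ (Q-sym (H t t∈h)) (proj₂ (∈-pot z) (η (y , y∈ , y-trans z (x⊆y z z∈)))) }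
      where
      TransF : Fm 1
      TransF = ∀̇ (v0 ∈̇ v1 ⇒̇ 0F ⊆̇ 1F)

    hist-lev : ∀ {h s} → Hist h → s ∈ h → Lev s
    hist-lev {h} {s} H s∈ = η (s ∩ h , (λ x x∈ → let (x∈s , x∈h) = proj₁ (∈-∩ x) x∈ in
        Q-trans (H x x∈h) (pot-cong (ext λ u →
          (λ m → let (a , b) = proj₁ (∈-∩ u) m in proj₂ (∈-∩ u) (a , proj₂ (∈-∩ u) (hist-trans H s s∈ x x∈s u a , b)))
          , λ m → let (a , b) = proj₁ (∈-∩ u) m in proj₂ (∈-∩ u) (a , proj₂ (proj₁ (∈-∩ u) b))))) , H s s∈)

    lev-potent : ∀ {s} → Lev s → ∀ {x y} → x ⊆ y → y ∈ s → x ∈ s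
    lev-potent L {x} {y} x⊆y y∈ = do
      (h , H , e) ← L
      (z , z∈ , y⊆z) ← proj₁ (∈-pot y) (∈ʳ e y∈)
      ∈ʳ (Q-sym e) (proj₂ (∈-pot x) (η (z , z∈ , λ w w∈ → y⊆z w (x⊆y w w∈))))

    lev-trans : ∀ {s} → Lev s → Trans s
    lev-trans L x x∈ z z∈ = do
      (h , H , e) ← L
      (y , y∈ , x⊆y) ← proj₁ (∈-pot x) (∈ʳ e x∈)
      ∈ʳ (Q-sym e) (proj₂ (∈-pot z) (η (y , y∈ , hist-trans H y y∈ z (x⊆y z z∈))))

    lev-below : ∀ {s} → Lev s → ∀ x → x ∈ s → ∃ λ r → Lev r × r ∈ s × x ⊆ r
    lev-below L x x∈ = do
      (h , H , e) ← L
      (y , y∈ , x⊆y) ← proj₁ (∈-pot x) (∈ʳ e x∈)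
      η (y , hist-lev H y∈ , ∈ʳ (Q-sym e) (proj₂ (∈-pot y) (η (y , y∈ , λ z z∈ → z∈))) , x⊆y)

    lev-least : (φ : Fm 1) → ∀ {s} → Lev s → Sat φ (s ∷ []) →
                ∃ λ r → Lev r × Sat φ (r ∷ []) × (∀ q → q ∈ r → Lev q → ¬ Sat φ (q ∷ []))
    lev-least φ {s} L p = foundation {sep (suc̆ s) (LevF ∧̇ φ)} (proj₂ (∈-sep (LevF ∧̇ φ) s) (+̂-new , L , p)) >>¬ λ { (r , r∈ , min) →
      let (r∈s , Lr , pr) = proj₁ (∈-sep (LevF ∧̇ φ) r) r∈ in
      η (r , Lr , pr , λ q q∈ Lq pq → min q q∈ (proj₂ (∈-sep (LevF ∧̇ φ) q)
        ((proj₁ (∈-+̂ r) r∈s >>= λ { (inj₁ m) → +̂-old (lev-trans L r m q q∈) ; (inj₂ e) → +̂-old (∈ʳ e q∈) }) , Lq , pq))) }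

    Comparable : M → M → Set
    Comparable s t = s ∈ t or (s ≈ t or t ∈ s)

    compF : Fm 2
    compF = v0 ∈̇ v1 ∨̇ (v0 ≈̇ v1 ∨̇ v1 ∈̇ v0)

    -- Let s₀ be a least level incomparable with some level, and t₀ a least level incomparable with
    -- s₀. Every element of one of them is included in a smaller level, and minimality locates that
    -- level relative to the other; so s₀ and t₀ have the same elements.
    lev-comp : ∀ {s t} → Lev s → Lev t → Comparable s t
    lev-comp {s} {t} Ls Lt = stable λ n →
      lev-least (∃̇ (sub LevF (0F ∷ []) ∧̇ ¬̇ sub compF (1F ∷ 0F ∷ []))) Ls (η (t , Lt , n)) λ { (s₀ , Ls₀ , bad , smin) → bad λ { (t₁ , Lt₁ , n₁) →
      lev-least (¬̇ (lt (con s₀) (sub compF (0F ∷ 1F ∷ [])))) Lt₁ n₁ λ { (t₀ , Lt₀ , n₀ , tmin) →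
      let s₀∉ : s₀ ∉ t₀
          s₀∉ m = n₀ (η (inj₁ m))
          t₀∉ : t₀ ∉ s₀
          t₀∉ m = n₀ (η (inj₂ (η (inj₂ m))))
      in n₀ (η (inj₂ (η (inj₁ (ext⊆
        (λ x x∈ → do
          (r , Lr , r∈ , x⊆r) ← lev-below Ls₀ x x∈
          inj₁ r∈t ← stable {A = Comparable r t₀} (λ m → smin r r∈ Lr (η (t₀ , Lt₀ , m)))
            where inj₂ h → h >>= λ { (inj₁ e) → ⊥-elim (t₀∉ (∈ˡ e r∈)) ; (inj₂ m) → ⊥-elim (t₀∉ (lev-trans Ls₀ r r∈ t₀ m)) }
          lev-potent Lt₀ x⊆r r∈t)
        (λ x x∈ → do
          (r , Lr , r∈ , x⊆r) ← lev-below Lt₀ x x∈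
          inj₁ s∈r ← stable {A = Comparable s₀ r} (tmin r r∈ Lr)
            where inj₂ h → h >>= λ { (inj₁ e) → ⊥-elim (s₀∉ (∈ˡ (Q-sym e) r∈)) ; (inj₂ m) → lev-potent Ls₀ x⊆r m }
          ⊥-elim (s₀∉ (lev-trans Lt₀ r r∈ s₀ s∈r)))))))) } } }

    lev-sup : ∀ d → (∀ s → s ∈ d → Lev s) → ∃ λ l → Lev l × d ⊆ l
    lev-sup d h = η (pot H , η (H , hist , Q-refl) , λ s s∈ → proj₂ (∈-pot s) (η (s , proj₂ (∈-sep LevF s) (∪ˡ s s∈ , h s s∈) , λ z z∈ → z∈)))
      where
      H = sep (d ∪ ⋃ d) LevF
      below : ∀ x r → x ∈ H → r ∈ x → r ∈ ⋃ d
      below x r x∈ r∈ = ∪-elim (proj₁ (proj₁ (∈-sep LevF x) x∈)) (λ m → proj₂ (∈-⋃ r) (η (x , m , r∈)))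
        λ m → proj₁ (∈-⋃ x) m >>= λ { (y , y∈ , x∈y) → proj₂ (∈-⋃ r) (η (y , y∈ , lev-trans (h y y∈) x x∈y r r∈)) }
      hist : Hist H
      hist x x∈ = let Lx = proj₂ (proj₁ (∈-sep LevF x) x∈) in ext⊆
        (λ z z∈ → lev-below Lx z z∈ >>= λ { (r , Lr , r∈ , z⊆r) →
          proj₂ (∈-pot z) (η (r , proj₂ (∈-∩ r) (r∈ , proj₂ (∈-sep LevF r) (∪ʳ r (below x r x∈ r∈) , Lr)) , z⊆r)) })
        (λ z z∈ → proj₁ (∈-pot z) z∈ >>= λ { (r , r∈ , z⊆r) → lev-potent Lx z⊆r (proj₁ (proj₁ (∈-∩ r) r∈)) })

    lev-next : ∀ {s} → Lev s → ∃ λ l → Lev l × s ∈ l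
    lev-next {s} L = lev-sup (sing s) (λ t t∈ → lev-≈ (Q-sym (proj₁ (∈-sing t) t∈)) L) >>¬ λ { (l , Ll , h) → η (l , Ll , h s (proj₂ (∈-sing s) Q-refl)) }

    leastF : Fm 2 → Fm 2 -- x, s : s is the least level having a member y with φ(x,y)
    leastF φ = sub LevF (1F ∷ []) ∧̇ ∃̇ (v0 ∈̇ v2 ∧̇ sub φ (1F ∷ 0F ∷ [])) ∧̇
               ∀̇ (v0 ∈̇ v2 ⇒̇ sub LevF (0F ∷ []) ⇒̇ ¬̇ ∃̇ (v0 ∈̇ v1 ∧̇ sub φ (2F ∷ 0F ∷ [])))

    leastF-fun : ∀ φ x s t → Sat (leastF φ) (x ∷ s ∷ []) → Sat (leastF φ) (x ∷ t ∷ []) → s ≈ t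
    leastF-fun φ x s t (Ls , p , min) (Lt , q , min′) = lev-comp Ls Lt >>= λ
      { (inj₁ m) → ⊥-elim (min′ s m Ls p) ; (inj₂ h) → h >>= λ { (inj₁ e) → e ; (inj₂ m) → ⊥-elim (min t m Lt q) } }

    -- Scott's trick: replacement is applied to the least level containing a witness. The witnesses
    -- are assumed to lie in levels because `in-level`, which removes this assumption, is itself
    -- proved from this lemma.
    lev-coll : (φ : Fm 2) → ∀ a → ∃ λ l → Lev l × (∀ x → x ∈ a → ∀ y s → Sat φ (x ∷ y ∷ []) → y ∈ s → Lev s → ∃ λ y′ → y′ ∈ l × Sat φ (x ∷ y′ ∷ []))
    lev-coll φ a = do
      (l , Ll , h) ← lev-sup d (λ s s∈ → proj₁ (∈-d s) s∈ >>= λ { (x , _ , Ls , _) → Ls })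
      η (l , Ll , λ x x∈ y s p y∈ Ls → do
        (r , Lr , q , min) ← lev-least (lt (con x) (∃̇ (v0 ∈̇ v2 ∧̇ sub φ (1F ∷ 0F ∷ [])))) Ls (η (y , y∈ , p))
        let r∈ = proj₂ (∈-d r) (η (x , x∈ , Lr , q , min))
        (y′ , y′∈ , p′) ← q
        η (y′ , lev-trans Ll r (h r r∈) y′ y′∈ , p′))
      where
      d = repl a (leastF φ)
      ∈-d = ∈-repl {a} (leastF φ) λ x s t _ → leastF-fun φ x s t

    in-level : ∀ x → ∃ λ s → Lev s × x ∈ s
    in-level = ∈-ind (∃̇ (sub LevF (0F ∷ []) ∧̇ v1 ∈̇ v0)) λ x ih → do
      (l , Ll , h) ← lev-coll (v0 ≈̇ v1) x
      let x⊆l : x ⊆ l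
          x⊆l y y∈ = do
            (s , Ls , y∈s) ← ih y y∈
            (y′ , y′∈ , e) ← h y y∈ y s Q-refl y∈s Ls
            ∈ˡ (Q-sym e) y′∈
      (l′ , Ll′ , m) ← lev-next Ll
      η (l′ , Ll′ , lev-potent Ll′ x⊆l m)

    collection : (φ : Fm 2) → ∀ a → ∃ λ b → ∀ x → x ∈ a → ∃ (λ y → Sat φ (x ∷ y ∷ [])) → ∃ λ y → y ∈ b × Sat φ (x ∷ y ∷ [])
    collection φ a = do
      (l , _ , h) ← lev-coll φ a
      η (l , λ x x∈ ey → do
        (y , p) ← ey
        (s , Ls , y∈) ← in-level y
        h x x∈ y s p y∈ Ls)

    -- What the forcing uses of B: pairs, finite patterns and traces over B are elements of B again.
    -- For V_ω, size at most |B| means countable, so `I` has the size of the continuum and the chain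
    -- condition is the countable one.
    record Universe (B : M) : Set where
      no-eta-equality
      field
        ω⊆     : ω ⊆ B
        trans′ : Trans B
        pair∈  : ∀ {x y} → x ∈ B → y ∈ B → ⟨ x , y ⟩ ∈ B
        fin∈   : ∀ {p} → Fin′ p → p ⊆ B → p ∈ B
        sub∈   : ∀ {x y} → x ⊆ y → y ∈ B → x ∈ B
        ∪∈     : ∀ {x y} → x ∈ B → y ∈ B → x ∪ y ∈ B

    -- V_ω, as the least level including ω
    universe : ¬ ¬ Σ M Universe
    universe = do
      (s , Ls , ω∈) ← in-level ω
      (B , LB , ω⊆B , min) ← lev-least (∀̇ (v0 ∈̇ con ω ⇒̇ v0 ∈̇ v1)) Ls (λ n n∈ → lev-trans Ls ω ω∈ n n∈)
      -- B has no last level. Were B the least level l containing r, then each `suc̆ n` would be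
      -- included in a level q ∈ B not containing r, hence in r; so r would include ω, against the
      -- minimality of B.
      let limit : ∀ r → Lev r → r ∈ B → ∃ λ l → Lev l × l ∈ B × r ∈ l
          limit r Lr r∈ = do
            (l , Ll , r∈l , lmin) ← lev-least (con r ∈̇ v0) LB r∈
            inj₁ m ← lev-comp Ll LB
              where inj₂ h → h >>= λ
                      { (inj₁ e) → ⊥-elim (min r r∈ Lr λ n n∈ → do
                          (q , Lq , q∈l , sn⊆q) ← lev-below Ll (suc̆ n) (∈ʳ (Q-sym e) (ω⊆B _ (suc∈ω n∈)))
                          inj₁ q∈r ← lev-comp Lq Lr
                            where inj₂ h → h >>= λ { (inj₁ e) → ∈ʳ e (sn⊆q n +̂-new) ; (inj₂ r∈q) → ⊥-elim (lmin q q∈l Lq r∈q) }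
                          lev-trans Lr q q∈r n (sn⊆q n +̂-new))
                      ; (inj₂ B∈l) → ⊥-elim (lmin B B∈l LB r∈) }
            η (l , Ll , m , r∈l)
          join : ∀ x y → x ∈ B → y ∈ B → ∃ λ r → Lev r × r ∈ B × x ⊆ r × y ∈ r
          join x y x∈ y∈ = do
            (r , Lr , r∈ , x⊆r) ← lev-below LB x x∈
            (q , Lq , q∈ , y⊆q) ← lev-below LB y y∈
            (q′ , Lq′ , q′∈ , q∈q′) ← limit q Lq q∈
            let y∈q′ = lev-potent Lq′ y⊆q q∈q′
            inj₁ m ← lev-comp Lr Lq′
              where inj₂ h → h >>¬ λ { (inj₁ e) → η (q′ , Lq′ , q′∈ , (λ z z∈ → ∈ʳ e (x⊆r z z∈)) , y∈q′) ; (inj₂ m) → η (r , Lr , r∈ , x⊆r , lev-trans Lr q′ m y y∈q′) }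
            η (q′ , Lq′ , q′∈ , (λ z z∈ → lev-trans Lq′ r m z (x⊆r z z∈)) , y∈q′)
          +∈ : ∀ {x y} → x ∈ B → y ∈ B → x +̂ y ∈ B
          +∈ {x} {y} x∈ y∈ = do
            (r , Lr , r∈ , x⊆r , y∈r) ← join x y x∈ y∈
            lev-potent LB (λ z z∈ → proj₁ (∈-+̂ z) z∈ >>= λ { (inj₁ m) → x⊆r z m ; (inj₂ e) → ∈ˡ (Q-sym e) y∈r }) r∈
          ∅∈ : ∅ ∈ B
          ∅∈ = ω⊆B ∅ 0∈ω
          up∈ : ∀ {x y} → x ∈ B → y ∈ B → upair x y ∈ B
          up∈ {x} {y} x∈ y∈ = lev-potent LB (λ z z∈ → proj₁ (∈-upair z) z∈ >>= λ
            { (inj₁ e) → +̂-old (∈ˡ (Q-sym e) +̂-new) ; (inj₂ e) → ∈ˡ (Q-sym e) +̂-new }) (+∈ (+∈ ∅∈ x∈) y∈)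
      η (B , record
        { ω⊆ = ω⊆B
        ; trans′ = lev-trans LB
        ; pair∈ = λ x∈ y∈ → ∈ˡ (Q-sym pair-def) (up∈ (up∈ x∈ x∈) (up∈ x∈ y∈))
        ; fin∈ = λ {p} f p⊆ → fin-ind (v0 ∈̇ con B) f ∅∈ (λ q x _ x∈ q∈ → +∈ q∈ (p⊆ x x∈))
        ; sub∈ = λ x⊆y y∈ → lev-potent LB x⊆y y∈
        ; ∪∈ = λ {x} {y} x∈ y∈ → join x y x∈ y∈ >>= λ { (r , Lr , r∈ , x⊆r , y∈r) →
            lev-potent LB (λ z z∈ → ∪-elim z∈ (x⊆r z) (lev-trans Lr y y∈r z)) r∈ } })

  -- Choice functions and maximal cliques

  module Choice where
    open Levels public

    choice : ∀ {a} → (∀ x → x ∈ a → ∃ λ y → y ∈ x) → (∀ x y z → x ∈ a → y ∈ a → z ∈ x → z ∈ y → x ≈ y) →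
             ∃ λ c → ∀ x → x ∈ a → ∃ λ u → ∀ v → (v ∈ x × v ∈ c) ↔ (v ≈ u)
    choice {a} ne dis = λ k → holds D.choice-ax a
      (proj₂ (S-∧ (D.all∈ 0F (D.ex (0F D.∈ 1F))) (D.all∈ 0F (D.all∈ 1F (D.~ 0F D.≐ 1F D.⇒ D.Disjoint 0F 1F))) {a ∷ []})
        ((λ x x∈ n → ne x x∈ λ { (y , m) → n y m })
        , λ x x∈ y y∈ y≢x d → d λ z m → let (m₁ , m₂) = proj₁ (S-∧ (0F D.∈ 1F) (0F D.∈ 2F) {z ∷ y ∷ x ∷ a ∷ []}) m in y≢x (dis y x z y∈ x∈ m₁ m₂)))
      λ c h → k (c , λ x x∈ k′ → h x x∈ λ u m → k′ (u , λ v → ↔-trans (↔-sym (S-∧ (0F D.∈ 2F) (0F D.∈ 3F) {v ∷ u ∷ x ∷ c ∷ a ∷ []}))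
          (proj₁ (S-⇔ (0F D.∈ 2F D.∧ 0F D.∈ 3F) (0F D.≐ 1F) {v ∷ u ∷ x ∷ c ∷ a ∷ []}) (m v))))

    Functional : M → Set
    Functional f = ∀ x y y′ → ⟨ x , y ⟩ ∈ f → ⟨ x , y′ ⟩ ∈ f → y ≈ y′

    -- The nonempty slices of r over single x are pairwise disjoint, so one choice set meets each of
    -- them in exactly one point.
    uniformize : ∀ X Y r → r ⊆ X ×ˢ Y → ∃ λ f → f ⊆ r × Functional f × (∀ x y → ⟨ x , y ⟩ ∈ r → ∃ λ y′ → ⟨ x , y′ ⟩ ∈ f)
    uniformize X Y r r⊆ = do
      (c , h) ← choice {a} nonempty disjoint
      let unique : ∀ x y y′ → ⟨ x , y ⟩ ∈ r ∩ c → ⟨ x , y′ ⟩ ∈ r ∩ c → y ≈ y′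
          unique x y y′ m m′ = let (p , q) = proj₁ (∈-∩ _) m ; (p′ , q′) = proj₁ (∈-∩ _) m′ in
            h (slice x) (slice∈ x y p) >>= λ { (u , k) → proj₂ (pair-inj (Q-trans (proj₁ (k _) (in-slice p , q)) (Q-sym (proj₁ (k _) (in-slice p′ , q′))))) }
      η (r ∩ c , (λ z m → proj₁ (proj₁ (∈-∩ z) m)) , unique , λ x y p → do
        (u , k) ← h (slice x) (slice∈ x y p)
        let (u∈s , u∈c) = proj₂ (k u) Q-refl
        let (u∈r , e) = proj₁ (∈-sep (sliceF x) u) u∈s
        (y′ , e) ← e
        η (y′ , ∈ˡ e (proj₂ (∈-∩ u) (u∈r , u∈c))))
      where
      sliceF : M → Fm 1
      sliceF x = ∃̇ (v1 ≈̇ ⟨ con x , v0 ⟩ᵗ)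
      slice : M → M
      slice x = sep r (sliceF x)
      in-slice : ∀ {x y} → ⟨ x , y ⟩ ∈ r → ⟨ x , y ⟩ ∈ slice x
      in-slice {x} {y} p = proj₂ (∈-sep (sliceF x) _) (p , η (y , Q-refl))
      aF : Fm 1 -- s is a slice of r, with some member ⟨x,y⟩
      aF = ∃̇ (∃̇ (⟨ v1 , v0 ⟩ᵗ ∈̇ con r ∧̇ ∀̇ (v0 ∈̇ v3 ⇔̇ (v0 ∈̇ con r ∧̇ ∃̇ (v1 ≈̇ ⟨ v3 , v0 ⟩ᵗ)))))
      a = sep (𝒫 r) aF
      slice∈ : ∀ x y → ⟨ x , y ⟩ ∈ r → slice x ∈ a
      slice∈ x y p = proj₂ (∈-sep aF _) (proj₂ (∈-𝒫 _) (λ z m → proj₁ (proj₁ (∈-sep (sliceF x) z) m)) , η (x , η (y , p , ∈-sep (sliceF x))))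
      nonempty : ∀ s → s ∈ a → ∃ λ y → y ∈ s
      nonempty s s∈ = proj₂ (proj₁ (∈-sep aF s) s∈) >>¬ λ { (x , h) → h >>¬ λ { (y , p , h) → η (⟨ x , y ⟩ , proj₂ (h _) (p , η (y , Q-refl))) } }
      disjoint : ∀ s t z → s ∈ a → t ∈ a → z ∈ s → z ∈ t → s ≈ t
      disjoint s t z s∈ t∈ z∈s z∈t =
        proj₂ (proj₁ (∈-sep aF s) s∈) >>= λ { (x , h) → h >>= λ { (y , _ , h) →
        proj₂ (proj₁ (∈-sep aF t) t∈) >>= λ { (x′ , h′) → h′ >>= λ { (y′ , _ , h′) →
        proj₂ (proj₁ (h z) z∈s) >>= λ { (w , e) → proj₂ (proj₁ (h′ z) z∈t) >>= λ { (w′ , e′) →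
        let x≈x′ = proj₁ (pair-inj (Q-trans (Q-sym e) e′)) in
        ext λ u → ↔-trans (h u) (↔-trans
          ((λ { (p , q) → p , (q >>¬ λ { (v , e) → η (v , Q-trans e (pair-cong x≈x′ Q-refl)) }) })
          , (λ { (p , q) → p , (q >>¬ λ { (v , e) → η (v , Q-trans e (pair-cong (Q-sym x≈x′) Q-refl)) }) })) (↔-sym (h′ u))) } } } } } }

    choice-function : (φ : Fm 2) → ∀ a → (∀ x → x ∈ a → ∃ λ y → Sat φ (x ∷ y ∷ [])) →
      ∃ λ f → Functional f × (∀ x y → ⟨ x , y ⟩ ∈ f → x ∈ a × Sat φ (x ∷ y ∷ [])) × (∀ x → x ∈ a → ∃ λ y → ⟨ x , y ⟩ ∈ f)
    choice-function φ a h = do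
      (b , hb) ← collection φ a
      let rF : Fm 1
          rF = ∃̇ (∃̇ (v2 ≈̇ ⟨ v1 , v0 ⟩ᵗ ∧̇ sub φ (1F ∷ 0F ∷ [])))
          r∈ : ∀ x y → ⟨ x , y ⟩ ∈ sep (a ×ˢ b) rF ↔ ((x ∈ a × y ∈ b) × Sat φ (x ∷ y ∷ []))
          r∈ x y = ↔-trans (∈-sep rF _) ((λ { (p , q) → proj₁ pair∈× p , stable {{Sat-stable φ _}} λ n → q λ { (x′ , q) → q λ { (y′ , e , s) →
            let (e₁ , e₂) = pair-inj e in n (cong₂ φ (Q-sym e₁) (Q-sym e₂) s) } } })
            , λ { (p , q) → proj₂ pair∈× p , η (x , η (y , Q-refl , q)) })
      (f , f⊆ , fun , tot) ← uniformize a b (sep (a ×ˢ b) rF) (λ z m → proj₁ (proj₁ (∈-sep rF z) m))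
      η (f , fun , (λ x y m → let ((p , _) , q) = proj₁ (r∈ x y) (f⊆ _ m) in p , q) , λ x x∈ → do
        (y , y∈ , s) ← hb x x∈ (h x x∈)
        tot x y (proj₂ (r∈ x y) ((x∈ , y∈) , s)))

    -- Zorn's lemma for cliques of a reflexive symmetric relation, by the
    -- Bourbaki–Witt argument.
    module MaximalClique (X : M) (ρ : Fm 2) where
      R : M → M → Set
      R x y = Sat ρ (x ∷ y ∷ [])

      Clique : M → Set
      Clique S = ∀ x y → x ∈ S → y ∈ S → R x y

      extF : Fm 2 -- S, x
      extF = v1 ∈̇ con X ∧̇ ¬̇ v1 ∈̇ v0 ∧̇ ∀̇ (v0 ∈̇ v1 ⇒̇ sub ρ (2F ∷ 0F ∷ []))

      module Tower (g : M) (g-fun : Functional g) (g-ext : ∀ S x → ⟨ S , x ⟩ ∈ g → Sat extF (S ∷ x ∷ [])) where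
        -- Closure under arbitrary unions, not only unions of chains, is harmless since the least
        -- closed family is a chain; the empty union provides its starting point ∅.
        closedF : Fm 1
        closedF = ∀̇ (∀̇ (v1 ∈̇ v2 ⇒̇ ⟨ v1 , v0 ⟩ᵗ ∈̇ con g ⇒̇ +̂-op [ v1 · v0 ] ∈̇ v2)) ∧̇ ∀̇ (0F ⊆̇ 1F ⇒̇ ⋃-op [ v0 · v0 ] ∈̇ v1)
        𝒯F : Fm 1
        𝒯F = ∀̇ (sub closedF (0F ∷ []) ⇒̇ v1 ∈̇ v0)
        𝒯 = sep (𝒫 X) 𝒯F

        𝒯-suc : ∀ S x → S ∈ 𝒯 → ⟨ S , x ⟩ ∈ g → S +̂ x ∈ 𝒯
        𝒯-suc S x S∈ m = let (a , b) = proj₁ (∈-sep 𝒯F S) S∈ in proj₂ (∈-sep 𝒯F _)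
          (proj₂ (∈-𝒫 _) (λ z z∈ → proj₁ (∈-+̂ z) z∈ >>= λ { (inj₁ p) → proj₁ (∈-𝒫 _) a z p ; (inj₂ e) → ∈ˡ (Q-sym e) (proj₁ (g-ext S x m)) })
          , λ F c → proj₁ c S x (b F c) m)

        𝒯-⋃ : ∀ C → C ⊆ 𝒯 → ⋃ C ∈ 𝒯
        𝒯-⋃ C C⊆ = proj₂ (∈-sep 𝒯F _)
          (proj₂ (∈-𝒫 _) (λ z z∈ → proj₁ (∈-⋃ z) z∈ >>= λ { (S , S∈ , p) → proj₁ (∈-𝒫 _) (proj₁ (proj₁ (∈-sep 𝒯F S) (C⊆ S S∈))) z p })
          , λ F c → proj₂ c C λ S S∈ → proj₂ (proj₁ (∈-sep 𝒯F S) (C⊆ S S∈)) F c)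

        𝒯-ind : (φ : Fm 1) → (∀ S x → S ∈ 𝒯 → Sat φ (S ∷ []) → ⟨ S , x ⟩ ∈ g → Sat φ (S +̂ x ∷ [])) →
                (∀ C → C ⊆ 𝒯 → (∀ S → S ∈ C → Sat φ (S ∷ [])) → Sat φ (⋃ C ∷ [])) → ∀ S → S ∈ 𝒯 → Sat φ (S ∷ [])
        𝒯-ind φ s u S S∈ = proj₂ (proj₁ (∈-sep φ S) (proj₂ (proj₁ (∈-sep 𝒯F S) S∈) (sep 𝒯 φ)
          ( (λ S x S∈ m → let (a , b) = proj₁ (∈-sep φ S) S∈ in proj₂ (∈-sep φ _) (𝒯-suc S x a m , s S x a b m))
          , λ C C⊆ → proj₂ (∈-sep φ _) (𝒯-⋃ C (λ S S∈ → proj₁ (proj₁ (∈-sep φ S) (C⊆ S S∈))) , u C (λ S S∈ → proj₁ (proj₁ (∈-sep φ S) (C⊆ S S∈))) (λ S S∈ → proj₂ (proj₁ (∈-sep φ S) (C⊆ S S∈)))) )))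

        +̂⊆ : ∀ {S x T} → S ⊆ T → x ∈ T → S +̂ x ⊆ T
        +̂⊆ p q z m = proj₁ (∈-+̂ z) m >>= λ { (inj₁ m) → p z m ; (inj₂ e) → ∈ˡ (Q-sym e) q }

        ⋃⊆ : ∀ {C T} → (∀ S → S ∈ C → S ⊆ T) → ⋃ C ⊆ T
        ⋃⊆ h z m = proj₁ (∈-⋃ z) m >>= λ { (S , S∈ , p) → h S S∈ z p }

        ⊆⋃ : ∀ {C S} → S ∈ C → S ⊆ ⋃ C
        ⊆⋃ S∈ z p = proj₂ (∈-⋃ z) (η (_ , S∈ , p))

        Pivot : M → Set
        Pivot C = ∀ T → T ∈ 𝒯 → T ⊆ C or C ⊆ T

        -- Induction on T. A step from T ⊆ C by some y ∉ C must start at T = C, because C is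
        -- comparable with the result; and there `g` adds the same element as above C.
        jump : ∀ C → C ∈ 𝒯 → Pivot C → ∀ T → T ∈ 𝒯 → T ⊆ C or (C ⊆ T × (∀ x → ⟨ C , x ⟩ ∈ g → x ∈ T))
        jump C C∈ piv = 𝒯-ind ((∀̇ (v0 ∈̇ v1 ⇒̇ v0 ∈̇ con C)) ∨̇ ((∀̇ (v0 ∈̇ con C ⇒̇ v0 ∈̇ v1)) ∧̇ ∀̇ (⟨ con C , v0 ⟩ᵗ ∈̇ con g ⇒̇ v0 ∈̇ v1)))
          (λ T y T∈ ih m → ih >>¬ λ
            { (inj₁ T⊆C) → cases {A = y ∈ C}
                (λ y∈ → η (inj₁ (+̂⊆ T⊆C y∈)))
                (λ y∉ → piv (T +̂ y) (𝒯-suc T y T∈ m) >>¬ λ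
                  { (inj₁ h) → ⊥-elim (y∉ (h y +̂-new))
                  ; (inj₂ C⊆) → η (inj₂ (C⊆ , λ x m′ → ∈ˡ (g-fun T y x m (∈ˡ (pair-cong (ext⊆ (λ z z∈ → proj₁ (∈-+̂ z) (C⊆ z z∈) >>= λ { (inj₁ p) → p ; (inj₂ e) → ⊥-elim (y∉ (∈ˡ e z∈)) }) T⊆C) Q-refl) m′)) +̂-new)) })
            ; (inj₂ (C⊆T , h)) → η (inj₂ ((λ z z∈ → +̂-old (C⊆T z z∈)) , λ x m → +̂-old (h x m))) })
          (λ 𝒞 𝒞⊆ ih → cases {A = ∃ λ T → T ∈ 𝒞 × (C ⊆ T × (∀ x → ⟨ C , x ⟩ ∈ g → x ∈ T))}
            (λ s → s >>¬ λ { (T , T∈ , C⊆T , h) → η (inj₂ ((λ z z∈ → ⊆⋃ T∈ z (C⊆T z z∈)) , λ x m → ⊆⋃ T∈ x (h x m))) })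
            (λ n → η (inj₁ (⋃⊆ λ T T∈ → ih T T∈ >>= λ { (inj₁ p) → p ; (inj₂ q) → ⊥-elim (n (η (T , T∈ , q))) }))))

        chain : ∀ C → C ∈ 𝒯 → Pivot C
        chain C C∈ = proj₂ (𝒯-ind (v0 ∈̇ con 𝒯 ∧̇ ∀̇ (v0 ∈̇ con 𝒯 ⇒̇ 0F ⊆̇ 1F ∨̇ 1F ⊆̇ 0F))
          (λ C x C∈ ih m → 𝒯-suc C x C∈ m , λ T T∈ → jump C C∈ (proj₂ ih) T T∈ >>¬ λ
            { (inj₁ p) → η (inj₁ λ z z∈ → +̂-old (p z z∈)) ; (inj₂ (p , q)) → η (inj₂ (+̂⊆ p (q x m))) })
          (λ 𝒞 𝒞⊆ ih → 𝒯-⋃ 𝒞 𝒞⊆ , λ T T∈ → cases {A = ∃ λ C → C ∈ 𝒞 × T ⊆ C}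
            (λ s → s >>¬ λ { (C , C∈ , p) → η (inj₁ λ z z∈ → ⊆⋃ C∈ z (p z z∈)) })
            (λ n → η (inj₂ (⋃⊆ λ C C∈ → proj₂ (ih C C∈) T T∈ >>= λ { (inj₁ p) → ⊥-elim (n (η (C , C∈ , p))) ; (inj₂ q) → q }))))
          C C∈)

        top : M
        top = ⋃ 𝒯

        top∈ : top ∈ 𝒯
        top∈ = 𝒯-⋃ 𝒯 λ z z∈ → z∈

        top⊆ : top ⊆ X
        top⊆ = proj₁ (∈-𝒫 _) (proj₁ (proj₁ (∈-sep 𝒯F top) top∈))

        top-max : ∀ x → ⟨ top , x ⟩ ∉ g
        top-max x m = proj₁ (proj₂ (g-ext top x m)) (⊆⋃ (𝒯-suc top x top∈ m) x +̂-new)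

        cliques : (∀ x → x ∈ X → R x x) → (∀ x y → R x y → R y x) → ∀ S → S ∈ 𝒯 → Clique S
        cliques rfl sm = 𝒯-ind (∀̇ (∀̇ (v1 ∈̇ v2 ⇒̇ v0 ∈̇ v2 ⇒̇ sub ρ (1F ∷ 0F ∷ []))))
          (λ S z S∈ ih m x y x∈ y∈ → stable {{Sat-stable ρ _}} λ n → let (z∈ , _ , h) = g-ext S z m in
            proj₁ (∈-+̂ x) x∈ λ
              { (inj₁ p) → proj₁ (∈-+̂ y) y∈ λ { (inj₁ q) → n (ih x y p q) ; (inj₂ e) → n (cong₂ ρ Q-refl (Q-sym e) (sm z x (h x p))) }
              ; (inj₂ e) → proj₁ (∈-+̂ y) y∈ λ { (inj₁ q) → n (cong₂ ρ (Q-sym e) Q-refl (h y q)) ; (inj₂ e′) → n (cong₂ ρ (Q-sym e) (Q-sym e′) (rfl z z∈)) } })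
          (λ C C⊆ ih x y x∈ y∈ → stable {{Sat-stable ρ _}} λ n → proj₁ (∈-⋃ x) x∈ λ { (S , S∈ , p) → proj₁ (∈-⋃ y) y∈ λ { (T , T∈ , q) →
            chain S (C⊆ S S∈) T (C⊆ T T∈) λ { (inj₁ T⊆S) → n (ih S S∈ x y p (T⊆S y q)) ; (inj₂ S⊆T) → n (ih T T∈ x y (S⊆T x p) q) } } })

      maximal-clique : (∀ x → x ∈ X → R x x) → (∀ x y → R x y → R y x) →
                       ∃ λ S → S ⊆ X × Clique S × (∀ x → x ∈ X → (∀ y → y ∈ S → R x y) → x ∈ S)
      maximal-clique rfl sm = do
        (g , g-fun , g-ext , g-tot) ← choice-function extF (sep (𝒫 X) (∃̇ (sub extF (1F ∷ 0F ∷ []))))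
          (λ S S∈ → proj₂ (proj₁ (∈-sep (∃̇ (sub extF (1F ∷ 0F ∷ []))) S) S∈))
        let open Tower g g-fun (λ S x m → proj₂ (g-ext S x m))
        η (top , top⊆ , cliques rfl sm top top∈ , λ x x∈ h → stable λ x∉ →
          g-tot top (proj₂ (∈-sep (∃̇ (sub extF (1F ∷ 0F ∷ []))) top) (proj₂ (∈-𝒫 _) top⊆ , η (x , x∈ , x∉ , h))) λ { (y , m) → top-max y m })

  open Choice

  module ForcingExtension (P T p₀ : M) (p₀∈P : p₀ ∈ P) (enum : ℕ → M) (enum-onto : ∀ x → Σ ℕ λ k → enum k ≡ x) where

    -- Names, the forcing relation and the truth lemma

    module Forcing where
      open import Data.Nat.Base using (_≤_; _≤′_; ≤′-refl; ≤′-step)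
      open import Data.Nat.Properties using (m≤m⊔n; m≤n⊔m; ≤⇒≤′)
      open import Data.Vec.Base using (map; allFin)
      open import Data.Vec.Properties using (map-lookup-allFin; map-∘)

      -- Conditions are ordered by reverse inclusion.
      infix 4 _≤ᴾ_
      _≤ᴾ_ : M → M → Set
      q ≤ᴾ p = q ∈ P × p ⊆ q

      ≤-refl : ∀ {p} → p ∈ P → p ≤ᴾ p
      ≤-refl p∈ = p∈ , λ z m → m

      ≤-trans : ∀ {p q r} → r ≤ᴾ q → q ≤ᴾ p → r ≤ᴾ p
      ≤-trans (r∈ , a) (_ , b) = r∈ , λ z m → a z (b z m)

      leF : Fm 2
      leF = v0 ∈̇ con P ∧̇ 1F ⊆̇ 0F

      -- A name contains a member y either untagged, unconditionally, or tagged
      -- as ⟨y,⟨T,q⟩⟩, under the condition q.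
      tagged : M → M → M
      tagged y q = ⟨ y , ⟨ T , q ⟩ ⟩

      TaggedF : Fm 1
      TaggedF = ∃̇ (∃̇ (v0 ∈̇ con P ∧̇ v2 ≈̇ ⟨ v1 , ⟨ con T , v0 ⟩ᵗ ⟩ᵗ))

      memF : Fm 3 -- x , p , y
      memF = (v2 ∈̇ v0 ∧̇ ¬̇ sub TaggedF (2F ∷ [])) ∨̇ ∃̇ (v0 ∈̇ con P ∧̇ 0F ⊆̇ 2F ∧̇ ⟨ v3 , ⟨ con T , v0 ⟩ᵗ ⟩ᵗ ∈̇ v1)

      infix 4 _∋[_]_
      opaque
        _∋[_]_ : M → M → M → Set
        x ∋[ p ] y = Sat memF (x ∷ p ∷ y ∷ [])

        instance
          stable-∋ : ∀ {x p y} → Stable (x ∋[ p ] y)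
          stable-∋ {x} {p} {y} = Sat-stable memF (x ∷ p ∷ y ∷ [])

        ∋-def : ∀ {x p y} → x ∋[ p ] y ↔ ((y ∈ x × ¬ Sat TaggedF (y ∷ [])) or ∃ λ q → q ∈ P × q ⊆ p × tagged y q ∈ x)
        ∋-def = ↔-refl

        ∋-cong : ∀ {x x′ p p′ y y′} → x ≈ x′ → p ≈ p′ → y ≈ y′ → x ∋[ p ] y → x′ ∋[ p′ ] y′
        ∋-cong = cong₃ memF

        ∋-ok : ∀ (v : Vec M 3) → lookup v 0F ∋[ lookup v 1F ] lookup v 2F ↔ Sat memF v
        ∋-ok (x ∷ p ∷ y ∷ []) = ↔-refl

      memP : ∀ {n} → Fin n → Fin n → Fin n → Fm n
      memP i j k = prd (λ v → lookup v 0F ∋[ lookup v 1F ] lookup v 2F) memF ∋-ok (i ∷ j ∷ k ∷ [])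

      ∋-mono : ∀ {x p q y} → p ⊆ q → x ∋[ p ] y → x ∋[ q ] y
      ∋-mono h m = proj₂ ∋-def (proj₁ ∋-def m >>¬ λ { (inj₁ a) → η (inj₁ a) ; (inj₂ b) → b >>¬ λ { (r , r∈ , r⊆ , t) → η (inj₂ (η (r , r∈ , (λ z z∈ → h z (r⊆ z z∈)) , t))) } })

      ∋-below : ∀ {x p y} → x ∋[ p ] y → ∀ {t} → Trans t → x ∈ t → y ∈ t
      ∋-below m tr x∈ = proj₁ ∋-def m >>= λ
        { (inj₁ (a , _)) → tr _ x∈ _ a
        ; (inj₂ b) → b >>= λ { (r , _ , _ , t) → fst∈∈ >>= λ { (u , u∈ , m) → tr _ (tr _ (tr _ x∈ _ t) _ u∈) _ m } } }

      name-ind : (φ : Fm 1) → (∀ x → (∀ q v → x ∋[ q ] v → Sat φ (v ∷ [])) → Sat φ (x ∷ [])) → ∀ x → Sat φ (x ∷ [])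
      -- A tagged member v lies in an element of an element of x, so the induction hypothesis is
      -- carried two levels further down.
      name-ind φ step x = proj₁ (∈-ind (φ ∧̇ (∀̇ (v0 ∈̇ v1 ⇒̇ sub φ (0F ∷ [])) ∧̇ ∀̇ (v0 ∈̇ v1 ⇒̇ ∀̇ (v0 ∈̇ v1 ⇒̇ sub φ (0F ∷ [])))))
        (λ x ih → step x (λ q v m → stable {{Sat-stable φ _}} λ n → proj₁ ∋-def m λ
            { (inj₁ (a , _)) → n (proj₁ (ih v a))
            ; (inj₂ b) → b λ { (r , _ , _ , t) → fst∈∈ λ { (u , u∈ , m) → n (proj₂ (proj₂ (ih _ t)) u u∈ v m) } } })
          , (λ y y∈ → proj₁ (ih y y∈)) , λ y y∈ z z∈ → proj₁ (proj₂ (ih y y∈)) z z∈) x)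

      -- Forced equality: the largest bisimulation.

      Sim : (M → M → M → Set) → M → M → M → Set
      Sim R p x y = ∀ q u → q ≤ᴾ p → x ∋[ q ] u → ∃ λ r → ∃ λ v → r ≤ᴾ q × y ∋[ r ] v × R r u v

      bisF : Fm 1
      bisF = ∀̇ (∀̇ (∀̇ (⟨ v2 , ⟨ v1 , v0 ⟩ᵗ ⟩ᵗ ∈̇ v3 ⇒̇ v2 ∈̇ con P ∧̇
        (∀̇ (∀̇ (sub leF (1F ∷ 4F ∷ []) ⇒̇ memP 3F 1F 0F ⇒̇
          ∃̇ (∃̇ (sub leF (1F ∷ 3F ∷ []) ∧̇ memP 4F 1F 0F ∧̇ ⟨ v1 , ⟨ v2 , v0 ⟩ᵗ ⟩ᵗ ∈̇ var 7F))))) ∧̇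
        (∀̇ (∀̇ (sub leF (1F ∷ 4F ∷ []) ⇒̇ memP 2F 1F 0F ⇒̇
          ∃̇ (∃̇ (sub leF (1F ∷ 3F ∷ []) ∧̇ memP 5F 1F 0F ∧̇ ⟨ v1 , ⟨ v0 , v2 ⟩ᵗ ⟩ᵗ ∈̇ var 7F))))))))

      In : M → M → M → M → Set
      In R p x y = ⟨ p , ⟨ x , y ⟩ ⟩ ∈ R

      flip : (M → M → M → Set) → M → M → M → Set
      flip R p x y = R p y x

      Bis : M → Set
      Bis R = ∀ p x y → In R p x y → p ∈ P × Sim (In R) p x y × Sim (flip (In R)) p y x

      EqF : Fm 3
      EqF = ∃̇ (sub bisF (0F ∷ []) ∧̇ ⟨ v1 , ⟨ v2 , v3 ⟩ᵗ ⟩ᵗ ∈̇ v0)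

      opaque
        Eq : M → M → M → Set
        Eq p x y = ∃ λ R → Bis R × In R p x y

        instance
          stable-Eq : ∀ {p x y} → Stable (Eq p x y)
          stable-Eq = stable-Π

        Eq-ok : ∀ (v : Vec M 3) → Eq (lookup v 0F) (lookup v 1F) (lookup v 2F) ↔ Sat EqF v
        Eq-ok (p ∷ x ∷ y ∷ []) = ↔-refl

        eq-cong : ∀ {p p′ x x′ y y′} → p ≈ p′ → x ≈ x′ → y ≈ y′ → Eq p x y → Eq p′ x′ y′
        eq-cong = cong₃ EqF

        -- Coinduction replaces a simultaneous recursion on two names. A definable bisimulation
        -- becomes a set by restricting it to the transitive closure of {x , y}, which is closed
        -- under passing to members of names.
        eq-coind : (φ : Fm 3) → (∀ p x y → Sat φ (p ∷ x ∷ y ∷ []) → p ∈ P ×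
            Sim (λ p x y → Sat φ (p ∷ x ∷ y ∷ [])) p x y × Sim (λ p y x → Sat φ (p ∷ x ∷ y ∷ [])) p y x) →
          ∀ p x y → Sat φ (p ∷ x ∷ y ∷ []) → Eq p x y
        eq-coind φ h p x y s = η (R , (λ p x y m → let ((p∈ , x∈ , y∈) , s) = proj₁ (R∈ p x y) m ; (_ , f , b) = h p x y s in p∈
            , (λ q u q≤ u∈ → f q u q≤ u∈ >>¬ λ { (r , k) → k >>¬ λ { (v , r≤ , v∈ , s) → η (r , η (v , r≤ , v∈ ,
                proj₂ (R∈ r u v) ((proj₁ r≤ , ∋-below u∈ closure-trans x∈ , ∋-below v∈ closure-trans y∈) , s))) } })
            , (λ q u q≤ u∈ → b q u q≤ u∈ >>¬ λ { (r , k) → k >>¬ λ { (v , r≤ , v∈ , s) → η (r , η (v , r≤ , v∈ ,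
                proj₂ (R∈ r v u) ((proj₁ r≤ , ∋-below v∈ closure-trans x∈ , ∋-below u∈ closure-trans y∈) , s))) } }))
          , proj₂ (R∈ p x y) ((proj₁ (h p x y s) , closure-trans _ self∈ x upairˡ , closure-trans _ self∈ y upairʳ) , s))
          where
          open TC (upair x y)
          RF : Fm 1
          RF = ∃̇ (∃̇ (∃̇ (v3 ≈̇ ⟨ v2 , ⟨ v1 , v0 ⟩ᵗ ⟩ᵗ ∧̇ sub φ (2F ∷ 1F ∷ 0F ∷ []))))
          R : M
          R = sep (P ×ˢ (closure ×ˢ closure)) RF
          R∈ : ∀ p x y → In R p x y ↔ ((p ∈ P × x ∈ closure × y ∈ closure) × Sat φ (p ∷ x ∷ y ∷ []))
          R∈ p x y = ↔-trans (∈-sep RF _)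
            ( (λ { (m , s) → let (a , b) = proj₁ pair∈× m ; (b , c) = proj₁ pair∈× b in (a , b , c) , stable {{Sat-stable φ _}} λ n →
                s λ { (p′ , s) → s λ { (x′ , s) → s λ { (y′ , e , s) → let (e₁ , e) = pair-inj e ; (e₂ , e₃) = pair-inj e in
                  n (cong₃ φ (Q-sym e₁) (Q-sym e₂) (Q-sym e₃) s) } } } })
            , (λ { ((a , b , c) , s) → proj₂ pair∈× (a , proj₂ pair∈× (b , c)) , η (p , η (x , η (y , Q-refl , s))) }) )

        eq-P : ∀ {p x y} → Eq p x y → p ∈ P
        eq-P h = h >>= λ { (R , B , m) → proj₁ (B _ _ _ m) }

        eq-fwd : ∀ {p x y} → Eq p x y → Sim Eq p x y
        eq-fwd h q u q≤ u∈ = h >>¬ λ { (R , B , m) → proj₁ (proj₂ (B _ _ _ m)) q u q≤ u∈ >>¬ λ { (r , k) → k >>¬ λ { (v , r≤ , v∈ , m) →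
          η (r , η (v , r≤ , v∈ , η (R , B , m))) } } }

        eq-bwd : ∀ {p x y} → Eq p x y → Sim (flip Eq) p y x
        eq-bwd h q u q≤ u∈ = h >>¬ λ { (R , B , m) → proj₂ (proj₂ (B _ _ _ m)) q u q≤ u∈ >>¬ λ { (r , k) → k >>¬ λ { (v , r≤ , v∈ , m) →
          η (r , η (v , r≤ , v∈ , η (R , B , m))) } } }

      EqP : ∀ {n} → Fin n → Fin n → Fin n → Fm n
      EqP i j k = prd (λ v → Eq (lookup v 0F) (lookup v 1F) (lookup v 2F)) EqF Eq-ok (i ∷ j ∷ k ∷ [])

      eq-refl : ∀ {p x} → p ∈ P → Eq p x x
      eq-refl {p} {x} p∈ = eq-coind (v0 ∈̇ con P ∧̇ v1 ≈̇ v2) (λ p x y → λ { (p∈ , e) → p∈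
          , (λ q u q≤ u∈ → η (q , η (u , ≤-refl (proj₁ q≤) , ∋-cong e Q-refl Q-refl u∈ , proj₁ q≤ , Q-refl)))
          , (λ q u q≤ u∈ → η (q , η (u , ≤-refl (proj₁ q≤) , ∋-cong (Q-sym e) Q-refl Q-refl u∈ , proj₁ q≤ , Q-refl))) }) p x x (p∈ , Q-refl)

      eq-sym : ∀ {p x y} → Eq p x y → Eq p y x
      eq-sym {p} {x} {y} = eq-coind (EqP 0F 2F 1F) (λ p x y h → eq-P h , eq-bwd h , eq-fwd h) p y x

      eq-mono : ∀ {p q x y} → q ≤ᴾ p → Eq p x y → Eq q x y
      eq-mono {p} {q} {x} {y} q≤ h = eq-coind (v0 ∈̇ con P ∧̇ ∃̇ (1F ⊇̇ 0F ∧̇ EqP 0F 2F 3F)) (λ p x y → λ { (p∈ , k) → p∈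
          , (λ q u q≤ u∈ → k >>¬ λ { (p′ , le , e) → eq-fwd e q u (≤-trans q≤ (p∈ , le)) u∈ >>¬ λ { (r , k) → k >>¬ λ { (v , r≤ , v∈ , e) → η (r , η (v , r≤ , v∈ , proj₁ r≤ , η (r , (λ z m → m) , e))) } } })
          , (λ q u q≤ u∈ → k >>¬ λ { (p′ , le , e) → eq-bwd e q u (≤-trans q≤ (p∈ , le)) u∈ >>¬ λ { (r , k) → k >>¬ λ { (v , r≤ , v∈ , e) → η (r , η (v , r≤ , v∈ , proj₁ r≤ , η (r , (λ z m → m) , e))) } } }) })
        q x y (proj₁ q≤ , η (p , proj₂ q≤ , h))
        where
        _⊇̇_ : ∀ {n} → Fin n → Fin n → Fm n
        s ⊇̇ t = t ⊆̇ s

      eq-trans : ∀ {p x y z} → Eq p x y → Eq p y z → Eq p x z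
      eq-trans {p} {x} {y} {z} h k = eq-coind (∃̇ (EqP 1F 2F 0F ∧̇ EqP 1F 0F 3F)) (λ p x z s → (s >>= λ { (y , h , _) → eq-P h })
          , (λ q u q≤ u∈ → s >>¬ λ { (y , h , k) → eq-fwd h q u q≤ u∈ >>¬ λ { (r , m) → m >>¬ λ { (v , r≤ , v∈ , e) →
              eq-fwd k r v (≤-trans r≤ q≤) v∈ >>¬ λ { (r′ , m) → m >>¬ λ { (w , r′≤ , w∈ , e′) → η (r′ , η (w , ≤-trans r′≤ r≤ , w∈ , η (v , eq-mono r′≤ e , e′))) } } } } })
          , (λ q u q≤ u∈ → s >>¬ λ { (y , h , k) → eq-bwd k q u q≤ u∈ >>¬ λ { (r , m) → m >>¬ λ { (v , r≤ , v∈ , e) →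
              eq-bwd h r v (≤-trans r≤ q≤) v∈ >>¬ λ { (r′ , m) → m >>¬ λ { (w , r′≤ , w∈ , e′) → η (r′ , η (w , ≤-trans r′≤ r≤ , w∈ , η (v , e′ , eq-mono r′≤ e))) } } } } }))
        p x z (η (y , h , k))

      eq-intro : ∀ {p x y} → p ∈ P → Sim Eq p x y → Sim Eq p y x → Eq p x y
      eq-intro {p} {x} {y} p∈ f b = eq-coind (EqP 0F 1F 2F ∨̇ (v0 ∈̇ con P ∧̇ (∀̇ (v0 ∈̇ con p ⇒̇ v0 ∈̇ v1)) ∧̇ v1 ≈̇ con x ∧̇ v2 ≈̇ con y))
        (λ p′ x′ y′ s →
          (s >>= λ { (inj₁ e) → eq-P e ; (inj₂ (p∈ , _)) → p∈ })
          , (λ q u q≤ u∈ → s >>¬ λ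
            { (inj₁ e) → inl (eq-fwd e q u q≤ u∈)
            ; (inj₂ (p∈ , le , e , e′)) → f q u (≤-trans q≤ (p∈ , le)) (∋-cong e Q-refl Q-refl u∈) >>¬ λ { (r , k) → k >>¬ λ { (v , r≤ , v∈ , h) →
                η (r , η (v , r≤ , ∋-cong (Q-sym e′) Q-refl Q-refl v∈ , η (inj₁ h))) } } })
          , (λ q u q≤ u∈ → s >>¬ λ
            { (inj₁ e) → inl (eq-bwd e q u q≤ u∈)
            ; (inj₂ (p∈ , le , e , e′)) → b q u (≤-trans q≤ (p∈ , le)) (∋-cong e′ Q-refl Q-refl u∈) >>¬ λ { (r , k) → k >>¬ λ { (v , r≤ , v∈ , h) →
                η (r , η (v , r≤ , ∋-cong (Q-sym e) Q-refl Q-refl v∈ , η (inj₁ (eq-sym h)))) } } }))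
        p x y (η (inj₂ (p∈ , (λ z m → m) , Q-refl , Q-refl)))
        where
        inl : ∀ {q y} {A C : M → M → Set} → ∃ (λ r → ∃ λ v → r ≤ᴾ q × y ∋[ r ] v × A r v) → ∃ (λ r → ∃ λ v → r ≤ᴾ q × y ∋[ r ] v × (A r v or C r v))
        inl h = h >>¬ λ { (r , k) → k >>¬ λ { (v , r≤ , v∈ , e) → η (r , η (v , r≤ , v∈ , η (inj₁ e))) } }

      eq-dense : ∀ {p x y} → p ∈ P → (∀ q → q ≤ᴾ p → ∃ λ r → r ≤ᴾ q × Eq r x y) → Eq p x y
      eq-dense p∈ h = eq-intro p∈
        (λ q u q≤ u∈ → h q q≤ >>¬ λ { (r , r≤ , e) → eq-fwd e r u (≤-refl (proj₁ r≤)) (∋-mono (proj₂ r≤) u∈) >>¬ λ { (s , k) → k >>¬ λ { (v , s≤ , v∈ , e) → η (s , η (v , ≤-trans s≤ r≤ , v∈ , e)) } } })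
        (λ q u q≤ u∈ → h q q≤ >>¬ λ { (r , r≤ , e) → eq-bwd e r u (≤-refl (proj₁ r≤)) (∋-mono (proj₂ r≤) u∈) >>¬ λ { (s , k) → k >>¬ λ { (v , s≤ , v∈ , e) → η (s , η (v , ≤-trans s≤ r≤ , v∈ , eq-sym e)) } } })

      MbF : Fm 3
      MbF = ∀̇ (sub leF (0F ∷ 1F ∷ []) ⇒̇ ∃̇ (sub leF (0F ∷ 1F ∷ []) ∧̇ ∃̇ (memP 5F 1F 0F ∧̇ EqP 1F 4F 0F)))

      Mb : M → M → M → Set
      Mb p x y = ∀ q → q ≤ᴾ p → ∃ λ r → r ≤ᴾ q × ∃ λ v → y ∋[ r ] v × Eq r x v

      mb-intro : ∀ {p x y v} → p ∈ P → y ∋[ p ] v → Eq p x v → Mb p x y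
      mb-intro p∈ m e q q≤ = η (q , ≤-refl (proj₁ q≤) , η (_ , ∋-mono (proj₂ q≤) m , eq-mono q≤ e))

      mb-cong : ∀ {p x x′ y y′} → Eq p x x′ → Eq p y y′ → Mb p x y → Mb p x′ y′
      mb-cong e e′ m q q≤ = m q q≤ >>¬ λ { (r , r≤ , k) → k >>¬ λ { (v , v∈ , d) →
        eq-fwd e′ r v (≤-trans r≤ q≤) v∈ >>¬ λ { (s , k) → k >>¬ λ { (w , s≤ , w∈ , d′) →
        η (s , ≤-trans s≤ r≤ , η (w , w∈ , eq-trans (eq-sym (eq-mono (≤-trans (≤-trans s≤ r≤) q≤) e)) (eq-trans (eq-mono s≤ d) d′))) } } } }

      -- With only ⇒, ⊥ and all as primitives, density needs to be built into the atoms alone;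
      -- `forces-dense` propagates it to all formulas.
      Forces : ∀ {n} → Formula n → M → Vec M n → Set
      Forces (x D.∈ y) p e = Mb p (lookup e x) (lookup e y)
      Forces (x D.≐ y) p e = Eq p (lookup e x) (lookup e y)
      Forces D.⊥ p e = 𝟘
      Forces (φ D.⇒ ψ) p e = ∀ q → q ≤ᴾ p → Forces φ q e → Forces ψ q e
      Forces (D.all φ) p e = ∀ x → Forces φ p (x ∷ e)

      rest : ∀ n → Vec (Fin (suc (suc n))) n
      rest n = map (λ i → suc (suc i)) (allFin n)

      frc : ∀ {n} → Formula n → Fm (suc n)
      frc (x D.∈ y) = sub MbF (0F ∷ suc x ∷ suc y ∷ [])
      frc (x D.≐ y) = EqP 0F (suc x) (suc y)
      frc D.⊥ = ⊥̇
      frc {n} (φ D.⇒ ψ) = ∀̇ (sub leF (0F ∷ 1F ∷ []) ⇒̇ sub (frc φ) (0F ∷ rest n) ⇒̇ sub (frc ψ) (0F ∷ rest n))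
      frc {n} (D.all φ) = ∀̇ (sub (frc φ) (1F ∷ 0F ∷ rest n))

      rest-env : ∀ {n} x y (e : Vec M n) → map (lookup (x ∷ y ∷ e)) (rest n) ≡ e
      rest-env x y e = trans (sym (map-∘ _ _ (allFin _))) (map-lookup-allFin e)

      frc-spec : ∀ {n} (φ : Formula n) p e → Sat (frc φ) (p ∷ e) ↔ Forces φ p e
      frc-spec (x D.∈ y) p e = ↔-refl
      frc-spec (x D.≐ y) p e = ↔-refl
      frc-spec D.⊥ p e = ↔-refl
      frc-spec (φ D.⇒ ψ) p e = (λ h q q≤ → proj₁ (imp q) (h q q≤)) , (λ h q q≤ → proj₂ (imp q) (h q q≤))
        where
        at : ∀ φ q → Sat (frc φ) (q ∷ map (lookup (q ∷ p ∷ e)) (rest _)) ↔ Forces φ q e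
        at φ q rewrite rest-env q p e = frc-spec φ q e
        imp = λ q → ↔-→ (at φ q) (at ψ q)
      frc-spec (D.all φ) p e = (λ h x → proj₁ (at x) (h x)) , (λ h x → proj₂ (at x) (h x))
        where
        at : ∀ x → Sat (frc φ) (p ∷ x ∷ map (lookup (x ∷ p ∷ e)) (rest _)) ↔ Forces φ p (x ∷ e)
        at x rewrite rest-env x p e = frc-spec φ p (x ∷ e)

      stable-Forces : ∀ {n} (φ : Formula n) p e → Stable (Forces φ p e)
      stable-Forces (x D.∈ y) p e = stable-Π
      stable-Forces (x D.≐ y) p e = stable-Eq
      stable-Forces D.⊥ p e = stable-𝟘
      stable-Forces (φ D.⇒ ψ) p e = stable-Π {{λ {q} → stable-Π {{stable-Π {{stable-Forces ψ q e}}}}}}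
      stable-Forces (D.all φ) p e = stable-Π {{λ {x} → stable-Forces φ p (x ∷ e)}}

      forces-mono : ∀ {n} (φ : Formula n) {p q e} → q ≤ᴾ p → Forces φ p e → Forces φ q e
      forces-mono (x D.∈ y) q≤ h r r≤ = h r (≤-trans r≤ q≤)
      forces-mono (x D.≐ y) q≤ h = eq-mono q≤ h
      forces-mono (φ D.⇒ ψ) q≤ h r r≤ = h r (≤-trans r≤ q≤)
      forces-mono (D.all φ) q≤ h x = forces-mono φ q≤ (h x)

      forces-dense : ∀ {n} (φ : Formula n) {p e} → p ∈ P → (∀ q → q ≤ᴾ p → ∃ λ r → r ≤ᴾ q × Forces φ r e) → Forces φ p e
      forces-dense (x D.∈ y) p∈ h q q≤ = h q q≤ >>¬ λ { (r , r≤ , m) → m r (≤-refl (proj₁ r≤)) >>¬ λ { (s , s≤ , k) → η (s , ≤-trans s≤ r≤ , k) } }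
      forces-dense (x D.≐ y) p∈ h = eq-dense p∈ h
      forces-dense D.⊥ p∈ h = h _ (≤-refl p∈) λ { (_ , _ , z) → z }
      forces-dense (φ D.⇒ ψ) p∈ h q q≤ a = forces-dense ψ (proj₁ q≤) λ r r≤ → h r (≤-trans r≤ q≤) >>¬ λ { (s , s≤ , k) →
        η (s , s≤ , k s (≤-refl (proj₁ s≤)) (forces-mono φ (≤-trans s≤ r≤) a)) }
      forces-dense (D.all φ) p∈ h x = forces-dense φ p∈ λ q q≤ → h q q≤ >>¬ λ { (r , r≤ , k) → η (r , r≤ , k x) }

      -- A generic sequence: the k-th step enters the k-th set if it can.
      stepF : M → M → Fm 1
      stepF p d = v0 ∈̇ con P ∧̇ (∀̇ (v0 ∈̇ con p ⇒̇ v0 ∈̇ v1)) ∧̇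
        (∃̇ (v0 ∈̇ con P ∧̇ (∀̇ (v0 ∈̇ con p ⇒̇ v0 ∈̇ v1)) ∧̇ v0 ∈̇ con d) ⇒̇ v0 ∈̇ con d)

      g : ℕ → M
      g zero = p₀
      g (suc k) = the (stepF (g k) (enum k))

      g∈P : ∀ k → g k ∈ P
      g-step : ∀ k → Sat (stepF (g k) (enum k)) (g (suc k) ∷ [])
      g∈P zero = p₀∈P
      g∈P (suc k) = proj₁ (g-step k)
      g-step k = the-spec (stepF (g k) (enum k)) (cases {A = ∃ λ r → r ∈ P × g k ⊆ r × r ∈ enum k}
        (λ h → h >>¬ λ { (r , r∈ , le , m) → η (r , r∈ , le , λ _ → m) })
        (λ n → η (g k , g∈P k , (λ z m → m) , λ h → ⊥-elim (n h))))

      g-mono : ∀ {k l} → k ≤ l → g l ≤ᴾ g k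
      g-mono {k} le = go (≤⇒≤′ le)
        where
        go : ∀ {l} → k ≤′ l → g l ≤ᴾ g k
        go ≤′-refl = ≤-refl (g∈P k)
        go (≤′-step {l} h) = ≤-trans (g∈P (suc l) , proj₁ (proj₂ (g-step l))) (go h)

      -- The set of conditions satisfying `φ` is `enum k` for some k, and step k enters it unless no
      -- extension of `g k` lies in it.
      generic : (φ : Fm 1) → ¬ ¬ Σ ℕ λ k → Sat φ (g k ∷ []) ⊎ (∀ r → r ≤ᴾ g k → ¬ Sat φ (r ∷ []))
      generic φ with enum-onto (sep P φ)
      ... | k , e = cases {A = ∃ λ r → r ∈ P × g k ⊆ r × r ∈ enum k}
        (λ h → η (suc k , inj₁ (proj₂ (proj₁ (∈-sep φ _) (subst (g (suc k) ∈_) e (proj₂ (proj₂ (g-step k)) h))))))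
        (λ n → η (k , inj₂ λ r r≤ s → n (η (r , proj₁ r≤ , proj₂ r≤ , subst (r ∈_) (sym e) (proj₂ (∈-sep φ r) (proj₁ r≤ , s))))))

      ⊩ : (M → Set) → Set
      ⊩ A = ¬ ¬ Σ ℕ λ k → A (g k)

      infix 4 _∈ᴳ_ _≈ᴳ_
      _∈ᴳ_ _≈ᴳ_ : M → M → Set
      x ∈ᴳ y = ⊩ λ p → Mb p x y
      x ≈ᴳ y = ⊩ λ p → Eq p x y

      ∨l : ∀ k l → g (k ⊔ l) ≤ᴾ g k
      ∨l k l = g-mono (m≤m⊔n k l)
      ∨r : ∀ k l → g (k ⊔ l) ≤ᴾ g l
      ∨r k l = g-mono (m≤n⊔m k l)

      mb-mono : ∀ {p q x y} → q ≤ᴾ p → Mb p x y → Mb q x y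
      mb-mono q≤ h r r≤ = h r (≤-trans r≤ q≤)

      N : Structure
      N = record
        { M = M ; E = _∈ᴳ_ ; Q = _≈ᴳ_
        ; Q-refl = η (0 , eq-refl p₀∈P)
        ; Q-sym = λ h → h >>¬ λ { (k , e) → η (k , eq-sym e) }
        ; Q-trans = λ h h′ → h >>¬ λ { (k , e) → h′ >>¬ λ { (l , e′) → η (k ⊔ l , eq-trans (eq-mono (∨l k l) e) (eq-mono (∨r k l) e′)) } }
        ; E-cong = λ h h′ m → h >>¬ λ { (k , e) → h′ >>¬ λ { (l , e′) → m >>¬ λ { (i , m) → η ((k ⊔ l) ⊔ i ,
            mb-cong (eq-mono (≤-trans (∨l (k ⊔ l) i) (∨l k l)) e) (eq-mono (≤-trans (∨l (k ⊔ l) i) (∨r k l)) e′) (mb-mono (∨r (k ⊔ l) i) m)) } } } }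
      module N = Structure N
      module NS = Semantics N

      generic-forces : ∀ {n} (φ : Formula n) e → ¬ ¬ Σ ℕ λ k → Forces φ (g k) e ⊎ (∀ r → r ≤ᴾ g k → ¬ Forces φ r e)
      generic-forces {n} φ e h = generic φ′ λ
        { (k , inj₁ s) → h (k , inj₁ (proj₁ (spec _) s))
        ; (k , inj₂ n) → h (k , inj₂ λ r r≤ f → n r r≤ (proj₂ (spec r) f)) }
        where
        φ′ : Fm 1
        φ′ = clo (frc φ) e
        spec : ∀ p → Sat φ′ (p ∷ []) ↔ Forces φ p e
        spec p = frc-spec φ p e

      truth : ∀ {n} (φ : Formula n) e → NS.⟦ φ ⟧ e ↔ ⊩ λ p → Forces φ p e
      truth (x D.∈ y) e = ↔-refl
      truth (x D.≐ y) e = ↔-refl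
      truth D.⊥ e = ⊥-elim , λ h → h λ { (_ , z) → z }
      truth (φ D.⇒ ψ) e =
        (λ f n → generic-forces (φ D.⇒ ψ) e λ
          { (k , inj₁ h) → n (k , h)
          ; (k , inj₂ no) → generic-forces φ e λ
            { (l , inj₁ h) → proj₁ (truth ψ e) (f (proj₂ (truth φ e) (η (l , h)))) λ { (i , h′) →
                no (g (k ⊔ i)) (∨l k i) λ q q≤ _ → forces-mono ψ (≤-trans q≤ (∨r k i)) h′ }
            ; (l , inj₂ no′) → no (g (k ⊔ l)) (∨l k l) λ q q≤ h → ⊥-elim (no′ q (≤-trans q≤ (∨r k l)) h) } })
        , λ h a → stable {{NS.stable-⟦⟧ ψ e}} λ n → h λ { (k , h) → proj₁ (truth φ e) a λ { (l , a) →
            n (proj₂ (truth ψ e) (η (k ⊔ l , h (g (k ⊔ l)) (∨l k l) (forces-mono φ (∨r k l) a)))) } }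
      truth (D.all φ) e =
        (λ f n → generic-forces (D.all φ) e λ
          { (k , inj₁ h) → n (k , h)
          -- The conditions considered here exclude some instance: no extension of theirs forces `φ`
          -- at a certain x. The sequence cannot enter this set, as every instance is true. Once no
          -- extension lies in it, each instance is forced densely, hence forced.
          ; (k , inj₂ no) → generic (∃̇ (∀̇ (sub leF (0F ∷ 2F ∷ []) ⇒̇ ¬̇ clo (sub (frc φ) (0F ∷ 1F ∷ map (λ i → suc (suc (suc i))) (allFin _))) e))) λ
            { (l , inj₁ h) → h λ { (x , h) → proj₁ (truth φ (x ∷ e)) (f x) λ { (i , h′) →
                h (g (l ⊔ i)) (∨l l i) (proj₂ (at φ x (g l) (g (l ⊔ i))) (forces-mono φ (∨r l i) h′)) } }
            ; (l , inj₂ no′) → no (g (k ⊔ l)) (∨l k l) λ x → forces-dense φ (g∈P (k ⊔ l)) λ q q≤ → stable λ m →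
                no′ q (≤-trans q≤ (∨r k l)) (η (x , λ r r≤ h → m (η (r , r≤ , proj₁ (at φ x q r) h)))) } })
        , λ h x → proj₂ (truth φ (x ∷ e)) (h >>¬ λ { (k , h) → η (k , h x) })
        where
        at : ∀ φ x p q → Sat (frc φ) (q ∷ x ∷ map (lookup (q ∷ x ∷ p ∷ e)) (map (λ i → suc (suc (suc i))) (allFin _))) ↔ Forces φ q (x ∷ e)
        at φ x p q rewrite trans (sym (map-∘ (lookup (q ∷ x ∷ p ∷ e)) (λ i → suc (suc (suc i))) (allFin _))) (map-lookup-allFin e) = frc-spec φ q (x ∷ e)

    -- Names for sets, and the axioms up to replacement in the extension

    module Extension where
      open import Data.Vec.Base using (map; allFin)
      open import Data.Vec.Properties using (map-lookup-allFin; map-∘)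
      open Forcing public
      open Connectives N public

      cl : M → M
      cl a = TC.closure a

      below-cl : ∀ {a p x} → a ∋[ p ] x → x ∈ cl a
      below-cl {a} m = ∋-below m (TC.closure-trans a) (TC.self∈ a)

      mem⇒ : ∀ {x y} k → y ∋[ g k ] x → x ∈ᴳ y
      mem⇒ k m = η (k , mb-intro (g∈P k) m (eq-refl (g∈P k)))

      mem⇐ : ∀ {x y} → x ∈ᴳ y → ¬ ¬ Σ ℕ λ k → Σ M λ v → y ∋[ g k ] v × Eq (g k) x v
      mem⇐ {x} {y} h n = h λ { (k , m) → generic (∃̇ (lt (con y) (memP 0F 2F 1F) ∧̇ lt (con x) (EqP 2F 0F 1F))) λ
        { (l , inj₁ s) → s λ { (v , a , b) → n (l , v , a , b) }
        ; (l , inj₂ no) → m (g (k ⊔ l)) (∨l k l) λ { (r , r≤ , s) → no r (≤-trans r≤ (∨r k l)) s } } }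

      tags : M → M
      tags Y = Y ×ˢ (sing T ×ˢ P)

      mkF : Fm 2 → Fm 1
      mkF φ = ∃̇ (∃̇ (v2 ≈̇ ⟨ v1 , ⟨ con T , v0 ⟩ᵗ ⟩ᵗ ∧̇ v0 ∈̇ con P ∧̇ sub φ (1F ∷ 0F ∷ [])))

      -- {⟨v,⟨T,p⟩⟩ : v ∈ Y , φ(v,p)}
      opaque
        mk : M → Fm 2 → M
        mk Y φ = sep (tags Y) (mkF φ)

        mk-⊆ : ∀ {Y} φ → mk Y φ ⊆ tags Y
        mk-⊆ φ z m = proj₁ (proj₁ (∈-sep (mkF φ) z) m)

        ∈-mk : ∀ {Y} φ {v p} → tagged v p ∈ mk Y φ ↔ (v ∈ Y × p ∈ P × Sat φ (v ∷ p ∷ []))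
        ∈-mk {Y} φ {v} {p} = ↔-trans (∈-sep (mkF φ) _)
          ( (λ { (m , s) → let (a , b) = proj₁ pair∈× m ; (_ , c) = proj₁ pair∈× b in a , c , (stable {{Sat-stable φ _}} λ n → s λ { (v′ , s) → s λ { (p′ , e , _ , s) →
              let (e₁ , e) = pair-inj e ; (_ , e₂) = pair-inj e in n (cong₂ φ (Q-sym e₁) (Q-sym e₂) s) } }) })
          , (λ { (a , b , s) → proj₂ pair∈× (a , proj₂ pair∈× (proj₂ (∈-sing T) Q-refl , b)) , η (v , η (p , Q-refl , b , s)) }) )

        ∋-mk : ∀ {Y} φ {v q} → mk Y φ ∋[ q ] v ↔ ∃ (λ p → (p ∈ P × p ⊆ q) × v ∈ Y × Sat φ (v ∷ p ∷ []))
        ∋-mk {Y} φ {v} {q} =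
          (λ h → proj₁ ∋-def h >>¬ λ
            { (inj₁ (m , nt)) → proj₂ (proj₁ (∈-sep (mkF φ) v) m) >>= λ { (y , s) → s >>= λ { (p , e , p∈ , _) → ⊥-elim (nt (η (y , η (p , p∈ , e)))) } }
            ; (inj₂ s) → s >>¬ λ { (p , p∈ , le , m) → let (a , _ , b) = proj₁ (∈-mk φ) m in η (p , (p∈ , le) , a , b) } })
          , (λ h → h >>= λ { (p , (p∈ , le) , a , b) → proj₂ ∋-def (η (inj₂ (η (p , p∈ , le , proj₂ (∈-mk φ) (a , p∈ , b))))) })

      mk-intro : ∀ {Y} φ {v p} k → p ∈ P → p ⊆ g k → v ∈ Y → Sat φ (v ∷ p ∷ []) → v ∈ᴳ mk Y φ
      mk-intro φ {p = p} k p∈ le a b = mem⇒ k (proj₂ (∋-mk φ) (η (p , (p∈ , le) , a , b)))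

      mk-elim : ∀ {Y} φ {x} → x ∈ᴳ mk Y φ → ¬ ¬ Σ ℕ λ k → Σ M λ v → Σ M λ p → (g k ≤ᴾ p × p ∈ P) × Eq (g k) x v × v ∈ Y × Sat φ (v ∷ p ∷ [])
      mk-elim φ h n = mem⇐ h λ { (k , v , m , e) → proj₁ (∋-mk φ) m λ { (p , (p∈ , le) , a , b) → n (k , v , p , ((g∈P k , le) , p∈) , e , a , b) } }

      truth⇒ : ∀ {n} (φ : Formula n) {e} → NS.⟦ φ ⟧ e → ⊩ λ p → Forces φ p e
      truth⇒ φ = proj₁ (truth φ _)

      -- Were the sequence to enter the set of conditions at which some member u of x has no partner
      -- in y below, u would belong to x but not to y. So each half of the bisimulation is
      -- eventually settled.
      N-ext : ∀ {x y} → (∀ z → z ∈ᴳ x ↔ z ∈ᴳ y) → x ≈ᴳ y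
      N-ext {x} {y} h n = half x y (λ z → proj₁ (h z)) λ { (k , f) → half y x (λ z → proj₂ (h z)) λ { (l , b) →
        n (k ⊔ l , eq-intro (g∈P (k ⊔ l)) (λ q u q≤ → f q u (≤-trans q≤ (∨l k l))) (λ q u q≤ → b q u (≤-trans q≤ (∨r k l)))) } }
        where
        half : ∀ x y → (∀ z → z ∈ᴳ x → z ∈ᴳ y) → ¬ ¬ Σ ℕ λ k → Sim Eq (g k) x y
        half x y h n = generic (∃̇ (lt (con x) (memP 0F 2F 1F) ∧̇ ∀̇ (∀̇ (sub leF (1F ∷ 3F ∷ []) ⇒̇ lt (con y) (memP 0F 2F 1F) ⇒̇ ¬̇ EqP 1F 2F 0F)))) λ
          { (k , inj₁ s) → s λ { (u , m , bad) → mem⇐ (h u (mem⇒ k m)) λ { (l , v , m′ , e) →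
              bad (g (k ⊔ l)) v (∨l k l) (∋-mono (proj₂ (∨r k l)) m′) (eq-mono (∨r k l) e) } }
          ; (k , inj₂ no) → n (k , λ q u q≤ m → stable λ n′ → no q q≤ (η (u , m , λ r v r≤ m′ e → n′ (η (r , η (v , r≤ , m′ , e)))))) }

      mem⇐′ : ∀ {x y} → x ∈ᴳ y → ¬ ¬ Σ ℕ λ k → Σ M λ v → y ∋[ g k ] v × x ≈ᴳ v
      mem⇐′ h n = mem⇐ h λ { (k , v , m , e) → n (k , v , m , η (k , e)) }

      NS-cong : ∀ {n} (φ : Formula n) {e e′ : Vec M n} → (∀ i → lookup e′ i ≈ᴳ lookup e i) → NS.⟦ φ ⟧ e → NS.⟦ φ ⟧ e′
      NS-cong φ {e} {e′} h s = proj₁ (NS.⟦rename⟧ φ (λ i → i) {e} {e′} h) (proj₂ (NS.⟦rename⟧ φ (λ i → i) {e} {e} λ i → N.Q-refl) s)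

      N-extensionality : NS.⟦ D.extensionality ⟧ []
      N-extensionality y x h = N-ext λ z → proj₁ (⟦⇔⟧ (0F D.∈ 1F) (0F D.∈ 2F) {z ∷ x ∷ y ∷ []}) (h z)

      -- Membership need not be well-founded from outside, so the absence of a minimal element is
      -- turned into a forced statement, and induction on names, which is internal to the ground
      -- model, shows that no condition below forces anything into a.
      N-foundation : NS.⟦ D.foundation ⟧ []
      N-foundation a ne n = truth⇒ ψ {a ∷ []} (λ y y∈ k → n y (proj₂ (⟦∧⟧ (0F D.∈ 1F) (D.Disjoint 0F 1F) {y ∷ a ∷ []})
          (y∈ , λ d → d λ z m → let (p , q) = proj₁ (⟦∧⟧ (0F D.∈ 1F) (0F D.∈ 2F) {z ∷ y ∷ a ∷ []}) m in k z p q)))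
        λ { (k , f) → ne λ x x∈ → x∈ λ { (l , m) → claim k f x (g (k ⊔ l)) (∨l k l) (mb-mono (∨r k l) m) } }
        where
        ψ : Formula 1
        ψ = D.all (0F D.∈ 1F D.⇒ D.~ D.all (0F D.∈ 1F D.⇒ D.~ 0F D.∈ 2F))
        claim : ∀ k → Forces ψ (g k) (a ∷ []) → ∀ x q → q ≤ᴾ g k → ¬ Mb q x a
        claim k f = name-ind (lt (con (g k)) (∀̇ (sub leF (0F ∷ 1F ∷ []) ⇒̇ lt (con a) (¬̇ sub MbF (1F ∷ 3F ∷ 0F ∷ [])))))
          λ x ih q q≤ m → f x q q≤ m q (≤-refl (proj₁ q≤)) λ z r r≤ mzx r′ r′≤ mza →
            mzx r′ r′≤ λ { (s , s≤ , h) → h λ { (v , v∈ , e) →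
              ih s v v∈ s (≤-trans s≤ (≤-trans r′≤ (≤-trans r≤ q≤))) (mb-cong e (eq-refl (proj₁ s≤)) (mb-mono s≤ mza)) } }

      topF : ∀ {n} → Fm n
      topF = ⊥̇ ⇒̇ ⊥̇

      upairᴺ : M → M → M
      upairᴺ x y = mk (upair x y) topF

      ∈-upairᴺ : ∀ {x y} u → u ∈ᴳ upairᴺ x y ↔ (u ≈ᴳ x or u ≈ᴳ y)
      ∈-upairᴺ {x} {y} u =
        (λ h → mk-elim topF h >>= λ { (k , v , p , _ , e , v∈ , _) → proj₁ (∈-upair v) v∈ >>¬ λ
            { (inj₁ d) → η (inj₁ (η (k , eq-trans e (≈⇒Eq k d)))) ; (inj₂ d) → η (inj₂ (η (k , eq-trans e (≈⇒Eq k d)))) } })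
        , (λ h → h >>= λ { (inj₁ e) → N.E-cong (N.Q-sym e) N.Q-refl (mk-intro topF 0 p₀∈P (λ z m → m) upairˡ λ z → z)
                         ; (inj₂ e) → N.E-cong (N.Q-sym e) N.Q-refl (mk-intro topF 0 p₀∈P (λ z m → m) upairʳ λ z → z) })
        where
        ≈⇒Eq : ∀ k {v x} → v ≈ x → Eq (g k) v x
        ≈⇒Eq k e = eq-cong Q-refl Q-refl e (eq-refl (g∈P k))

      N-pairing : NS.⟦ D.pairing ⟧ []
      N-pairing y x n = n (upairᴺ x y) λ u → proj₂ (⟦⇔⟧ (0F D.∈ 1F) (0F D.≐ 2F D.∨ 0F D.≐ 3F) {u ∷ upairᴺ x y ∷ x ∷ y ∷ []})
        (↔-trans (∈-upairᴺ u) (↔-sym (⟦∨⟧ (0F D.≐ 2F) (0F D.≐ 3F) {u ∷ upairᴺ x y ∷ x ∷ y ∷ []})))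

      N-union : NS.⟦ D.union ⟧ []
      N-union a n = n u λ x → proj₂ (⟦⇔⟧ (0F D.∈ 1F) (D.ex∈ 2F (1F D.∈ 0F)) {x ∷ u ∷ a ∷ []}) (↔-trans (to x , from x) (↔-sym (⟦ex∈⟧ 2F (1F D.∈ 0F) {x ∷ u ∷ a ∷ []})))
        where
        φ : Fm 2
        φ = ∃̇ (lt (con a) (memP 0F 3F 1F) ∧̇ memP 0F 2F 1F)
        u = mk (cl a) φ
        to : ∀ x → x ∈ᴳ u → ¬ ¬ Σ M λ y → y ∈ᴳ a × x ∈ᴳ y
        to x h = mk-elim φ h >>¬ λ { (k , v , p , (le , _) , e , _ , s) → s >>¬ λ { (y , m , m′) →
          η (y , mem⇒ k (∋-mono (proj₂ le) m) , η (k , mb-intro (g∈P k) (∋-mono (proj₂ le) m′) e)) } }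
        from : ∀ x → ¬ ¬ (Σ M λ y → y ∈ᴳ a × x ∈ᴳ y) → x ∈ᴳ u
        from x h = h >>= λ { (y , y∈ , x∈) → mem⇐′ y∈ >>= λ { (k , v , m , e) → mem⇐′ (N.E-cong N.Q-refl e x∈) >>= λ { (l , w , m′ , e′) →
          N.E-cong (N.Q-sym e′) N.Q-refl (mk-intro φ (k ⊔ l) (g∈P (k ⊔ l)) (λ z q → q) (∋-below m′ (TC.closure-trans a) (below-cl m))
            (η (v , ∋-mono (proj₂ (∨l k l)) m , ∋-mono (proj₂ (∨r k l)) m′))) } } }

      N-separation : ∀ {n} (φ : Formula (suc (suc n))) → NS.⟦ D.separation φ ⟧ []
      N-separation {n} φ = proj₂ (NS.⟦closure⟧ (D.all (D.ex (D.all body)))) λ e a k → k (b e a) λ x →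
        proj₂ (⟦⇔⟧ (0F D.∈ 1F) (0F D.∈ 2F D.∧ rename (lift 1 suc) φ) {x ∷ b e a ∷ a ∷ e})
          (↔-trans (to e a x , from e a x) (↔-sym (⟦∧⟧ (0F D.∈ 2F) (rename (lift 1 suc) φ) {x ∷ b e a ∷ a ∷ e})))
        where
        body = 0F D.∈ 1F D.⇔ 0F D.∈ 2F D.∧ rename (lift 1 suc) φ
        ψ : Vec M n → M → Fm 2
        ψ e a = lt (con a) (memP 0F 2F 1F) ∧̇ clo (sub (frc φ) (1F ∷ 0F ∷ rest (suc n))) (a ∷ e)
        b : Vec M n → M → M
        b e a = mk (cl a) (ψ e a)
        at : ∀ e a x p → Sat (frc φ) (p ∷ x ∷ map (lookup (x ∷ p ∷ a ∷ e)) (rest (suc n))) ↔ Forces φ p (x ∷ a ∷ e)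
        at e a x p rewrite rest-env x p (a ∷ e) = frc-spec φ p (x ∷ a ∷ e)
        ren : ∀ e a x → NS.⟦ rename (lift 1 suc) φ ⟧ (x ∷ b e a ∷ a ∷ e) ↔ NS.⟦ φ ⟧ (x ∷ a ∷ e)
        ren e a x = NS.⟦rename⟧ φ (lift 1 suc) λ { zero → N.Q-refl ; (suc i) → N.Q-refl }
        to : ∀ e a x → x ∈ᴳ b e a → x ∈ᴳ a × NS.⟦ rename (lift 1 suc) φ ⟧ (x ∷ b e a ∷ a ∷ e)
        to e a x h = stable {{stable-× {{stable-Π}} {{NS.stable-⟦⟧ (rename (lift 1 suc) φ) _}}}} λ k → mk-elim (ψ e a) h λ { (i , v , p , (le , _) , d , _ , m , s) →
          k ( η (i , mb-intro (g∈P i) (∋-mono (proj₂ le) m) d)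
            , proj₂ (ren e a x) (NS-cong φ {v ∷ a ∷ e} (λ { zero → η (i , d) ; (suc j) → N.Q-refl })
                (proj₂ (truth φ _) (η (i , forces-mono φ le (proj₁ (at e a v p) s))))) ) }
        from : ∀ e a x → x ∈ᴳ a × NS.⟦ rename (lift 1 suc) φ ⟧ (x ∷ b e a ∷ a ∷ e) → x ∈ᴳ b e a
        from e a x (x∈ , s) = mem⇐′ x∈ >>= λ { (k , v , m , d) →
          truth⇒ φ {v ∷ a ∷ e} (NS-cong φ {x ∷ a ∷ e} (λ { zero → N.Q-sym d ; (suc j) → N.Q-refl }) (proj₁ (ren e a x) s)) >>= λ { (l , f) →
          N.E-cong (N.Q-sym d) N.Q-refl (mk-intro (ψ e a) (k ⊔ l) (g∈P (k ⊔ l)) (λ z q → q) (below-cl m)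
            (∋-mono (proj₂ (∨l k l)) m , proj₂ (at e a v (g (k ⊔ l))) (forces-mono φ (∨r k l) f))) } }

      -- Collection provides, for every candidate member v and condition p, some y′ with p forcing
      -- φ(v,y′). Functionality in the extension identifies this y′ with the value that is wanted.
      N-replacement : ∀ {n} (φ : Formula (suc (suc (suc n)))) → NS.⟦ D.replacement φ ⟧ []
      N-replacement {n} φ = proj₂ (NS.⟦closure⟧ (D.all (D.all (D.all (D.all∈ 2F (rename (lift 1 suc) φ D.⇒ rename (lift 2 suc) φ D.⇒ 2F D.≐ 1F)))
          D.⇒ D.ex (D.all (0F D.∈ 1F D.⇔ D.ex∈ 2F (rename (lift 2 suc) φ)))))) λ e a fun k →
        collection (χ e a) (cl a ×ˢ P) λ { (Y , hY) →
          k (mk Y (ψ e a)) λ y → proj₂ (⟦⇔⟧ (0F D.∈ 1F) (D.ex∈ 2F (rename (lift 2 suc) φ)) {y ∷ mk Y (ψ e a) ∷ a ∷ e})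
            (↔-trans (to e a Y y , from e a fun Y hY y) (↔-sym (⟦ex∈⟧ 2F (rename (lift 2 suc) φ) {y ∷ mk Y (ψ e a) ∷ a ∷ e}))) }
        where
        χ ψ : Vec M n → M → Fm 2
        χ e a = ∃̇ (∃̇ (v2 ≈̇ ⟨ v1 , v0 ⟩ᵗ ∧̇ clo (sub (frc φ) (0F ∷ 1F ∷ 3F ∷ map (λ i → suc (suc (suc (suc i)))) (allFin (suc n)))) (a ∷ e)))
        ψ e a = ∃̇ (lt (con a) (memP 0F 3F 1F) ∧̇ clo (sub (frc φ) (2F ∷ 0F ∷ 1F ∷ map (λ i → suc (suc (suc i))) (allFin (suc n)))) (a ∷ e))
        atχ : ∀ e a w x y p → Sat (frc φ) (p ∷ x ∷ y ∷ map (lookup (p ∷ x ∷ w ∷ y ∷ a ∷ e)) (map (λ i → suc (suc (suc (suc i)))) (allFin (suc n)))) ↔ Forces φ p (x ∷ y ∷ a ∷ e)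
        atχ e a w x y p rewrite trans (sym (map-∘ (lookup (p ∷ x ∷ w ∷ y ∷ a ∷ e)) (λ i → suc (suc (suc (suc i)))) (allFin _))) (map-lookup-allFin (a ∷ e)) = frc-spec φ p (x ∷ y ∷ a ∷ e)
        atψ : ∀ e a x y p → Sat (frc φ) (p ∷ x ∷ y ∷ map (lookup (x ∷ y ∷ p ∷ a ∷ e)) (map (λ i → suc (suc (suc i))) (allFin (suc n)))) ↔ Forces φ p (x ∷ y ∷ a ∷ e)
        atψ e a x y p rewrite trans (sym (map-∘ (lookup (x ∷ y ∷ p ∷ a ∷ e)) (λ i → suc (suc (suc i))) (allFin _))) (map-lookup-allFin (a ∷ e)) = frc-spec φ p (x ∷ y ∷ a ∷ e)
        ren₁ : ∀ e a x y′ y → NS.⟦ rename (lift 1 suc) φ ⟧ (x ∷ y′ ∷ y ∷ a ∷ e) ↔ NS.⟦ φ ⟧ (x ∷ y ∷ a ∷ e)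
        ren₁ e a x y′ y = NS.⟦rename⟧ φ (lift 1 suc) λ { zero → N.Q-refl ; (suc zero) → N.Q-refl ; (suc (suc i)) → N.Q-refl }
        ren₂ : ∀ e a x y′ y → NS.⟦ rename (lift 2 suc) φ ⟧ (x ∷ y′ ∷ y ∷ a ∷ e) ↔ NS.⟦ φ ⟧ (x ∷ y′ ∷ a ∷ e)
        ren₂ e a x y′ y = NS.⟦rename⟧ φ (lift 2 suc) λ { zero → N.Q-refl ; (suc zero) → N.Q-refl ; (suc (suc i)) → N.Q-refl }
        to : ∀ e a Y y → y ∈ᴳ mk Y (ψ e a) → ¬ ¬ Σ M λ x → x ∈ᴳ a × NS.⟦ rename (lift 2 suc) φ ⟧ (x ∷ y ∷ mk Y (ψ e a) ∷ a ∷ e)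
        to e a Y y h k = mk-elim (ψ e a) h λ { (i , v , p , (le , _) , d , _ , s) → s λ { (x , m , f) →
          k (x , mem⇒ i (∋-mono (proj₂ le) m) , proj₂ (ren₂ e a x y _) (NS-cong φ {x ∷ v ∷ a ∷ e} (λ { zero → N.Q-refl ; (suc zero) → η (i , d) ; (suc (suc j)) → N.Q-refl })
            (proj₂ (truth φ _) (η (i , forces-mono φ le (proj₁ (atψ e a x v p) f)))))) } }
        from : ∀ e a → (∀ y y′ x → x ∈ᴳ a → NS.⟦ rename (lift 1 suc) φ ⟧ (x ∷ y′ ∷ y ∷ a ∷ e) → NS.⟦ rename (lift 2 suc) φ ⟧ (x ∷ y′ ∷ y ∷ a ∷ e) → y ≈ᴳ y′) →
          ∀ Y → (∀ w → w ∈ cl a ×ˢ P → ∃ (λ y → Sat (χ e a) (w ∷ y ∷ [])) → ∃ λ y → y ∈ Y × Sat (χ e a) (w ∷ y ∷ [])) →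
          ∀ y → ¬ ¬ (Σ M λ x → x ∈ᴳ a × NS.⟦ rename (lift 2 suc) φ ⟧ (x ∷ y ∷ mk Y (ψ e a) ∷ a ∷ e)) → y ∈ᴳ mk Y (ψ e a)
        from e a fun Y hY y h = h >>= λ { (x , x∈ , s) → mem⇐′ x∈ >>= λ { (k , v , m , d) →
          let s′ = NS-cong φ {x ∷ y ∷ a ∷ e} {v ∷ y ∷ a ∷ e} (λ { zero → N.Q-sym d ; (suc j) → N.Q-refl }) (proj₁ (ren₂ e a x y _) s) in
          truth⇒ φ s′ >>= λ { (l , f) → let i = k ⊔ l in
          hY ⟨ v , g i ⟩ (proj₂ pair∈× (below-cl m , g∈P i)) (η (y , η (v , η (g i , Q-refl , proj₂ (atχ e a _ v y (g i)) (forces-mono φ (∨r k l) f))))) >>= λ { (y′ , y′∈ , c) →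
          c >>= λ { (v′ , c) → c >>= λ { (p′ , eq , f′) → let (e₁ , e₂) = pair-inj eq in
          let f″ = proj₁ (atψ e a v y′ (g i)) (Sat-cong (frc φ) (env v′ y′ p′ i e₁ e₂) (proj₂ (atχ′ v′ y′ p′) (proj₁ (atχ e a _ v′ y′ p′) f′))) in
          N.E-cong (fun y′ y v (mem⇒ k m) (proj₂ (ren₁ e a v y y′) (proj₂ (truth φ _) (η (i , f″)))) (proj₂ (ren₂ e a v y y′) s′)) N.Q-refl
            (mk-intro (ψ e a) i (g∈P i) (λ z q → q) y′∈ (η (v , ∋-mono (proj₂ (∨l k l)) m , proj₂ (atψ e a v y′ (g i)) f″))) } } } } } }
          where
          atχ′ : ∀ v′ y′ p′ → Sat (frc φ) (p′ ∷ v′ ∷ y′ ∷ a ∷ e) ↔ Forces φ p′ (v′ ∷ y′ ∷ a ∷ e)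
          atχ′ v′ y′ p′ = frc-spec φ p′ (v′ ∷ y′ ∷ a ∷ e)
          env : ∀ {v} v′ y′ p′ i → v ≈ v′ → g i ≈ p′ → (p′ ∷ v′ ∷ y′ ∷ a ∷ e) ≋ lookup (g i ∷ v ∷ y′ ∷ map (lookup (v ∷ y′ ∷ g i ∷ a ∷ e)) (map (λ i → suc (suc (suc i))) (allFin (suc n))))
          env {v} v′ y′ p′ i e₁ e₂ rewrite trans (sym (map-∘ (lookup (v ∷ y′ ∷ g i ∷ a ∷ e)) (λ i → suc (suc (suc i))) (allFin _))) (map-lookup-allFin (a ∷ e)) =
            λ { zero → e₂ ; (suc zero) → e₁ ; (suc (suc j)) → Q-refl }

    -- Power set, infinity and choice in the extension

    module ExtensionZFC where
      open Extension public

      -- A subset z of a is equal to the name made of the pairs v, p with v in the closure of a and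
      -- p forcing v ∈ z, and names of this shape form a set.
      N-powerset : NS.⟦ D.powerset ⟧ []
      N-powerset a k = k b λ z → proj₂ (⟦⇔⟧ (0F D.∈ 1F) (0F D.⊆ 2F) {z ∷ b ∷ a ∷ []}) (to z , from z)
        where
        ψ : Fm 2
        ψ = clo (sub (frc (0F D.⊆ 1F)) (1F ∷ 0F ∷ 2F ∷ [])) (a ∷ [])
        b = mk (𝒫 (tags (cl a))) ψ
        at : ∀ y p → Sat (frc (0F D.⊆ 1F)) (p ∷ y ∷ a ∷ []) ↔ Forces (0F D.⊆ 1F) p (y ∷ a ∷ [])
        at y p = frc-spec (0F D.⊆ 1F) p (y ∷ a ∷ [])
        to : ∀ z → z ∈ᴳ b → ∀ w → w ∈ᴳ z → w ∈ᴳ a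
        to z h w w∈ = mk-elim ψ h >>= λ { (i , v , p , (le , _) , d , _ , s) →
          proj₂ (truth (0F D.⊆ 1F) (v ∷ a ∷ [])) (η (i , forces-mono (0F D.⊆ 1F) {e = v ∷ a ∷ []} le (proj₁ (at v p) s))) w (N.E-cong N.Q-refl (η (i , d)) w∈) }
        from : ∀ z → (∀ w → w ∈ᴳ z → w ∈ᴳ a) → z ∈ᴳ b
        from z h = truth⇒ (0F D.⊆ 1F) {y ∷ a ∷ []} (λ w w∈ → h w (N.E-cong N.Q-refl y≈z w∈)) >>= λ { (i , f) →
          N.E-cong y≈z N.Q-refl (mk-intro ψ i (g∈P i) (λ z q → q) (proj₂ (∈-𝒫 y) (mk-⊆ θ)) (proj₂ (at y (g i)) f)) }
          where
          θ : Fm 2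
          θ = lt (con z) (sub MbF (2F ∷ 1F ∷ 0F ∷ []))
          y = mk (cl a) θ
          y≈z : y ≈ᴳ z
          y≈z = N-ext λ w →
            (λ w∈ → mk-elim θ w∈ >>¬ λ { (i , v , p , (le , _) , d , _ , m) → η (i , mb-cong (eq-sym d) (eq-refl (g∈P i)) (mb-mono le m)) })
            , (λ w∈ → mem⇐′ (h w w∈) >>= λ { (i , v , m , d) → N.E-cong d N.Q-refl w∈ >>= λ { (j , m′) →
                N.E-cong (N.Q-sym d) N.Q-refl (mk-intro θ j (g∈P j) (λ z q → q) (below-cl m) m′) } })

      -- Members of a transitive set not containing the tag T name themselves.
      module Pure (A : M) (A-trans : Trans A) (T∉A : T ∉ A) where

        untagged : ∀ {y q} → tagged y q ∉ A
        untagged m = snd∈∈ λ { (u , u∈ , m′) → fst∈∈ λ { (w , w∈ , m″) → T∉A (A-trans _ (A-trans _ (A-trans _ (A-trans _ m _ u∈) _ m′) _ w∈) _ m″) } }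

        pure-∋ : ∀ {x q v} → x ∈ A → x ∋[ q ] v ↔ v ∈ x
        pure-∋ x∈ = (λ m → proj₁ ∋-def m >>= λ { (inj₁ (m , _)) → m ; (inj₂ s) → s >>= λ { (_ , _ , _ , t) → ⊥-elim (untagged (A-trans _ x∈ _ t)) } })
          , λ m → proj₂ ∋-def (η (inj₁ (m , λ t → t λ { (y , t) → t λ { (q , _ , e) → untagged (∈ˡ e (A-trans _ x∈ _ m)) } })))

        pure-eq : ∀ x y p → x ∈ A → y ∈ A → Eq p x y → x ≈ y
        pure-eq = ∈-ind (∀̇ (∀̇ (v2 ∈̇ con A ⇒̇ v1 ∈̇ con A ⇒̇ EqP 0F 2F 1F ⇒̇ v2 ≈̇ v1))) λ x ih y p x∈ y∈ e → ext⊆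
          (λ u u∈ → eq-fwd e p u (≤-refl (eq-P e)) (proj₂ (pure-∋ x∈) u∈) >>= λ { (r , h) → h >>= λ { (v , r≤ , m , d) →
            let v∈ = proj₁ (pure-∋ y∈) m in ∈ˡ (Q-sym (ih u u∈ v r (A-trans x x∈ u u∈) (A-trans y y∈ v v∈) d)) v∈ } })
          (λ v v∈ → eq-bwd e p v (≤-refl (eq-P e)) (proj₂ (pure-∋ y∈) v∈) >>= λ { (r , h) → h >>= λ { (u , r≤ , m , d) →
            let u∈ = proj₁ (pure-∋ x∈) m in ∈ˡ (ih u u∈ v r (A-trans x x∈ u u∈) (A-trans y y∈ v v∈) d) u∈ } })

        pure-≈ᴳ : ∀ {x y} → x ∈ A → y ∈ A → x ≈ᴳ y ↔ (x ≈ y)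
        pure-≈ᴳ x∈ y∈ = (λ h → h >>= λ { (k , e) → pure-eq _ _ _ x∈ y∈ e }) , (λ e → η (0 , eq-cong Q-refl Q-refl e (eq-refl p₀∈P)))

        pure-∈ᴳ : ∀ {x} → x ∈ A → ∀ z → z ∈ᴳ x ↔ ∃ λ v → v ∈ x × z ≈ᴳ v
        pure-∈ᴳ x∈ z = (λ h → mem⇐′ h >>¬ λ { (k , v , m , e) → η (v , proj₁ (pure-∋ x∈) m , e) })
          , (λ h → h >>= λ { (v , m , e) → N.E-cong (N.Q-sym e) N.Q-refl (mem⇒ 0 (proj₂ (pure-∋ x∈) m)) })

        pure-∈ : ∀ {x y} → x ∈ A → y ∈ A → x ∈ᴳ y ↔ x ∈ y
        pure-∈ x∈ y∈ = (λ h → proj₁ (pure-∈ᴳ y∈ _) h >>= λ { (v , v∈ , e) → ∈ˡ (Q-sym (proj₁ (pure-≈ᴳ x∈ (A-trans _ y∈ _ v∈)) e)) v∈ })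
          , λ m → mem⇒ 0 (proj₂ (pure-∋ y∈) m)

        N-Inductive : ω ∈ A → NS.⟦ D.Inductive 0F ⟧ (ω ∷ [])
        N-Inductive ω∈ = proj₂ (⟦∧⟧ (D.ex∈ 0F (D.IsEmpty 0F)) (D.all∈ 0F (D.ex∈ 1F (D.IsSucc 0F 1F))) {ω ∷ []})
          ( proj₂ (⟦ex∈⟧ 0F (D.IsEmpty 0F) {ω ∷ []}) (η (∅ , in-ω 0∈ω , λ z h → proj₁ (pure-∈ᴳ (ω⊆A 0∈ω) z) h λ { (v , m , _) → ∉∅ m }))
          , λ x x∈ → proj₂ (⟦ex∈⟧ 1F (D.IsSucc 0F 1F) {x ∷ ω ∷ []}) (proj₁ (pure-∈ᴳ ω∈ x) x∈ >>¬ λ { (n , n∈ , e) →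
              η (suc̆ n , in-ω (suc∈ω n∈) , λ u → proj₂ (⟦⇔⟧ (0F D.∈ 1F) (0F D.∈ 2F D.∨ 0F D.≐ 2F) {u ∷ suc̆ n ∷ x ∷ ω ∷ []})
                (↔-trans (is-suc x n n∈ e u) (↔-sym (⟦∨⟧ (0F D.∈ 2F) (0F D.≐ 2F) {u ∷ suc̆ n ∷ x ∷ ω ∷ []})))) }) )
          where
          ω⊆A : ∀ {n} → n ∈ ω → n ∈ A
          ω⊆A m = A-trans ω ω∈ _ m
          in-ω : ∀ {n} → n ∈ ω → n ∈ᴳ ω
          in-ω m = proj₂ (pure-∈ (ω⊆A m) ω∈) m
          is-suc : ∀ x n → n ∈ ω → x ≈ᴳ n → ∀ u → u ∈ᴳ suc̆ n ↔ (u ∈ᴳ x or u ≈ᴳ x)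
          is-suc x n n∈ e u =
            (λ h → proj₁ (pure-∈ᴳ (ω⊆A (suc∈ω n∈)) u) h >>= λ { (v , m , d) → proj₁ (∈-+̂ v) m >>¬ λ
              { (inj₁ v∈) → η (inj₁ (N.E-cong (N.Q-sym d) (N.Q-sym e) (proj₂ (pure-∈ (ω⊆A (ω-down n n∈ v v∈)) (ω⊆A n∈)) v∈)))
              ; (inj₂ v≈) → η (inj₂ (N.Q-trans d (N.Q-trans (proj₂ (pure-≈ᴳ (A-trans _ (ω⊆A (suc∈ω n∈)) v m) (ω⊆A n∈)) v≈) (N.Q-sym e)))) } })
            , (λ h → h >>= λ
              { (inj₁ m) → proj₁ (pure-∈ᴳ (ω⊆A n∈) u) (N.E-cong N.Q-refl e m) >>= λ { (v , v∈ , d) → proj₂ (pure-∈ᴳ (ω⊆A (suc∈ω n∈)) u) (η (v , +̂-old v∈ , d)) }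
              ; (inj₂ d) → proj₂ (pure-∈ᴳ (ω⊆A (suc∈ω n∈)) u) (η (n , +̂-new , N.Q-trans d e)) })

      -- No well-ordering of names is needed. Pairs ⟨z,p⟩ and ⟨z′,p′⟩ are related if every common
      -- extension that forces z and z′ into one member of the family forces z = z′. A maximal
      -- clique, read as a name, thus has at most one element in each member; if it missed some
      -- member, an element of that member could be added to the clique.
      N-choice : NS.⟦ D.choice ⟧ []
      N-choice a hyp = λ k → maximal-clique (λ w _ → rfl w) sm λ { (C , C⊆ , cl , mx) → k (mk Z (cF C)) λ x x∈ → pick C C⊆ cl mx x x∈ }
        where
        Z = cl a
        ρ : Fm 2
        ρ = ∀̇ (∀̇ (∀̇ (∀̇ (∀̇ (∀̇ (var 6F ≈̇ ⟨ v5 , v4 ⟩ᵗ ⇒̇ var 7F ≈̇ ⟨ v3 , v2 ⟩ᵗ ⇒̇ sub leF (1F ∷ 4F ∷ []) ⇒̇ sub leF (1F ∷ 2F ∷ []) ⇒̇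
          lt (con a) (sub MbF (2F ∷ 1F ∷ 0F ∷ [])) ⇒̇ sub MbF (1F ∷ 5F ∷ 0F ∷ []) ⇒̇ sub MbF (1F ∷ 3F ∷ 0F ∷ []) ⇒̇ EqP 1F 5F 3F))))))
        open MaximalClique (Z ×ˢ P) ρ
        rfl : ∀ w → R w w
        rfl w z p z′ p′ r y e e′ r≤ _ _ _ _ = eq-cong Q-refl Q-refl (proj₁ (pair-inj (Q-trans (Q-sym e) e′))) (eq-refl (proj₁ r≤))
        sm : ∀ w w′ → R w w′ → R w′ w
        sm w w′ h z p z′ p′ r y e e′ r≤ r≤′ m₁ m₂ m₃ = eq-sym (h z′ p′ z p r y e′ e r≤′ r≤ m₁ m₃ m₂)
        cF : M → Fm 2
        cF C = ⟨ v0 , v1 ⟩ᵗ ∈̇ con C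
        hyps = proj₁ (⟦∧⟧ (D.all∈ 0F (D.ex (0F D.∈ 1F))) (D.all∈ 0F (D.all∈ 1F (D.~ 0F D.≐ 1F D.⇒ D.Disjoint 0F 1F))) {a ∷ []}) hyp
        dis : ∀ x y z → x ∈ᴳ a → y ∈ᴳ a → z ∈ᴳ x → z ∈ᴳ y → x ≈ᴳ y
        dis x y z x∈ y∈ m m′ = stable λ n → proj₂ hyps y y∈ x x∈ n λ d → d z (proj₂ (⟦∧⟧ (0F D.∈ 1F) (0F D.∈ 2F) {z ∷ x ∷ y ∷ a ∷ []}) (m , m′))
        χ₁ χ₂ : Formula 2
        χ₁ = D.all (0F D.∈ 1F D.⇒ 0F D.∈ 2F D.⇒ D.⊥)
        χ₂ = D.all (D.all (1F D.∈ 3F D.⇒ 0F D.∈ 1F D.⇒ 0F D.∈ 2F D.⇒ 1F D.≐ 2F))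
        module _ (C : M) (C⊆ : C ⊆ Z ×ˢ P) (clq : Clique C) (mx : ∀ w → w ∈ Z ×ˢ P → (∀ w′ → w′ ∈ C → R w w′) → w ∈ C) (x : M) (x∈ : x ∈ᴳ a) where
          c = mk Z (cF C)
          unique : ∀ u u′ → u ∈ᴳ x → u ∈ᴳ c → u′ ∈ᴳ x → u′ ∈ᴳ c → u ≈ᴳ u′
          unique u u′ m h m′ h′ = x∈ >>¬ λ { (i , x∈) → mk-elim (cF C) h >>¬ λ { (k , z , p , (le , _) , e , _ , s) → mk-elim (cF C) h′ >>¬ λ { (l , z′ , p′ , (le′ , _) , e′ , _ , s′) →
            m >>¬ λ { (j , m) → m′ >>¬ λ { (j′ , m′) →
            let b = (i ⊔ k) ⊔ (l ⊔ (j ⊔ j′))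
                b₁ = ∨l (i ⊔ k) (l ⊔ (j ⊔ j′))
                b₂ = ∨r (i ⊔ k) (l ⊔ (j ⊔ j′))
                bi = ≤-trans b₁ (∨l i k)
                bk = ≤-trans b₁ (∨r i k)
                bl = ≤-trans b₂ (∨l l (j ⊔ j′))
                bj = ≤-trans b₂ (≤-trans (∨r l (j ⊔ j′)) (∨l j j′))
                bj′ = ≤-trans b₂ (≤-trans (∨r l (j ⊔ j′)) (∨r j j′))
                E₁ = eq-mono bk e
                E₂ = eq-mono bl e′
            in η (b , eq-trans E₁ (eq-trans (clq _ _ s s′ z p z′ p′ (g b) x Q-refl Q-refl (≤-trans bk le) (≤-trans bl le′) (mb-mono bi x∈)
                 (mb-cong E₁ (eq-refl (g∈P b)) (mb-mono bj m)) (mb-cong E₂ (eq-refl (g∈P b)) (mb-mono bj′ m′))) (eq-sym E₂))) } } } } }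
          exists : ¬ ¬ Σ M λ u → u ∈ᴳ x × u ∈ᴳ c
          exists n = proj₁ hyps x x∈ λ w w∈ → mem⇐′ x∈ λ { (k , y , y∈ , e) → mem⇐′ (N.E-cong N.Q-refl e w∈) λ { (l , z , z∈ , d) →
            let z∈x = N.E-cong d N.Q-refl w∈ in z∈x λ { (i , mz) →
            truth⇒ χ₁ {x ∷ c ∷ []} (λ u m m′ → n (u , m , m′)) λ { (j , f₁) → truth⇒ χ₂ {x ∷ a ∷ []} (λ y z y∈ m m′ → dis y x z y∈ x∈ m m′) λ { (j′ , f₂) →
            let b = i ⊔ (j ⊔ j′)
                bi = ∨l i (j ⊔ j′)
                bj = ≤-trans (∨r i (j ⊔ j′)) (∨l j j′)
                bj′ = ≤-trans (∨r i (j ⊔ j′)) (∨r j j′)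
                z∈Z = ∋-below z∈ (TC.closure-trans a) (below-cl y∈)
                new : ⟨ z , g b ⟩ ∈ C
                new = mx _ (proj₂ pair∈× (z∈Z , g∈P b)) λ w′ w′∈ z₁ p₁ z′ p′ r y′ e₁ e₂ r≤ r≤′ m₁ m₂ m₃ →
                  let (ez , ep) = pair-inj e₁
                      r≤b : r ≤ᴾ g b
                      r≤b = proj₁ r≤ , λ t t∈ → proj₂ r≤ t (∈ʳ ep t∈)
                      r∈ = ≤-refl (proj₁ r≤)
                      y′≈x = f₂ y′ z r (≤-trans r≤b bj′) m₁ r r∈ (mb-cong (eq-cong Q-refl (Q-sym ez) Q-refl (eq-refl (proj₁ r≤)) ⁻) (eq-refl (proj₁ r≤)) m₂) r r∈ (mb-mono (≤-trans r≤b bi) mz)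
                      z′∈c : Mb r z′ c
                      z′∈c = mb-intro (proj₁ r≤) (proj₂ (∋-mk (cF C)) (η (p′ , (proj₂ (proj₁ pair∈× (C⊆ _ (∈ˡ e₂ w′∈))) , proj₂ r≤′) , proj₁ (proj₁ pair∈× (C⊆ _ (∈ˡ e₂ w′∈))) , ∈ˡ e₂ w′∈))) (eq-refl (proj₁ r≤))
                  in ⊥-elim (f₁ z′ r (≤-trans r≤b bj) (mb-cong (eq-refl (proj₁ r≤)) y′≈x m₃) r r∈ z′∈c)
            in n (z , z∈x , mk-intro (cF C) b (g∈P b) (λ t q → q) z∈Z new) } } } } }
            where
            _⁻ : ∀ {r z z₁} → Eq r z z₁ → Eq r z₁ z
            e ⁻ = eq-sym e
          pick : NS.⟦ D.ex (D.all (0F D.∈ 2F D.∧ 0F D.∈ 3F D.⇔ 0F D.≐ 1F)) ⟧ (x ∷ c ∷ a ∷ [])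
          pick k = exists λ { (u , m , h) → k u λ v → proj₂ (⟦⇔⟧ (0F D.∈ 2F D.∧ 0F D.∈ 3F) (0F D.≐ 1F) {v ∷ u ∷ x ∷ c ∷ a ∷ []})
            ( (λ vm → let (m′ , h′) = proj₁ (⟦∧⟧ (0F D.∈ 2F) (0F D.∈ 3F) {v ∷ u ∷ x ∷ c ∷ a ∷ []}) vm in unique v u m′ h′ m h)
            , (λ e → proj₂ (⟦∧⟧ (0F D.∈ 2F) (0F D.∈ 3F) {v ∷ u ∷ x ∷ c ∷ a ∷ []}) (N.E-cong (N.Q-sym e) N.Q-refl m , N.E-cong (N.Q-sym e) N.Q-refl h)) ) }

      N-ZFC : (A : M) → Trans A → T ∉ A → ω ∈ A → ∀ {σ} → ZFC σ → NS.⟦ σ ⟧ []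
      N-ZFC A tr T∉ ω∈ D.extensionality-ax = N-extensionality
      N-ZFC A tr T∉ ω∈ D.foundation-ax = N-foundation
      N-ZFC A tr T∉ ω∈ D.pairing-ax = N-pairing
      N-ZFC A tr T∉ ω∈ D.union-ax = N-union
      N-ZFC A tr T∉ ω∈ D.powerset-ax = N-powerset
      N-ZFC A tr T∉ ω∈ D.infinity-ax = λ n → n ω (Pure.N-Inductive A tr T∉ ω∈)
      N-ZFC A tr T∉ ω∈ D.choice-ax = N-choice
      N-ZFC A tr T∉ ω∈ (D.separation-ax φ) = N-separation φ
      N-ZFC A tr T∉ ω∈ (D.replacement-ax φ) = N-replacement φ

  -- Size bounds by partial surjections

  module Smallness where
    FunctionalF : Fm 1
    FunctionalF = ∀̇ (∀̇ (∀̇ (⟨ v2 , v1 ⟩ᵗ ∈̇ v3 ⇒̇ ⟨ v2 , v0 ⟩ᵗ ∈̇ v3 ⇒̇ v1 ≈̇ v0)))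

    graphF : Fm 2 → Fm 1
    graphF φ = ∃̇ (∃̇ (v2 ≈̇ ⟨ v1 , v0 ⟩ᵗ ∧̇ sub φ (1F ∷ 0F ∷ [])))

    opaque
      graph : M → M → Fm 2 → M
      graph X Y φ = sep (X ×ˢ Y) (graphF φ)

      graph-⊆ : ∀ {X Y} φ → graph X Y φ ⊆ X ×ˢ Y
      graph-⊆ φ z m = proj₁ (proj₁ (∈-sep (graphF φ) z) m)

      ∈-graph : ∀ {X Y} φ {x y} → ⟨ x , y ⟩ ∈ graph X Y φ ↔ ((x ∈ X × y ∈ Y) × Sat φ (x ∷ y ∷ []))
      ∈-graph φ {x} {y} = ↔-trans (∈-sep (graphF φ) _)
        ( (λ { (m , s) → proj₁ pair∈× m , stable {{Sat-stable φ _}} λ n → s λ { (x′ , s) → s λ { (y′ , e , s) →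
            let (e₁ , e₂) = pair-inj e in n (cong₂ φ (Q-sym e₁) (Q-sym e₂) s) } } })
        , (λ { (m , s) → proj₂ pair∈× m , η (x , η (y , Q-refl , s)) }) )

    module SmallDef (K : M) where
      -- A partial function on K whose values cover X. Empty sets need no exception, and images of
      -- small sets are small without choosing preimages.
      SmallF : Fm 1
      SmallF = ∃̇ (sub FunctionalF (0F ∷ []) ∧̇ ∀̇ (v0 ∈̇ v2 ⇒̇ ∃̇ (v0 ∈̇ con K ∧̇ ⟨ v0 , v1 ⟩ᵗ ∈̇ v2)))

      opaque
        IsSmall : M → Set
        IsSmall X = Sat SmallF (X ∷ [])

        instance
          stable-Small : ∀ {X} → Stable (IsSmall X)
          stable-Small {X} = Sat-stable SmallF (X ∷ [])

        small-def : ∀ {X} → IsSmall X ↔ ∃ λ f → Functional f × (∀ x → x ∈ X → ∃ λ k → k ∈ K × ⟨ k , x ⟩ ∈ f)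
        small-def = ↔-refl

        small-ok : ∀ (v : Vec M 1) → IsSmall (lookup v 0F) ↔ Sat SmallF v
        small-ok (X ∷ []) = ↔-refl

        small-≈ : ∀ {X Y} → X ≈ Y → IsSmall X → IsSmall Y
        small-≈ = cong₁ SmallF

      smallP : ∀ {n} → Fin n → Fm n
      smallP i = prd (λ v → IsSmall (lookup v 0F)) SmallF small-ok (i ∷ [])

      small-intro : ∀ {X} f → Functional f → (∀ x → x ∈ X → ∃ λ k → k ∈ K × ⟨ k , x ⟩ ∈ f) → IsSmall X
      small-intro f fun cov = proj₂ small-def (η (f , fun , cov))

      small-⊆ : ∀ {X Y} → X ⊆ Y → IsSmall Y → IsSmall X
      small-⊆ h s = proj₁ small-def s >>= λ { (f , fun , cov) → small-intro f fun λ x x∈ → cov x (h x x∈) }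

      small-self : IsSmall K
      small-self = small-intro (graph K K (v0 ≈̇ v1)) (λ x y y′ m m′ →
          Q-trans (Q-sym (proj₂ (proj₁ (∈-graph (v0 ≈̇ v1)) m))) (proj₂ (proj₁ (∈-graph (v0 ≈̇ v1)) m′)))
        λ x x∈ → η (x , x∈ , proj₂ (∈-graph (v0 ≈̇ v1)) ((x∈ , x∈) , Q-refl))

      small-img : ∀ {X Y} (φ : Fm 2) → IsSmall X → (∀ x y y′ → x ∈ X → Sat φ (x ∷ y ∷ []) → Sat φ (x ∷ y′ ∷ []) → y ≈ y′) →
                  (∀ y → y ∈ Y → ∃ λ x → x ∈ X × Sat φ (x ∷ y ∷ [])) → IsSmall Y
      small-img {X} {Y} φ s fun cov = proj₁ small-def s >>= λ { (f , ffun , fcov) →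
        let ψ : Fm 2
            ψ = ∃̇ (v0 ∈̇ con X ∧̇ ⟨ v1 , v0 ⟩ᵗ ∈̇ con f ∧̇ sub φ (0F ∷ 2F ∷ []))
        in small-intro (graph K Y ψ)
          (λ k y y′ m m′ → proj₂ (proj₁ (∈-graph ψ) m) >>= λ { (x , x∈ , a , b) → proj₂ (proj₁ (∈-graph ψ) m′) >>= λ { (x′ , _ , a′ , b′) →
            fun x y y′ x∈ b (cong₂ φ (ffun k x′ x a′ a) Q-refl b′) } })
          λ y y∈ → cov y y∈ >>¬ λ { (x , x∈ , b) → fcov x x∈ >>¬ λ { (k , k∈ , a) → η (k , k∈ , proj₂ (∈-graph ψ) ((k∈ , y∈) , η (x , x∈ , a , b))) } } }

    -- K is mapped onto K × K by the relation π.
    module Small (K : M) (π : Fm 3)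
      (π-fun : ∀ k x y x′ y′ → Sat π (k ∷ x ∷ y ∷ []) → Sat π (k ∷ x′ ∷ y′ ∷ []) → x ≈ x′ × y ≈ y′)
      (π-onto : ∀ x y → x ∈ K → y ∈ K → ∃ λ k → k ∈ K × Sat π (k ∷ x ∷ y ∷ []))
      (k₀ k₁ : M) (k₀∈ : k₀ ∈ K) (k₁∈ : k₁ ∈ K) (k₀≢k₁ : ¬ k₀ ≈ k₁) where

      open SmallDef K public

      small-upair : ∀ {x y} → IsSmall (upair x y)
      small-upair {x} {y} = small-intro (graph K (upair x y) ψ)
        (λ k u u′ m m′ → proj₂ (proj₁ (∈-graph ψ) m) >>= λ
          { (inj₁ (a , b)) → proj₂ (proj₁ (∈-graph ψ) m′) >>= λ { (inj₁ (_ , b′)) → Q-trans b (Q-sym b′) ; (inj₂ (a′ , _)) → ⊥-elim (k₀≢k₁ (Q-trans (Q-sym a) a′)) }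
          ; (inj₂ (a , b)) → proj₂ (proj₁ (∈-graph ψ) m′) >>= λ { (inj₂ (_ , b′)) → Q-trans b (Q-sym b′) ; (inj₁ (a′ , _)) → ⊥-elim (k₀≢k₁ (Q-trans (Q-sym a′) a)) } })
        λ u u∈ → proj₁ (∈-upair u) u∈ >>¬ λ
          { (inj₁ e) → η (k₀ , k₀∈ , proj₂ (∈-graph ψ) ((k₀∈ , u∈) , η (inj₁ (Q-refl , e))))
          ; (inj₂ e) → η (k₁ , k₁∈ , proj₂ (∈-graph ψ) ((k₁∈ , u∈) , η (inj₂ (Q-refl , e)))) }
        where
        ψ : Fm 2
        ψ = (v0 ≈̇ con k₀ ∧̇ v1 ≈̇ con x) ∨̇ (v0 ≈̇ con k₁ ∧̇ v1 ≈̇ con y)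

      small-sing : ∀ {x} → IsSmall (sing x)
      small-sing {x} = small-⊆ (λ z m → ∈ˡ (Q-sym (proj₁ (∈-sing z) m)) upairˡ) (small-upair {x} {x})

      small-⋃ : ∀ {X Y} (φ : Fm 2) → IsSmall X → (∀ x → x ∈ X → IsSmall (sep Y (lt (con x) (sub φ (0F ∷ 1F ∷ []))))) →
                (∀ y → y ∈ Y → ∃ λ x → x ∈ X × Sat φ (x ∷ y ∷ [])) → IsSmall Y
      small-⋃ {X} {Y} φ s each cov = do
        (f , ffun , fcov) ← proj₁ small-def s
        (G , Gfun , Gspec , Gtot) ← choice-function χ X (λ x x∈ → proj₁ small-def (each x x∈) >>¬ λ { (h , hfun , hcov) →
          η (h , hfun , λ y y∈ m → hcov y (proj₂ (∈-sep (lt (con x) (sub φ (0F ∷ 1F ∷ []))) y) (y∈ , m))) })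
        let ψ : Fm 2
            ψ = ∃̇ (∃̇ (∃̇ (∃̇ (sub π (4F ∷ 3F ∷ 2F ∷ []) ∧̇ ⟨ v3 , v1 ⟩ᵗ ∈̇ con f ∧̇ ⟨ v1 , v0 ⟩ᵗ ∈̇ con G ∧̇ ⟨ v2 , v5 ⟩ᵗ ∈̇ v0))))
        small-intro (graph K Y ψ)
          (λ k y y′ m m′ → do
            (a , h) ← proj₂ (proj₁ (∈-graph ψ) m)
            (b , h) ← h
            (x , h) ← h
            (g , p , fx , Gx , gy) ← h
            (a′ , h) ← proj₂ (proj₁ (∈-graph ψ) m′)
            (b′ , h) ← h
            (x′ , h) ← h
            (g′ , p′ , fx′ , Gx′ , gy′) ← h
            let (ea , eb) = π-fun k a b a′ b′ p p′
            let ex = ffun a x x′ fx (∈ˡ (pair-cong (Q-sym ea) Q-refl) fx′)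
            let eg = Gfun x g g′ Gx (∈ˡ (pair-cong (Q-sym ex) Q-refl) Gx′)
            proj₁ (proj₂ (Gspec x g Gx)) b y y′ gy (∈ʳ (Q-sym eg) (∈ˡ (pair-cong (Q-sym eb) Q-refl) gy′)))
          λ y y∈ → do
            (x , x∈ , s) ← cov y y∈
            (a , a∈ , fx) ← fcov x x∈
            (g , Gx) ← Gtot x x∈
            (b , b∈ , gy) ← proj₂ (proj₂ (Gspec x g Gx)) y y∈ s
            (k , k∈ , p) ← π-onto a b a∈ b∈
            η (k , k∈ , proj₂ (∈-graph ψ) ((k∈ , y∈) , η (a , η (b , η (x , η (g , p , fx , Gx , gy))))))
        where
        χ : Fm 2
        χ = sub FunctionalF (1F ∷ []) ∧̇ ∀̇ (v0 ∈̇ con Y ⇒̇ sub φ (1F ∷ 0F ∷ []) ⇒̇ ∃̇ (v0 ∈̇ con K ∧̇ ⟨ v0 , v1 ⟩ᵗ ∈̇ v3))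

      small-⋃′ : ∀ {X} → IsSmall X → (∀ x → x ∈ X → IsSmall x) → IsSmall (⋃ X)
      small-⋃′ {X} s each = small-⋃ (v1 ∈̇ v0) s
        (λ x x∈ → small-⊆ (λ z m → proj₂ (proj₁ (∈-sep (lt (con x) (sub (v1 ∈̇ v0) (0F ∷ 1F ∷ []))) z) m)) (each x x∈))
        λ y y∈ → proj₁ (∈-⋃ y) y∈

      small-∪ : ∀ {X Y} → IsSmall X → IsSmall Y → IsSmall (X ∪ Y)
      small-∪ {X} {Y} sX sY = small-⊆ (λ z m → ∪-elim m (λ m → proj₂ (∈-⋃ z) (η (X , upairˡ , m))) (λ m → proj₂ (∈-⋃ z) (η (Y , upairʳ , m))))
        (small-⋃′ (small-upair {X} {Y}) λ x x∈ → proj₁ (∈-upair x) x∈ >>= λ { (inj₁ e) → small-≈ (Q-sym e) sX ; (inj₂ e) → small-≈ (Q-sym e) sY })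

      small-∅ : IsSmall ∅
      small-∅ = small-⊆ (λ z m → ⊥-elim (∉∅ m)) (small-sing {∅})

      small-+̂ : ∀ {X x} → IsSmall X → IsSmall (X +̂ x)
      small-+̂ {X} {x} s = small-⊆ (λ z m → proj₁ (∈-+̂ z) m >>= λ { (inj₁ m) → ∪ˡ z m ; (inj₂ e) → ∪ʳ z (proj₂ (∈-sing z) e) }) (small-∪ s (small-sing {x}))

      small-fin : ∀ {p} → Fin′ p → IsSmall p
      small-fin f = fin-ind (smallP 0F) f small-∅ (λ q x _ _ s → small-+̂ s)

  open Smallness

  module Conditions (B : M) (U : Universe B) where

    -- The index set I and the set H of possible coordinates

    module Hereditary where
      open Universe U public

      I : M
      I = 𝒫 B

      n₀ n₁ : M
      n₀ = ∅
      n₁ = suc̆ n₀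

      n₀∈B : n₀ ∈ B
      n₀∈B = ω⊆ _ 0∈ω
      n₁∈B : n₁ ∈ B
      n₁∈B = ω⊆ _ (suc∈ω 0∈ω)

      ∈⇒≢ : ∀ {x y} → x ∈ y → ¬ x ≈ y
      ∈⇒≢ m e = x∉x (∈ʳ (Q-sym e) m)

      n₀≢n₁ : ¬ n₀ ≈ n₁
      n₀≢n₁ = ∈⇒≢ +̂-new

      module ≤B = Small B (v0 ≈̇ ⟨ v1 , v2 ⟩ᵗ) (λ k x y x′ y′ e e′ → pair-inj (Q-trans (Q-sym e) e′))
        (λ x y x∈ y∈ → η (⟨ x , y ⟩ , pair∈ x∈ y∈ , Q-refl)) n₀ n₁ n₀∈B n₁∈B n₀≢n₁

      -- Two subsets of B are coded into one as a disjoint union, with the marks 0 and 1.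
      πI : Fm 3
      πI = ∀̇ (v0 ∈̇ v2 ⇔̇ v0 ∈̇ con B ∧̇ ⟨ con n₀ , v0 ⟩ᵗ ∈̇ v1) ∧̇ ∀̇ (v0 ∈̇ v3 ⇔̇ v0 ∈̇ con B ∧̇ ⟨ con n₁ , v0 ⟩ᵗ ∈̇ v1)

      πI-onto : ∀ x y → x ∈ I → y ∈ I → ∃ λ k → k ∈ I × Sat πI (k ∷ x ∷ y ∷ [])
      πI-onto x y x∈ y∈ = η (sep B kF , proj₂ (∈-𝒫 _) (λ z m → proj₁ (proj₁ (∈-sep kF z) m)) ,
          (λ b → (λ m → let b∈ = proj₁ (∈-𝒫 x) x∈ b m in b∈ , proj₂ (∈-sep kF _) (pair∈ n₀∈B b∈ , η (b , η (inj₁ (Q-refl , m)))))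
               , λ { (b∈ , m) → proj₂ (proj₁ (∈-sep kF _) m) >>= λ { (b′ , h) → h >>= λ
                   { (inj₁ (e , m)) → ∈ˡ (Q-sym (proj₂ (pair-inj e))) m ; (inj₂ (e , _)) → ⊥-elim (n₀≢n₁ (proj₁ (pair-inj e))) } } }) ,
          (λ b → (λ m → let b∈ = proj₁ (∈-𝒫 y) y∈ b m in b∈ , proj₂ (∈-sep kF _) (pair∈ n₁∈B b∈ , η (b , η (inj₂ (Q-refl , m)))))
               , λ { (b∈ , m) → proj₂ (proj₁ (∈-sep kF _) m) >>= λ { (b′ , h) → h >>= λ
                   { (inj₂ (e , m)) → ∈ˡ (Q-sym (proj₂ (pair-inj e))) m ; (inj₁ (e , _)) → ⊥-elim (n₀≢n₁ (Q-sym (proj₁ (pair-inj e)))) } } }))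
        where
        kF : Fm 1
        kF = ∃̇ ((v1 ≈̇ ⟨ con n₀ , v0 ⟩ᵗ ∧̇ v0 ∈̇ con x) ∨̇ (v1 ≈̇ ⟨ con n₁ , v0 ⟩ᵗ ∧̇ v0 ∈̇ con y))

      B⊆I : B ⊆ I
      B⊆I x x∈ = proj₂ (∈-𝒫 x) (trans′ x x∈)

      module ≤I = Small I πI
        (λ k x y x′ y′ s s′ → ext (λ b → ↔-trans (proj₁ s b) (↔-sym (proj₁ s′ b))) , ext (λ b → ↔-trans (proj₂ s b) (↔-sym (proj₂ s′ b))))
        πI-onto n₀ n₁ (B⊆I _ n₀∈B) (B⊆I _ n₁∈B) n₀≢n₁

      -- Cantor
      I-large : ¬ ≤B.IsSmall I
      I-large s = proj₁ ≤B.small-def s λ { (f , fun , cov) →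
        let dF : Fm 1
            dF = ∃̇ (⟨ v1 , v0 ⟩ᵗ ∈̇ con f ∧̇ ¬̇ v1 ∈̇ v0)
            d = sep B dF
        in cov d (proj₂ (∈-𝒫 d) λ z m → proj₁ (proj₁ (∈-sep dF z) m)) λ { (k , k∈ , m) →
          let k∉d : k ∉ d
              k∉d h = proj₂ (proj₁ (∈-sep dF k) h) λ { (x , m′ , n) → n (∈ʳ (fun k d x m m′) h) }
          in k∉d (proj₂ (∈-sep dF k) (k∈ , η (d , m , k∉d))) } }

      small-B : ≤I.IsSmall B
      small-B = ≤I.small-img (v0 ≈̇ upair-op [ v1 · v1 ]) ≤I.small-self
        (λ x y y′ _ e e′ → ∈-upair-same (∈ʳ (Q-trans (Q-sym e) e′) upairˡ))
        λ b b∈ → η (upair b b , proj₂ (∈-𝒫 _) (λ z m → ∈ˡ (Q-sym (∈-upair-same m)) b∈) , Q-refl)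

      ≤B⇒≤I : ∀ {X} → ≤B.IsSmall X → ≤I.IsSmall X
      ≤B⇒≤I s = proj₁ ≤B.small-def s >>= λ { (f , fun , cov) → ≤I.small-img (⟨ v0 , v1 ⟩ᵗ ∈̇ con f) small-B (λ x y y′ _ → fun x y y′) cov }

      -- The set of sets with a transitive superset of size at most |I|.

      record Coded (t f E d : M) : Set where
        no-eta-equality
        pattern
        constructor coded
        field
          c-trans : Trans t
          c-fun   : Functional f
          c-cov   : ∀ s → s ∈ t → ∃ λ i → i ∈ I × ⟨ i , s ⟩ ∈ f
          c-in    : ∀ i s → ⟨ i , s ⟩ ∈ f → s ∈ t
          c-E     : ∀ i j → ⟨ i , j ⟩ ∈ E ↔ ∃ λ s → ∃ λ s′ → ⟨ i , s ⟩ ∈ f × ⟨ j , s′ ⟩ ∈ f × s ∈ s′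
          c-d     : ∀ i → i ∈ d ↔ ∃ λ s → ⟨ i , s ⟩ ∈ f
      open Coded

      codedF : Fm 4
      codedF = ∀̇ (v0 ∈̇ v1 ⇒̇ 0F ⊆̇ 1F) ∧̇ sub FunctionalF (1F ∷ []) ∧̇ ∀̇ (v0 ∈̇ v1 ⇒̇ ∃̇ (v0 ∈̇ con I ∧̇ ⟨ v0 , v1 ⟩ᵗ ∈̇ v3)) ∧̇
        ∀̇ (∀̇ (⟨ v1 , v0 ⟩ᵗ ∈̇ v3 ⇒̇ v0 ∈̇ v2)) ∧̇
        ∀̇ (∀̇ (⟨ v1 , v0 ⟩ᵗ ∈̇ v4 ⇔̇ ∃̇ (∃̇ (⟨ v3 , v1 ⟩ᵗ ∈̇ v5 ∧̇ ⟨ v2 , v0 ⟩ᵗ ∈̇ v5 ∧̇ v1 ∈̇ v0)))) ∧̇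
        ∀̇ (v0 ∈̇ v4 ⇔̇ ∃̇ (⟨ v1 , v0 ⟩ᵗ ∈̇ v3))

      coded-spec : ∀ {t f E d} → Sat codedF (t ∷ f ∷ E ∷ d ∷ []) ↔ Coded t f E d
      coded-spec = (λ { (a , b , c , d , e , f) → coded a b c d e f }) , λ { (coded a b c d e f) → a , b , c , d , e , f }

      -- Uniqueness of the Mostowski collapse, by ∈-induction: two decodings of one relation agree.
      -- Decoding is therefore functional, and replacement over the set of relations on subsets of
      -- `I` collects all the decoded sets into `H`.
      coded-unique : ∀ {t f t′ f′ E d E′ d′} → E ≈ E′ → d ≈ d′ → Coded t f E d → Coded t′ f′ E′ d′ → ∀ s i → ⟨ i , s ⟩ ∈ f → ⟨ i , s ⟩ ∈ f′
      coded-unique {t} {f} {t′} {f′} {E} {d} {E′} {d′} eE ed C C′ = ∈-ind (∀̇ (⟨ v0 , v1 ⟩ᵗ ∈̇ con f ⇒̇ ⟨ v0 , v1 ⟩ᵗ ∈̇ con f′)) λ s ih i m → do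
        (s′ , m′) ← proj₁ (c-d C′ i) (∈ʳ ed (proj₂ (c-d C i) (η (s , m))))
        let s≈s′ : s ≈ s′
            s≈s′ = ext⊆
              (λ z z∈ → do
                (j , _ , mz) ← c-cov C z (c-trans C s (c-in C i s m) z z∈)
                (z′ , h) ← proj₁ (c-E C′ j i) (∈ʳ eE (proj₂ (c-E C j i) (η (z , η (s , mz , m , z∈)))))
                (s″ , a , b , z′∈) ← h
                ∈ˡ (Q-sym (c-fun C′ j z z′ (ih z z∈ j mz) a)) (∈ʳ (c-fun C′ i s″ s′ b m′) z′∈))
              (λ z z∈ → do
                (j , _ , mz) ← c-cov C′ z (c-trans C′ s′ (c-in C′ i s′ m′) z z∈)
                (z₁ , h) ← proj₁ (c-E C j i) (∈ʳ (Q-sym eE) (proj₂ (c-E C′ j i) (η (z , η (s′ , mz , m′ , z∈)))))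
                (s₁ , a , b , z₁∈) ← h
                let z₁∈s = ∈ʳ (c-fun C i s₁ s b m) z₁∈
                ∈ˡ (Q-sym (c-fun C′ j z z₁ mz (ih z₁ z₁∈s j a))) z₁∈s)
        ∈ˡ (pair-cong Q-refl (Q-sym s≈s′)) m′

      decodeF : Fm 2
      decodeF = ∃̇ (∃̇ (∃̇ (∃̇ (∃̇ (var 5F ≈̇ ⟨ v2 , ⟨ v1 , v0 ⟩ᵗ ⟩ᵗ ∧̇ sub codedF (4F ∷ 3F ∷ 2F ∷ 1F ∷ []) ∧̇ ⟨ v0 , var 6F ⟩ᵗ ∈̇ v3)))))

      decode-fun : ∀ w x y → Sat decodeF (w ∷ x ∷ []) → Sat decodeF (w ∷ y ∷ []) → x ≈ y
      decode-fun w x y p q =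
        p >>= λ { (t , p) → p >>= λ { (f , p) → p >>= λ { (E , p) → p >>= λ { (d , p) → p >>= λ { (i , e , c , m) →
        q >>= λ { (t′ , q) → q >>= λ { (f′ , q) → q >>= λ { (E′ , q) → q >>= λ { (d′ , q) → q >>= λ { (i′ , e′ , c′ , m′) →
        let (eE , e″) = pair-inj (Q-trans (Q-sym e) e′) ; (ed , ei) = pair-inj e″ ; C′ = proj₁ coded-spec c′ in
        c-fun C′ i x y (coded-unique eE ed (proj₁ coded-spec c) C′ x i m) (∈ˡ (pair-cong (Q-sym ei) Q-refl) m′) } } } } } } } } } }

      module Encode {t f₀ i x : M} (tr : Trans t) (fun : Functional f₀) (cov : ∀ s → s ∈ t → ∃ λ i → i ∈ I × ⟨ i , s ⟩ ∈ f₀)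
                    (i∈ : i ∈ I) (x∈ : x ∈ t) (m : ⟨ i , x ⟩ ∈ f₀) where
        φ : Fm 2
        φ = ⟨ v0 , v1 ⟩ᵗ ∈̇ con f₀
        f : M
        f = graph I t φ
        f∈ : ∀ {i s} → i ∈ I → s ∈ t → ⟨ i , s ⟩ ∈ f₀ → ⟨ i , s ⟩ ∈ f
        f∈ a b c = proj₂ (∈-graph φ) ((a , b) , c)
        f⇒ : ∀ {i s} → ⟨ i , s ⟩ ∈ f → (i ∈ I × s ∈ t) × ⟨ i , s ⟩ ∈ f₀
        f⇒ = proj₁ (∈-graph φ)
        EF : Fm 2
        EF = ∃̇ (∃̇ (⟨ v2 , v1 ⟩ᵗ ∈̇ con f ∧̇ ⟨ v3 , v0 ⟩ᵗ ∈̇ con f ∧̇ v1 ∈̇ v0))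
        dF : Fm 1
        dF = ∃̇ (⟨ v1 , v0 ⟩ᵗ ∈̇ con f)
        E d : M
        E = graph I I EF
        d = sep I dF

        coded-E : Coded t f E d
        coded-E = coded tr (λ i s s′ a b → fun i s s′ (proj₂ (f⇒ a)) (proj₂ (f⇒ b)))
          (λ s s∈ → cov s s∈ >>¬ λ { (i , i∈ , m) → η (i , i∈ , f∈ i∈ s∈ m) }) (λ i s a → proj₂ (proj₁ (f⇒ a)))
          (λ i j → ↔-trans (∈-graph EF) (proj₂ , λ h → (h >>= λ { (s , h) → h >>= λ { (s′ , a , b , _) → proj₁ (proj₁ (f⇒ a)) , proj₁ (proj₁ (f⇒ b)) } }) , h))
          (λ i → ↔-trans (∈-sep dF i) (proj₂ , λ h → (h >>= λ { (s , a) → proj₁ (proj₁ (f⇒ a)) }) , h))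

        E∈ : ⟨ E , ⟨ d , i ⟩ ⟩ ∈ 𝒫 (I ×ˢ I) ×ˢ (𝒫 I ×ˢ I)
        E∈ = proj₂ pair∈× (proj₂ (∈-𝒫 _) (graph-⊆ EF) , proj₂ pair∈× (proj₂ (∈-𝒫 _) (λ z m → proj₁ (proj₁ (∈-sep dF z) m)) , i∈))

        decodes : Sat decodeF (⟨ E , ⟨ d , i ⟩ ⟩ ∷ x ∷ [])
        decodes ret = ret (t , λ ret → ret (f , λ ret → ret (E , λ ret → ret (d , λ ret → ret (i , Q-refl , proj₂ coded-spec coded-E , f∈ i∈ x∈ m)))))

      opaque
        H : M
        H = repl (𝒫 (I ×ˢ I) ×ˢ (𝒫 I ×ˢ I)) decodeF

        ∈-H : ∀ x → x ∈ H ↔ ∃ λ t → Trans t × x ∈ t × ≤I.IsSmall t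
        ∈-H x = ↔-trans (∈-repl decodeF (λ w x y _ → decode-fun w x y) x) (to , from)
          where
          to : ∃ (λ w → w ∈ 𝒫 (I ×ˢ I) ×ˢ (𝒫 I ×ˢ I) × Sat decodeF (w ∷ x ∷ [])) → ∃ λ t → Trans t × x ∈ t × ≤I.IsSmall t
          to h ret = h λ { (w , _ , p) → p λ { (t , p) → p λ { (f , p) → p λ { (E , p) → p λ { (d , p) → p λ { (i , e , c , m) →
            let C = proj₁ coded-spec c in ret (t , c-trans C , c-in C i x m , ≤I.small-intro f (c-fun C) (c-cov C)) } } } } } }
          from : ∃ (λ t → Trans t × x ∈ t × ≤I.IsSmall t) → ∃ (λ w → w ∈ 𝒫 (I ×ˢ I) ×ˢ (𝒫 I ×ˢ I) × Sat decodeF (w ∷ x ∷ []))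
          from h ret = h λ { (t , tr , x∈ , s) → proj₁ ≤I.small-def s λ { (f₀ , fun , cov) → cov x x∈ λ { (i , i∈ , m) →
            ret (⟨ Encode.E tr fun cov i∈ x∈ m , ⟨ Encode.d tr fun cov i∈ x∈ m , i ⟩ ⟩ , Encode.E∈ tr fun cov i∈ x∈ m , Encode.decodes tr fun cov i∈ x∈ m) } } }

      -- The union of chosen transitive supersets of the members has size at most |I|, and it stays
      -- transitive when S itself is adjoined.
      H-closed : ∀ {S} → S ⊆ H → ≤I.IsSmall S → S ∈ H
      H-closed {S} S⊆ sS = do
        (F , Ffun , Fspec , Ftot) ← choice-function χ S (λ s s∈ → proj₁ (∈-H s) (S⊆ s s∈))
        let φ : Fm 2
            φ = ⟨ v0 , v1 ⟩ᵗ ∈̇ con F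
            R = repl S φ
            R∈ = ∈-repl {S} φ (λ x y y′ _ → Ffun x y y′)
            small-R : ≤I.IsSmall R
            small-R = ≤I.small-img φ sS (λ x y y′ _ → Ffun x y y′) (λ t t∈ → proj₁ (R∈ t) t∈)
            t-ok : ∀ t → t ∈ R → Trans t × ≤I.IsSmall t
            t-ok t t∈ = proj₁ (R∈ t) t∈ >>= λ { (s , s∈ , m) → let (_ , tr , _ , sm) = Fspec s t m in tr , sm }
            S⊆R : S ⊆ ⋃ R
            S⊆R s s∈ = Ftot s s∈ >>= λ { (t , m) → proj₂ (∈-⋃ s) (η (t , proj₂ (R∈ t) (η (s , s∈ , m)) , proj₁ (proj₂ (proj₂ (Fspec s t m))))) }
        proj₂ (∈-H S) (η (⋃ R +̂ S ,
          (λ x x∈ z z∈ → proj₁ (∈-+̂ x) x∈ >>= λ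
            { (inj₁ m) → proj₁ (∈-⋃ x) m >>= λ { (t , t∈ , m) → +̂-old (proj₂ (∈-⋃ z) (η (t , t∈ , proj₁ (t-ok t t∈) x m z z∈))) }
            ; (inj₂ e) → +̂-old (S⊆R z (∈ʳ e z∈)) }) ,
          +̂-new , ≤I.small-+̂ (≤I.small-⋃′ small-R λ t t∈ → proj₂ (t-ok t t∈))))
        where
        χ : Fm 2
        χ = ∀̇ (v0 ∈̇ v2 ⇒̇ 0F ⊆̇ 2F) ∧̇ v0 ∈̇ v1 ∧̇ ≤I.smallP 1F

      H-fin : ∀ {p} → Fin′ p → p ⊆ H → p ∈ H
      H-fin f p⊆ = H-closed p⊆ (≤I.small-fin f)

      H-pair : ∀ {x y} → x ∈ H → y ∈ H → ⟨ x , y ⟩ ∈ H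
      H-pair {x} {y} x∈ y∈ = ∈ˡ (Q-sym pair-def) (up (up x∈ x∈) (up x∈ y∈))
        where
        up : ∀ {x y} → x ∈ H → y ∈ H → upair x y ∈ H
        up x∈ y∈ = H-closed (λ z m → proj₁ (∈-upair z) m >>= λ { (inj₁ e) → ∈ˡ (Q-sym e) x∈ ; (inj₂ e) → ∈ˡ (Q-sym e) y∈ }) ≤I.small-upair

      B⊆H : B ⊆ H
      B⊆H b b∈ = proj₂ (∈-H b) (η (B , trans′ , b∈ , small-B))

      I⊆H : I ⊆ H
      I⊆H i i∈ = H-closed (λ b b∈ → B⊆H b (proj₁ (∈-𝒫 i) i∈ b b∈)) (≤I.small-⊆ (proj₁ (∈-𝒫 i) i∈) small-B)

    -- Conditions, their one-step extensions and amalgamation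

    module Poset where
      open import Relation.Binary.PropositionalEquality using (cong)
      open Hereditary public

      num : ℕ → M
      num zero = ∅
      num (suc k) = suc̆ (num k)

      num-inj : ∀ a b → num a ≈ num b → a ≡ b
      num-inj zero zero e = refl
      num-inj zero (suc b) e = ⊥-elim (suc≢∅ (Q-sym e))
      num-inj (suc a) zero e = ⊥-elim (suc≢∅ e)
      num-inj (suc a) (suc b) e = cong suc (num-inj a b (suc-inj e))

      num∈ω : ∀ k → num k ∈ ω
      num∈ω zero = 0∈ω
      num∈ω (suc k) = suc∈ω (num∈ω k)

      num∈B : ∀ k → num k ∈ B
      num∈B k = ω⊆ _ (num∈ω k)

      atomᵗ : ∀ {n} → ℕ → Tm n → Tm n → Tm n → Tm n
      atomᵗ k c u v = ⟨ ⟨ con (num k) , c ⟩ᵗ , ⟨ u , v ⟩ᵗ ⟩ᵗ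

      opaque
        atom : ℕ → M → M → M → M
        atom k c u v = ⟨ ⟨ num k , c ⟩ , ⟨ u , v ⟩ ⟩

        atom-def : ∀ {k c u v} → atom k c u v ≈ ⟨ ⟨ num k , c ⟩ , ⟨ u , v ⟩ ⟩
        atom-def = Q-refl

        atom-inj : ∀ {a b c c′ u u′ v v′} → atom a c u v ≈ atom b c′ u′ v′ → a ≡ b × c ≈ c′ × u ≈ u′ × v ≈ v′
        atom-inj e = let (e₁ , e₂) = pair-inj e ; (ea , ec) = pair-inj e₁ ; (eu , ev) = pair-inj e₂ in num-inj _ _ ea , ec , eu , ev

        atom-cong : ∀ k {c c′ u u′ v v′} → c ≈ c′ → u ≈ u′ → v ≈ v′ → atom k c u v ≈ atom k c′ u′ v′
        atom-cong k ec eu ev = pair-cong (pair-cong Q-refl ec) (pair-cong eu ev)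

      At : M
      At = B ×ˢ (H ×ˢ H)

      ∅∈H : ∅ ∈ H
      ∅∈H = B⊆H _ (num∈B 0)

      atom∈At : ∀ k {c u v} → c ∈ B → u ∈ H → v ∈ H → atom k c u v ∈ At
      atom∈At k c∈ u∈ v∈ = ∈ˡ (Q-sym atom-def) (proj₂ pair∈× (pair∈ (num∈B k) c∈ , proj₂ pair∈× (u∈ , v∈)))

      -- m ∈ a_i ;  a_i ∩ a_j ⊆ n ;  [t] ⊆ U_k^α ;  i ∉ U_k^α ;  m has label l
      inn : M → M → M
      inn i m = atom 0 m i ∅
      prom pos neg : M → M → M → M
      prom i j n = atom 1 n i j
      pos α k t = atom 2 ⟨ k , t ⟩ α ∅
      neg α k i = atom 3 k α i
      lab : M → M → M
      lab m l = atom 4 ⟨ m , l ⟩ ∅ ∅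

      -- t = ⟨F,s⟩ describes the clopen set of all i with i ∩ F = s
      SatR : M → M → Set
      SatR i t = ∃ λ F → ∃ λ s → t ≈ ⟨ F , s ⟩ × i ∩ F ≈ s

      satF : Fm 2
      satF = ∃̇ (∃̇ (v3 ≈̇ ⟨ v1 , v0 ⟩ᵗ ∧̇ ∩-op [ v2 · v1 ] ≈̇ v0))

      -- `legal` makes α act as a name: a generic filter containing i ∉ U_k^α contains some q with
      -- ⟨i,q⟩ ∈ α. It mentions only subsets of p, so it is inherited by unions of conditions and
      -- needs no forcing relation.
      record Cond (p : M) : Set where
        no-eta-equality
        pattern
        constructor cond
        field
          p-fin : Fin′ p
          p-At  : p ⊆ At
          ad    : ∀ i j m n → inn i m ∈ p → inn j m ∈ p → prom i j n ∈ p → i ≈ j or m ∈ n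
          sep′  : ∀ α k t i → pos α k t ∈ p → neg α k i ∈ p → ¬ SatR i t
          fun   : ∀ m l l′ → lab m l ∈ p → lab m l′ ∈ p → l ≈ l′
          legal : ∀ α k i → neg α k i ∈ p → i ∈ I × ∃ λ q → q ⊆ p × ⟨ i , q ⟩ ∈ α
          dom   : ∀ i m → inn i m ∈ p → i ∈ I × m ∈ ω
      open Cond public

      condF : Fm 1
      condF = finP 0F ∧̇ ∀̇ (v0 ∈̇ v1 ⇒̇ v0 ∈̇ con At) ∧̇
        ∀̇ (∀̇ (∀̇ (∀̇ (atomᵗ 0 v1 v3 (con ∅) ∈̇ v4 ⇒̇ atomᵗ 0 v1 v2 (con ∅) ∈̇ v4 ⇒̇ atomᵗ 1 v0 v3 v2 ∈̇ v4 ⇒̇ v3 ≈̇ v2 ∨̇ v1 ∈̇ v0)))) ∧̇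
        ∀̇ (∀̇ (∀̇ (∀̇ (atomᵗ 2 ⟨ v2 , v1 ⟩ᵗ v3 (con ∅) ∈̇ v4 ⇒̇ atomᵗ 3 v2 v3 v0 ∈̇ v4 ⇒̇ ¬̇ sub satF (0F ∷ 1F ∷ []))))) ∧̇
        ∀̇ (∀̇ (∀̇ (atomᵗ 4 ⟨ v2 , v1 ⟩ᵗ (con ∅) (con ∅) ∈̇ v3 ⇒̇ atomᵗ 4 ⟨ v2 , v0 ⟩ᵗ (con ∅) (con ∅) ∈̇ v3 ⇒̇ v1 ≈̇ v0))) ∧̇
        ∀̇ (∀̇ (∀̇ (atomᵗ 3 v1 v2 v0 ∈̇ v3 ⇒̇ v0 ∈̇ con I ∧̇ ∃̇ (0F ⊆̇ 4F ∧̇ ⟨ v1 , v0 ⟩ᵗ ∈̇ v3)))) ∧̇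
        ∀̇ (∀̇ (atomᵗ 0 v0 v1 (con ∅) ∈̇ v2 ⇒̇ v1 ∈̇ con I ∧̇ v0 ∈̇ con ω))

      opaque
        unfolding atom
        P : M
        P = sep (𝒫 At) condF

        ∈-P : ∀ {p} → p ∈ P ↔ Cond p
        ∈-P {p} = ↔-trans (∈-sep condF p)
          ( (λ { (_ , a , b , c , d , e , f , g) → cond a b c d e f g })
          , (λ { (cond a b c d e f g) → proj₂ (∈-𝒫 p) b , a , b , c , d , e , f , g }) )

      ∅∈P : ∅ ∈ P
      ∅∈P = proj₂ ∈-P (cond fin-∅ (λ z m → ⊥-elim (∉∅ m)) (λ _ _ _ _ m → ⊥-elim (∉∅ m)) (λ _ _ _ _ m → ⊥-elim (∉∅ m)) (λ _ _ _ m → ⊥-elim (∉∅ m)) (λ _ _ _ m → ⊥-elim (∉∅ m)) λ _ _ m → ⊥-elim (∉∅ m))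

      old : ∀ {a b p c u v c′ u′ v′} → ¬ a ≡ b → atom a c u v ∈ p +̂ atom b c′ u′ v′ → atom a c u v ∈ p
      old n m = proj₁ (∈-+̂ _) m >>= λ { (inj₁ m) → m ; (inj₂ e) → ⊥-elim (n (proj₁ (atom-inj e))) }

      new : ∀ {a p c u v c′ u′ v′} → atom a c u v ∈ p +̂ atom a c′ u′ v′ → atom a c u v ∈ p or (c ≈ c′ × u ≈ u′ × v ≈ v′)
      new m = proj₁ (∈-+̂ _) m >>¬ λ { (inj₁ m) → η (inj₁ m) ; (inj₂ e) → η (inj₂ (proj₂ (atom-inj e))) }

      +At : ∀ {p z} → p ⊆ At → z ∈ At → p +̂ z ⊆ At
      +At h z∈ w m = proj₁ (∈-+̂ w) m >>= λ { (inj₁ m) → h w m ; (inj₂ e) → ∈ˡ (Q-sym e) z∈ }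

      legal+ : ∀ {p z α i} → i ∈ I × ∃ (λ q → q ⊆ p × ⟨ i , q ⟩ ∈ α) → i ∈ I × ∃ λ q → q ⊆ p +̂ z × ⟨ i , q ⟩ ∈ α
      legal+ (i∈ , h) = i∈ , (h >>¬ λ { (q , q⊆ , m) → η (q , (λ w w∈ → +̂-old (q⊆ w w∈)) , m) })

      add-in : ∀ {p i m} → Cond p → i ∈ I → m ∈ ω →
               (∀ j n → inn j m ∈ p → prom i j n ∈ p or prom j i n ∈ p → i ≈ j or m ∈ n) → Cond (p +̂ inn i m)
      add-in {p} {i} {m} C i∈ m∈ ok = cond (fin-+̂ (p-fin C)) (+At (p-At C) (atom∈At 0 (ω⊆ m m∈) (I⊆H i i∈) ∅∈H))
        (λ i₁ j₁ m₁ n a b c → let c = old (λ ()) c in new a >>= λ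
          { (inj₁ a) → new b >>= λ
            { (inj₁ b) → ad C i₁ j₁ m₁ n a b c
            ; (inj₂ (em , ej , _)) → ok i₁ n (∈ˡ (atom-cong 0 em Q-refl Q-refl) a) (η (inj₂ (∈ˡ (atom-cong 1 Q-refl Q-refl ej) c))) >>¬ λ
                { (inj₁ e) → η (inj₁ (Q-sym (Q-trans ej e))) ; (inj₂ m∈n) → η (inj₂ (∈ˡ (Q-sym em) m∈n)) } }
          ; (inj₂ (em , ei , _)) → new b >>¬ λ
            { (inj₁ b) → ok j₁ n (∈ˡ (atom-cong 0 em Q-refl Q-refl) b) (η (inj₁ (∈ˡ (atom-cong 1 Q-refl ei Q-refl) c))) >>¬ λ
                { (inj₁ e) → η (inj₁ (Q-trans ei e)) ; (inj₂ m∈n) → η (inj₂ (∈ˡ (Q-sym em) m∈n)) }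
            ; (inj₂ (_ , ej , _)) → η (inj₁ (Q-trans ei (Q-sym ej))) } })
        (λ α k t j a b → sep′ C α k t j (old (λ ()) a) (old (λ ()) b)) (λ m l l′ a b → fun C m l l′ (old (λ ()) a) (old (λ ()) b))
        (λ α k j a → legal+ (legal C α k j (old (λ ()) a)))
        (λ i₁ m₁ a → new a >>= λ { (inj₁ a) → dom C i₁ m₁ a ; (inj₂ (em , ei , _)) → ∈ˡ (Q-sym ei) i∈ , ∈ˡ (Q-sym em) m∈ })

      add-prom : ∀ {p i j n} → Cond p → i ∈ I → j ∈ I → n ∈ ω → (∀ m → inn i m ∈ p → m ∈ n) → Cond (p +̂ prom i j n)
      add-prom {p} {i} {j} {n} C i∈ j∈ n∈ ok = cond (fin-+̂ (p-fin C)) (+At (p-At C) (atom∈At 1 (ω⊆ n n∈) (I⊆H i i∈) (I⊆H j j∈)))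
        (λ i₁ j₁ m₁ n₁ a b c → let a = old (λ ()) a ; b = old (λ ()) b in new c >>¬ λ
          { (inj₁ c) → ad C i₁ j₁ m₁ n₁ a b c
          ; (inj₂ (en , ei , _)) → η (inj₂ (∈ʳ (Q-sym en) (ok m₁ (∈ˡ (atom-cong 0 Q-refl ei Q-refl) a)))) })
        (λ α k t j a b → sep′ C α k t j (old (λ ()) a) (old (λ ()) b)) (λ m l l′ a b → fun C m l l′ (old (λ ()) a) (old (λ ()) b))
        (λ α k j a → legal+ (legal C α k j (old (λ ()) a)))
        (λ i m a → dom C i m (old (λ ()) a))

      sat-cong : ∀ {i i′ t t′} → i ≈ i′ → t ≈ t′ → SatR i t → SatR i′ t′
      sat-cong = cong₂ satF

      add-pos : ∀ {p α k t} → Cond p → α ∈ H → k ∈ ω → t ∈ B → (∀ i → neg α k i ∈ p → ¬ SatR i t) → Cond (p +̂ pos α k t)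
      add-pos {p} {α} {k} {t} C α∈ k∈ t∈ ok = cond (fin-+̂ (p-fin C)) (+At (p-At C) (atom∈At 2 (pair∈ (ω⊆ k k∈) t∈) α∈ ∅∈H))
        (λ i j m n a b c → ad C i j m n (old (λ ()) a) (old (λ ()) b) (old (λ ()) c))
        (λ α₁ k₁ t₁ i a b s → let b = old (λ ()) b in new a λ
          { (inj₁ a) → sep′ C α₁ k₁ t₁ i a b s
          ; (inj₂ (e , eα , _)) → let (ek , et) = pair-inj e in ok i (∈ˡ (atom-cong 3 ek eα Q-refl) b) (sat-cong Q-refl et s) })
        (λ m l l′ a b → fun C m l l′ (old (λ ()) a) (old (λ ()) b)) (λ α k j a → legal+ (legal C α k j (old (λ ()) a)))
        (λ i m a → dom C i m (old (λ ()) a))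

      add-neg : ∀ {p α k i q} → Cond p → α ∈ H → k ∈ ω → i ∈ I → (∀ t → ¬ pos α k t ∈ p) → q ⊆ p → ⟨ i , q ⟩ ∈ α → Cond (p +̂ neg α k i)
      add-neg {p} {α} {k} {i} {q} C α∈ k∈ i∈ ok q⊆ q∈ = cond (fin-+̂ (p-fin C)) (+At (p-At C) (atom∈At 3 (ω⊆ k k∈) α∈ (I⊆H i i∈)))
        (λ i j m n a b c → ad C i j m n (old (λ ()) a) (old (λ ()) b) (old (λ ()) c))
        (λ α₁ k₁ t₁ i₁ a b s → let a = old (λ ()) a in new b λ
          { (inj₁ b) → sep′ C α₁ k₁ t₁ i₁ a b s
          ; (inj₂ (ek , eα , _)) → ok t₁ (∈ˡ (atom-cong 2 (pair-cong ek Q-refl) eα Q-refl) a) })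
        (λ m l l′ a b → fun C m l l′ (old (λ ()) a) (old (λ ()) b))
        (λ α₁ k₁ i₁ a → new a >>= λ
          { (inj₁ a) → legal+ (legal C α₁ k₁ i₁ a)
          ; (inj₂ (ek , eα , ei)) → ∈ˡ (Q-sym ei) i∈ , η (q , (λ w w∈ → +̂-old (q⊆ w w∈)) , ∈ʳ (Q-sym eα) (∈ˡ (pair-cong (Q-sym ei) Q-refl) q∈)) })
        (λ i m a → dom C i m (old (λ ()) a))

      add-lab : ∀ {p m l} → Cond p → m ∈ ω → l ∈ B → (∀ l′ → ¬ lab m l′ ∈ p) → Cond (p +̂ lab m l)
      add-lab {p} {m} {l} C m∈ l∈ ok = cond (fin-+̂ (p-fin C)) (+At (p-At C) (atom∈At 4 (pair∈ (ω⊆ m m∈) l∈) ∅∈H ∅∈H))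
        (λ i j m n a b c → ad C i j m n (old (λ ()) a) (old (λ ()) b) (old (λ ()) c))
        (λ α k t j a b → sep′ C α k t j (old (λ ()) a) (old (λ ()) b))
        (λ m₁ l₁ l₂ a b → new a >>= λ
          { (inj₁ a) → new b >>= λ
            { (inj₁ b) → fun C m₁ l₁ l₂ a b
            ; (inj₂ (e , _)) → ⊥-elim (ok l₁ (∈ˡ (atom-cong 4 (pair-cong (proj₁ (pair-inj e)) Q-refl) Q-refl Q-refl) a)) }
          ; (inj₂ (e , _)) → new b >>= λ
            { (inj₁ b) → ⊥-elim (ok l₂ (∈ˡ (atom-cong 4 (pair-cong (proj₁ (pair-inj e)) Q-refl) Q-refl Q-refl) b))
            ; (inj₂ (e′ , _)) → Q-trans (proj₂ (pair-inj e)) (Q-sym (proj₂ (pair-inj e′))) } })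
        (λ α k j a → legal+ (legal C α k j (old (λ ()) a)))
        (λ i m a → dom C i m (old (λ ()) a))

      add-label : ∀ {p i m l} → Cond p → i ∈ I → m ∈ ω → l ∈ B → (∀ j → ¬ inn j m ∈ p) → (∀ l′ → ¬ lab m l′ ∈ p) → Cond (p +̂ inn i m +̂ lab m l)
      add-label {p} {i} {m} {l} Cp i∈ m∈ l∈ no no′ = add-lab {p +̂ inn i m} {m} {l} (add-in {p} {i} {m} Cp i∈ m∈ λ j k h _ → ⊥-elim (no j h)) m∈ l∈ λ l h → no′ l (old (λ ()) h)

      -- Amalgamation of p with r ⊇ p′, where tw matches the coordinates of p with
      -- those of its twin p′.

      Coord : M → M → Set
      Coord r u = ∃ λ c → ∃ λ v → ⟨ c , ⟨ u , v ⟩ ⟩ ∈ r or ⟨ c , ⟨ v , u ⟩ ⟩ ∈ r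

      -- `tw-root` says that a coordinate occurring in r is not moved, and `tw-near` that twins have
      -- the same trace on the domain F of every clopen set occurring positively in r, so that none
      -- of those sets tells them apart.
      record Twin (p p′ r tw : M) : Set where
        no-eta-equality
        field
          tw-atom : ∀ c u v → ⟨ c , ⟨ u , v ⟩ ⟩ ∈ p → ∃ λ u′ → ∃ λ v′ → ⟨ u , u′ ⟩ ∈ tw × ⟨ v , v′ ⟩ ∈ tw × ⟨ c , ⟨ u′ , v′ ⟩ ⟩ ∈ p′
          tw-fun  : Functional tw
          tw-inj  : ∀ u w u′ → ⟨ u , u′ ⟩ ∈ tw → ⟨ w , u′ ⟩ ∈ tw → u ≈ w
          tw-root : ∀ u u′ → ⟨ u , u′ ⟩ ∈ tw → Coord r u → u ≈ u′
          tw-∅    : ⟨ ∅ , ∅ ⟩ ∈ tw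
          tw-near : ∀ u u′ → ⟨ u , u′ ⟩ ∈ tw → ∀ α k F s → pos α k ⟨ F , s ⟩ ∈ r → u ∩ F ≈ u′ ∩ F

      module Amalgam {p p′ r tw : M} (C : Cond p) (Cr : Cond r) (p′⊆r : p′ ⊆ r) (tn : Twin p p′ r tw) where
        open Twin tn

        Rel : M → M → Set
        Rel u u′ = ⟨ u , u′ ⟩ ∈ tw or (u ≈ u′ × Coord r u)

        coord-≈ : ∀ {u w} → u ≈ w → Coord r u → Coord r w
        coord-≈ e h = h >>= λ { (c , h) → h >>= λ { (v , h) → h >>¬ λ
          { (inj₁ m) → η (c , η (v , η (inj₁ (∈ˡ (pair-cong Q-refl (pair-cong e Q-refl)) m))))
          ; (inj₂ m) → η (c , η (v , η (inj₂ (∈ˡ (pair-cong Q-refl (pair-cong Q-refl e)) m)))) } } }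

        rel-fun : ∀ {u u′ w w′} → Rel u u′ → Rel w w′ → u ≈ w → u′ ≈ w′
        rel-fun a b e = a >>= λ
          { (inj₁ a) → b >>= λ
            { (inj₁ b) → tw-fun _ _ _ a (∈ˡ (pair-cong (Q-sym e) Q-refl) b)
            ; (inj₂ (e′ , c)) → Q-trans (Q-sym (tw-root _ _ a (coord-≈ (Q-sym e) c))) (Q-trans e e′) }
          ; (inj₂ (e′ , c)) → b >>= λ
            { (inj₁ b) → Q-trans (Q-sym e′) (Q-trans e (tw-root _ _ b (coord-≈ e c)))
            ; (inj₂ (e″ , _)) → Q-trans (Q-sym e′) (Q-trans e e″) } }

        image : ∀ c u v → ⟨ c , ⟨ u , v ⟩ ⟩ ∈ r ∪ p → ∃ λ u′ → ∃ λ v′ → ⟨ c , ⟨ u′ , v′ ⟩ ⟩ ∈ r × Rel u u′ × Rel v v′ × (u′ ≈ v′ → u ≈ v)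
        image c u v m = ∪-elim m
          (λ m → η (u , η (v , m , η (inj₂ (Q-refl , η (c , η (v , η (inj₁ m))))) , η (inj₂ (Q-refl , η (c , η (u , η (inj₂ m))))) , λ e → e)))
          (λ m → tw-atom c u v m >>¬ λ { (u′ , h) → h >>¬ λ { (v′ , a , b , m′) →
            η (u′ , η (v′ , p′⊆r _ m′ , η (inj₁ a) , η (inj₁ b) , λ e → tw-inj u v v′ (∈ˡ (pair-cong Q-refl e) a) b)) } })

        near : ∀ {u u′} → Rel u u′ → ∀ α k F s → pos α k ⟨ F , s ⟩ ∈ r → u ∩ F ≈ u′ ∩ F
        near h α k F s m = h >>= λ { (inj₁ a) → tw-near _ _ a α k F s m ; (inj₂ (e , _)) → Op.cong ∩-op e Q-refl }

        opaque
          unfolding atom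
          imageₐ : ∀ {k c u v} → atom k c u v ∈ r ∪ p → ∃ λ u′ → ∃ λ v′ → atom k c u′ v′ ∈ r × Rel u u′ × Rel v v′ × (u′ ≈ v′ → u ≈ v)
          imageₐ m = image _ _ _ m

        image∅ : ∀ {k c u} → atom k c u ∅ ∈ r ∪ p → ∃ λ u′ → atom k c u′ ∅ ∈ r × Rel u u′
        image∅ m = imageₐ m >>¬ λ { (u′ , h) → h >>¬ λ { (v′ , m , ru , rv , _) →
          η (u′ , ∈ˡ (atom-cong _ Q-refl Q-refl (rel-fun rv (η (inj₁ tw-∅)) Q-refl)) m , ru) } }

        -- Every atom of r ∪ p has an image in r, by `tw` on p and by the identity on r, so a clash
        -- in the union is reflected into r. An index kept out of an open set may be moved, but its
        -- trace on F is not; a promise whose indices are identified by the image had equal indices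
        -- from the start. Legality passes to the union directly.
        amalgam : Cond (r ∪ p)
        amalgam = cond (fin-∪ (p-fin Cr) (p-fin C)) (λ z m → ∪-elim m (p-At Cr z) (p-At C z))
          (λ i j m n a b c → do
            (i₁ , a , ri₁) ← image∅ a
            (j₁ , b , rj₁) ← image∅ b
            (i₂ , h) ← imageₐ c
            (j₂ , c , ri₂ , rj₂ , inj) ← h
            inj₁ e ← ad Cr i₂ j₂ m n (∈ˡ (atom-cong 0 Q-refl (rel-fun ri₁ ri₂ Q-refl) Q-refl) a) (∈ˡ (atom-cong 0 Q-refl (rel-fun rj₁ rj₂ Q-refl) Q-refl) b) c
              where inj₂ m → η (inj₂ m)
            η (inj₁ (inj e)))
          (λ α k t i a b s → do
            (α₁ , a , rα₁) ← image∅ a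
            (α₂ , h) ← imageₐ b
            (i₂ , b , rα₂ , ri₂ , _) ← h
            (F , s) ← s
            (x , et , es) ← s
            let a′ = ∈ˡ (atom-cong 2 (pair-cong Q-refl et) (rel-fun rα₁ rα₂ Q-refl) Q-refl) a
            sep′ Cr α₂ k ⟨ F , x ⟩ i₂ a′ b (η (F , η (x , Q-refl , Q-trans (Q-sym (near ri₂ α₂ k F x a′)) es))))
          (λ m l l′ a b → do
            (u , a , ru) ← image∅ a
            (w , b , rw) ← image∅ b
            let e = rel-fun ru (η (inj₁ tw-∅)) Q-refl
            let e′ = rel-fun rw (η (inj₁ tw-∅)) Q-refl
            fun Cr m l l′ (∈ˡ (atom-cong 4 Q-refl e Q-refl) a) (∈ˡ (atom-cong 4 Q-refl e′ Q-refl) b))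
          (λ α k i a → ∪-elim a
            (λ a → let (i∈ , h) = legal Cr α k i a in i∈ , (h >>¬ λ { (q , q⊆ , m) → η (q , (λ w w∈ → ∪ˡ w (q⊆ w w∈)) , m) }))
            (λ a → let (i∈ , h) = legal C α k i a in i∈ , (h >>¬ λ { (q , q⊆ , m) → η (q , (λ w w∈ → ∪ʳ w (q⊆ w w∈)) , m) })))
          (λ i m a → ∪-elim a (dom Cr i m) (dom C i m))

    -- Finite patterns of conditions

    module Patterns where
      open Poset public

      -- Slot ∅ is reserved for the dummy coordinate ∅, which guarantees that twins never move it.
      record Slots (D cf : M) : Set where
        no-eta-equality
        pattern
        constructor slots
        field
          s-fin : Fin′ D
          s-B   : D ⊆ B
          s-fun : Functional cf
          s-inj : ∀ a b u → ⟨ a , u ⟩ ∈ cf → ⟨ b , u ⟩ ∈ cf → a ≈ b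
          s-in  : ∀ a u → ⟨ a , u ⟩ ∈ cf → a ∈ D × u ∈ H
          s-tot : ∀ a → a ∈ D → ∃ λ u → ⟨ a , u ⟩ ∈ cf
          s-∅   : ⟨ ∅ , ∅ ⟩ ∈ cf
      open Slots public

      -- p arises from the finite pattern τ ∈ B by putting the coordinate cf(a)
      -- into each slot a ∈ D.
      record Enum (p D τ cf : M) : Set where
        no-eta-equality
        pattern
        constructor enum
        field
          e-slots : Slots D cf
          t-fin   : Fin′ τ
          t-B     : τ ⊆ B
          t-slot  : ∀ c a b → ⟨ c , ⟨ a , b ⟩ ⟩ ∈ τ → a ∈ D × b ∈ D
          t-p     : ∀ c u v → ⟨ c , ⟨ u , v ⟩ ⟩ ∈ p ↔ ∃ λ a → ∃ λ b → ⟨ c , ⟨ a , b ⟩ ⟩ ∈ τ × ⟨ a , u ⟩ ∈ cf × ⟨ b , v ⟩ ∈ cf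
      open Enum public

      enumF : Fm 4 -- p , D , τ , cf
      enumF = (finP 1F ∧̇ ∀̇ (v0 ∈̇ v2 ⇒̇ v0 ∈̇ con B) ∧̇ sub FunctionalF (3F ∷ []) ∧̇
          ∀̇ (∀̇ (∀̇ (⟨ v2 , v0 ⟩ᵗ ∈̇ var 6F ⇒̇ ⟨ v1 , v0 ⟩ᵗ ∈̇ var 6F ⇒̇ v2 ≈̇ v1))) ∧̇
          ∀̇ (∀̇ (⟨ v1 , v0 ⟩ᵗ ∈̇ v5 ⇒̇ v1 ∈̇ v3 ∧̇ v0 ∈̇ con H)) ∧̇
          ∀̇ (v0 ∈̇ v2 ⇒̇ ∃̇ (⟨ v1 , v0 ⟩ᵗ ∈̇ v5)) ∧̇ ⟨ con ∅ , con ∅ ⟩ᵗ ∈̇ v3) ∧̇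
        finP 2F ∧̇ ∀̇ (v0 ∈̇ v3 ⇒̇ v0 ∈̇ con B) ∧̇
        ∀̇ (∀̇ (∀̇ (⟨ v2 , ⟨ v1 , v0 ⟩ᵗ ⟩ᵗ ∈̇ v5 ⇒̇ v1 ∈̇ v4 ∧̇ v0 ∈̇ v4))) ∧̇
        ∀̇ (∀̇ (∀̇ (⟨ v2 , ⟨ v1 , v0 ⟩ᵗ ⟩ᵗ ∈̇ v3 ⇔̇ ∃̇ (∃̇ (⟨ v4 , ⟨ v1 , v0 ⟩ᵗ ⟩ᵗ ∈̇ var 7F ∧̇ ⟨ v1 , v3 ⟩ᵗ ∈̇ var 8F ∧̇ ⟨ v0 , v2 ⟩ᵗ ∈̇ var 8F)))))
        where open import Data.Fin.Patterns using (8F)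

      enum-ok : ∀ (v : Vec M 4) → Enum (lookup v 0F) (lookup v 1F) (lookup v 2F) (lookup v 3F) ↔ Sat enumF v
      enum-ok (p ∷ D ∷ τ ∷ cf ∷ []) =
        (λ { (enum (slots a b c d e f g) h i j k) → (a , b , c , d , e , f , g) , h , i , j , k })
        , λ { ((a , b , c , d , e , f , g) , h , i , j , k) → enum (slots a b c d e f g) h i j k }

      enumP : ∀ {n} → Fin n → Fin n → Fin n → Fin n → Fm n
      enumP i j k l = prd (λ v → Enum (lookup v 0F) (lookup v 1F) (lookup v 2F) (lookup v 3F)) enumF enum-ok (i ∷ j ∷ k ∷ l ∷ [])

      insert : ∀ {D cf u} → Slots D cf → u ∈ H → ∃ λ D′ → ∃ λ cf′ → ∃ λ a → Slots D′ cf′ × D ⊆ D′ × cf ⊆ cf′ × ⟨ a , u ⟩ ∈ cf′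
      insert {D} {cf} {u} S u∈ = cases {A = ∃ λ a → ⟨ a , u ⟩ ∈ cf}
        (λ h → h >>¬ λ { (a , m) → η (D , η (cf , η (a , S , (λ z m → m) , (λ z m → m) , m))) })
        -- D itself serves as the new slot: as a finite subset of B it lies in B, and D ∉ D makes it
        -- fresh.
        λ no → η (D +̂ D , η (cf +̂ ⟨ D , u ⟩ , η (D , slots (fin-+̂ (s-fin S))
            (λ z m → proj₁ (∈-+̂ z) m >>= λ { (inj₁ m) → s-B S z m ; (inj₂ e) → ∈ˡ (Q-sym e) (fin∈ (s-fin S) (s-B S)) })
            (λ a x y m m′ → split m >>= λ
              { (inj₁ m) → split m′ >>= λ { (inj₁ m′) → s-fun S a x y m m′ ; (inj₂ (e , _)) → ⊥-elim (fresh m e) }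
              ; (inj₂ (e , e₁)) → split m′ >>= λ { (inj₁ m′) → ⊥-elim (fresh m′ e) ; (inj₂ (_ , e₂)) → Q-trans e₁ (Q-sym e₂) } })
            (λ a b x m m′ → split m >>= λ
              { (inj₁ m) → split m′ >>= λ { (inj₁ m′) → s-inj S a b x m m′ ; (inj₂ (_ , e)) → ⊥-elim (no (η (a , ∈ˡ (pair-cong Q-refl e) m))) }
              ; (inj₂ (e , e₁)) → split m′ >>= λ { (inj₁ m′) → ⊥-elim (no (η (b , ∈ˡ (pair-cong Q-refl e₁) m′))) ; (inj₂ (e′ , _)) → Q-trans e (Q-sym e′) } })
            (λ a x m → split m >>= λ
              { (inj₁ m) → let (p , q) = s-in S a x m in +̂-old p , q ; (inj₂ (e , e′)) → ∈ˡ (Q-sym e) +̂-new , ∈ˡ (Q-sym e′) u∈ })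
            (λ a m → proj₁ (∈-+̂ a) m >>¬ λ
              { (inj₁ m) → s-tot S a m >>¬ λ { (x , m) → η (x , +̂-old m) } ; (inj₂ e) → η (u , ∈ˡ (pair-cong (Q-sym e) Q-refl) +̂-new) })
            (+̂-old (s-∅ S)) , (λ z m → +̂-old m) , (λ z m → +̂-old m) , +̂-new)))
        where
        split : ∀ {a x} → ⟨ a , x ⟩ ∈ cf +̂ ⟨ D , u ⟩ → ⟨ a , x ⟩ ∈ cf or (a ≈ D × x ≈ u)
        split m = proj₁ (∈-+̂ _) m >>¬ λ { (inj₁ m) → η (inj₁ m) ; (inj₂ e) → η (inj₂ (pair-inj e)) }
        fresh : ∀ {a x} → ⟨ a , x ⟩ ∈ cf → ¬ a ≈ D
        fresh m e = x∉x (∈ˡ e (proj₁ (s-in S _ _ m)))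

      ∈-At : ∀ {x} → x ∈ At → ∃ λ c → ∃ λ u → ∃ λ v → x ≈ ⟨ c , ⟨ u , v ⟩ ⟩ × c ∈ B × u ∈ H × v ∈ H
      ∈-At m = proj₁ (∈-× _) m >>¬ λ { (c , h) → h >>¬ λ { (w , e , c∈ , w∈) → proj₁ (∈-× _) w∈ >>¬ λ { (u , h) → h >>¬ λ { (v , e′ , u∈ , v∈) →
        η (c , η (u , η (v , Q-trans e (pair-cong Q-refl e′) , c∈ , u∈ , v∈))) } } } }

      enum-+̂ : ∀ {q x c u v D τ cf D₂ cf₂ a b} → Enum q D τ cf → Slots D₂ cf₂ → D ⊆ D₂ → cf ⊆ cf₂ → x ≈ ⟨ c , ⟨ u , v ⟩ ⟩ → c ∈ B →
                ⟨ a , u ⟩ ∈ cf₂ → ⟨ b , v ⟩ ∈ cf₂ → Enum (q +̂ x) D₂ (τ +̂ ⟨ c , ⟨ a , b ⟩ ⟩) cf₂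
      enum-+̂ {q} {x} {c} {u} {v} {D} {τ} {cf} {D₂} {cf₂} {a} {b} E S₂ D⊆ cf⊆ x≈ c∈ au bv = enum S₂ (fin-+̂ (t-fin E))
        (λ z m → proj₁ (∈-+̂ z) m >>= λ { (inj₁ m) → t-B E z m
          ; (inj₂ e) → ∈ˡ (Q-sym e) (pair∈ c∈ (pair∈ (s-B S₂ a (proj₁ (s-in S₂ a u au))) (s-B S₂ b (proj₁ (s-in S₂ b v bv))))) })
        (λ c′ a′ b′ m → proj₁ (∈-+̂ _) m >>= λ
          { (inj₁ m) → let (p , q) = t-slot E c′ a′ b′ m in D⊆ a′ p , D⊆ b′ q
          ; (inj₂ e) → let (_ , e) = pair-inj e ; (ea , eb) = pair-inj e in
              ∈ˡ (Q-sym ea) (proj₁ (s-in S₂ a u au)) , ∈ˡ (Q-sym eb) (proj₁ (s-in S₂ b v bv)) })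
        (λ c′ u′ v′ → to c′ u′ v′ , from c′ u′ v′)
        where
        up : ∀ {a u} → ⟨ a , u ⟩ ∈ cf → ⟨ a , u ⟩ ∈ cf₂
        up m = cf⊆ _ m
        down : ∀ {a u} → a ∈ D → ⟨ a , u ⟩ ∈ cf₂ → ⟨ a , u ⟩ ∈ cf
        down {a} {u} a∈ m = s-tot (e-slots E) a a∈ >>= λ { (u₀ , m₀) → ∈ˡ (pair-cong Q-refl (s-fun S₂ a u₀ u (up m₀) m)) m₀ }
        to : ∀ c′ u′ v′ → ⟨ c′ , ⟨ u′ , v′ ⟩ ⟩ ∈ q +̂ x → ∃ λ a′ → ∃ λ b′ → ⟨ c′ , ⟨ a′ , b′ ⟩ ⟩ ∈ τ +̂ ⟨ c , ⟨ a , b ⟩ ⟩ × ⟨ a′ , u′ ⟩ ∈ cf₂ × ⟨ b′ , v′ ⟩ ∈ cf₂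
        to c′ u′ v′ m ret = proj₁ (∈-+̂ _) m λ
          { (inj₁ m) → proj₁ (t-p E c′ u′ v′) m λ { (a′ , h) → h λ { (b′ , m , ma , mb) → ret (a′ , λ ret → ret (b′ , +̂-old m , up ma , up mb)) } }
          ; (inj₂ e) → let (ec , e) = pair-inj (Q-trans e x≈) ; (eu , ev) = pair-inj e in
              ret (a , λ ret → ret (b , ∈ˡ (pair-cong (Q-sym ec) Q-refl) +̂-new , ∈ˡ (pair-cong Q-refl (Q-sym eu)) au , ∈ˡ (pair-cong Q-refl (Q-sym ev)) bv)) }
        from : ∀ c′ u′ v′ → ∃ (λ a′ → ∃ λ b′ → ⟨ c′ , ⟨ a′ , b′ ⟩ ⟩ ∈ τ +̂ ⟨ c , ⟨ a , b ⟩ ⟩ × ⟨ a′ , u′ ⟩ ∈ cf₂ × ⟨ b′ , v′ ⟩ ∈ cf₂) → ⟨ c′ , ⟨ u′ , v′ ⟩ ⟩ ∈ q +̂ x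
        from c′ u′ v′ h = h >>= λ { (a′ , h) → h >>= λ { (b′ , m , ma , mb) → proj₁ (∈-+̂ _) m >>= λ
          { (inj₁ m) → let (a∈ , b∈) = t-slot E c′ a′ b′ m in +̂-old (proj₂ (t-p E c′ u′ v′) λ ret → ret (a′ , λ ret → ret (b′ , m , down a∈ ma , down b∈ mb)))
          ; (inj₂ e) → let (ec , e) = pair-inj e ; (ea , eb) = pair-inj e in
              ∈ˡ (Q-trans x≈ (pair-cong (Q-sym ec) (pair-cong
                (s-fun S₂ a u u′ au (∈ˡ (pair-cong ea Q-refl) ma)) (s-fun S₂ b v v′ bv (∈ˡ (pair-cong eb Q-refl) mb))))) +̂-new } } }

      enumerate : ∀ {p} → Fin′ p → p ⊆ At → ∃ λ D → ∃ λ τ → ∃ λ cf → Enum p D τ cf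
      enumerate {p} f p⊆ = fin-ind (∃̇ (∃̇ (∃̇ (enumP 3F 2F 1F 0F)))) f
        (η (sing ∅ , η (∅ , η (sing ⟨ ∅ , ∅ ⟩ , enum
          (slots fin-sing (λ z m → ∈ˡ (Q-sym (proj₁ (∈-sing z) m)) (num∈B 0))
            (λ a x y m m′ → Q-trans (proj₂ (is m)) (Q-sym (proj₂ (is m′)))) (λ a b x m m′ → Q-trans (proj₁ (is m)) (Q-sym (proj₁ (is m′))))
            (λ a x m → proj₂ (∈-sing a) (proj₁ (is m)) , ∈ˡ (Q-sym (proj₂ (is m))) ∅∈H)
            (λ a m → η (∅ , proj₂ (∈-sing _) (pair-cong (proj₁ (∈-sing a) m) Q-refl))) (proj₂ (∈-sing _) Q-refl))
          fin-∅ (λ z m → ⊥-elim (∉∅ m)) (λ c a b m → ⊥-elim (∉∅ m))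
          (λ c u v → (λ m → ⊥-elim (∉∅ m)) , λ h → h >>= λ { (_ , h) → h >>= λ { (_ , m , _) → ⊥-elim (∉∅ m) } })))))
        λ q x q⊆ x∈ ih ret → ih λ { (D , ih) → ih λ { (τ , ih) → ih λ { (cf , E) → ∈-At (p⊆ x x∈) λ { (c , h) → h λ { (u , h) → h λ { (v , x≈ , c∈ , u∈ , v∈) →
          insert (e-slots E) u∈ λ { (D₁ , h) → h λ { (cf₁ , h) → h λ { (a , S₁ , D⊆₁ , cf⊆₁ , au₁) →
          insert S₁ v∈ λ { (D₂ , h) → h λ { (cf₂ , h) → h λ { (b , S₂ , D⊆₂ , cf⊆₂ , bv) →
          ret (D₂ , λ ret → ret (τ +̂ ⟨ c , ⟨ a , b ⟩ ⟩ , λ ret → ret (cf₂ ,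
            enum-+̂ E S₂ (λ z m → D⊆₂ z (D⊆₁ z m)) (λ z m → cf⊆₂ z (cf⊆₁ z m)) x≈ c∈ (cf⊆₂ _ au₁) bv))) } } } } } } } } } } } }
        where
        is : ∀ {a x} → ⟨ a , x ⟩ ∈ sing ⟨ ∅ , ∅ ⟩ → a ≈ ∅ × x ≈ ∅
        is m = pair-inj (proj₁ (∈-sing _) m)

    -- A Δ-system argument: among more than |B| many conditions there is one, p′,
    -- such that above every r ⊇ p′ one finds twins of p′.
    module Root where
      open Patterns public
      open ≤B using (IsSmall; smallP; small-⊆; small-⋃; small-self; small-fin; small-upair; small-∪; small-∅)

      large-nonempty : ∀ {X} → ¬ IsSmall X → ∃ λ x → x ∈ X
      large-nonempty h k = h (small-⊆ (λ z m → ⊥-elim (k (z , m))) small-∅)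

      B×B-small : IsSmall (B ×ˢ B)
      B×B-small = small-⊆ (λ z m → proj₁ (∈-× z) m >>= λ { (x , h) → h >>= λ { (y , e , x∈ , y∈) → ∈ˡ (Q-sym e) (pair∈ x∈ y∈) } }) small-self

      coordF : M → Fm 1
      coordF r = ∃̇ (∃̇ (⟨ v1 , ⟨ v2 , v0 ⟩ᵗ ⟩ᵗ ∈̇ con r ∨̇ ⟨ v1 , ⟨ v0 , v2 ⟩ᵗ ⟩ᵗ ∈̇ con r))

      coords : M → M
      coords r = sep H (coordF r)

      ∈-coords : ∀ {r} → r ⊆ At → ∀ u → u ∈ coords r ↔ Coord r u
      ∈-coords {r} r⊆ u = ↔-trans (∈-sep (coordF r) u) (proj₂ , λ h → (h >>= λ { (c , h) → h >>= λ { (v , h) → h >>= λ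
        { (inj₁ m) → proj₁ (proj₁ pair∈× (proj₂ (proj₁ pair∈× (r⊆ _ m)))) ; (inj₂ m) → proj₂ (proj₁ pair∈× (proj₂ (proj₁ pair∈× (r⊆ _ m)))) } } }) , h)

      coords-small : ∀ {r} → Fin′ r → r ⊆ At → IsSmall (coords r)
      coords-small {r} f r⊆ = small-⋃ φ (small-fin f)
        (λ z z∈ → ∈-At (r⊆ z z∈) >>= λ { (c , h) → h >>= λ { (u , h) → h >>= λ { (v , e , _) →
          small-⊆ (λ w m → is-coord e (proj₂ (proj₁ (∈-sep (lt (con z) (sub φ (0F ∷ 1F ∷ []))) w) m))) (small-upair {u} {v}) } } })
        (λ u m → proj₁ (∈-coords r⊆ u) m >>= λ { (c , h) → h >>= λ { (v , h) → h >>¬ λ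
          { (inj₁ m) → η (⟨ c , ⟨ u , v ⟩ ⟩ , m , η (c , η (v , η (inj₁ Q-refl)))) ; (inj₂ m) → η (⟨ c , ⟨ v , u ⟩ ⟩ , m , η (c , η (v , η (inj₂ Q-refl)))) } } })
        where
        φ : Fm 2
        φ = ∃̇ (∃̇ (v2 ≈̇ ⟨ v1 , ⟨ v3 , v0 ⟩ᵗ ⟩ᵗ ∨̇ v2 ≈̇ ⟨ v1 , ⟨ v0 , v3 ⟩ᵗ ⟩ᵗ))
        is-coord : ∀ {z c u v w} → z ≈ ⟨ c , ⟨ u , v ⟩ ⟩ → ∃ (λ c′ → ∃ λ v′ → z ≈ ⟨ c′ , ⟨ w , v′ ⟩ ⟩ or z ≈ ⟨ c′ , ⟨ v′ , w ⟩ ⟩) → w ∈ upair u v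
        is-coord {z} {c} {u} {v} {w} e h = h >>= λ { (c′ , h) → h >>= λ { (v′ , h) → h >>= λ
          { (inj₁ e′) → let (_ , d) = pair-inj (Q-trans (Q-sym e) e′) ; (d , _) = pair-inj d in ∈ˡ d upairˡ
          ; (inj₂ e′) → let (_ , d) = pair-inj (Q-trans (Q-sym e) e′) ; (_ , d) = pair-inj d in ∈ˡ d upairʳ } } }

      B-fst : ∀ {x y} → ⟨ x , y ⟩ ∈ B → x ∈ B
      B-fst m = fst∈∈ >>= λ { (u , u∈ , x∈) → trans′ _ (trans′ _ m _ u∈) _ x∈ }
      B-snd : ∀ {x y} → ⟨ x , y ⟩ ∈ B → y ∈ B
      B-snd m = snd∈∈ >>= λ { (u , u∈ , x∈) → trans′ _ (trans′ _ m _ u∈) _ x∈ }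

      opaque
        unfolding atom
        -- One window G ∈ B includes the domains of all positive facts in r, so agreement on G is
        -- enough for `tw-near`.
        domain : ∀ {r} → Fin′ r → r ⊆ At → ∃ λ G → G ∈ B × (∀ α k F s → pos α k ⟨ F , s ⟩ ∈ r → F ⊆ G)
        domain {r} f r⊆ = fin-ind (∃̇ (v0 ∈̇ con B ∧̇ ∀̇ (∀̇ (∀̇ (∀̇ (atomᵗ 2 ⟨ v2 , ⟨ v1 , v0 ⟩ᵗ ⟩ᵗ v3 (con ∅) ∈̇ v5 ⇒̇ 1F ⊆̇ 4F)))))) f
          (η (∅ , num∈B 0 , λ α k F s m → ⊥-elim (∉∅ m)))
          λ q x q⊆ x∈ ih → ih >>= λ { (G , G∈ , h) → cases {A = ∃ λ α → ∃ λ k → ∃ λ F → ∃ λ s → x ≈ pos α k ⟨ F , s ⟩}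
            (λ e → e >>¬ λ { (α₀ , e) → e >>¬ λ { (k₀ , e) → e >>¬ λ { (F₀ , e) → e >>¬ λ { (s₀ , e) →
              let F₀∈ = B-fst (B-snd (B-snd (proj₁ (proj₁ pair∈× (∈ˡ e (r⊆ x x∈)))))) in
              η (G ∪ F₀ , ∪∈ G∈ F₀∈ , λ α k F s m z z∈ → proj₁ (∈-+̂ _) m >>= λ
                { (inj₁ m) → ∪ˡ z (h α k F s m z z∈)
                ; (inj₂ e′) → ∪ʳ z (∈ʳ (proj₁ (pair-inj (proj₂ (pair-inj (proj₁ (proj₂ (atom-inj {2} {2} (Q-trans e′ e)))))))) z∈) }) } } } })
            (λ n → η (G , G∈ , λ α k F s m → proj₁ (∈-+̂ _) m >>= λ
              { (inj₁ m) → h α k F s m ; (inj₂ e) → ⊥-elim (n (η (α , η (k , η (F , η (s , Q-sym e)))))) })) }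

      module RootLemma (X : M) (Φ : Fm 2) (X-large : ¬ IsSmall X) (hyp : ∀ x → x ∈ X → ∃ λ p → p ∈ P × Sat Φ (x ∷ p ∷ [])) where

        datF : Fm 5 -- x , p , cf , D , τ
        datF = v1 ∈̇ con P ∧̇ sub Φ (0F ∷ 1F ∷ []) ∧̇ enumP 1F 3F 4F 2F

        quad : M → M → M → M → M
        quad p cf D τ = ⟨ p , ⟨ cf , ⟨ D , τ ⟩ ⟩ ⟩

        χ : Fm 2
        χ = ∃̇ (∃̇ (∃̇ (∃̇ (v5 ≈̇ ⟨ v3 , ⟨ v2 , ⟨ v1 , v0 ⟩ᵗ ⟩ᵗ ⟩ᵗ ∧̇ sub datF (4F ∷ 3F ∷ 2F ∷ 1F ∷ 0F ∷ [])))))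

        module WithF (F : M) (F-fun : Functional F) (F-spec : ∀ x w → ⟨ x , w ⟩ ∈ F → x ∈ X × Sat χ (x ∷ w ∷ [])) (F-tot : ∀ x → x ∈ X → ∃ λ w → ⟨ x , w ⟩ ∈ F) where

          Datum : M → M → M → M → M → Set
          Datum x p cf D τ = ⟨ x , quad p cf D τ ⟩ ∈ F

          datum-spec : ∀ {x p cf D τ} → Datum x p cf D τ → x ∈ X × Sat datF (x ∷ p ∷ cf ∷ D ∷ τ ∷ [])
          datum-spec {x} {p} {cf} {D} {τ} m = proj₁ (F-spec x _ m) , stable {{Sat-stable datF (x ∷ p ∷ cf ∷ D ∷ τ ∷ [])}} λ n →
            proj₂ (F-spec x _ m) λ { (p₁ , h) → h λ { (cf₁ , h) → h λ { (D₁ , h) → h λ { (τ₁ , e , s) →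
              let (ep , e) = pair-inj e ; (ec , e) = pair-inj e ; (eD , eτ) = pair-inj e in
              n (Sat-cong datF {x ∷ p₁ ∷ cf₁ ∷ D₁ ∷ τ₁ ∷ []} {x ∷ p ∷ cf ∷ D ∷ τ ∷ []} (λ { zero → Q-refl ; (suc zero) → ep ; (suc (suc zero)) → ec ; (suc (suc (suc zero))) → eD ; (suc (suc (suc (suc zero)))) → eτ }) s) } } } }

          datum-tot : ∀ x → x ∈ X → ∃ λ p → ∃ λ cf → ∃ λ D → ∃ λ τ → Datum x p cf D τ
          datum-tot x x∈ = F-tot x x∈ >>¬ λ { (w , m) → proj₂ (F-spec x w m) >>¬ λ { (p , h) → h >>¬ λ { (cf , h) → h >>¬ λ { (D , h) → h >>¬ λ { (τ , e , _) →
            η (p , η (cf , η (D , η (τ , ∈ˡ (pair-cong Q-refl e) m)))) } } } } }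

          typeF : M → M → Fm 1
          typeF D τ = ∃̇ (∃̇ (⟨ v2 , ⟨ v1 , ⟨ v0 , ⟨ con D , con τ ⟩ᵗ ⟩ᵗ ⟩ᵗ ⟩ᵗ ∈̇ con F))

          -- A pattern together with its slots is an element of B × B, so some pattern is shared by
          -- a large set of conditions.
          pigeon : ∃ λ D → ∃ λ τ → ¬ IsSmall (sep X (typeF D τ))
          pigeon n = X-large (small-⋃ φ B×B-small
            (λ w w∈ → proj₁ (∈-× w) w∈ >>= λ { (D , h) → h >>= λ { (τ , e , _) → stable λ m → n (D , η (τ , λ s → m (small-⊆
              (λ x k → let (x∈ , k) = proj₁ (∈-sep (lt (con w) (sub φ (0F ∷ 1F ∷ []))) x) k in proj₂ (∈-sep (typeF D τ) x) (x∈ , (k >>¬ λ { (p , k) → k >>¬ λ { (cf , k) → k >>¬ λ { (D′ , k) → k >>¬ λ { (τ′ , e′ , k) →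
                let (eD , eτ) = pair-inj (Q-trans (Q-sym e) e′) in η (p , η (cf , ∈ˡ (pair-cong Q-refl (pair-cong Q-refl (pair-cong Q-refl (pair-cong (Q-sym eD) (Q-sym eτ))))) k)) } } } }))) s))) } })
            (λ x x∈ → datum-tot x x∈ >>¬ λ { (p , h) → h >>¬ λ { (cf , h) → h >>¬ λ { (D , h) → h >>¬ λ { (τ , d) →
              let E = proj₂ (proj₂ (proj₂ (datum-spec d))) in
              η (⟨ D , τ ⟩ , proj₂ pair∈× (fin∈ (s-fin (e-slots E)) (s-B (e-slots E)) , fin∈ (t-fin E) (t-B E)) , η (p , η (cf , η (D , η (τ , Q-refl , d))))) } } } }))
            where
            φ : Fm 2
            φ = ∃̇ (∃̇ (∃̇ (∃̇ (v4 ≈̇ ⟨ v1 , v0 ⟩ᵗ ∧̇ ⟨ v5 , ⟨ v3 , ⟨ v2 , ⟨ v1 , v0 ⟩ᵗ ⟩ᵗ ⟩ᵗ ⟩ᵗ ∈̇ con F))))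

          module Typed (D τ : M) (X₁-large : ¬ IsSmall (sep X (typeF D τ))) where
            X₁ = sep X (typeF D τ)

            cfF : Fm 3
            cfF = ∃̇ (∃̇ (⟨ v2 , ⟨ v1 , ⟨ v0 , ⟨ con D , con τ ⟩ᵗ ⟩ᵗ ⟩ᵗ ⟩ᵗ ∈̇ con F ∧̇ ⟨ v3 , v4 ⟩ᵗ ∈̇ v0))

            opaque
              CF : M → M → M → Set
              CF x a u = ∃ λ p → ∃ λ cf → Datum x p cf D τ × ⟨ a , u ⟩ ∈ cf

              instance
                stable-CF : ∀ {x a u} → Stable (CF x a u)
                stable-CF = stable-Π

              cf-ok : ∀ (v : Vec M 3) → CF (lookup v 0F) (lookup v 1F) (lookup v 2F) ↔ Sat cfF v
              cf-ok (x ∷ a ∷ u ∷ []) = ↔-refl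

              cf-intro : ∀ {x p cf a u} → Datum x p cf D τ → ⟨ a , u ⟩ ∈ cf → CF x a u
              cf-intro d m = η (_ , η (_ , d , m))

              cf-elim : ∀ {x p cf a u} → Datum x p cf D τ → CF x a u → ⟨ a , u ⟩ ∈ cf
              cf-elim {x} d h = h >>= λ { (p′ , h) → h >>= λ { (cf′ , d′ , m) →
                ∈ʳ (proj₁ (pair-inj (proj₂ (pair-inj (F-fun x _ _ d′ d))))) m } }

              cf-datum : ∀ {x a u} → CF x a u → ∃ λ p → ∃ λ cf → Datum x p cf D τ × ⟨ a , u ⟩ ∈ cf
              cf-datum h = h

              cf-cong : ∀ {x a u x′ a′ u′} → x ≈ x′ → a ≈ a′ → u ≈ u′ → CF x a u → CF x′ a′ u′
              cf-cong = cong₃ cfF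

            cfP : ∀ {n} → Fin n → Fin n → Fin n → Fm n
            cfP i j k = prd (λ v → CF (lookup v 0F) (lookup v 1F) (lookup v 2F)) cfF cf-ok (i ∷ j ∷ k ∷ [])

            X₁-datum : ∀ x → x ∈ X₁ → ∃ λ p → ∃ λ cf → Datum x p cf D τ
            X₁-datum x m = proj₂ (proj₁ (∈-sep (typeF D τ) x) m)

            enum-of : ∀ {x p cf} → Datum x p cf D τ → Enum p D τ cf
            enum-of d = proj₂ (proj₂ (proj₂ (datum-spec d)))

            slots-of : ∀ {x p cf} → Datum x p cf D τ → Slots D cf
            slots-of d = e-slots (enum-of d)

            cf-fun : ∀ {x a u u′} → CF x a u → CF x a u′ → u ≈ u′
            cf-fun h h′ = cf-datum h >>= λ { (p , h) → h >>= λ { (cf , d , m) → s-fun (slots-of d) _ _ _ m (cf-elim d h′) } }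

            cf-inj : ∀ {x a b u} → CF x a u → CF x b u → a ≈ b
            cf-inj h h′ = cf-datum h >>= λ { (p , h) → h >>= λ { (cf , d , m) → s-inj (slots-of d) _ _ _ m (cf-elim d h′) } }

            cf-in : ∀ {x a u} → CF x a u → a ∈ D × u ∈ H
            cf-in h = cf-datum h >>= λ { (p , h) → h >>= λ { (cf , d , m) → s-in (slots-of d) _ _ m } }

            D-ok : Fin′ D × D ⊆ B
            D-ok = large-nonempty X₁-large >>= λ { (x , x∈) → X₁-datum x x∈ >>= λ { (p , h) → h >>= λ { (cf , d) → s-fin (slots-of d) , s-B (slots-of d) } } }

            -- The two kinds of slots replace the root and the petals of a Δ-system: a slot has a
            -- fixed coordinate, or takes each single value on a small set only.
            Const Thin : M → M → Set
            Const X′ a = ∃ λ h → ∀ x → x ∈ X′ → CF x a h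
            Thin X′ a = ∀ h Y → Y ⊆ X′ → (∀ x → x ∈ Y → CF x a h) → IsSmall Y

            constF thinF : Fm 2
            constF = ∃̇ (∀̇ (v0 ∈̇ v2 ⇒̇ cfP 0F 3F 1F))
            thinF = ∀̇ (∀̇ (0F ⊆̇ 2F ⇒̇ ∀̇ (v0 ∈̇ v1 ⇒̇ cfP 0F 4F 2F) ⇒̇ smallP 0F))

            refineF : Fm 1
            refineF = ∃̇ ((∀̇ (v0 ∈̇ v1 ⇒̇ v0 ∈̇ con X₁)) ∧̇ ¬̇ smallP 0F ∧̇ ∀̇ (v0 ∈̇ v2 ⇒̇ sub constF (1F ∷ 0F ∷ []) ∨̇ sub thinF (1F ∷ 0F ∷ [])))

            -- Slots are treated one after the other. One that is not thin takes some value on a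
            -- large subset, and passing to it makes the slot constant; both alternatives survive
            -- further shrinking.
            refine : ∃ λ X₂ → X₂ ⊆ X₁ × ¬ IsSmall X₂ × (∀ a → a ∈ D → Const X₂ a or Thin X₂ a)
            refine = fin-ind refineF (proj₁ D-ok)
              (η (X₁ , (λ z m → m) , X₁-large , none))
              λ q a q⊆ a∈ ih → ih >>= λ { (X′ , X′⊆ , lg , h) → cases {A = Thin X′ a}
                (λ t → η (X′ , X′⊆ , lg , λ b m → proj₁ (∈-+̂ b) m >>¬ λ
                  { (inj₁ m) → h b m ; (inj₂ e) → η (inj₂ (λ u Y Y⊆ k → t u Y Y⊆ λ x x∈ → cf-cong Q-refl e Q-refl (k x x∈))) }))
                (λ nt k → nt λ u Y Y⊆ c → stable λ ns → k (Y , (λ z m → X′⊆ z (Y⊆ z m)) , ns , λ b m → proj₁ (∈-+̂ b) m >>¬ λ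
                  { (inj₁ m) → h b m >>¬ λ
                    { (inj₁ c′) → η (inj₁ (c′ >>¬ λ { (w , c′) → η (w , λ x x∈ → c′ x (Y⊆ x x∈)) }))
                    ; (inj₂ t) → η (inj₂ λ w Z Z⊆ → t w Z λ z m → Y⊆ z (Z⊆ z m)) }
                  ; (inj₂ e) → η (inj₁ (η (u , λ x x∈ → cf-cong Q-refl (Q-sym e) Q-refl (c x x∈)))) })) }

              where
              none : ∀ a → a ∈ ∅ → Const X₁ a or Thin X₁ a
              none a m = ⊥-elim (∉∅ m)

            -- the traces of the coordinates of x on F
            Inf : M → M → M → Set
            Inf x F y = ∀ w → w ∈ y ↔ ∃ λ a → ∃ λ u → CF x a u × w ≈ ⟨ a , u ∩ F ⟩

            infF : Fm 3
            infF = ∀̇ (v0 ∈̇ v3 ⇔̇ ∃̇ (∃̇ (cfP 3F 1F 0F ∧̇ v2 ≈̇ ⟨ v1 , ∩-op [ v0 · v4 ] ⟩ᵗ)))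

            inf-exists : ∀ {x F} → x ∈ X₁ → F ∈ B → ∃ λ y → y ∈ B × Inf x F y
            inf-exists {x} {F} x∈ F∈ = η (repl D φ , fin∈ (fin-repl φ φ-fun (proj₁ D-ok)) in-B , λ w → ↔-trans (∈-repl φ φ-fun w)
              ( (λ h → h >>¬ λ { (a , a∈ , h) → h >>¬ λ { (u , c , e) → η (a , η (u , c , e)) } })
              , (λ h → h >>¬ λ { (a , h) → h >>¬ λ { (u , c , e) → η (a , proj₁ (cf-in c) , η (u , c , e)) } }) ))
              where
              φ : Fm 2
              φ = ∃̇ (lt (con x) (cfP 0F 2F 1F) ∧̇ v2 ≈̇ ⟨ v1 , ∩-op [ v0 · con F ] ⟩ᵗ)
              φ-fun : ∀ a y y′ → a ∈ D → Sat φ (a ∷ y ∷ []) → Sat φ (a ∷ y′ ∷ []) → y ≈ y′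
              φ-fun a y y′ _ h h′ = h >>= λ { (u , c , e) → h′ >>= λ { (u′ , c′ , e′) → Q-trans e (Q-trans (pair-cong Q-refl (Op.cong ∩-op (cf-fun c c′) Q-refl)) (Q-sym e′)) } }
              in-B : repl D φ ⊆ B
              in-B w m = proj₁ (∈-repl φ φ-fun w) m >>= λ { (a , a∈ , h) → h >>= λ { (u , c , e) →
                ∈ˡ (Q-sym e) (pair∈ (proj₂ D-ok a a∈) (sub∈ (λ z m → proj₂ (proj₁ (∈-∩ z) m)) F∈)) } }

            inf-same : ∀ {x x′ F y a u u′} → Inf x F y → Inf x′ F y → CF x a u → CF x′ a u′ → u ∩ F ≈ u′ ∩ F
            inf-same {a = a} {u} i i′ c c′ = proj₁ (i′ _) (proj₂ (i _) (η (a , η (u , c , Q-refl)))) >>= λ { (a₁ , h) → h >>= λ { (u₁ , c₁ , e) →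
              let (ea , eu) = pair-inj e in Q-trans eu (Op.cong ∩-op (cf-fun (cf-cong Q-refl (Q-sym ea) Q-refl c₁) c′) Q-refl) } }

            module Refined (X₂ : M) (X₂⊆ : X₂ ⊆ X₁) (X₂-large : ¬ IsSmall X₂) (dich : ∀ a → a ∈ D → Const X₂ a or Thin X₂ a) where

              ψ : Fm 2 -- w , x
              ψ = ∃̇ (∃̇ (v2 ≈̇ ⟨ v1 , v0 ⟩ᵗ ∧̇ sub infF (3F ∷ 1F ∷ 0F ∷ [])))

              WF : Fm 1
              WF = ∃̇ (smallP 0F ∧̇ ∀̇ (v0 ∈̇ con X₂ ⇒̇ sub ψ (2F ∷ 0F ∷ []) ⇒̇ v0 ∈̇ v1))
              W = sep (B ×ˢ B) WF

              -- `W` collects the pairs of a window F and a trace y shown by few x only. There are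
              -- at most |B| such pairs, so few x show any of them. An x′ that shows none has each
              -- of its traces repeated on a large set, whatever window is asked for later.
              good : ∃ λ x′ → x′ ∈ X₂ × (∀ F y → F ∈ B → y ∈ B → Inf x′ F y → ⟨ F , y ⟩ ∉ W)
              good n = X₂-large (small-⋃ ψ (small-⊆ (λ w m → proj₁ (proj₁ (∈-sep WF w) m)) B×B-small)
                (λ w w∈ → proj₂ (proj₁ (∈-sep WF w) w∈) >>= λ { (Y , s , h) → small-⊆ (λ x m → let (x∈ , k) = proj₁ (∈-sep (lt (con w) (sub ψ (0F ∷ 1F ∷ []))) x) m in h x x∈ k) s })
                (λ x x∈ → stable λ k → n (x , x∈ , λ F y F∈ y∈ i w∈ → k (η (⟨ F , y ⟩ , w∈ , η (F , η (y , Q-refl , i)))))))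

              module At-x′ (x′ : M) (x′∈ : x′ ∈ X₂) (x′-good : ∀ F y → F ∈ B → y ∈ B → Inf x′ F y → ⟨ F , y ⟩ ∉ W)
                           (p′ cf′ : M) (d′ : Datum x′ p′ cf′ D τ) (r : M) (Cr : Cond r) (p′⊆r : p′ ⊆ r) (Z : M) (Z-small : IsSmall Z) where

                DtF : Fm 1
                DtF = lt (con X₂) (sub thinF (0F ∷ 1F ∷ []))
                Dt = sep D DtF

                ExF : Fm 1
                ExF = ∃̇ (v0 ∈̇ con Dt ∧̇ ∃̇ (v0 ∈̇ con (coords r) ∧̇ cfP 2F 1F 0F))
                Ex = sep X₂ ExF

                -- There are finitely many thin slots and few coordinates of r, and a thin slot
                -- takes a given value on a small set.
                Ex-small : IsSmall Ex
                Ex-small = small-⋃ φ (small-⊆ (λ a m → proj₁ (proj₁ (∈-sep DtF a) m)) (small-fin (proj₁ D-ok)))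
                  (λ a a∈ → small-⋃ {X = coords r} {Y = slice a} (lt (con a) (cfP 2F 0F 1F)) (coords-small (p-fin Cr) (p-At Cr))
                    (λ h h∈ → proj₂ (proj₁ (∈-sep DtF a) a∈) h (sep (slice a) (hF a h))
                      (λ x m → proj₁ (proj₁ (∈-sep ExF x) (proj₁ (proj₁ (∈-sep (sliceF a) x) (proj₁ (proj₁ (∈-sep (hF a h) x) m))))))
                      (λ x m → proj₂ (proj₁ (∈-sep (hF a h) x) m)))
                    (λ x m → proj₂ (proj₁ (∈-sep (sliceF a) x) m)))
                  (λ x m → proj₂ (proj₁ (∈-sep ExF x) m))
                  where
                  φ : Fm 2
                  φ = ∃̇ (v0 ∈̇ con (coords r) ∧̇ cfP 2F 1F 0F)
                  sliceF : M → Fm 1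
                  sliceF a = lt (con a) (sub φ (0F ∷ 1F ∷ []))
                  slice : M → M
                  slice a = sep Ex (sliceF a)
                  hF : M → M → Fm 1
                  hF a h = lt (con h) (sub (lt (con a) (cfP 2F 0F 1F)) (0F ∷ 1F ∷ []))

                twF : M → Fm 2
                twF x = ∃̇ (lt (con x) (cfP 0F 1F 2F) ∧̇ lt (con x′) (cfP 0F 1F 3F))

                tw : M → M
                tw x = graph H H (twF x)

                tw∈ : ∀ {x u u′} → ⟨ u , u′ ⟩ ∈ tw x ↔ ((u ∈ H × u′ ∈ H) × ∃ λ a → CF x a u × CF x′ a u′)
                tw∈ {x} = ∈-graph (twF x)

                tw-intro : ∀ {x a u u′} → CF x a u → CF x′ a u′ → ⟨ u , u′ ⟩ ∈ tw x
                tw-intro {a = a} c c′ = proj₂ tw∈ ((proj₂ (cf-in c) , proj₂ (cf-in c′)) , η (a , c , c′))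

                twin : ∀ {x p cf G y} → x ∈ X₂ → x ∉ Ex → Datum x p cf D τ → (∀ α k F s → pos α k ⟨ F , s ⟩ ∈ r → F ⊆ G) → Inf x G y → Inf x′ G y → Twin p p′ r (tw x)
                twin {x} {p} {cf} {G} {y} x∈ x∉ d G-dom i i′ = record
                  { tw-atom = λ c u v m ret → proj₁ (t-p (enum-of d) c u v) m λ { (a , h) → h λ { (b , t∈ , au , bv) →
                      let (a∈ , b∈) = t-slot (enum-of d) c a b t∈ in
                      s-tot (slots-of d′) a a∈ λ { (u′ , au′) → s-tot (slots-of d′) b b∈ λ { (v′ , bv′) →
                      ret (u′ , λ ret → ret (v′ , tw-intro (cf-intro d au) (cf-intro d′ au′) , tw-intro (cf-intro d bv) (cf-intro d′ bv′) ,
                        proj₂ (t-p (enum-of d′) c u′ v′) λ ret → ret (a , λ ret → ret (b , t∈ , au′ , bv′)))) } } } }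
                  ; tw-fun = λ u u₁ u₂ m m′ → proj₂ (proj₁ tw∈ m) >>= λ { (a , c , c₁) → proj₂ (proj₁ tw∈ m′) >>= λ { (b , c′ , c₂) →
                      cf-fun c₁ (cf-cong Q-refl (cf-inj c′ c) Q-refl c₂) } }
                  ; tw-inj = λ u w u′ m m′ → proj₂ (proj₁ tw∈ m) >>= λ { (a , c , c₁) → proj₂ (proj₁ tw∈ m′) >>= λ { (b , c′ , c₂) →
                      cf-fun c (cf-cong Q-refl (cf-inj c₂ c₁) Q-refl c′) } }
                  ; tw-root = λ u u′ m co → proj₂ (proj₁ tw∈ m) >>= λ { (a , c , c₁) → dich a (proj₁ (cf-in c)) >>= λ
                      { (inj₁ k) → k >>= λ { (h , k) → Q-trans (cf-fun c (k x x∈)) (cf-fun (k x′ x′∈) c₁) }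
                      ; (inj₂ t) → ⊥-elim (x∉ (proj₂ (∈-sep ExF x) (x∈ , η (a , proj₂ (∈-sep DtF a) (proj₁ (cf-in c) , t) , η (u , proj₂ (∈-coords (p-At Cr) u) co , c))))) } }
                  ; tw-∅ = tw-intro (cf-intro d (s-∅ (slots-of d))) (cf-intro d′ (s-∅ (slots-of d′)))
                  ; tw-near = λ u u′ m α k F s p∈ → proj₂ (proj₁ tw∈ m) >>= λ { (a , c , c₁) →
                      let e = inf-same i i′ c c₁ ; F⊆ = G-dom α k F s p∈ in ext λ z →
                      (λ m → let (z∈ , zF) = proj₁ (∈-∩ z) m in proj₂ (∈-∩ z) (proj₁ (proj₁ (∈-∩ z) (∈ʳ e (proj₂ (∈-∩ z) (z∈ , F⊆ z zF)))) , zF))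
                      , (λ m → let (z∈ , zF) = proj₁ (∈-∩ z) m in proj₂ (∈-∩ z) (proj₁ (proj₁ (∈-∩ z) (∈ʳ (Q-sym e) (proj₂ (∈-∩ z) (z∈ , F⊆ z zF)))) , zF)) }
                  }

                KF : M → M → Fm 1
                KF G y = lt (con G) (lt (con y) (sub infF (2F ∷ 1F ∷ 0F ∷ [])))

                K-large : ∀ {G y} → G ∈ B → y ∈ B → Inf x′ G y → ¬ IsSmall (sep X₂ (KF G y))
                K-large {G} {y} G∈ y∈ i′ s = x′-good G y G∈ y∈ i′ (proj₂ (∈-sep WF _) (proj₂ pair∈× (G∈ , y∈) , η (sep X₂ (KF G y) , s , λ x x∈ h → proj₂ (∈-sep (KF G y) x) (x∈ ,
                  λ w → h >>= λ { (G₁ , h) → h >>= λ { (y₁ , e , i) → let (eG , ey) = pair-inj e in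
                    Sat-cong infF {x ∷ G₁ ∷ y₁ ∷ []} {x ∷ G ∷ y ∷ []} (λ { zero → Q-refl ; (suc zero) → eG ; (suc (suc zero)) → ey }) i w } }))))

                -- Many x repeat the trace of x′ on the window of r, so one of them lies outside
                -- both `Z` and `Ex`. Being outside `Ex`, it has no thin coordinate in r, which
                -- gives `tw-root`; the common trace gives `tw-near`.
                result : ∃ λ x → ∃ λ p → ∃ λ tw → x ∈ X × x ∉ Z × p ∈ P × Sat Φ (x ∷ p ∷ []) × Twin p p′ r tw
                result ret = domain (p-fin Cr) (p-At Cr) λ { (G , G∈ , G-dom) → inf-exists (X₂⊆ x′ x′∈) G∈ λ { (y , y∈ , i′) →
                  K-large G∈ y∈ i′ (small-⊆ (λ x x∈K → stable λ x∉ →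
                    let (x∈ , i) = proj₁ (∈-sep (KF G y) x) x∈K in X₁-datum x (X₂⊆ x x∈) λ { (p , h) → h λ { (cf , d) →
                    let (x∈X , p∈ , s , _) = datum-spec d in
                    ret (x , λ ret → ret (p , λ ret → ret (tw x , x∈X , (λ m → x∉ (∪ʳ x m)) , p∈ , s , twin x∈ (λ m → x∉ (∪ˡ x m)) d G-dom i i′))) } })
                  (small-∪ Ex-small Z-small)) } }

        Twins : M → M → Set
        Twins x′ p′ = ∀ r → r ∈ P → p′ ⊆ r → ∀ Z → IsSmall Z → ∃ λ x → ∃ λ p → ∃ λ tw → x ∈ X × x ∉ Z × p ∈ P × Sat Φ (x ∷ p ∷ []) × Twin p p′ r tw

        root : ∃ λ x′ → ∃ λ p′ → x′ ∈ X × p′ ∈ P × Sat Φ (x′ ∷ p′ ∷ []) × Twins x′ p′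
        root = do
          (F , F-fun , F-spec , F-tot) ← choice-function χ X λ x x∈ → hyp x x∈ >>¬ λ { (p , p∈ , s) →
            let C = proj₁ ∈-P p∈ in enumerate (p-fin C) (p-At C) >>¬ λ { (D , h) → h >>¬ λ { (τ , h) → h >>¬ λ { (cf , E) →
            η (quad p cf D τ , η (p , η (cf , η (D , η (τ , Q-refl , p∈ , s , E))))) } } } }
          let open WithF F F-fun F-spec F-tot
          (D , h) ← pigeon
          (τ , lg) ← h
          let open Typed D τ lg
          (X₂ , X₂⊆ , X₂-large , dich) ← refine
          let open Refined X₂ X₂⊆ X₂-large dich
          (x′ , x′∈ , gd) ← good
          (p′ , h) ← X₁-datum x′ (X₂⊆ x′ x′∈)
          (cf′ , d′) ← h
          let sp = datum-spec d′
          η (x′ , η (p′ , proj₁ sp , proj₁ (proj₂ sp) , proj₁ (proj₂ (proj₂ sp)) , λ r r∈ p′⊆r Z Z-small →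
            At-x′.result x′ x′∈ gd p′ cf′ d′ r (proj₁ ∈-P r∈) p′⊆r Z Z-small))

      -- Applied to a large antichain, with r = p′ and only x′ to be avoided, `root` yields another
      -- member of the antichain that amalgamates with p′.
      chain-condition : ∀ A → A ⊆ P → (∀ p q r → p ∈ A → q ∈ A → r ∈ P → p ⊆ r → q ⊆ r → p ≈ q) → IsSmall A
      chain-condition A A⊆ anti = stable λ lg → RootLemma.root A (v0 ≈̇ v1) lg (λ x x∈ → η (x , A⊆ x x∈ , Q-refl)) λ { (x′ , h) → h λ { (p′ , x′∈ , p′∈ , e , tws) →
        tws p′ p′∈ (λ z m → m) (sing x′) ≤B.small-sing λ { (x , h) → h λ { (p , h) → h λ { (tw , x∈ , x∉ , p∈ , e′ , tn) →
        x∉ (proj₂ (∈-sing x) (anti x x′ (p′ ∪ p) x∈ x′∈ (proj₂ ∈-P (Amalgam.amalgam (proj₁ ∈-P p∈) (proj₁ ∈-P p′∈) (λ z m → m) tn))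
          (λ z m → ∪ʳ z (∈ʳ e′ m)) (λ z m → ∪ˡ z (∈ʳ e m)))) } } } } }

    open Root

    module Generic (enumM : ℕ → M) (enumM-onto : ∀ x → Σ ℕ λ k → enumM k ≡ x) where

      -- The generic family, labels and open sets as names

      module GenericObjects where
        Rel : M
        Rel = graph I B satF

        -- The ground sets over which the generic objects are evaluated. The products are listed so
        -- that the pairs in them, too, name themselves.
        base : M
        base = ⟨ ω , ⟨ I , ⟨ B , ⟨ Rel , ⟨ I ×ˢ ω , ⟨ ω ×ˢ B , I ×ˢ B ⟩ ⟩ ⟩ ⟩ ⟩ ⟩

        opaque
          A : M
          A = TC.closure base

          A-trans : Trans A
          A-trans = TC.closure-trans base

          base∈A : base ∈ A
          base∈A = TC.self∈ base

        A-fst : ∀ {x y} → ⟨ x , y ⟩ ∈ A → x ∈ A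
        A-fst m = fst∈∈ >>= λ { (u , u∈ , x∈) → A-trans _ (A-trans _ m _ u∈) _ x∈ }
        A-snd : ∀ {x y} → ⟨ x , y ⟩ ∈ A → y ∈ A
        A-snd m = snd∈∈ >>= λ { (u , u∈ , x∈) → A-trans _ (A-trans _ m _ u∈) _ x∈ }

        ω∈A : ω ∈ A
        ω∈A = A-fst base∈A
        I∈A : I ∈ A
        I∈A = A-fst (A-snd base∈A)
        B∈A : B ∈ A
        B∈A = A-fst (A-snd (A-snd base∈A))
        Rel∈A : Rel ∈ A
        Rel∈A = A-fst (A-snd (A-snd (A-snd base∈A)))
        I×ω∈A : I ×ˢ ω ∈ A
        I×ω∈A = A-fst (A-snd (A-snd (A-snd (A-snd base∈A))))
        ω×B∈A : ω ×ˢ B ∈ A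
        ω×B∈A = A-fst (A-snd (A-snd (A-snd (A-snd (A-snd base∈A)))))
        I×B∈A : I ×ˢ B ∈ A
        I×B∈A = A-snd (A-snd (A-snd (A-snd (A-snd (A-snd base∈A)))))

        -- The tag is `A` itself, which foundation keeps out of `A`.
        open ForcingExtension.ExtensionZFC P A ∅ ∅∈P enumM enumM-onto public
          using (_≤ᴾ_; ≤-refl; ≤-trans; leF; _∋[_]_; Eq; eq-refl; eq-sym; eq-mono; eq-cong; Mb; MbF; mb-mono; mb-cong; mb-intro;
                 Forces; forces-mono; g; g∈P; generic; ⊩; _∈ᴳ_; _≈ᴳ_; N; module N; module NS; ∨l; ∨r; truth; truth⇒;
                 mk; mk-intro; mk-elim; N-ext; NS-cong; mem⇐′; ⟦∧⟧; ⟦⇔⟧; ⟦∨⟧; ⟦ex∈⟧; module Pure; N-ZFC)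
        open Pure A A-trans x∉x public

        N-zfc : ∀ {σ} → ZFC σ → NS.⟦ σ ⟧ []
        N-zfc = N-ZFC A A-trans x∉x ω∈A

        dense : (φ : Fm 1) → (∀ p → p ∈ P → ∃ λ r → r ≤ᴾ p × Sat φ (r ∷ [])) → ⊩ λ p → Sat φ (p ∷ [])
        dense φ h n = generic φ λ { (k , inj₁ s) → n (k , s) ; (k , inj₂ no) → h (g k) (g∈P k) λ { (r , r≤ , s) → no r r≤ s } }

        C : ∀ k → Cond (g k)
        C k = proj₁ ∈-P (g∈P k)

        ∀pure : ∀ {S n} → S ∈ A → (φ : Formula (suc n)) → ∀ {e} → (∀ v → v ∈ S → NS.⟦ φ ⟧ (v ∷ e)) → ∀ x → x ∈ᴳ S → NS.⟦ φ ⟧ (x ∷ e)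
        ∀pure S∈ φ {e} h x x∈ = stable {{NS.stable-⟦⟧ φ (x ∷ e)}} λ n → proj₁ (pure-∈ᴳ S∈ x) x∈ λ { (v , v∈ , d) →
          n (NS-cong φ {v ∷ e} {x ∷ e} (λ { zero → d ; (suc i) → N.Q-refl }) (h v v∈)) }

        in-pure : ∀ {S v} → S ∈ A → v ∈ S → v ∈ᴳ S
        in-pure S∈ v∈ = proj₂ (pure-∈ (A-trans _ S∈ _ v∈) S∈) v∈

        Pr : M → M → M → Set
        Pr f x y = NS.⟦ D.Maps 0F 1F 2F ⟧ (f ∷ x ∷ y ∷ [])

        UP : M → M → M → Set
        UP z x y = ∀ u → u ∈ᴳ z ↔ (u ≈ᴳ x or u ≈ᴳ y)

        N-IsUPair : ∀ {n} (z x y : Fin n) {e} → NS.⟦ D.IsUPair z x y ⟧ e ↔ UP (lookup e z) (lookup e x) (lookup e y)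
        N-IsUPair z x y {e} =
          (λ h u → ↔-trans (proj₁ (⟦⇔⟧ (0F D.∈ suc z) (0F D.≐ suc x D.∨ 0F D.≐ suc y) {u ∷ e}) (h u)) (⟦∨⟧ (0F D.≐ suc x) (0F D.≐ suc y) {u ∷ e}))
          , (λ h u → proj₂ (⟦⇔⟧ (0F D.∈ suc z) (0F D.≐ suc x D.∨ 0F D.≐ suc y) {u ∷ e}) (↔-trans (h u) (↔-sym (⟦∨⟧ (0F D.≐ suc x) (0F D.≐ suc y) {u ∷ e}))))

        up-unique : ∀ {z z′ x x′ y y′} → x ≈ᴳ x′ → y ≈ᴳ y′ → UP z x y → UP z′ x′ y′ → z ≈ᴳ z′
        up-unique ex ey h h′ = N-ext λ u → ↔-trans (h u) (↔-trans
          ((λ s → s >>¬ λ { (inj₁ e) → η (inj₁ (N.Q-trans e ex)) ; (inj₂ e) → η (inj₂ (N.Q-trans e ey)) })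
          , (λ s → s >>¬ λ { (inj₁ e) → η (inj₁ (N.Q-trans e (N.Q-sym ex))) ; (inj₂ e) → η (inj₂ (N.Q-trans e (N.Q-sym ey))) })) (↔-sym (h′ u)))

        pure-upair : ∀ {x y} → upair x y ∈ A → UP (upair x y) x y
        pure-upair {x} {y} m u = ↔-trans (pure-∈ᴳ m u)
          ( (λ h → h >>= λ { (v , v∈ , d) → proj₁ (∈-upair v) v∈ >>¬ λ
              { (inj₁ e) → η (inj₁ (N.Q-trans d (proj₂ (pure-≈ᴳ (A-trans _ m _ v∈) (A-trans _ m _ upairˡ)) e)))
              ; (inj₂ e) → η (inj₂ (N.Q-trans d (proj₂ (pure-≈ᴳ (A-trans _ m _ v∈) (A-trans _ m _ upairʳ)) e))) } })
          , (λ h → h >>¬ λ { (inj₁ e) → η (x , upairˡ , e) ; (inj₂ e) → η (y , upairʳ , e) }) )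

        -- Unordered pairs in `A` name themselves, so what the extension takes for the ordered pair
        -- of x and y is the ground one.
        N-Maps : ∀ {f x y} → ⟨ x , y ⟩ ∈ A → Pr f x y ↔ ⟨ x , y ⟩ ∈ᴳ f
        N-Maps {f} {x} {y} m = ↔-trans (⟦ex∈⟧ 0F (D.IsPair 0F 2F 3F) {f ∷ x ∷ y ∷ []})
          ( (λ h → h >>= λ { (z , z∈ , ip) → stable λ n → ip λ a k → k λ b c →
              let (ua , c′) = proj₁ (⟦∧⟧ (D.IsUPair 1F 4F 4F) (D.IsUPair 0F 4F 5F D.∧ D.IsUPair 2F 1F 0F) {e a b z}) c
                  (ub , uz) = proj₁ (⟦∧⟧ (D.IsUPair 0F 4F 5F) (D.IsUPair 2F 1F 0F) {e a b z}) c′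
                  ea = up-unique N.Q-refl N.Q-refl (proj₁ (N-IsUPair 1F 4F 4F {e a b z}) ua) (pure-upair xx∈)
                  eb = up-unique N.Q-refl N.Q-refl (proj₁ (N-IsUPair 0F 4F 5F {e a b z}) ub) (pure-upair xy∈)
              in n (N.E-cong (up-unique ea eb (proj₁ (N-IsUPair 2F 1F 0F {e a b z}) uz) pure-pair) N.Q-refl z∈) })
          , (λ h → η (⟨ x , y ⟩ , h , λ k → k (upair x x) λ k′ → k′ (upair x y)
              (proj₂ (⟦∧⟧ (D.IsUPair 1F 4F 4F) (D.IsUPair 0F 4F 5F D.∧ D.IsUPair 2F 1F 0F) {e (upair x x) (upair x y) ⟨ x , y ⟩})
                ( proj₂ (N-IsUPair 1F 4F 4F {e (upair x x) (upair x y) ⟨ x , y ⟩}) (pure-upair xx∈)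
                , proj₂ (⟦∧⟧ (D.IsUPair 0F 4F 5F) (D.IsUPair 2F 1F 0F) {e (upair x x) (upair x y) ⟨ x , y ⟩})
                  ( proj₂ (N-IsUPair 0F 4F 5F {e (upair x x) (upair x y) ⟨ x , y ⟩}) (pure-upair xy∈)
                  , proj₂ (N-IsUPair 2F 1F 0F {e (upair x x) (upair x y) ⟨ x , y ⟩}) pure-pair ) )))) )
          where
          e : M → M → M → Vec M 6
          e a b z = b ∷ a ∷ z ∷ f ∷ x ∷ y ∷ []
          xx∈ : upair x x ∈ A
          xx∈ = A-trans _ m _ (proj₂ (∈-pair _) (η (inj₁ Q-refl)))
          xy∈ : upair x y ∈ A
          xy∈ = A-trans _ m _ (proj₂ (∈-pair _) (η (inj₂ Q-refl)))
          pure-pair : UP ⟨ x , y ⟩ (upair x x) (upair x y)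
          pure-pair u = ↔-trans (pure-∈ᴳ m u)
            ( (λ h → h >>= λ { (v , v∈ , d) → proj₁ (∈-pair v) v∈ >>¬ λ
                { (inj₁ e) → η (inj₁ (N.Q-trans d (proj₂ (pure-≈ᴳ (A-trans _ m _ v∈) xx∈) e)))
                ; (inj₂ e) → η (inj₂ (N.Q-trans d (proj₂ (pure-≈ᴳ (A-trans _ m _ v∈) xy∈) e))) } })
            , (λ h → h >>¬ λ { (inj₁ e) → η (upair x x , proj₂ (∈-pair _) (η (inj₁ Q-refl)) , e) ; (inj₂ e) → η (upair x y , proj₂ (∈-pair _) (η (inj₂ Q-refl)) , e) }) )

        relF : Fm 3 → Fm 2
        relF θ = ∃̇ (∃̇ (v2 ≈̇ ⟨ v1 , v0 ⟩ᵗ ∧̇ sub θ (1F ∷ 0F ∷ 3F ∷ [])))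

        relᴺ : M → M → Fm 3 → M
        relᴺ X Y θ = mk (X ×ˢ Y) (relF θ)

        rel-spec : ∀ {X Y} θ → X ×ˢ Y ∈ A → (∀ x y p q → p ⊆ q → Sat θ (x ∷ y ∷ p ∷ []) → Sat θ (x ∷ y ∷ q ∷ [])) →
                   ∀ {x y} → x ∈ X → y ∈ Y → Pr (relᴺ X Y θ) x y ↔ ⊩ λ p → Sat θ (x ∷ y ∷ p ∷ [])
        rel-spec {X} {Y} θ X×Y∈ mono {x} {y} x∈ y∈ = ↔-trans (N-Maps xy∈)
          ( (λ h → mk-elim (relF θ) h >>= λ { (k , v , p , (le , _) , d , v∈ , s) n → s λ { (x′ , s) → s λ { (y′ , e , s) →
              let (ex , ey) = pair-inj (Q-trans (proj₁ (pure-≈ᴳ xy∈ (A-trans _ X×Y∈ _ v∈)) (η (k , d))) e) in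
              n (k , mono x y p (g k) (proj₂ le) (cong₃ θ (Q-sym ex) (Q-sym ey) Q-refl s)) } } })
          , (λ h → h >>= λ { (k , s) → mk-intro (relF θ) k (g∈P k) (λ z m → m) (proj₂ pair∈× (x∈ , y∈)) (η (x , η (y , Q-refl , s))) }) )
          where
          xy∈ : ⟨ x , y ⟩ ∈ A
          xy∈ = A-trans _ X×Y∈ _ (proj₂ pair∈× (x∈ , y∈))

        InG : M → Set
        InG z = ⊩ λ p → z ∈ p

        raw : ∀ k {c u v p} → ⟨ ⟨ num k , c ⟩ , ⟨ u , v ⟩ ⟩ ∈ p ↔ atom k c u v ∈ p
        raw k = ∈ˡ (Q-sym atom-def) , ∈ˡ atom-def

        ⊩raw : ∀ n {c u v} → (⊩ λ p → ⟨ ⟨ num n , c ⟩ , ⟨ u , v ⟩ ⟩ ∈ p) ↔ InG (atom n c u v)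
        ⊩raw n = (λ h → h >>¬ λ { (k , m) → η (k , proj₁ (raw n) m) }) , (λ h → h >>¬ λ { (k , m) → η (k , proj₂ (raw n) m) })

        θa : Fm 3
        θa = atomᵗ 0 v1 v0 (con ∅) ∈̇ v2
        θl : M → Fm 3
        θl c = atomᵗ 4 ⟨ v0 , ⟨ con c , v1 ⟩ᵗ ⟩ᵗ (con ∅) (con ∅) ∈̇ v2
        θu : M → Fm 3
        θu α = atomᵗ 2 ⟨ v0 , v1 ⟩ᵗ (con α) (con ∅) ∈̇ v2

        ȧ : M
        ȧ = relᴺ I ω θa
        L̇ : M → M
        L̇ c = relᴺ ω B (θl c)
        u̇ : M → M
        u̇ α = relᴺ ω B (θu α)

        a-spec : ∀ {i m} → i ∈ I → m ∈ ω → Pr ȧ i m ↔ InG (inn i m)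
        a-spec i∈ m∈ = ↔-trans (rel-spec θa I×ω∈A (λ x y p q h m → h _ m) i∈ m∈) (⊩raw 0)

        L-spec : ∀ c {m t} → m ∈ ω → t ∈ B → Pr (L̇ c) m t ↔ InG (lab m ⟨ c , t ⟩)
        L-spec c m∈ t∈ = ↔-trans (rel-spec (θl c) ω×B∈A (λ x y p q h m → h _ m) m∈ t∈) (⊩raw 4)

        u-spec : ∀ α {k t} → k ∈ ω → t ∈ B → Pr (u̇ α) k t ↔ InG (pos α k t)
        u-spec α k∈ t∈ = ↔-trans (rel-spec (θu α) ω×B∈A (λ x y p q h m → h _ m) k∈ t∈) (⊩raw 2)

        R-spec : ∀ {i t} → i ∈ I → t ∈ B → Pr Rel i t ↔ SatR i t
        R-spec i∈ t∈ = ↔-trans (N-Maps it∈) (↔-trans (pure-∈ it∈ Rel∈A) (↔-trans (∈-graph satF) (proj₂ , λ s → (i∈ , t∈) , s)))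
          where it∈ = A-trans _ I×B∈A _ (proj₂ pair∈× (i∈ , t∈))

        both : ∀ {z w} → InG z → InG w → ¬ ¬ Σ ℕ λ k → z ∈ g k × w ∈ g k
        both h h′ n = h λ { (k , m) → h′ λ { (l , m′) → n (k ⊔ l , proj₂ (∨l k l) _ m , proj₂ (∨r k l) _ m′) } }

        -- Beside elements and labelled numbers, the indices k of positive facts [t] ⊆ U_k^α count
        -- as mentioned: a fresh k is one for which a negative fact can be added.
        mentionF : Fm 2
        mentionF = ∃̇ (v1 ≈̇ atomᵗ 0 v2 v0 (con ∅)) ∨̇ (∃̇ (v1 ≈̇ atomᵗ 4 ⟨ v2 , v0 ⟩ᵗ (con ∅) (con ∅)) ∨̇ ∃̇ (∃̇ (v2 ≈̇ atomᵗ 2 ⟨ v3 , v0 ⟩ᵗ v1 (con ∅))))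

        Mentions : M → M → Set
        Mentions p m = ∃ (λ j → inn j m ∈ p) or (∃ (λ l → lab m l ∈ p) or ∃ λ α → ∃ λ t → pos α m t ∈ p)

        opaque
          unfolding atom
          mention-bound : ∀ {p} → Fin′ p → ∃ λ n → n ∈ ω × (∀ m → m ∈ ω → Mentions p m → m ∈ n)
          mention-bound {p} f = fin-bounded (fin-⊆ (fin-repl mentionF (λ z m m′ _ → fn z m m′) f) (λ z m → proj₁ (proj₁ (∈-∩ z) m)))
              (λ z m → proj₂ (proj₁ (∈-∩ {repl p mentionF} {ω} z) m)) >>¬ λ { (n , n∈ , h) → η (n , n∈ , λ m m∈ k → h m (proj₂ (∈-∩ m) (proj₂ (∈-repl mentionF (λ z m m′ _ → fn z m m′) m) (men m k) , m∈))) }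
            where
            men : ∀ m → Mentions p m → ∃ λ z → z ∈ p × Sat mentionF (z ∷ m ∷ [])
            men m k = k >>¬ λ
              { (inj₁ h) → h >>¬ λ { (j , m∈) → η (_ , m∈ , η (inj₁ (η (j , Q-refl)))) }
              ; (inj₂ h) → h >>¬ λ
                { (inj₁ h) → h >>¬ λ { (l , m∈) → η (_ , m∈ , η (inj₂ (η (inj₁ (η (l , Q-refl)))))) }
                ; (inj₂ h) → h >>¬ λ { (α , h) → h >>¬ λ { (t , m∈) → η (_ , m∈ , η (inj₂ (η (inj₂ (η (α , η (t , Q-refl))))))) } } } }
            c : ∀ {a b c c′ u u′ v v′ z} → z ≈ atom a c u v → z ≈ atom b c′ u′ v′ → a ≡ b × c ≈ c′
            c e e′ = let (x , y , _) = atom-inj (Q-trans (Q-sym e) e′) in x , y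
            fn : ∀ z m m′ → Sat mentionF (z ∷ m ∷ []) → Sat mentionF (z ∷ m′ ∷ []) → m ≈ m′
            fn z m m′ h h′ = h >>= λ
              { (inj₁ h) → h >>= λ { (j , e) → h′ >>= λ
                  { (inj₁ h′) → h′ >>= λ { (j′ , e′) → proj₂ (c {0} {0} e e′) }
                  ; (inj₂ h′) → h′ >>= λ { (inj₁ h′) → h′ >>= λ { (l , e′) → ⊥-elim (z04 (proj₁ (c {0} {4} e e′))) } ; (inj₂ h′) → h′ >>= λ { (α , h′) → h′ >>= λ { (t , e′) → ⊥-elim (z02 (proj₁ (c {0} {2} e e′))) } } } } }
              ; (inj₂ h) → h >>= λ
                { (inj₁ h) → h >>= λ { (l , e) → h′ >>= λ
                  { (inj₁ h′) → h′ >>= λ { (j , e′) → ⊥-elim (z04 (proj₁ (c {0} {4} e′ e))) }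
                  ; (inj₂ h′) → h′ >>= λ { (inj₁ h′) → h′ >>= λ { (l′ , e′) → proj₁ (pair-inj (proj₂ (c {4} {4} e e′))) } ; (inj₂ h′) → h′ >>= λ { (α , h′) → h′ >>= λ { (t , e′) → ⊥-elim (z42 (proj₁ (c {4} {2} e e′))) } } } } }
                ; (inj₂ h) → h >>= λ { (α , h) → h >>= λ { (t , e) → h′ >>= λ
                  { (inj₁ h′) → h′ >>= λ { (j , e′) → ⊥-elim (z02 (proj₁ (c {0} {2} e′ e))) }
                  ; (inj₂ h′) → h′ >>= λ { (inj₁ h′) → h′ >>= λ { (l′ , e′) → ⊥-elim (z42 (proj₁ (c {4} {2} e′ e))) } ; (inj₂ h′) → h′ >>= λ { (α′ , h′) → h′ >>= λ { (t′ , e′) → proj₁ (pair-inj (proj₂ (c {2} {2} e e′))) } } } } } } } }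
              where
              z04 : ¬ 0 ≡ 4
              z04 ()
              z02 : ¬ 0 ≡ 2
              z02 ()
              z42 : ¬ 4 ≡ 2
              z42 ()

        fresh : ∀ {p n} → Fin′ p → n ∈ ω → ∃ λ m → m ∈ ω × m ∉ n × ¬ Mentions p m
        fresh {p} {n} f n∈ = mention-bound f >>¬ λ { (b , b∈ , h) → ω-max n∈ b∈ >>¬ λ { (m , m∈ , n⊆ , b⊆) →
          η (m , m∈ , (λ k → x∉x (n⊆ m k)) , λ k → x∉x (b⊆ m (h m m∈ k))) } }

      -- The clauses of the combinatorial statement that follow from one-step extensions

      module GroundFacts where
        open GenericObjects public

        e₇ : Vec M 7
        e₇ = L̇ (num 0) ∷ L̇ (num 1) ∷ ȧ ∷ Rel ∷ B ∷ I ∷ ω ∷ []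

        N-least : NS.⟦ Ψ.least ⟧ e₇
        N-least = N-Inductive ω∈A

        ω-cases : ∀ n → n ∈ ω → n ≈ ∅ or ∃ λ m → m ∈ ω × n ≈ suc̆ m
        ω-cases = ω-ind (v0 ≈̇ con ∅ ∨̇ ∃̇ (v0 ∈̇ con ω ∧̇ v1 ≈̇ +̂-op [ v0 · v0 ])) (η (inj₁ Q-refl)) λ n n∈ _ → η (inj₂ (η (n , n∈ , Q-refl)))

        ω⊆A : ∀ {n} → n ∈ ω → n ∈ A
        ω⊆A m = A-trans ω ω∈A _ m

        pure-suc : ∀ {n} → n ∈ ω → ∀ u → u ∈ᴳ suc̆ n ↔ (u ∈ᴳ n or u ≈ᴳ n)
        pure-suc {n} n∈ u =
          (λ h → proj₁ (pure-∈ᴳ (ω⊆A (suc∈ω n∈)) u) h >>= λ { (v , m , d) → proj₁ (∈-+̂ v) m >>¬ λ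
            { (inj₁ v∈) → η (inj₁ (proj₂ (pure-∈ᴳ (ω⊆A n∈) u) (η (v , v∈ , d))))
            ; (inj₂ e) → η (inj₂ (N.Q-trans d (proj₂ (pure-≈ᴳ (A-trans _ (ω⊆A (suc∈ω n∈)) v m) (ω⊆A n∈)) e))) } })
          , (λ h → h >>= λ
            { (inj₁ m) → proj₁ (pure-∈ᴳ (ω⊆A n∈) u) m >>= λ { (v , v∈ , d) → proj₂ (pure-∈ᴳ (ω⊆A (suc∈ω n∈)) u) (η (v , +̂-old v∈ , d)) }
            ; (inj₂ d) → proj₂ (pure-∈ᴳ (ω⊆A (suc∈ω n∈)) u) (η (n , +̂-new , d)) })

        -- Consider the conditions for which some n is forced out of x while all smaller numbers are
        -- forced in. Entering this set contradicts inductiveness at n; if it is avoided from some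
        -- `g k` on, induction shows that `g k` forces every number into x.
        N-minimal : NS.⟦ Ψ.minimal ⟧ e₇
        N-minimal x ind = ∀pure ω∈A (0F D.∈ 1F) {x ∷ e₇} λ n n∈ → stable λ n∉ → generic φ λ
          { (k , inj₁ h) → h λ { (n , n∈ , no , below) → ω-cases n n∈ λ
              { (inj₁ e) → x∌ k no (N.E-cong (N.Q-sym (proj₂ (pure-≈ᴳ (ω⊆A n∈) (ω⊆A 0∈ω)) e)) N.Q-refl zero∈)
              ; (inj₂ s) → s λ { (m , m∈ , e) → x∌ k no (N.E-cong (N.Q-sym (proj₂ (pure-≈ᴳ (ω⊆A n∈) (ω⊆A (suc∈ω m∈))) e)) N.Q-refl
                  (suc∈ m∈ (η (k , below m (∈ʳ (Q-sym e) +̂-new))))) } } }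
          ; (k , inj₂ no) → n∉ (η (k , all-in k no n n∈)) }
          where
          inds = proj₁ (⟦∧⟧ (D.ex∈ 0F (D.IsEmpty 0F)) (D.all∈ 0F (D.ex∈ 1F (D.IsSucc 0F 1F))) {x ∷ e₇}) ind
          zero∈ : ∅ ∈ᴳ x
          zero∈ = proj₁ (⟦ex∈⟧ 0F (D.IsEmpty 0F) {x ∷ e₇}) (proj₁ inds) >>= λ { (z , z∈ , emp) →
            N.E-cong (N-ext λ u → (λ m → ⊥-elim (emp u m)) , λ m → ⊥-elim (proj₁ (pure-∈ᴳ (ω⊆A 0∈ω) u) m λ { (v , v∈ , _) → ∉∅ v∈ })) N.Q-refl z∈ }
          suc∈ : ∀ {m} → m ∈ ω → m ∈ᴳ x → suc̆ m ∈ᴳ x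
          suc∈ {m} m∈ mx = proj₁ (⟦ex∈⟧ 1F (D.IsSucc 0F 1F) {m ∷ x ∷ e₇}) (proj₂ inds m mx) >>= λ { (s , s∈ , is) →
            N.E-cong (N-ext λ u → ↔-trans (↔-trans (proj₁ (⟦⇔⟧ (0F D.∈ 1F) (0F D.∈ 2F D.∨ 0F D.≐ 2F) {u ∷ s ∷ m ∷ x ∷ e₇}) (is u))
              (⟦∨⟧ (0F D.∈ 2F) (0F D.≐ 2F) {u ∷ s ∷ m ∷ x ∷ e₇})) (↔-sym (pure-suc m∈ u))) N.Q-refl s∈ }
          φ : Fm 1
          φ = ∃̇ (v0 ∈̇ con ω ∧̇ ∀̇ (sub leF (0F ∷ 2F ∷ []) ⇒̇ lt (con x) (¬̇ sub MbF (1F ∷ 2F ∷ 0F ∷ []))) ∧̇ ∀̇ (v0 ∈̇ v1 ⇒̇ lt (con x) (sub MbF (3F ∷ 1F ∷ 0F ∷ []))))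
          x∌ : ∀ k {n} → (∀ r → r ≤ᴾ g k → ¬ Mb r n x) → ¬ n ∈ᴳ x
          x∌ k no h = h λ { (l , m) → no (g (k ⊔ l)) (∨l k l) (mb-mono (∨r k l) m) }
          all-in : ∀ k → (∀ r → r ≤ᴾ g k → ¬ Sat φ (r ∷ [])) → ∀ n → n ∈ ω → Mb (g k) n x
          all-in k no = ∈-ind (v0 ∈̇ con ω ⇒̇ lt (con (g k)) (lt (con x) (sub MbF (1F ∷ 2F ∷ 0F ∷ [])))) λ n ih n∈ q q≤ → stable λ bad →
            no q q≤ (η (n , n∈ , (λ r r≤ m → m r (≤-refl (proj₁ r≤)) λ { (s , s≤ , h) → bad (η (s , ≤-trans s≤ r≤ , h)) })
              , λ m m∈ → mb-mono q≤ (ih m m∈ (ω-down n n∈ m m∈))))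

        N-nat⊆I : NS.⟦ Ψ.nat⊆I ⟧ e₇
        N-nat⊆I = ∀pure ω∈A (0F D.∈ 6F) {e₇} λ n n∈ → in-pure I∈A (B⊆I n (ω⊆ n n∈))

        same-label : ∀ {m l l′} → InG (lab m l) → InG (lab m l′) → l ≈ l′
        same-label h h′ = both h h′ >>= λ { (k , a , b) → fun (C k) _ _ _ a b }

        B⊆A : ∀ {t} → t ∈ B → t ∈ A
        B⊆A m = A-trans _ B∈A _ m

        N-labelFun₁ : NS.⟦ Ψ.labelFun 1F ⟧ e₇
        N-labelFun₁ = ∀pure ω∈A (Ψ.labelFun₁ 1F) {e₇} λ m m∈ → ∀pure B∈A (Ψ.labelFun₂ 1F) {m ∷ e₇} λ t t∈ → ∀pure B∈A (Ψ.labelFun₃ 1F) {t ∷ m ∷ e₇} λ t′ t′∈ h h′ →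
          proj₂ (pure-≈ᴳ (B⊆A t∈) (B⊆A t′∈)) (proj₂ (pair-inj (same-label (proj₁ (L-spec (num 1) m∈ t∈) h) (proj₁ (L-spec (num 1) m∈ t′∈) h′))))

        N-labelFun₀ : NS.⟦ Ψ.labelFun 0F ⟧ e₇
        N-labelFun₀ = ∀pure ω∈A (Ψ.labelFun₁ 0F) {e₇} λ m m∈ → ∀pure B∈A (Ψ.labelFun₂ 0F) {m ∷ e₇} λ t t∈ → ∀pure B∈A (Ψ.labelFun₃ 0F) {t ∷ m ∷ e₇} λ t′ t′∈ h h′ →
          proj₂ (pure-≈ᴳ (B⊆A t∈) (B⊆A t′∈)) (proj₂ (pair-inj (same-label (proj₁ (L-spec (num 0) m∈ t∈) h) (proj₁ (L-spec (num 0) m∈ t′∈) h′))))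

        N-labelDisj : NS.⟦ Ψ.labelDisj ⟧ e₇
        N-labelDisj = ∀pure ω∈A Ψ.labelDisj₁ {e₇} λ m m∈ → ∀pure B∈A Ψ.labelDisj₂ {m ∷ e₇} λ t t∈ → ∀pure B∈A Ψ.labelDisj₃ {t ∷ m ∷ e₇} λ t′ t′∈ h h′ →
          suc≢∅ (proj₁ (pair-inj (same-label (proj₁ (L-spec (num 1) m∈ t∈) h) (proj₁ (L-spec (num 0) m∈ t′∈) h′))))

        dense-label : ∀ c {i t n} → c ∈ B → i ∈ I → t ∈ B → n ∈ ω → ⊩ λ p → ∃ λ m → m ∈ ω × m ∉ n × inn i m ∈ p × lab m ⟨ c , t ⟩ ∈ p
        dense-label c {i} {t} {n} c∈ i∈ t∈ n∈ = dense φ (λ p p∈ → extend p (proj₁ ∈-P p∈))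
          >>¬ λ { (k , h) → η (k , (h >>¬ λ { (m , a , b , c , d) → η (m , a , b , proj₁ (raw 0) c , proj₁ (raw 4) d) })) }
          where
          φ : Fm 1
          φ = ∃̇ (v0 ∈̇ con ω ∧̇ ¬̇ v0 ∈̇ con n ∧̇ atomᵗ 0 v0 (con i) (con ∅) ∈̇ v1 ∧̇ atomᵗ 4 ⟨ v0 , con ⟨ c , t ⟩ ⟩ᵗ (con ∅) (con ∅) ∈̇ v1)
          extend : ∀ p → Cond p → ∃ λ r → r ≤ᴾ p × Sat φ (r ∷ [])
          extend p Cp ret = fresh (p-fin Cp) n∈ λ { (m , m∈ , m∉ , no) →
            ret (p +̂ inn i m +̂ lab m ⟨ c , t ⟩ , (proj₂ ∈-P (add-label Cp i∈ m∈ (pair∈ c∈ t∈) (λ j h → no (η (inj₁ (η (j , h))))) λ l h → no (η (inj₂ (η (inj₁ (η (l , h))))))) , λ z h → +̂-old (+̂-old h)) ,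
              η (m , m∈ , m∉ , proj₂ (raw 0) (+̂-old +̂-new) , proj₂ (raw 4) +̂-new)) }

        not-in : ∀ {m n} → m ∈ ω → n ∈ ω → m ∉ n → ¬ m ∈ᴳ n
        not-in m∈ n∈ m∉ h = m∉ (proj₁ (pure-∈ (ω⊆A m∈) (ω⊆A n∈)) h)

        N-meets₁ : NS.⟦ Ψ.meets 1F ⟧ e₇
        N-meets₁ = ∀pure I∈A (Ψ.meets₁ 1F) {e₇} λ i i∈ → ∀pure B∈A (Ψ.meets₂ 1F) {i ∷ e₇} λ t t∈ → ∀pure ω∈A (Ψ.meets₃ 1F) {t ∷ i ∷ e₇} λ n n∈ no →
          dense-label (num 1) (num∈B 1) i∈ t∈ n∈ λ { (k , h) → h λ { (m , m∈ , m∉ , a , l) →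
            no m (in-pure ω∈A m∈) (not-in m∈ n∈ m∉) (proj₂ (a-spec i∈ m∈) (η (k , a))) (proj₂ (L-spec (num 1) m∈ t∈) (η (k , l))) } }

        N-meets₀ : NS.⟦ Ψ.meets 0F ⟧ e₇
        N-meets₀ = ∀pure I∈A (Ψ.meets₁ 0F) {e₇} λ i i∈ → ∀pure B∈A (Ψ.meets₂ 0F) {i ∷ e₇} λ t t∈ → ∀pure ω∈A (Ψ.meets₃ 0F) {t ∷ i ∷ e₇} λ n n∈ no →
          dense-label (num 0) (num∈B 0) i∈ t∈ n∈ λ { (k , h) → h λ { (m , m∈ , m∉ , a , l) →
            no m (in-pure ω∈A m∈) (not-in m∈ n∈ m∉) (proj₂ (a-spec i∈ m∈) (η (k , a))) (proj₂ (L-spec (num 0) m∈ t∈) (η (k , l))) } }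

        dense-prom : ∀ {i j} → i ∈ I → j ∈ I → ⊩ λ p → ∃ λ n → n ∈ ω × prom i j n ∈ p
        dense-prom {i} {j} i∈ j∈ = dense φ (λ p p∈ ret → let Cp = proj₁ ∈-P p∈ in mention-bound (p-fin Cp) λ { (n , n∈ , h) →
            ret (p +̂ prom i j n , (proj₂ ∈-P (add-prom Cp i∈ j∈ n∈ λ m a → h m (proj₂ (dom Cp i m a)) (η (inj₁ (η (i , a))))) , λ z → +̂-old) , η (n , n∈ , proj₂ (raw 1) +̂-new)) })
          >>¬ λ { (k , h) → η (k , (h >>¬ λ { (n , a , b) → η (n , a , proj₁ (raw 1) b) })) }
          where
          φ : Fm 1
          φ = ∃̇ (v0 ∈̇ con ω ∧̇ atomᵗ 1 v0 (con i) (con j) ∈̇ v1)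

        N-ad : NS.⟦ Ψ.ad ⟧ e₇
        N-ad = ∀pure I∈A Ψ.ad₁ {e₇} λ i i∈ → ∀pure I∈A Ψ.ad₂ {i ∷ e₇} λ j j∈ i≢j no → dense-prom i∈ j∈ λ { (k , h) → h λ { (n , n∈ , pr) →
          no n (in-pure ω∈A n∈) (∀pure ω∈A Ψ.ad₄ {n ∷ j ∷ i ∷ e₇} λ m m∈ hi hj →
            both (proj₁ (a-spec i∈ m∈) hi) (proj₁ (a-spec j∈ m∈) hj) >>= λ { (l , mi , mj) →
            ad (C (k ⊔ l)) i j m n (proj₂ (∨r k l) _ mi) (proj₂ (∨r k l) _ mj) (proj₂ (∨l k l) _ pr) >>= λ
              { (inj₁ e) → ⊥-elim (i≢j (proj₂ (pure-≈ᴳ (A-trans _ I∈A _ i∈) (A-trans _ I∈A _ j∈)) e))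
              ; (inj₂ m∈n) → proj₂ (pure-∈ (ω⊆A m∈) (ω⊆A n∈)) m∈n } }) } }

        N-topLabel : NS.⟦ Ψ.topLabel ⟧ e₇
        N-topLabel no = no ⟨ ∅ , ∅ ⟩ (in-pure B∈A t∈) (∀pure I∈A (D.Maps 5F 0F 1F) {⟨ ∅ , ∅ ⟩ ∷ e₇} λ i i∈ →
          -- `⟨ ∅ , ∅ ⟩` describes all of `I`, since i ∩ ∅ = ∅.
          proj₂ (R-spec i∈ t∈) (η (∅ , η (∅ , Q-refl , empty λ z m → ∉∅ (proj₂ (proj₁ (∈-∩ z) m))))))
          where
          t∈ : ⟨ ∅ , ∅ ⟩ ∈ B
          t∈ = pair∈ (num∈B 0) (num∈B 0)

      -- Every subset of I in the extension has a code

      module Coding where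
        open GroundFacts

        At⊆H : At ⊆ H
        At⊆H z m = proj₁ (∈-× z) m >>= λ { (c , h) → h >>= λ { (y , e , c∈ , y∈) → proj₁ (∈-× y) y∈ >>= λ { (u , h) → h >>= λ { (v , e′ , u∈ , v∈) →
          ∈ˡ (Q-sym (Q-trans e (pair-cong Q-refl e′))) (H-pair (B⊆H c c∈) (H-pair u∈ v∈)) } } } }

        P⊆H : P ⊆ H
        P⊆H p p∈ = let Cp = proj₁ ∈-P p∈ in H-fin (p-fin Cp) λ z m → At⊆H z (p-At Cp z m)

        separate₁ : ∀ {i j} → i ∈ I → j ∈ I → ¬ i ≈ j → ∃ λ b → b ∈ B × ¬ (b ∈ i ↔ b ∈ j)
        separate₁ {i} {j} i∈ j∈ i≢j ret = i≢j (ext⊆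
          (λ b m → stable λ n → ret (b , proj₁ (∈-𝒫 i) i∈ b m , λ h → n (proj₁ h m)))
          (λ b m → stable λ n → ret (b , proj₁ (∈-𝒫 j) j∈ b m , λ h → n (proj₂ h m))))

        agree-⊆ : ∀ {i j F F′} → F ⊆ F′ → i ∩ F′ ≈ j ∩ F′ → i ∩ F ≈ j ∩ F
        agree-⊆ h e = ext λ z →
          (λ m → let (a , b) = proj₁ (∈-∩ z) m in proj₂ (∈-∩ z) (proj₁ (proj₁ (∈-∩ z) (∈ʳ e (proj₂ (∈-∩ z) (a , h z b)))) , b))
          , (λ m → let (a , b) = proj₁ (∈-∩ z) m in proj₂ (∈-∩ z) (proj₁ (proj₁ (∈-∩ z) (∈ʳ (Q-sym e) (proj₂ (∈-∩ z) (a , h z b)))) , b))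

        agree-∈ : ∀ {i j F b} → i ∩ F ≈ j ∩ F → b ∈ F → b ∈ i ↔ b ∈ j
        agree-∈ e b∈ = (λ m → proj₁ (proj₁ (∈-∩ _) (∈ʳ e (proj₂ (∈-∩ _) (m , b∈))))) , (λ m → proj₁ (proj₁ (∈-∩ _) (∈ʳ (Q-sym e) (proj₂ (∈-∩ _) (m , b∈)))))

        module Separate (α k i r : M) (Cr : Cond r) (i∈ : i ∈ I) (i-new : ¬ neg α k i ∈ r) where
          sepF′ : Fm 1
          sepF′ = ∃̇ (v0 ∈̇ con B ∧̇ ∀̇ (atomᵗ 3 (con k) (con α) v0 ∈̇ v2 ⇒̇ ¬̇ ∩-op [ con i · v1 ] ≈̇ ∩-op [ v0 · v1 ]))

          step : ∀ q x → q ⊆ r → x ∈ r → Sat sepF′ (q ∷ []) → Sat sepF′ (q +̂ x ∷ [])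
          step q x q⊆ x∈ ih ret = ih λ { (F , F∈ , h) → lem {∃ λ j → x ≈ neg α k j} λ
            { (inj₁ e) → e λ { (j , e) →
                separate₁ i∈ (proj₁ (legal Cr α k j (∈ˡ e x∈))) (λ i≈j → i-new (∈ˡ (Q-trans e (atom-cong 3 Q-refl Q-refl (Q-sym i≈j))) x∈)) λ { (b , b∈ , d) →
                ret (F ∪ sing b , ∪∈ F∈ (fin∈ fin-sing λ z m → ∈ˡ (Q-sym (proj₁ (∈-sing z) m)) b∈) , λ j′ m eq → proj₁ (∈-+̂ _) m λ
                  { (inj₁ m) → h j′ m (agree-⊆ ∪ˡ eq)
                  ; (inj₂ e′) → d (agree-∈ (Q-trans eq (Op.cong ∩-op (proj₂ (proj₂ (proj₂ (atom-inj {3} {3} (Q-trans (Q-trans (atom-def {3}) e′) e))))) Q-refl)) (∪ʳ b (proj₂ (∈-sing b) Q-refl))) }) } }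
            ; (inj₂ n) → ret (F , F∈ , λ j′ m → proj₁ (∈-+̂ _) m >>= λ
                { (inj₁ m) → h j′ m ; (inj₂ e′) → ⊥-elim (n (η (j′ , Q-trans (Q-sym e′) (Q-sym (atom-def {3}))))) }) } }

          -- Only finitely many j occur in facts j ∉ U_k^α of r, all of them different from i. One
          -- point of B distinguishing i from each such j is put into F.
          separated : ∃ λ F → F ∈ B × (∀ j → neg α k j ∈ r → ¬ i ∩ F ≈ j ∩ F)
          separated = fin-ind sepF′ (p-fin Cr) (η (∅ , num∈B 0 , λ j m → ⊥-elim (∉∅ m))) step >>¬ λ { (F , F∈ , h) → η (F , F∈ , λ j m → h j (proj₂ (raw 3 {k} {α} {j}) m)) }

          extended : α ∈ H → k ∈ ω → ∃ λ t → t ∈ B × SatR i t × Cond (r +̂ pos α k t)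
          extended α∈ k∈ ret = separated λ { (F , F∈ , h) →
            let t∈ = pair∈ F∈ (sub∈ (λ z m → proj₂ (proj₁ (∈-∩ {i} {F} z) m)) F∈) in
            ret (⟨ F , i ∩ F ⟩ , t∈ , η (F , η (i ∩ F , Q-refl , Q-refl)) , add-pos Cr α∈ k∈ t∈ λ j m s → s λ { (F′ , s) → s λ { (x , e , e′) →
              let (eF , ex) = pair-inj e in h j m (Q-trans ex (Q-trans (Q-sym e′) (Op.cong ∩-op Q-refl (Q-sym eF)))) } }) }

        -- α is a maximal set of pairwise "incompatible" pairs ⟨i,q⟩ with q ⊩ i ∉ Y.
        module Code (Y : M) where
          outF : Fm 1
          outF = ∃̇ (∃̇ (v2 ≈̇ ⟨ v1 , v0 ⟩ᵗ ∧̇ ∀̇ (sub leF (0F ∷ 1F ∷ []) ⇒̇ lt (con Y) (¬̇ sub MbF (1F ∷ 3F ∷ 0F ∷ [])))))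

          Out : M
          Out = sep (I ×ˢ P) outF

          out-intro : ∀ {i q} → i ∈ I → q ∈ P → (∀ r → r ≤ᴾ q → ¬ Mb r i Y) → ⟨ i , q ⟩ ∈ Out
          out-intro {i} {q} i∈ q∈ h = proj₂ (∈-sep outF _) (proj₂ pair∈× (i∈ , q∈) , η (i , η (q , Q-refl , h)))

          mb-≈ : ∀ {r i i′} → i ≈ i′ → Mb r i Y → Mb r i′ Y
          mb-≈ {r} {i} {i′} e = cong₃ MbF Q-refl e Q-refl

          out-elim : ∀ {i q} → ⟨ i , q ⟩ ∈ Out → (i ∈ I × q ∈ P) × (∀ r → r ≤ᴾ q → ¬ Mb r i Y)
          out-elim {i} {q} m = let (a , h) = proj₁ (∈-sep outF _) m in proj₁ pair∈× a , λ r r≤ mb → h λ { (i′ , h) → h λ { (q′ , e , h) →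
            let (ei , eq) = pair-inj e in h r (proj₁ r≤ , λ z z∈ → proj₂ r≤ z (∈ʳ (Q-sym eq) z∈)) (mb-≈ ei mb) } }

          ρ : Fm 2
          ρ = ∀̇ (∀̇ (∀̇ (∀̇ (var 4F ≈̇ ⟨ v3 , v2 ⟩ᵗ ⇒̇ var 5F ≈̇ ⟨ v3 , v1 ⟩ᵗ ⇒̇ v0 ∈̇ con P ⇒̇ 2F ⊆̇ 0F ⇒̇ 1F ⊆̇ 0F ⇒̇ var 4F ≈̇ var 5F))))

          module WithCode (α : M) (α⊆ : α ⊆ Out) (clique : MaximalClique.Clique Out ρ α)
                          (mx : ∀ w → w ∈ Out → (∀ w′ → w′ ∈ α → MaximalClique.R Out ρ w w′) → w ∈ α) where

            qF : M → Fm 1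
            qF i = ⟨ con i , v0 ⟩ᵗ ∈̇ con α

            slice-small : ∀ i → ≤B.IsSmall (sep P (qF i))
            slice-small i = chain-condition _ (λ q m → proj₁ (proj₁ (∈-sep (qF i) q) m)) λ p q r p∈ q∈ r∈ p⊆ q⊆ →
              proj₂ (pair-inj (clique ⟨ i , p ⟩ ⟨ i , q ⟩ (proj₂ (proj₁ (∈-sep (qF i) p) p∈)) (proj₂ (proj₁ (∈-sep (qF i) q) q∈)) i p q r Q-refl Q-refl r∈ p⊆ q⊆))

            α-pair : ∀ w → w ∈ α → ∃ λ i → ∃ λ q → w ≈ ⟨ i , q ⟩ × i ∈ I × q ∈ P
            α-pair w m = proj₁ (∈-× w) (proj₁ (proj₁ (∈-sep outF w) (α⊆ w m)))

            φ : Fm 2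
            φ = ∃̇ (v2 ≈̇ ⟨ v1 , v0 ⟩ᵗ)

            -- Here the chain condition pays off: for each i the conditions paired with i form an
            -- antichain, hence number at most |B|, so α has size at most |I|.
            α∈H : α ∈ H
            α∈H = H-closed (λ w m → α-pair w m >>= λ { (i , h) → h >>= λ { (q , e , i∈ , q∈) → ∈ˡ (Q-sym e) (H-pair (I⊆H i i∈) (P⊆H q q∈)) } })
              (≤I.small-⋃ φ ≤I.small-self
                (λ i i∈ → ≤I.small-img (v1 ≈̇ ⟨ con i , v0 ⟩ᵗ) (≤B⇒≤I (slice-small i)) (λ q w w′ _ e e′ → Q-trans e (Q-sym e′))
                  λ w m → let (w∈ , h) = proj₁ (∈-sep (lt (con i) (sub φ (0F ∷ 1F ∷ []))) w) m in h >>¬ λ { (q , e) →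
                    let iq∈ = ∈ˡ e w∈ in η (q , proj₂ (∈-sep (qF i) q) (proj₂ (proj₁ (out-elim (α⊆ _ iq∈))) , iq∈) , e) })
                λ w m → α-pair w m >>¬ λ { (i , h) → h >>¬ λ { (q , e , i∈ , _) → η (i , i∈ , η (q , e)) } })

            -- A fact i ∉ U_k^α in a condition that forces i ∈ Y would be legal through some q
            -- forcing i ∉ Y. So there is none, and a clopen set around i can be put into U_k^α.
            inside : ∀ {i k} → i ∈ I → k ∈ ω → i ∈ᴳ Y → ⊩ λ p → ∃ λ t → t ∈ B × SatR i t × pos α k t ∈ p
            inside {i} {k} i∈ k∈ i∈Y ret = i∈Y λ { (l , mb) → generic ψ λ
              { (l′ , inj₁ h) → ret (l′ , λ n → h λ { (t , t∈ , s , m) → n (t , t∈ , s , proj₁ (raw 2) m) })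
              ; (l′ , inj₂ no) → Separate.extended α k i (g (l ⊔ l′)) (C (l ⊔ l′)) i∈
                  (λ m → proj₂ (legal (C (l ⊔ l′)) α k i m) λ { (q , q⊆ , q∈) → proj₂ (out-elim (α⊆ _ q∈)) (g (l ⊔ l′)) (g∈P (l ⊔ l′) , q⊆) (mb-mono (∨l l l′) mb) })
                  α∈H k∈ λ { (t , t∈ , s , Cs) → no (g (l ⊔ l′) +̂ pos α k t) (≤-trans (proj₂ ∈-P Cs , λ z → +̂-old) (∨r l l′))
                    (η (t , t∈ , s , proj₂ (raw 2) +̂-new)) } } }
              where
              ψ : Fm 1
              ψ = ∃̇ (v0 ∈̇ con B ∧̇ lt (con i) (sub satF (0F ∷ 1F ∷ [])) ∧̇ atomᵗ 2 ⟨ con k , v0 ⟩ᵗ (con α) (con ∅) ∈̇ v1)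

            -- Maximality of α: if r were incompatible with every q paired with i, then ⟨i,r⟩ would
            -- itself belong to α.
            compatible : ∀ {i r} → i ∈ I → r ∈ P → (∀ s → s ≤ᴾ r → ¬ Mb s i Y) → ∃ λ q → ∃ λ s → ⟨ i , q ⟩ ∈ α × s ≤ᴾ r × q ⊆ s
            compatible {i} {r} i∈ r∈ no ret = ret (r , η (r , ir∈ , ≤-refl r∈ , λ z m → m))
              where
              ir∈ : ⟨ i , r ⟩ ∈ α
              ir∈ = mx ⟨ i , r ⟩ (out-intro i∈ r∈ no) λ w w∈ j q q′ s e e′ s∈ q⊆ q′⊆ → let (ei , er) = pair-inj e in ⊥-elim
                (ret (q′ , η (s , ∈ˡ (Q-trans e′ (pair-cong (Q-sym ei) Q-refl)) w∈ , (s∈ , λ z m → q⊆ z (∈ʳ er m)) , q′⊆)))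

            -- A condition forcing i ∉ Y extends to one that includes some q with ⟨i,q⟩ ∈ α, which
            -- legalizes i ∉ U_k^α; a fresh k is chosen so that no positive fact stands against it.
            outside : ∀ {i} → i ∈ I → ¬ i ∈ᴳ Y → ∃ λ k → k ∈ ω × InG (neg α k i)
            outside {i} i∈ i∉Y ret = generic χ λ
              { (l , inj₁ mb) → i∉Y (η (l , mb))
              ; (l , inj₂ no) → generic ψ λ
                { (l′ , inj₁ h) → h λ { (k , k∈ , m) → ret (k , k∈ , η (l′ , proj₁ (raw 3) m)) }
                ; (l′ , inj₂ no′) → compatible i∈ (g∈P (l ⊔ l′)) (λ s s≤ → no s (≤-trans s≤ (∨l l l′))) λ { (q , h) → h λ { (s , q∈ , s≤ , q⊆) →
                    fresh (p-fin (proj₁ ∈-P (proj₁ s≤))) 0∈ω λ { (k , k∈ , _ , nm) →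
                    no′ (s +̂ neg α k i) (≤-trans (proj₂ ∈-P (add-neg (proj₁ ∈-P (proj₁ s≤)) α∈H k∈ i∈ (λ t m → nm (η (inj₂ (η (inj₂ (η (α , η (t , m)))))))) q⊆ q∈) , λ z → +̂-old)
                      (≤-trans s≤ (∨r l l′))) (η (k , k∈ , proj₂ (raw 3) +̂-new)) } } } } }
              where
              χ ψ : Fm 1
              χ = lt (con i) (lt (con Y) (sub MbF (2F ∷ 1F ∷ 0F ∷ [])))
              ψ = ∃̇ (v0 ∈̇ con ω ∧̇ atomᵗ 3 v0 (con α) (con i) ∈̇ v1)

            covers : ∀ {i} → i ∈ I → i ∈ᴳ Y → NS.⟦ Ψ.covered ⟧ (i ∷ u̇ α ∷ Y ∷ e₇)
            covers {i} i∈ i∈Y = ∀pure ω∈A Ψ.covered₄ {i ∷ u̇ α ∷ Y ∷ e₇} λ k k∈ no → inside i∈ k∈ i∈Y λ { (l , h) → h λ { (t , t∈ , s , m) →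
              no t (in-pure B∈A t∈) (proj₂ (R-spec i∈ t∈) s) (proj₂ (u-spec α k∈ t∈) (η (l , m))) } }

            only : ∀ {i} → i ∈ I → NS.⟦ Ψ.covered ⟧ (i ∷ u̇ α ∷ Y ∷ e₇) → i ∈ᴳ Y
            only {i} i∈ cov = stable λ i∉Y → outside i∈ i∉Y λ { (k , k∈ , ng) → cov k (in-pure ω∈A k∈) (∀pure B∈A
              (D.Maps 8F 2F 0F D.⇒ D.Maps 3F 1F 0F D.⇒ D.⊥) {k ∷ i ∷ u̇ α ∷ Y ∷ e₇} λ t t∈ s m →
              both (proj₁ (u-spec α k∈ t∈) m) ng λ { (l , a , b) → sep′ (C l) α k t i a b (proj₁ (R-spec i∈ t∈) s) }) }

        N-coded : NS.⟦ Ψ.coded ⟧ e₇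
        N-coded Y Y⊆ no = MaximalClique.maximal-clique Out ρ (λ w _ i q q′ r _ _ _ _ _ → Q-refl) (λ w w′ h i q q′ r e e′ r∈ a b → Q-sym (h i q′ q r e′ e r∈ b a))
          λ { (α , α⊆ , clq , mx) → let open WithCode α α⊆ clq mx in
            no (u̇ α) (∀pure I∈A (0F D.∈ 2F D.⇒ Ψ.covered) {u̇ α ∷ Y ∷ e₇} λ i i∈ → covers i∈)
                     (∀pure I∈A (Ψ.covered D.⇒ 0F D.∈ 2F) {u̇ α ∷ Y ∷ e₇} λ i i∈ → only i∈) }
          where open Code Y

      -- Maximality of the generic almost disjoint family

      module Maximality where
        open GroundFacts

        fstF sndF : Fm 2
        fstF = ∃̇ (∃̇ (v2 ≈̇ ⟨ v1 , ⟨ v3 , v0 ⟩ᵗ ⟩ᵗ))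
        sndF = ∃̇ (∃̇ (v2 ≈̇ ⟨ v1 , ⟨ v0 , v3 ⟩ᵗ ⟩ᵗ))

        coords-fin : ∀ {r} → Fin′ r → ∃ λ F → Fin′ F × (∀ k c u v → atom k c u v ∈ r → u ∈ F × v ∈ F)
        coords-fin {r} f ret = ret (repl r fstF ∪ repl r sndF , fin-∪ (fin-repl fstF fn₁ f) (fin-repl sndF fn₂ f) , λ k c u v m →
          ∪ˡ u (proj₂ (∈-repl fstF fn₁ u) (η (atom k c u v , m , η (⟨ num k , c ⟩ , η (v , atom-def))))) ,
          ∪ʳ v (proj₂ (∈-repl sndF fn₂ v) (η (atom k c u v , m , η (⟨ num k , c ⟩ , η (u , atom-def))))))
          where
          fn₁ : ∀ x y y′ → x ∈ r → Sat fstF (x ∷ y ∷ []) → Sat fstF (x ∷ y′ ∷ []) → y ≈ y′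
          fn₁ x y y′ _ h h′ = h >>= λ { (c , h) → h >>= λ { (v , e) → h′ >>= λ { (c′ , h′) → h′ >>= λ { (v′ , e′) →
            proj₁ (pair-inj (proj₂ (pair-inj (Q-trans (Q-sym e) e′)))) } } } }
          fn₂ : ∀ x y y′ → x ∈ r → Sat sndF (x ∷ y ∷ []) → Sat sndF (x ∷ y′ ∷ []) → y ≈ y′
          fn₂ x y y′ _ h h′ = h >>= λ { (c , h) → h >>= λ { (v , e) → h′ >>= λ { (c′ , h′) → h′ >>= λ { (v′ , e′) →
            proj₂ (pair-inj (proj₂ (pair-inj (Q-trans (Q-sym e) e′)))) } } } }

        coordˡ : ∀ {k c u v r} → atom k c u v ∈ r → Coord r u
        coordˡ {k} {c} {u} {v} m = η (⟨ num k , c ⟩ , η (v , η (inj₁ (proj₂ (raw k) m))))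
        coordʳ : ∀ {k c u v r} → atom k c u v ∈ r → Coord r v
        coordʳ {k} {c} {u} {v} m = η (⟨ num k , c ⟩ , η (u , η (inj₂ (proj₂ (raw k) m))))

        twin-atom : ∀ {p p′ r tw} → Twin p p′ r tw → ∀ k {c u v} → atom k c u v ∈ p →
                    ∃ λ u′ → ∃ λ v′ → ⟨ u , u′ ⟩ ∈ tw × ⟨ v , v′ ⟩ ∈ tw × atom k c u′ v′ ∈ p′
        twin-atom tn k {c} {u} {v} m ret = Twin.tw-atom tn ⟨ num k , c ⟩ u v (proj₂ (raw k) m) λ { (u′ , h) → h λ { (v′ , a , b , m′) →
          ret (u′ , η (v′ , a , b , proj₁ (raw k) m′)) } }

        module Unbounded (z : M) where
          bdF : Fm 3
          bdF = ∀̇ (sub leF (0F ∷ 1F ∷ []) ⇒̇ ∀̇ (v0 ∈̇ con ω ⇒̇ ¬̇ v0 ∈̇ var 4F ⇒̇ atomᵗ 0 v0 v3 (con ∅) ∈̇ v1 ⇒̇ lt (con z) (¬̇ sub MbF (2F ∷ 1F ∷ 0F ∷ []))))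

          opaque
            -- p forces a_i ∩ z ⊆ n
            Bd : M → M → M → Set
            Bd p i n = Sat bdF (p ∷ i ∷ n ∷ [])

            instance
              stable-Bd : ∀ {p i n} → Stable (Bd p i n)
              stable-Bd {p} {i} {n} = Sat-stable bdF (p ∷ i ∷ n ∷ [])

            bd-ok : ∀ (v : Vec M 3) → Bd (lookup v 0F) (lookup v 1F) (lookup v 2F) ↔ Sat bdF v
            bd-ok (p ∷ i ∷ n ∷ []) = ↔-refl

            bd-intro : ∀ {p i n} → (∀ r → r ≤ᴾ p → ∀ m → m ∈ ω → m ∉ n → inn i m ∈ r → ¬ Mb r m z) → Bd p i n
            bd-intro h r r≤ m m∈ m∉ a = h r r≤ m m∈ m∉ (proj₁ (raw 0) a)

            bd-elim : ∀ {p i n} → Bd p i n → ∀ {r m} → r ≤ᴾ p → m ∈ ω → m ∉ n → inn i m ∈ r → ¬ Mb r m z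
            bd-elim h {r} {m} r≤ m∈ m∉ a = h r r≤ m m∈ m∉ (proj₂ (raw 0) a)

          bdP : ∀ {k} → Fin k → Fin k → Fin k → Fm k
          bdP i j k = prd (λ v → Bd (lookup v 0F) (lookup v 1F) (lookup v 2F)) bdF bd-ok (i ∷ j ∷ k ∷ [])

          bd-mono : ∀ {p q i j n n′} → q ≤ᴾ p → i ≈ j → n ⊆ n′ → Bd p i n → Bd q j n′
          bd-mono q≤ e n⊆ b = bd-intro λ r r≤ m m∈ m∉ a → bd-elim b (≤-trans r≤ q≤) m∈ (λ k → m∉ (n⊆ m k)) (∈ˡ (atom-cong 0 Q-refl (Q-sym e) Q-refl) a)

          -- Given below p₀: every a_i ∩ z can be bounded, and z itself cannot.
          module Contradiction (p₀ : M) (p₀∈ : p₀ ∈ P)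
            (bound : ∀ q → q ≤ᴾ p₀ → ∀ i → i ∈ I → ∃ λ n → n ∈ ω × ∃ λ r → r ≤ᴾ q × Bd r i n)
            (unbound : ∀ q → q ≤ᴾ p₀ → ∀ n → n ∈ ω → ∃ λ m → m ∈ ω × m ∉ n × ∃ λ r → r ≤ᴾ q × Mb r m z) where

            xF : Fm 2 -- n , i
            xF = ∃̇ (lt (con p₀) (sub leF (1F ∷ 0F ∷ [])) ∧̇ bdP 0F 2F 1F)
            X : M → M
            X n = sep I (lt (con n) (sub xF (0F ∷ 1F ∷ [])))

            -- There are more than |B| indices but only |ω| ≤ |B| possible bounds, so a large set of
            -- i shares one bound n.
            pigeon : ∃ λ n → n ∈ ω × ¬ ≤B.IsSmall (X n)
            pigeon ret = I-large (≤B.small-⋃ xF (≤B.small-⊆ ω⊆ ≤B.small-self) (λ n n∈ → stable λ lg → ret (n , n∈ , lg))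
              λ i i∈ → bound p₀ (≤-refl p₀∈) i i∈ >>¬ λ { (n , n∈ , h) → η (n , n∈ , h) })

            boundF : M → Fm 1
            boundF p = ∃̇ (∃̇ (lt (con p) (sub leF (2F ∷ 0F ∷ [])) ∧̇ v0 ∈̇ con ω ∧̇ ∀̇ (v0 ∈̇ v3 ⇒̇ bdP 2F 0F 1F)))

            bound-step : ∀ p → p ≤ᴾ p₀ → ∀ F → F ⊆ I → ∀ q x → q ⊆ F → x ∈ F → Sat (boundF p) (q ∷ []) → Sat (boundF p) (q +̂ x ∷ [])
            bound-step p p≤ F F⊆ q x q⊆ x∈ ih ret = ih λ { (r , h) → h λ { (n , r≤ , n∈ , h) → bound r (≤-trans r≤ p≤) x (F⊆ x x∈) λ { (n′ , n′∈ , h′) → h′ λ { (r′ , r′≤ , b) →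
              ω-max n∈ n′∈ λ { (m , m∈ , n⊆ , n′⊆) → ret (r′ , η (m , ≤-trans r′≤ r≤ , m∈ , λ y y∈ → _>>=_ {C = Bd r′ y m} (proj₁ (∈-+̂ y) y∈) λ
                { (inj₁ y∈) → bd-mono r′≤ Q-refl n⊆ (h y y∈) ; (inj₂ e) → bd-mono (≤-refl (proj₁ r′≤)) (Q-sym e) n′⊆ b })) } } } } }

            bound-fin : ∀ p → p ≤ᴾ p₀ → ∀ {F} → Fin′ F → F ⊆ I → ∃ λ r → ∃ λ n → r ≤ᴾ p × n ∈ ω × (∀ i → i ∈ F → Bd r i n)
            bound-fin p p≤ {F} f F⊆ = fin-ind (boundF p) f (η (p , η (∅ , ≤-refl (proj₁ p≤) , 0∈ω , λ i m → ⊥-elim (∉∅ m)))) (bound-step p p≤ F F⊆)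

            module _ (n₀ : M) (n₀∈ : n₀ ∈ ω) (lg : ¬ ≤B.IsSmall (X n₀)) where
              Φ : Fm 2 -- i , p
              Φ = lt (con p₀) (sub leF (2F ∷ 0F ∷ [])) ∧̇ lt (con n₀) (bdP 2F 1F 0F)

              hyp : ∀ i → i ∈ X n₀ → ∃ λ p → p ∈ P × Sat Φ (i ∷ p ∷ [])
              hyp i m = proj₂ (proj₁ (∈-sep (lt (con n₀) (sub xF (0F ∷ 1F ∷ []))) i) m) >>¬ λ { (p , p≤ , b) → η (p , proj₁ p≤ , p≤ , b) }

              open RootLemma (X n₀) Φ lg hyp

              X⊆I : X n₀ ⊆ I
              X⊆I i m = proj₁ (proj₁ (∈-sep (lt (con n₀) (sub xF (0F ∷ 1F ∷ []))) i) m)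

              -- r forces j ∈ z, while the twin p forces a_i ∩ z ⊆ n₀ and j ∉ n₀, so it remains to
              -- add j ∈ a_i to r ∪ p. Only a promise between i and some θ with j ∈ a_θ could
              -- prevent this. As i is no coordinate of r, the promise comes from p, and the twin of
              -- θ is a coordinate of p′. The fact j ∈ a_θ is not in p, since p′ mentions no number
              -- as large as j. If it is in r, then θ equals its twin, so a_θ ∩ z is bounded by N
              -- already, although j ∉ N.
              clash : ∀ {p′ r r₀ F N b j i p tw} → p′ ∈ P → r ≤ᴾ r₀ → p′ ⊆ r → p ∈ P → i ∈ I → Bd p i n₀ → Twin p p′ r tw → i ∉ coords r →
                      (∀ k c u v → atom k c u v ∈ p′ → u ∈ F × v ∈ F) → (∀ θ → θ ∈ F ∩ I → Bd r₀ θ N) → j ∈ ω → j ∉ N → j ∉ n₀ →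
                      (∀ m → m ∈ ω → Mentions p′ m → m ∈ b) → j ∉ b → ¬ Mb r j z
              clash {p′} {r} {r₀} {F} {N} {b} {j} {i} {p} {tw} p′∈ r≤ p′⊆ p∈ i∈ bd tn i∉ F-co F-bd j∈ j∉N j∉n₀ ment j∉b mb =
                bd-elim bd {s} {j} (s∈ , λ w m → +̂-old (∪ʳ w m)) j∈ j∉n₀ +̂-new (mb-mono (s∈ , λ w m → +̂-old (∪ˡ w m)) mb)
                where
                Cr : Cond r
                Cr = proj₁ ∈-P (proj₁ r≤)
                s : M
                s = (r ∪ p) +̂ inn i j
                i-coord : ¬ Coord r i
                i-coord co = i∉ (proj₂ (∈-coords (p-At Cr) i) co)
                root-bd : ∀ {θ θ′} → ⟨ θ , θ′ ⟩ ∈ tw → θ′ ∈ F → ¬ inn θ j ∈ r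
                root-bd {θ} {θ′} tθ θ′∈ a =
                  let e = Twin.tw-root tn θ θ′ tθ (coordˡ {0} a) in
                  bd-elim (F-bd θ (proj₂ (∈-∩ θ) (∈ˡ (Q-sym e) θ′∈ , proj₁ (dom Cr θ j a)))) r≤ j∈ j∉N a mb
                not-p : ∀ {θ} → ¬ inn θ j ∈ p
                not-p {θ} a = twin-atom tn 0 a λ { (θ′ , h) → h λ { (e , tθ , t∅ , a′) →
                  j∉b (ment j j∈ (η (inj₁ (η (θ′ , ∈ˡ (atom-cong 0 Q-refl Q-refl (Twin.tw-fun tn ∅ e ∅ t∅ (Twin.tw-∅ tn))) a′))))) } }
                ok : ∀ θ n → inn θ j ∈ r ∪ p → prom i θ n ∈ r ∪ p or prom θ i n ∈ r ∪ p → i ≈ θ or j ∈ n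
                ok θ n a h = ⊥-elim (∪-elim a
                  (λ a → h λ
                    { (inj₁ m) → ∪-elim m (λ m → i-coord (coordˡ {1} m)) λ m → twin-atom tn 1 m λ { (i′ , h) → h λ { (θ′ , _ , tθ , m′) → root-bd tθ (proj₂ (F-co 1 n i′ θ′ m′)) a } }
                    ; (inj₂ m) → ∪-elim m (λ m → i-coord (coordʳ {1} m)) λ m → twin-atom tn 1 m λ { (θ′ , h) → h λ { (i′ , tθ , _ , m′) → root-bd tθ (proj₁ (F-co 1 n θ′ i′ m′)) a } } })
                  not-p)
                s∈ : s ∈ P
                s∈ = proj₂ ∈-P (add-in (Amalgam.amalgam (proj₁ ∈-P p∈) Cr p′⊆ tn) i∈ j∈ ok)

              -- The order of the choices matters: the coordinates of p′ are finitely many and can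
              -- be given one bound N before j is chosen; j exceeds all bounds; and the twin is
              -- taken last, avoiding the coordinates of the condition r that forces j ∈ z.
              absurd : 𝟘
              absurd = root λ { (x′ , h) → h λ { (p′ , _ , p′∈ , (p′≤ , _) , twins) →
                coords-fin (p-fin (proj₁ ∈-P p′∈)) λ { (F , F-fin , F-co) →
                bound-fin p′ p′≤ {F ∩ I} (fin-⊆ F-fin λ w m → proj₁ (proj₁ (∈-∩ w) m)) (λ w m → proj₂ (proj₁ (∈-∩ w) m)) λ { (r₀ , h) → h λ { (N , r₀≤ , N∈ , F-bd) →
                mention-bound (p-fin (proj₁ ∈-P p′∈)) λ { (b , b∈ , ment) →
                ω-max N∈ n₀∈ λ { (k , k∈ , N⊆ , n₀⊆) → ω-max k∈ b∈ λ { (l , l∈ , k⊆ , b⊆) →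
                unbound r₀ (≤-trans r₀≤ p′≤) l l∈ λ { (j , j∈ , j∉ , h) → h λ { (r , r≤ , mb) →
                let p′⊆ : p′ ⊆ r
                    p′⊆ = proj₂ (≤-trans r≤ r₀≤)
                    Cr = proj₁ ∈-P (proj₁ r≤)
                in twins r (proj₁ r≤) p′⊆ (coords r) (coords-small (p-fin Cr) (p-At Cr)) λ { (i , h) → h λ { (p , h) → h λ { (tw , i∈ , i∉ , p∈ , (_ , bd) , tn) →
                clash p′∈ r≤ p′⊆ p∈ (X⊆I i i∈) bd tn i∉ F-co F-bd j∈ (λ m → j∉ (k⊆ j (N⊆ j m))) (λ m → j∉ (k⊆ j (n₀⊆ j m))) ment (λ m → j∉ (b⊆ j m)) mb } } } } } } } } } } } } }

            contradiction : 𝟘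
            contradiction = pigeon λ { (n , n∈ , lg) → absurd n n∈ lg }

          freeF boundedF : Fm 1
          freeF = ∃̇ (v0 ∈̇ con I ∧̇ ∀̇ (v0 ∈̇ con ω ⇒̇ ∀̇ (sub leF (0F ∷ 3F ∷ []) ⇒̇ ¬̇ bdP 0F 2F 1F)))
          boundedF = ∃̇ (v0 ∈̇ con ω ∧̇ ∀̇ (v0 ∈̇ con ω ⇒̇ ¬̇ v0 ∈̇ v1 ⇒̇ ∀̇ (sub leF (0F ∷ 3F ∷ []) ⇒̇ lt (con z) (¬̇ sub MbF (1F ∷ 2F ∷ 0F ∷ [])))))

          meets-z : ∀ {i n} l → i ∈ I → n ∈ ω → (∀ r → r ≤ᴾ g l → ¬ Bd r i n) → NS.⟦ Ψ.mad₃ ⟧ (n ∷ i ∷ z ∷ e₇)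
          meets-z {i} {n} l i∈ n∈ nb no = generic φ λ
            { (l′ , inj₁ h) → h λ { (m , m∈ , m∉ , a , mb) → no m (η (l′ , mb)) (not-in m∈ n∈ m∉) (proj₂ (a-spec i∈ m∈) (η (l′ , proj₁ (raw 0) a))) }
            ; (l′ , inj₂ nn) → nb (g (l ⊔ l′)) (∨l l l′) (bd-intro λ r r≤ m m∈ m∉ a mb → nn r (≤-trans r≤ (∨r l l′)) (η (m , m∈ , m∉ , proj₂ (raw 0) a , mb))) }
            where
            φ : Fm 1
            φ = ∃̇ (v0 ∈̇ con ω ∧̇ ¬̇ v0 ∈̇ con n ∧̇ atomᵗ 0 v0 (con i) (con ∅) ∈̇ v1 ∧̇ lt (con z) (sub MbF (2F ∷ 1F ∷ 0F ∷ [])))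

          -- If the generic sequence finds an i with a_i ∩ z nowhere bounded, that i is as required;
          -- if it finds a bound for z, then z is not infinite. Otherwise both assumptions of
          -- `Contradiction` hold below some `g k`.
          mad-z : (∀ x → x ∈ᴳ z → x ∈ᴳ ω) → (∀ n → n ∈ᴳ ω → ¬ (∀ m → m ∈ᴳ z → ¬ m ∈ᴳ n → 𝟘)) →
                  ¬ (∀ i → i ∈ᴳ I → (∀ n → n ∈ᴳ ω → NS.⟦ Ψ.mad₃ ⟧ (n ∷ i ∷ z ∷ e₇)) → 𝟘)
          mad-z z⊆ unb no = generic freeF λ
            { (l , inj₁ h) → h λ { (i , i∈ , h) → no i (in-pure I∈A i∈) (∀pure ω∈A Ψ.mad₃ {i ∷ z ∷ e₇} λ n n∈ → meets-z l i∈ n∈ (h n n∈)) }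
            ; (l , inj₂ nf) → generic boundedF λ
              { (l′ , inj₁ h) → h λ { (n , n∈ , h) → unb n (in-pure ω∈A n∈) λ m m∈z m∉n → proj₁ (pure-∈ᴳ ω∈A m) (z⊆ m m∈z) λ { (m₀ , m₀∈ , e) →
                  N.E-cong e N.Q-refl m∈z λ { (k , mb) → h m₀ m₀∈ (λ k → m∉n (N.E-cong (N.Q-sym e) N.Q-refl (proj₂ (pure-∈ (ω⊆A m₀∈) (ω⊆A n∈)) k)))
                    (g (l′ ⊔ k)) (∨l l′ k) (mb-mono (∨r l′ k) mb) } } }
              ; (l′ , inj₂ nb) → Contradiction.contradiction (g (l ⊔ l′)) (g∈P (l ⊔ l′))
                  (λ q q≤ i i∈ ret → nf q (≤-trans q≤ (∨l l l′)) (η (i , i∈ , λ n n∈ r r≤ b → ret (n , n∈ , η (r , r≤ , b)))))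
                  (λ q q≤ n n∈ ret → nb q (≤-trans q≤ (∨r l l′)) (η (n , n∈ , λ m m∈ m∉ r r≤ mb → ret (m , m∈ , m∉ , η (r , r≤ , mb))))) } }

        N-mad : NS.⟦ Ψ.mad ⟧ e₇
        N-mad z z⊆ unb = Unbounded.mad-z z z⊆ unb

      open GroundFacts
      open Coding using (N-coded)
      open Maximality using (N-mad)

      N-Ψ : NS.⟦ Ψ.Ψ ⟧ []
      N-Ψ h = h ω I B Rel ȧ (L̇ (num 1)) (L̇ (num 0)) N-least N-minimal N-nat⊆I N-labelFun₁ N-labelFun₀ N-labelDisj N-meets₁ N-meets₀ N-ad N-mad N-topLabel N-coded

      N-holds : ∀ {σ} → (ZFC ＋ Ψ.Ψ) σ → NS.⟦ σ ⟧ []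
      N-holds (inj₁ z) = N-zfc z
      N-holds (inj₂ refl) = N-Ψ

      consistent : D.Consistent (ZFC ＋ Ψ.Ψ)
      consistent = NS.sound⇒consistent N-holds

  -- Functions and finiteness as the official formulas express them

  module Interpretation where
    ×-↔ : ∀ {A A′ B B′ : Set} → A ↔ A′ → B ↔ B′ → (A × B) ↔ (A′ × B′)
    ×-↔ (f , g) (f′ , g′) = (λ { (a , b) → f a , f′ b }) , (λ { (a , b) → g a , g′ b })

    ⇔-↔ : ∀ {A A′ B B′ : Set} → A ↔ A′ → B ↔ B′ → (A ↔ B) ↔ (A′ ↔ B′)
    ⇔-↔ a b = (λ h → ↔-trans (↔-sym a) (↔-trans h b)) , (λ h → ↔-trans a (↔-trans h (↔-sym b)))

    module _ {n : ℕ} (e : Vec M n) where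
      S-∧′ : ∀ φ ψ {P Q} → S.⟦ φ ⟧ e ↔ P → S.⟦ ψ ⟧ e ↔ Q → S.⟦ φ D.∧ ψ ⟧ e ↔ (P × Q)
      S-∧′ φ ψ p q = ↔-trans (S-∧ φ ψ {e}) (×-↔ p q)

      S-⇔′ : ∀ φ ψ {P Q} → S.⟦ φ ⟧ e ↔ P → S.⟦ ψ ⟧ e ↔ Q → S.⟦ φ D.⇔ ψ ⟧ e ↔ (P ↔ Q)
      S-⇔′ φ ψ p q = ↔-trans (S-⇔ φ ψ {e}) (⇔-↔ p q)

      S-ex : ∀ φ {P : M → Set} → (∀ x → S.⟦ φ ⟧ (x ∷ e) ↔ P x) → S.⟦ D.ex φ ⟧ e ↔ ∃ P
      S-ex φ h = (λ k r → k λ x s → r (x , proj₁ (h x) s)) , (λ k r → k λ { (x , p) → r x (proj₂ (h x) p) })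

      S-all : ∀ φ {P : M → Set} → (∀ x → S.⟦ φ ⟧ (x ∷ e) ↔ P x) → S.⟦ D.all φ ⟧ e ↔ (∀ x → P x)
      S-all φ h = (λ k x → proj₁ (h x) (k x)) , (λ k x → proj₂ (h x) (k x))

      S-ex∈′ : ∀ a φ {P : M → Set} → (∀ x → S.⟦ φ ⟧ (x ∷ e) ↔ P x) → S.⟦ D.ex∈ a φ ⟧ e ↔ ∃ λ x → x ∈ lookup e a × P x
      S-ex∈′ a φ h = S-ex (0F D.∈ suc a D.∧ φ) λ x → ↔-trans (S-∧ (0F D.∈ suc a) φ {x ∷ e}) (×-↔ ↔-refl (h x))

      S-all∈ : ∀ a φ {P : M → Set} → (∀ x → S.⟦ φ ⟧ (x ∷ e) ↔ P x) → S.⟦ D.all∈ a φ ⟧ e ↔ (∀ x → x ∈ lookup e a → P x)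
      S-all∈ a φ h = S-all (0F D.∈ suc a D.⇒ φ) λ x → ↔-→ ↔-refl (h x)

    IsUP : M → M → M → Set
    IsUP z x y = ∀ u → u ∈ z ↔ (u ≈ x or u ≈ y)

    isUP-≈ : ∀ {z x y x′ y′} → x ≈ x′ → y ≈ y′ → IsUP z x y → z ≈ upair x′ y′
    isUP-≈ ex ey h = Q-trans (ext λ u → ↔-trans (h u) (↔-sym (∈-upair u))) (Op.cong upair-op ex ey)

    S-IsPair : ∀ {n} (p x y : Fin n) {e} → S.⟦ D.IsPair p x y ⟧ e ↔ (lookup e p ≈ ⟨ lookup e x , lookup e y ⟩)
    S-IsPair {n} p x y {e} = ↔-trans
      (S-ex e (D.ex body) λ a → S-ex (a ∷ e) body λ b → S-∧′ (b ∷ a ∷ e) (D.IsUPair 1F x₂ x₂) (D.IsUPair 0F x₂ y₂ D.∧ D.IsUPair p₂ 1F 0F) (S-IsUPair 1F x₂ x₂ {b ∷ a ∷ e})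
        (S-∧′ (b ∷ a ∷ e) (D.IsUPair 0F x₂ y₂) (D.IsUPair p₂ 1F 0F) (S-IsUPair 0F x₂ y₂ {b ∷ a ∷ e}) (S-IsUPair p₂ 1F 0F {b ∷ a ∷ e})))
      ( (λ h → h >>= λ { (a , h) → h >>= λ { (b , ha , hb , hp) → Q-trans (isUP-≈ (isUP-≈ Q-refl Q-refl ha) (isUP-≈ Q-refl Q-refl hb) hp) (Q-sym pair-def) } })
      , (λ q → η (upair X X , η (upair X Y , ∈-upair , ∈-upair , λ u → ↔-trans (∈ʳ (Q-trans q pair-def) , ∈ʳ (Q-sym (Q-trans q pair-def))) (∈-upair u)))) )
      where
      X = lookup e x
      Y = lookup e y
      x₂ y₂ p₂ : Fin (suc (suc n))
      x₂ = suc (suc x)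
      y₂ = suc (suc y)
      p₂ = suc (suc p)
      body : Formula (suc (suc n))
      body = D.IsUPair 1F x₂ x₂ D.∧ D.IsUPair 0F x₂ y₂ D.∧ D.IsUPair p₂ 1F 0F

    S-Maps : ∀ {n} (f x y : Fin n) {e} → S.⟦ D.Maps f x y ⟧ e ↔ (⟨ lookup e x , lookup e y ⟩ ∈ lookup e f)
    S-Maps f x y {e} = ↔-trans (S-ex∈′ e f (D.IsPair 0F (suc x) (suc y)) λ z → S-IsPair 0F (suc x) (suc y) {z ∷ e})
      ( (λ h → h >>= λ { (z , z∈ , q) → ∈ˡ q z∈ }) , (λ m → η (⟨ lookup e x , lookup e y ⟩ , m , Q-refl)) )

    Total Injective : M → M → Set
    Total f a = ∀ x → x ∈ a → ∃ λ y → ⟨ x , y ⟩ ∈ f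
    Injective f a = ∀ x → x ∈ a → ∀ x′ → x′ ∈ a → ∀ y → ⟨ x , y ⟩ ∈ f × ⟨ x′ , y ⟩ ∈ f → x ≈ x′

    Fn Inj Bij : M → M → M → Set
    Fn f a b = f ⊆ a ×ˢ b × Functional f × Total f a
    Inj f a b = Fn f a b × Injective f a
    Bij f a b = Inj f a b × (∀ y → y ∈ b → ∃ λ x → x ∈ a × ⟨ x , y ⟩ ∈ f)

    fn-in : ∀ {f a b x y} → Fn f a b → ⟨ x , y ⟩ ∈ f → x ∈ a × y ∈ b
    fn-in (s , _) m = proj₁ pair∈× (s _ m)

    S-Function : ∀ {n} (f a b : Fin n) {e} → S.⟦ D.Function f a b ⟧ e ↔ Fn (lookup e f) (lookup e a) (lookup e b)
    S-Function {n} f a b {e} = ↔-trans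
      (S-∧′ e (D.all∈ f (D.ex∈ (suc a) φ₂)) (D.all∈ a (D.ex (D.all ψ₃)))
        (S-all∈ e f (D.ex∈ (suc a) φ₂) λ z → S-ex∈′ (z ∷ e) (suc a) φ₂ λ x → S-ex∈′ (x ∷ z ∷ e) (suc (suc b)) (D.IsPair 2F 1F 0F) λ y → S-IsPair 2F 1F 0F {y ∷ x ∷ z ∷ e})
        (S-all∈ e a (D.ex (D.all ψ₃)) λ x → S-ex (x ∷ e) (D.all ψ₃) λ y → S-all (y ∷ x ∷ e) ψ₃ λ u →
          S-⇔′ (u ∷ y ∷ x ∷ e) (D.Maps (suc (suc (suc f))) 2F 0F) (0F D.≐ 1F) (S-Maps (suc (suc (suc f))) 2F 0F {u ∷ y ∷ x ∷ e}) ↔-refl))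
      ( (λ { (h , k) → sub⊆ h , (λ x y y′ m m′ → k x (proj₁ (proj₁ pair∈× (sub⊆ h _ m))) >>= λ { (u , k) → Q-trans (proj₁ (k y) m) (Q-sym (proj₁ (k y′) m′)) })
          , λ x x∈ → k x x∈ >>¬ λ { (u , k) → η (u , proj₂ (k u) Q-refl) } })
      , (λ { (s , fn , t) → (λ z m → proj₁ (∈-× z) (s z m) >>¬ λ { (x , h) → h >>¬ λ { (y , q , x∈ , y∈) → η (x , x∈ , η (y , y∈ , q)) } })
          , λ x x∈ → t x x∈ >>¬ λ { (y , m) → η (y , λ u → (λ m′ → fn x u y m′ m) , (λ q → ∈ˡ (pair-cong Q-refl (Q-sym q)) m)) } }) )
      where
      φ₂ : Formula (suc (suc n))
      φ₂ = D.ex∈ (suc (suc b)) (D.IsPair 2F 1F 0F)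
      ψ₃ : Formula (suc (suc (suc n)))
      ψ₃ = D.Maps (suc (suc (suc f))) 2F 0F D.⇔ 0F D.≐ 1F
      sub⊆ : ∀ {f a b} → (∀ z → z ∈ f → ∃ λ x → x ∈ a × ∃ λ y → y ∈ b × z ≈ ⟨ x , y ⟩) → f ⊆ a ×ˢ b
      sub⊆ h z m = h z m >>= λ { (x , x∈ , h) → h >>= λ { (y , y∈ , q) → ∈ˡ (Q-sym q) (proj₂ pair∈× (x∈ , y∈)) } }

    S-Injection : ∀ {n} (f a b : Fin n) {e} → S.⟦ D.Injection f a b ⟧ e ↔ Inj (lookup e f) (lookup e a) (lookup e b)
    S-Injection {n} f a b {e} = S-∧′ e (D.Function f a b) (D.all∈ a (D.all∈ (suc a) (D.all χ))) (S-Function f a b {e})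
      (S-all∈ e a (D.all∈ (suc a) (D.all χ)) λ x → S-all∈ (x ∷ e) (suc a) (D.all χ) λ x′ → S-all (x′ ∷ x ∷ e) χ λ u →
        ↔-→ (S-∧′ (u ∷ x′ ∷ x ∷ e) (D.Maps f₃ 2F 0F) (D.Maps f₃ 1F 0F) (S-Maps f₃ 2F 0F {u ∷ x′ ∷ x ∷ e}) (S-Maps f₃ 1F 0F {u ∷ x′ ∷ x ∷ e})) ↔-refl)
      where
      f₃ : Fin (suc (suc (suc n)))
      f₃ = suc (suc (suc f))
      χ : Formula (suc (suc (suc n)))
      χ = D.Maps f₃ 2F 0F D.∧ D.Maps f₃ 1F 0F D.⇒ 2F D.≐ 1F

    S-Bijection : ∀ {n} (f a b : Fin n) {e} → S.⟦ D.Bijection f a b ⟧ e ↔ Bij (lookup e f) (lookup e a) (lookup e b)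
    S-Bijection f a b {e} = S-∧′ e (D.Injection f a b) (D.all∈ b (D.ex∈ (suc a) (D.Maps (suc (suc f)) 0F 1F))) (S-Injection f a b {e})
      (S-all∈ e b (D.ex∈ (suc a) (D.Maps (suc (suc f)) 0F 1F)) λ y → S-ex∈′ (y ∷ e) (suc a) (D.Maps (suc (suc f)) 0F 1F) λ x → S-Maps (suc (suc f)) 0F 1F {x ∷ y ∷ e})

    ×-op : Op
    ×-op = record { fun = _×ˢ_ ; body = ∃̇ (∃̇ (v2 ≈̇ ⟨ v1 , v0 ⟩ᵗ ∧̇ v1 ∈̇ v3 ∧̇ v0 ∈̇ v4)) ; spec = λ a b u → ∈-× u }

    fnF bijF : Fm 3 -- f , a , b
    fnF = ∀̇ (v0 ∈̇ v1 ⇒̇ v0 ∈̇ ×-op [ v2 · v3 ]) ∧̇ sub FunctionalF (0F ∷ []) ∧̇ ∀̇ (v0 ∈̇ v2 ⇒̇ ∃̇ (⟨ v1 , v0 ⟩ᵗ ∈̇ v2))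
    bijF = (fnF ∧̇ ∀̇ (v0 ∈̇ v2 ⇒̇ ∀̇ (v0 ∈̇ v3 ⇒̇ ∀̇ (⟨ v2 , v0 ⟩ᵗ ∈̇ v3 ∧̇ ⟨ v1 , v0 ⟩ᵗ ∈̇ v3 ⇒̇ v2 ≈̇ v1))))
      ∧̇ ∀̇ (v0 ∈̇ v3 ⇒̇ ∃̇ (v0 ∈̇ v3 ∧̇ ⟨ v0 , v1 ⟩ᵗ ∈̇ v2))

    FiniteIn : M → M → Set
    FiniteIn w a = ∃ λ n → n ∈ w × ∃ λ f → Bij f n a

    Finite : M → Set
    Finite = FiniteIn ω

    finiteF : Fm 1
    finiteF = ∃̇ (v0 ∈̇ con ω ∧̇ ∃̇ (sub bijF (0F ∷ 1F ∷ 2F ∷ [])))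

    finite-≈ : ∀ {a b} → a ≈ b → Finite a → Finite b
    finite-≈ = cong₁ finiteF

    finite-∅ : Finite ∅
    finite-∅ = η (∅ , 0∈ω , η (∅ , (((λ z m → ⊥-elim (∉∅ m)) , (λ x y y′ m → ⊥-elim (∉∅ m)) , λ x m → ⊥-elim (∉∅ m)) , λ x m → ⊥-elim (∉∅ m)) , λ y m → ⊥-elim (∉∅ m)))

    bij-+̂ : ∀ {f n q x} → x ∉ q → Bij f n q → Bij (f +̂ ⟨ n , x ⟩) (suc̆ n) (q +̂ x)
    bij-+̂ {f} {n} {q} {x} x∉ ((fn , inj) , sur) = ((f⊆ , f-fun , f-tot) , f-inj) , f-sur
      where
      split : ∀ {k u} → ⟨ k , u ⟩ ∈ f +̂ ⟨ n , x ⟩ → ((k ∈ n × u ∈ q) × ⟨ k , u ⟩ ∈ f) or (k ≈ n × u ≈ x)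
      split m = proj₁ (∈-+̂ _) m >>¬ λ { (inj₁ m) → η (inj₁ (fn-in {f} {n} {q} fn m , m)) ; (inj₂ e) → η (inj₂ (pair-inj e)) }
      f⊆ : f +̂ ⟨ n , x ⟩ ⊆ suc̆ n ×ˢ (q +̂ x)
      f⊆ z m = proj₁ (∈-+̂ z) m >>= λ
        { (inj₁ m) → proj₁ (∈-× z) (proj₁ fn z m) >>= λ { (k , h) → h >>= λ { (u , e , k∈ , u∈) → ∈ˡ (Q-sym e) (proj₂ pair∈× (+̂-old k∈ , +̂-old u∈)) } }
        ; (inj₂ e) → ∈ˡ (Q-sym e) (proj₂ pair∈× (+̂-new , +̂-new)) }
      f-fun : Functional (f +̂ ⟨ n , x ⟩)
      f-fun k u u′ m m′ = split m >>= λ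
        { (inj₁ ((k∈ , _) , m)) → split m′ >>= λ { (inj₁ (_ , m′)) → proj₁ (proj₂ fn) k u u′ m m′ ; (inj₂ (e , _)) → ⊥-elim (x∉x (∈ˡ e k∈)) }
        ; (inj₂ (e , eu)) → split m′ >>= λ { (inj₁ ((k∈ , _) , _)) → ⊥-elim (x∉x (∈ˡ e k∈)) ; (inj₂ (_ , eu′)) → Q-trans eu (Q-sym eu′) } }
      f-tot : Total (f +̂ ⟨ n , x ⟩) (suc̆ n)
      f-tot k m = proj₁ (∈-+̂ k) m >>¬ λ
        { (inj₁ k∈) → proj₂ (proj₂ fn) k k∈ >>¬ λ { (y , m) → η (y , +̂-old m) }
        ; (inj₂ e) → η (x , ∈ˡ (pair-cong (Q-sym e) Q-refl) +̂-new) }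
      f-inj : Injective (f +̂ ⟨ n , x ⟩) (suc̆ n)
      f-inj k _ k′ _ y (m , m′) = split m >>= λ
        { (inj₁ ((k∈ , y∈) , m)) → split m′ >>= λ { (inj₁ ((k′∈ , _) , m′)) → inj k k∈ k′ k′∈ y (m , m′) ; (inj₂ (_ , e)) → ⊥-elim (x∉ (∈ˡ e y∈)) }
        ; (inj₂ (ek , e)) → split m′ >>= λ { (inj₁ ((_ , y∈) , _)) → ⊥-elim (x∉ (∈ˡ e y∈)) ; (inj₂ (ek′ , _)) → Q-trans ek (Q-sym ek′) } }
      f-sur : ∀ y → y ∈ q +̂ x → ∃ λ k → k ∈ suc̆ n × ⟨ k , y ⟩ ∈ f +̂ ⟨ n , x ⟩
      f-sur y m = proj₁ (∈-+̂ y) m >>¬ λ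
        { (inj₁ y∈) → sur y y∈ >>¬ λ { (k , k∈ , m) → η (k , +̂-old k∈ , +̂-old m) }
        ; (inj₂ e) → η (n , +̂-new , ∈ˡ (pair-cong Q-refl (Q-sym e)) +̂-new) }

    fin⇒finite : ∀ {p} → Fin′ p → Finite p
    fin⇒finite f = fin-ind finiteF f finite-∅ λ q x _ _ ih → lem {x ∈ q} >>= λ
      { (inj₁ x∈) → finite-≈ (ext λ z → +̂-old , λ m → proj₁ (∈-+̂ z) m >>= λ { (inj₁ m) → m ; (inj₂ e) → ∈ˡ (Q-sym e) x∈ }) ih
      ; (inj₂ x∉) ret → ih λ { (n , n∈ , h) → h λ { (f , b) → ret (suc̆ n , suc∈ω n∈ , η (f +̂ ⟨ n , x ⟩ , bij-+̂ x∉ b)) } } }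

    fin-ω : ∀ n → n ∈ ω → Fin′ n
    fin-ω = ω-ind (finP 0F) fin-∅ λ n _ f → fin-+̂ f

    fin-image : ∀ (φ : Fm 2) {p q} → Fin′ p → (∀ x y y′ → Sat φ (x ∷ y ∷ []) → Sat φ (x ∷ y′ ∷ []) → y ≈ y′) →
                (∀ y → y ∈ q → ∃ λ x → x ∈ p × Sat φ (x ∷ y ∷ [])) → Fin′ q
    fin-image φ f fn h = fin-⊆ (fin-repl φ (λ x y y′ _ → fn x y y′) f) λ y y∈ → proj₂ (∈-repl φ (λ x y y′ _ → fn x y y′) y) (h y y∈)

    finite⇒fin : ∀ {p} → Finite p → Fin′ p
    finite⇒fin h = h >>= λ { (n , n∈ , h) → h >>= λ { (f , ((_ , fn , _) , _) , sur) → fin-image (⟨ v0 , v1 ⟩ᵗ ∈̇ con f) (fin-ω n n∈) fn sur } }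

    Unbounded : M → Set
    Unbounded x = ∀ n → n ∈ ω → ∃ λ m → m ∈ x × m ∉ n

    unbounded⇒infinite : ∀ {x} → x ⊆ ω → Unbounded x → ¬ Finite x
    unbounded⇒infinite x⊆ u f = fin-bounded (finite⇒fin f) x⊆ λ { (n , n∈ , h) → u n n∈ λ { (m , m∈ , m∉) → m∉ (h m m∈) } }

    bounded⇒finite : ∀ {x n} → n ∈ ω → x ⊆ n → Finite x
    bounded⇒finite {x} {n} n∈ h = fin⇒finite (fin-⊆ (fin-ω n n∈) h)

    infinite⇒unbounded : ∀ {x} → ¬ Finite x → Unbounded x
    infinite⇒unbounded inf n n∈ ret = inf (bounded⇒finite n∈ λ m m∈ → stable λ m∉ → ret (m , m∈ , m∉))

    S-Finite : ∀ {n} (w a : Fin n) {e} → S.⟦ D.Finite w a ⟧ e ↔ FiniteIn (lookup e w) (lookup e a)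
    S-Finite w a {e} = S-ex∈′ e w (D.ex (D.Bijection 0F 1F (suc (suc a)))) λ k → S-ex (k ∷ e) (D.Bijection 0F 1F (suc (suc a))) λ f → S-Bijection 0F 1F (suc (suc a)) {f ∷ k ∷ e}

  -- Splitting the family; maximal almost disjoint families are uncountable

  module Almost where
    open Interpretation public

    record Labelled (I J R a : M) (L : Bool → M) : Set where
      no-eta-equality
      field
        nat⊆I    : ω ⊆ I
        lab-fun  : ∀ c m t t′ → m ∈ ω → t ∈ J → t′ ∈ J → ⟨ m , t ⟩ ∈ L c → ⟨ m , t′ ⟩ ∈ L c → t ≈ t′
        lab-disj : ∀ m t t′ → m ∈ ω → t ∈ J → t′ ∈ J → ⟨ m , t ⟩ ∈ L true → ⟨ m , t′ ⟩ ∈ L false → 𝟘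
        meets    : ∀ c i t n → i ∈ I → t ∈ J → n ∈ ω → ∃ λ m → m ∈ ω × m ∉ n × ⟨ i , m ⟩ ∈ a × ⟨ m , t ⟩ ∈ L c
        ad       : ∀ i j → i ∈ I → j ∈ I → ¬ i ≈ j → ∃ λ n → n ∈ ω × (∀ m → m ∈ ω → ⟨ i , m ⟩ ∈ a → ⟨ j , m ⟩ ∈ a → m ∈ n)
        mad      : ∀ z → z ⊆ ω → Unbounded z → ∃ λ i → i ∈ I × (∀ n → n ∈ ω → ∃ λ m → m ∈ z × m ∉ n × ⟨ i , m ⟩ ∈ a)
        t₀       : M
        t₀∈      : t₀ ∈ J
        t₀-top   : ∀ i → i ∈ I → ⟨ i , t₀ ⟩ ∈ R
        coded    : ∀ Y → Y ⊆ I → ∃ λ u → ∀ i → i ∈ I → i ∈ Y ↔ (∀ k → k ∈ ω → ∃ λ t → t ∈ J × ⟨ i , t ⟩ ∈ R × ⟨ k , t ⟩ ∈ u)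

    module Family {I J R a : M} {L : Bool → M} (𝓛 : Labelled I J R a L) where
      open Labelled 𝓛

      -- a_i is split into two parts.  The labels with sign c of the elements of
      -- part c are exactly the t with R(i,t).
      goodF : Fm 2 -- i , m
      goodF = ∃̇ (v0 ∈̇ con J ∧̇ ((⟨ v2 , v0 ⟩ᵗ ∈̇ con (L true) ∧̇ ⟨ v1 , v0 ⟩ᵗ ∈̇ con R) ∨̇ (⟨ v2 , v0 ⟩ᵗ ∈̇ con (L false) ∧̇ ¬̇ ⟨ v1 , v0 ⟩ᵗ ∈̇ con R)))

      partF : Bool → Fm 2
      partF true = goodF
      partF false = ¬̇ goodF

      InPart : Bool → M → M → Set
      InPart c i m = Sat (partF c) (i ∷ m ∷ [])

      good-true : ∀ {i m t} → t ∈ J → m ∈ ω → ⟨ m , t ⟩ ∈ L true → InPart true i m ↔ (⟨ i , t ⟩ ∈ R)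
      good-true {i} {m} {t} t∈ m∈ l =
        (λ h → h >>= λ { (t′ , t′∈ , h) → h >>= λ { (inj₁ (l′ , r)) → ∈ˡ (pair-cong Q-refl (lab-fun true m t′ t m∈ t′∈ t∈ l′ l)) r ; (inj₂ (l′ , _)) → ⊥-elim (lab-disj m t t′ m∈ t∈ t′∈ l l′) } })
        , λ r → η (t , t∈ , η (inj₁ (l , r)))

      good-false : ∀ {i m t} → t ∈ J → m ∈ ω → ⟨ m , t ⟩ ∈ L false → InPart true i m ↔ ¬ ⟨ i , t ⟩ ∈ R
      good-false {i} {m} {t} t∈ m∈ l =
        (λ h → h >>= λ { (t′ , t′∈ , h) → h >>= λ { (inj₂ (l′ , r)) r′ → r (∈ˡ (pair-cong Q-refl (lab-fun false m t t′ m∈ t∈ t′∈ l l′)) r′) ; (inj₁ (l′ , _)) → ⊥-elim (lab-disj m t′ t m∈ t′∈ t∈ l′ l) } })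
        , λ r → η (t , t∈ , η (inj₂ (l , r)))

      part-same : ∀ c {i m t} → t ∈ J → m ∈ ω → ⟨ m , t ⟩ ∈ L c → InPart c i m ↔ (⟨ i , t ⟩ ∈ R)
      part-same true t∈ m∈ l = good-true t∈ m∈ l
      part-same false t∈ m∈ l = (λ n → stable λ r → n (proj₂ (good-false t∈ m∈ l) r)) , (λ r h → proj₁ (good-false t∈ m∈ l) h r)

      part-other : ∀ c {i m t} → t ∈ J → m ∈ ω → ⟨ m , t ⟩ ∈ L (not c) → InPart c i m → ¬ ⟨ i , t ⟩ ∈ R
      part-other true t∈ m∈ l h = proj₁ (good-false t∈ m∈ l) h
      part-other false t∈ m∈ l n r = n (proj₂ (good-true t∈ m∈ l) r)

      memF : Bool → Fm 2
      memF c = ⟨ v0 , v1 ⟩ᵗ ∈̇ con a ∧̇ sub (partF c) (0F ∷ 1F ∷ [])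

      opaque
        Part : Bool → M → M
        Part c i = sep ω (lt (con i) (sub (memF c) (0F ∷ 1F ∷ [])))

        ∈-Part : ∀ c {i} m → m ∈ Part c i ↔ (m ∈ ω × ⟨ i , m ⟩ ∈ a × InPart c i m)
        ∈-Part c {i} m = ∈-sep (lt (con i) (sub (memF c) (0F ∷ 1F ∷ []))) m

      Part-op : Bool → Op
      Part-op c = record { fun = λ i _ → Part c i ; body = v0 ∈̇ con ω ∧̇ sub (memF c) (1F ∷ 0F ∷ []) ; spec = λ i _ m → ∈-Part c m }

      part-cong : ∀ c {i j} → i ≈ j → Part c i ≈ Part c j
      part-cong c e = Op.cong (Part-op c) e e

      part⊆ω : ∀ c i → Part c i ⊆ ω
      part⊆ω c i m h = proj₁ (proj₁ (∈-Part c m) h)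

      sees : ∀ c i t → i ∈ I → t ∈ J → ∃ (λ m → m ∈ Part c i × ⟨ m , t ⟩ ∈ L c) ↔ (⟨ i , t ⟩ ∈ R)
      sees c i t i∈ t∈ =
        (λ h → h >>= λ { (m , m∈ , l) → let (m∈ω , _ , g) = proj₁ (∈-Part c m) m∈ in proj₁ (part-same c t∈ m∈ω l) g })
        , λ r → meets c i t ∅ i∈ t∈ 0∈ω >>¬ λ { (m , m∈ , _ , am , l) → η (m , proj₂ (∈-Part c m) (m∈ , am , proj₂ (part-same c t∈ m∈ l) r) , l) }

      -- This is how the sign of a part is recognized from its elements: the label t₀ occurs in part
      -- c with sign c, and with the opposite sign never.
      unseen : ∀ c i → i ∈ I → ∀ m → m ∈ Part c i → ⟨ m , t₀ ⟩ ∉ L (not c)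
      unseen c i i∈ m m∈ l = let (m∈ω , _ , g) = proj₁ (∈-Part c m) m∈ in part-other c t₀∈ m∈ω l g (t₀-top i i∈)

      part-unbounded : ∀ c i → i ∈ I → Unbounded (Part c i)
      part-unbounded c i i∈ n n∈ = meets c i t₀ n i∈ t₀∈ n∈ >>¬ λ { (m , m∈ , m∉ , am , l) →
        η (m , proj₂ (∈-Part c m) (m∈ , am , proj₂ (part-same c t₀∈ m∈ l) (t₀-top i i∈)) , m∉) }

      famF : Fm 1
      famF = ∃̇ (v0 ∈̇ con I ∧̇ (v1 ≈̇ Part-op true [ v0 · v0 ] ∨̇ v1 ≈̇ Part-op false [ v0 · v0 ]))

      opaque
        𝒜 : M
        𝒜 = sep (𝒫 ω) famF

        𝒜-elim : ∀ {x} → x ∈ 𝒜 → ¬ ¬ Σ Bool λ c → Σ M λ i → i ∈ I × x ≈ Part c i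
        𝒜-elim {x} m ret = proj₂ (proj₁ (∈-sep famF x) m) λ { (i , i∈ , h) → h λ { (inj₁ e) → ret (true , i , i∈ , e) ; (inj₂ e) → ret (false , i , i∈ , e) } }

        𝒜⊆ : ∀ {x} → x ∈ 𝒜 → x ⊆ ω
        𝒜⊆ {x} m = proj₁ (∈-𝒫 x) (proj₁ (proj₁ (∈-sep famF x) m))

        part∈𝒜 : ∀ c {i} → i ∈ I → Part c i ∈ 𝒜
        part∈𝒜 true {i} i∈ = proj₂ (∈-sep famF _) (proj₂ (∈-𝒫 _) (part⊆ω true i) , η (i , i∈ , η (inj₁ Q-refl)))
        part∈𝒜 false {i} i∈ = proj₂ (∈-sep famF _) (proj₂ (∈-𝒫 _) (part⊆ω false i) , η (i , i∈ , η (inj₂ Q-refl)))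

      unbounded-≈ : ∀ {x y} → x ≈ y → Unbounded x → Unbounded y
      unbounded-≈ e u n n∈ = u n n∈ >>¬ λ { (m , m∈ , m∉) → η (m , ∈ʳ e m∈ , m∉) }

      𝒜-unbounded : ∀ {x} → x ∈ 𝒜 → Unbounded x
      𝒜-unbounded x∈ = 𝒜-elim x∈ >>= λ { (c , i , i∈ , e) → unbounded-≈ (Q-sym e) (part-unbounded c i i∈) }

      Apart : M → M → Set
      Apart x y = ∃ λ b → b ∈ ω × (∀ m → m ∈ x → m ∈ y → m ∈ b)

      apart : ∀ c d {i j} → i ∈ I → j ∈ I → ¬ Part c i ≈ Part d j → Apart (Part c i) (Part d j)
      apart c d {i} {j} i∈ j∈ ne ret = lem {i ≈ j} λ
        { (inj₁ e) → ret (∅ , 0∈ω , same c d e ne)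
        ; (inj₂ n) → ad i j i∈ j∈ n λ { (b , b∈ , h) → ret (b , b∈ , λ m m∈ m∈′ →
            let (m∈ω , ai , _) = proj₁ (∈-Part c m) m∈ ; (_ , aj , _) = proj₁ (∈-Part d m) m∈′ in h m m∈ω ai aj) } }
        where
        same : ∀ c d → i ≈ j → ¬ Part c i ≈ Part d j → ∀ m → m ∈ Part c i → m ∈ Part d j → m ∈ ∅
        same true true e n = ⊥-elim (n (part-cong true e))
        same false false e n = ⊥-elim (n (part-cong false e))
        same true false e n m m∈ m∈′ = ⊥-elim (proj₂ (proj₂ (proj₁ (∈-Part false m) (∈ʳ (part-cong false (Q-sym e)) m∈′))) (proj₂ (proj₂ (proj₁ (∈-Part true m) m∈))))
        same false true e n m m∈ m∈′ = ⊥-elim (proj₂ (proj₂ (proj₁ (∈-Part false m) m∈)) (proj₂ (proj₂ (proj₁ (∈-Part true m) (∈ʳ (part-cong true (Q-sym e)) m∈′)))))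

      almost-disjoint : ∀ {x y} → x ∈ 𝒜 → y ∈ 𝒜 → ¬ x ≈ y → Apart x y
      almost-disjoint x∈ y∈ ne ret = 𝒜-elim x∈ λ { (c , i , i∈ , e) → 𝒜-elim y∈ λ { (d , j , j∈ , e′) →
        apart c d i∈ j∈ (λ q → ne (Q-trans e (Q-trans q (Q-sym e′)))) λ { (b , b∈ , h) → ret (b , b∈ , λ m m∈ m∈′ → h m (∈ʳ e m∈) (∈ʳ e′ m∈′)) } } }

      -- If z met both parts of a_i in bounded sets, the larger of the two bounds would bound a_i ∩
      -- z. Calling `ret` for one part after the other expresses this choice between them.
      maximal : ∀ z → z ⊆ ω → Unbounded z → ∃ λ x → x ∈ 𝒜 × (∀ n → n ∈ ω → ∃ λ m → m ∈ x × m ∈ z × m ∉ n)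
      maximal z z⊆ u ret = mad z z⊆ u λ { (i , i∈ , h) →
        ret (Part true i , part∈𝒜 true i∈ , λ n₁ n₁∈ no₁ →
        ret (Part false i , part∈𝒜 false i∈ , λ n₂ n₂∈ no₂ →
        ω-max n₁∈ n₂∈ λ { (n , n∈ , n₁⊆ , n₂⊆) → h n n∈ λ { (m , m∈ , m∉ , am) → lem {InPart true i m} λ
          { (inj₁ g) → no₁ (m , proj₂ (∈-Part true m) (z⊆ m m∈ , am , g) , m∈ , λ k → m∉ (n₁⊆ m k))
          ; (inj₂ g) → no₂ (m , proj₂ (∈-Part false m) (z⊆ m m∈ , am , g) , m∈ , λ k → m∉ (n₂⊆ m k)) } } })) }

      indexF : Fm 2
      indexF = v1 ∈̇ con ω ∧̇ v0 ≈̇ Part-op true [ v1 · v1 ]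

      𝒜-infinite : ¬ Fin′ 𝒜
      𝒜-infinite f = fin-bounded (fin-image indexF f uniq λ n n∈ → η (Part true n , part∈𝒜 true (nat⊆I n n∈) , n∈ , Q-refl)) (λ z m → m) λ { (n , n∈ , h) → x∉x (h n n∈) }
        where
        uniq : ∀ x n n′ → Sat indexF (x ∷ n ∷ []) → Sat indexF (x ∷ n′ ∷ []) → n ≈ n′
        uniq x n n′ (n∈ , e) (n′∈ , e′) = stable λ ne → ad n n′ (nat⊆I n n∈) (nat⊆I n′ n′∈) ne λ { (b , b∈ , h) →
          part-unbounded true n (nat⊆I n n∈) b b∈ λ { (m , m∈ , m∉) → m∉ (h m (part⊆ω true n m m∈) (proj₁ (proj₂ (proj₁ (∈-Part true m) m∈)))
            (proj₁ (proj₂ (proj₁ (∈-Part true m) (∈ʳ (Q-trans (Q-sym e) e′) m∈))))) } }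

      -- The diagonal argument: a countable infinite almost disjoint family is not maximal.
      module Countable (κ : Fm 2) (κ-tot : ∀ x → x ∈ 𝒜 → ∃ λ n → n ∈ ω × Sat κ (x ∷ n ∷ []))
        (κ-fun : ∀ x n n′ → Sat κ (x ∷ n ∷ []) → Sat κ (x ∷ n′ ∷ []) → n ≈ n′)
        (κ-inj : ∀ x y n → x ∈ 𝒜 → y ∈ 𝒜 → Sat κ (x ∷ n ∷ []) → Sat κ (y ∷ n ∷ []) → x ≈ y) where

        Code : M → M → Set
        Code x n = Sat κ (x ∷ n ∷ [])

        avoidF : M → Fm 1
        avoidF x = ∃̇ (v0 ∈̇ con ω ∧̇ ∀̇ (v0 ∈̇ con 𝒜 ⇒̇ ∀̇ (v0 ∈̇ v3 ⇒̇ sub κ (1F ∷ 0F ∷ []) ⇒̇ ¬̇ v1 ≈̇ con x ⇒̇ ∀̇ (v0 ∈̇ con x ⇒̇ v0 ∈̇ v2 ⇒̇ v0 ∈̇ v3))))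

        avoid : ∀ x → x ∈ 𝒜 → ∀ n → n ∈ ω → ∃ λ b → b ∈ ω × (∀ y → y ∈ 𝒜 → ∀ k → k ∈ n → Code y k → ¬ y ≈ x → ∀ m → m ∈ x → m ∈ y → m ∈ b)
        avoid x x∈ = ω-ind (avoidF x) (η (∅ , 0∈ω , λ y _ k k∈ → ⊥-elim (∉∅ k∈))) λ n n∈ ih ret → ih λ { (b , b∈ , h) →
          lem {∃ λ y → y ∈ 𝒜 × Code y n × ¬ y ≈ x} λ
          { (inj₁ e) → e λ { (y₀ , y₀∈ , c₀ , ne) → almost-disjoint x∈ y₀∈ (λ q → ne (Q-sym q)) λ { (b′ , b′∈ , h′) → ω-max b∈ b′∈ λ { (l , l∈ , b⊆ , b′⊆) →
              ret (l , l∈ , λ y y∈ k k∈ c n′ m m∈ m∈′ → proj₁ (∈-+̂ k) k∈ >>= λ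
                { (inj₁ k∈) → b⊆ m (h y y∈ k k∈ c n′ m m∈ m∈′)
                ; (inj₂ e) → b′⊆ m (h′ m m∈ (∈ʳ (κ-inj y y₀ n y∈ y₀∈ (cong₂ κ Q-refl e c) c₀) m∈′)) }) } } }
          ; (inj₂ none) → ret (b , b∈ , λ y y∈ k k∈ c n′ m m∈ m∈′ → proj₁ (∈-+̂ k) k∈ >>= λ
                { (inj₁ k∈) → h y y∈ k k∈ c n′ m m∈ m∈′
                ; (inj₂ e) → ⊥-elim (none (η (y , y∈ , cong₂ κ Q-refl e c , n′))) }) } }

        pickF : Fm 2 -- x , m
        pickF = v1 ∈̇ v0 ∧̇ ∃̇ (v0 ∈̇ con ω ∧̇ sub κ (1F ∷ 0F ∷ []) ∧̇ ¬̇ v2 ∈̇ v0 ∧̇ ∀̇ (v0 ∈̇ con 𝒜 ⇒̇ ∀̇ (v0 ∈̇ v2 ⇒̇ sub κ (1F ∷ 0F ∷ []) ⇒̇ ¬̇ v4 ∈̇ v1)))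

        pick : ∀ x → x ∈ 𝒜 → ∃ λ m → Sat pickF (x ∷ m ∷ [])
        pick x x∈ ret = κ-tot x x∈ λ { (n , n∈ , c) → avoid x x∈ n n∈ λ { (b , b∈ , h) → ω-max n∈ b∈ λ { (l , l∈ , n⊆ , b⊆) → 𝒜-unbounded x∈ l l∈ λ { (m , m∈ , m∉) →
          ret (m , m∈ , η (n , n∈ , c , (λ k → m∉ (n⊆ m k)) , λ y y∈ k k∈ c′ m∈y →
            m∉ (b⊆ m (h y y∈ k k∈ c′ (λ e → x∉x (∈ˡ (κ-fun x k n (cong₂ κ e Q-refl c′) c) k∈)) m m∈ m∈y)))) } } } }

        module _ (F : M) (F-fun : Functional F) (F-spec : ∀ x m → ⟨ x , m ⟩ ∈ F → x ∈ 𝒜 × Sat pickF (x ∷ m ∷ [])) (F-tot : ∀ x → x ∈ 𝒜 → ∃ λ m → ⟨ x , m ⟩ ∈ F) where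
          zF : Fm 1
          zF = ∃̇ (⟨ v0 , v1 ⟩ᵗ ∈̇ con F)
          z : M
          z = sep ω zF

          κ⁻¹ : Fm 2
          κ⁻¹ = v1 ∈̇ con 𝒜 ∧̇ sub κ (1F ∷ 0F ∷ [])

          large-code : ∀ n → n ∈ ω → ∃ λ x → x ∈ 𝒜 × ∃ λ k → k ∈ ω × Code x k × k ∉ n
          large-code n n∈ ret = 𝒜-infinite (fin-image κ⁻¹ (fin-ω n n∈) (λ k x y (x∈ , c) (y∈ , d) → κ-inj x y k x∈ y∈ c d)
            λ x x∈ → κ-tot x x∈ >>¬ λ { (k , k∈ , c) → η (k , stable (λ k∉ → ret (x , x∈ , η (k , k∈ , c , k∉))) , x∈ , c) })

          z-unbounded : Unbounded z
          z-unbounded n n∈ ret = large-code n n∈ λ { (x , x∈ , h) → h λ { (k , k∈ , c , k∉) → F-tot x x∈ λ { (m , Fm) → let (_ , m∈ , h) = F-spec x m Fm in h λ { (k′ , _ , c′ , m∉ , _) →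
            ret (m , proj₂ (∈-sep zF m) (𝒜⊆ x∈ m m∈ , η (x , Fm)) , λ m∈n → m∉ (∈ʳ (κ-fun x k k′ c c′) (ω-lin n n∈ k k∈ >>= λ
              { (inj₁ k∈n) → ⊥-elim (k∉ k∈n) ; (inj₂ h) → h >>= λ { (inj₁ e) → ∈ʳ (Q-sym e) m∈n ; (inj₂ n∈k) → ω-trans k k∈ n n∈k m m∈n } }))) } } } }

          φ : Fm 2 -- k , m
          φ = ∃̇ (v0 ∈̇ con 𝒜 ∧̇ sub κ (0F ∷ 1F ∷ []) ∧̇ ⟨ v0 , v2 ⟩ᵗ ∈̇ con F)

          -- Each pick avoids all members of smaller code. So a member of code k contains picks only
          -- from members of code at most k, one from each, and meets z in a finite set.
          absurd : 𝟘
          absurd = maximal z (λ m h → proj₁ (proj₁ (∈-sep zF m) h)) z-unbounded λ { (y , y∈ , h) → κ-tot y y∈ λ { (k , k∈ , c) →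
            fin-bounded {y ∩ z} (fin-image φ (fin-ω _ (suc∈ω k∈))
              (λ n m m′ s s′ → s >>= λ { (x , x∈ , c , Fx) → s′ >>= λ { (x′ , x′∈ , c′ , Fx′) → F-fun x m m′ Fx (∈ˡ (pair-cong (κ-inj x′ x n x′∈ x∈ c′ c) Q-refl) Fx′) } })
              (λ m m∈ → let (m∈y , m∈z) = proj₁ (∈-∩ m) m∈ in proj₂ (proj₁ (∈-sep zF m) m∈z) >>¬ λ { (x , Fx) → let (x∈ , _ , q) = F-spec x m Fx in q >>¬ λ { (n , n∈ , c′ , _ , av) →
                η (n , (ω-lin k k∈ n n∈ >>= λ { (inj₁ n∈k) → +̂-old n∈k ; (inj₂ h) → h >>= λ { (inj₁ e) → ∈ˡ (Q-sym e) +̂-new ; (inj₂ k∈n) → ⊥-elim (av y y∈ k k∈n c m∈y) } }) , η (x , x∈ , c′ , Fx)) } }))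
              (λ m m∈ → 𝒜⊆ y∈ m (proj₁ (proj₁ (∈-∩ m) m∈)))
              λ { (b , b∈ , bd) → h b b∈ λ { (m , m∈y , m∈z , m∉) → m∉ (bd m (proj₂ (∈-∩ m) (m∈y , m∈z))) } } } }

        uncountable : 𝟘
        uncountable = choice-function pickF 𝒜 pick λ { (F , a , b , c) → absurd F a b c }

  -- The family in 2^ω, and its subsets as G_δ sets

  module CharacteristicFunctions where
    open Almost public

    one two : M
    one = suc̆ ∅
    two = suc̆ one

    Char : M → M → Set
    Char f x = Fn f ω two × (∀ m → m ∈ ω → m ∈ x ↔ (⟨ m , one ⟩ ∈ f))

    charF : Fm 2 -- f , x
    charF = lt (con two) (lt (con ω) (sub fnF (2F ∷ 0F ∷ 1F ∷ []))) ∧̇ ∀̇ (v0 ∈̇ con ω ⇒̇ (v0 ∈̇ v2 ⇔̇ ⟨ v0 , con one ⟩ᵗ ∈̇ v1))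

    char-cong : ∀ {f f′ x x′} → f ≈ f′ → x ≈ x′ → Char f x → Char f′ x′
    char-cong = cong₂ charF

    two-cases : ∀ {y} → y ∈ two → y ≈ ∅ or y ≈ one
    two-cases m = proj₁ (∈-+̂ _) m >>¬ λ { (inj₁ m) → proj₁ (∈-+̂ _) m >>¬ λ { (inj₁ m) → ⊥-elim (∉∅ m) ; (inj₂ e) → η (inj₁ e) } ; (inj₂ e) → η (inj₂ e) }

    char-exists : ∀ x → ∃ λ f → Char f x
    char-exists x = η (f , ((graph-⊆ φ , f-fun , f-tot) , λ m m∈ → (λ h → f-intro m∈ +̂-new (η (inj₁ (h , Q-refl)))) ,
        λ h → proj₂ (proj₁ (∈-graph φ) h) >>= λ { (inj₁ (m∈x , _)) → m∈x ; (inj₂ (_ , e)) → ⊥-elim (suc≢∅ e) }))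
      where
      φ : Fm 2
      φ = (v0 ∈̇ con x ∧̇ v1 ≈̇ con one) ∨̇ (¬̇ v0 ∈̇ con x ∧̇ v1 ≈̇ con ∅)
      f : M
      f = graph ω two φ
      f-intro : ∀ {m y} → m ∈ ω → y ∈ two → Sat φ (m ∷ y ∷ []) → ⟨ m , y ⟩ ∈ f
      f-intro a b s = proj₂ (∈-graph φ) ((a , b) , s)
      f-fun : Functional f
      f-fun m y y′ h h′ = proj₂ (proj₁ (∈-graph φ) h) >>= λ
        { (inj₁ (m∈ , e)) → proj₂ (proj₁ (∈-graph φ) h′) >>= λ { (inj₁ (_ , e′)) → Q-trans e (Q-sym e′) ; (inj₂ (m∉ , _)) → ⊥-elim (m∉ m∈) }
        ; (inj₂ (m∉ , e)) → proj₂ (proj₁ (∈-graph φ) h′) >>= λ { (inj₁ (m∈ , _)) → ⊥-elim (m∉ m∈) ; (inj₂ (_ , e′)) → Q-trans e (Q-sym e′) } }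
      f-tot : Total f ω
      f-tot m m∈ = lem {m ∈ x} >>¬ λ
        { (inj₁ h) → η (one , f-intro m∈ +̂-new (η (inj₁ (h , Q-refl))))
        ; (inj₂ h) → η (∅ , f-intro m∈ (+̂-old +̂-new) (η (inj₂ (h , Q-refl)))) }

    char-⊆ : ∀ {f f′ x} → Char f x → Char f′ x → f ⊆ f′
    char-⊆ {f} {f′} {x} ((s , fn , _) , h) ((s′ , _ , tot′) , h′) z z∈ = proj₁ (∈-× z) (s z z∈) >>= λ { (m , k) → k >>= λ { (y , e , m∈ , y∈) →
      let my∈ = ∈ˡ e z∈ in ∈ˡ (Q-sym e) (two-cases y∈ >>= λ
        { (inj₂ y≈) → ∈ˡ (pair-cong Q-refl (Q-sym y≈)) (proj₁ (h′ m m∈) (proj₂ (h m m∈) (∈ˡ (pair-cong Q-refl y≈) my∈)))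
        ; (inj₁ y≈) → tot′ m m∈ >>= λ { (y′ , my′) → two-cases (proj₂ (proj₁ pair∈× (s′ _ my′))) >>= λ
            { (inj₁ e′) → ∈ˡ (pair-cong Q-refl (Q-trans e′ (Q-sym y≈))) my′
            ; (inj₂ e′) → ⊥-elim (suc≢∅ (Q-trans (fn m one y (proj₁ (h m m∈) (proj₂ (h′ m m∈) (∈ˡ (pair-cong Q-refl e′) my′))) my∈) y≈)) } } }) } }

    char-unique : ∀ {f f′ x} → Char f x → Char f′ x → f ≈ f′
    char-unique c c′ = ext⊆ (char-⊆ c c′) (char-⊆ c′ c)

    char-inj : ∀ {f x y} → x ⊆ ω → y ⊆ ω → Char f x → Char f y → x ≈ y
    char-inj x⊆ y⊆ (_ , h) (_ , h′) = ext⊆ (λ m m∈ → proj₂ (h′ m (x⊆ m m∈)) (proj₁ (h m (x⊆ m m∈)) m∈)) (λ m m∈ → proj₂ (h m (y⊆ m m∈)) (proj₁ (h′ m (y⊆ m m∈)) m∈))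

    Near : M → M → M → Set
    Near f F g = Fn g ω two × (∀ m → m ∈ F → ∃ λ y → ⟨ m , y ⟩ ∈ f × ⟨ m , y ⟩ ∈ g)

    IsOpen : M → Set
    IsOpen V = (∀ f → f ∈ V → Fn f ω two) × (∀ f → f ∈ V → ∃ λ F → F ⊆ ω × Finite F × (∀ g → Near f F g → g ∈ V))

    IsGδ : M → M → Set
    IsGδ X Y = ∃ λ 𝒪 → ∃ (λ h → Inj h 𝒪 ω) × (∀ O → O ∈ 𝒪 → ∃ λ V → IsOpen V × (∀ f → f ∈ O ↔ (f ∈ X × f ∈ V))) × (∀ f → f ∈ Y ↔ (f ∈ X × (∀ O → O ∈ 𝒪 → f ∈ O)))

    module QSet {I J R a : M} {L : Bool → M} (𝓛 : Labelled I J R a L) where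
      open Labelled 𝓛
      open Family 𝓛 public

      XF : Fm 1
      XF = ∃̇ (v0 ∈̇ con 𝒜 ∧̇ sub charF (1F ∷ 0F ∷ []))

      opaque
        X : M
        X = sep (𝒫 (ω ×ˢ two)) XF

        ∈-X : ∀ f → f ∈ X ↔ ∃ λ x → x ∈ 𝒜 × Char f x
        ∈-X f = ↔-trans (∈-sep XF f) (proj₂ , λ h → (h >>= λ { (x , _ , c) → proj₂ (∈-𝒫 f) (proj₁ (proj₁ c)) }) , h)

      X-fn : ∀ f → f ∈ X → Fn f ω two
      X-fn f m = (stable λ n → proj₁ (∈-X f) m λ { (x , _ , c) → n (proj₁ (proj₁ c)) })
        , (λ x y y′ p q → proj₁ (∈-X f) m >>= λ { (_ , _ , c) → proj₁ (proj₂ (proj₁ c)) x y y′ p q })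
        , λ x x∈ → proj₁ (∈-X f) m >>= λ { (_ , _ , c) → proj₂ (proj₂ (proj₁ c)) x x∈ }

      X-uncountable : ¬ ∃ λ h → Inj h X ω
      X-uncountable k = k λ { (h , fn , inj) → Countable.uncountable (codeF h)
        (λ x x∈ ret → char-exists x λ { (f , c) → proj₂ (proj₂ fn) f (proj₂ (∈-X f) (η (x , x∈ , c))) λ { (n , m) → ret (n , proj₂ (fn-in {h} {X} {ω} fn m) , η (f , c , m)) } })
        (λ x n n′ s s′ → s >>= λ { (f , c , m) → s′ >>= λ { (f′ , c′ , m′) → proj₁ (proj₂ fn) f n n′ m (∈ˡ (pair-cong (char-unique c′ c) Q-refl) m′) } })
        (λ x y n x∈ y∈ s s′ → s >>= λ { (f , c , m) → s′ >>= λ { (f′ , c′ , m′) →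
          char-inj (𝒜⊆ x∈) (𝒜⊆ y∈) c (char-cong (inj f′ (proj₁ (fn-in {h} {X} {ω} fn m′)) f (proj₁ (fn-in {h} {X} {ω} fn m)) n (m′ , m)) Q-refl c′) } }) }
        where
        codeF : M → Fm 2 -- x , n
        codeF h = ∃̇ (sub charF (0F ∷ 1F ∷ []) ∧̇ ⟨ v0 , v2 ⟩ᵗ ∈̇ con h)

      module _ (Y : M) (Y⊆ : Y ⊆ X) where
        -- A subset of the family amounts to two subsets of `I`, one for each sign, and each of them
        -- receives its own code.
        indF : Bool → Fm 1
        indF c = lt (Part-op c [ v0 · v0 ]) (∃̇ (v0 ∈̇ con Y ∧̇ sub charF (0F ∷ 1F ∷ [])))

        Ind′ : Bool → M
        Ind′ c = sep I (indF c)

        module _ (u : Bool → M) (u-spec : ∀ c i → i ∈ I → i ∈ Ind′ c ↔ (∀ k → k ∈ ω → ∃ λ t → t ∈ J × ⟨ i , t ⟩ ∈ R × ⟨ k , t ⟩ ∈ u c)) where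

          witF : Bool → Fm 2 -- k , f
          witF c = ∃̇ (∃̇ (∃̇ (v0 ∈̇ con J ∧̇ ⟨ v2 , con one ⟩ᵗ ∈̇ v4 ∧̇ ⟨ v1 , con one ⟩ᵗ ∈̇ v4 ∧̇ ⟨ v2 , con t₀ ⟩ᵗ ∈̇ con (L c) ∧̇ ⟨ v1 , v0 ⟩ᵗ ∈̇ con (L c) ∧̇ ⟨ v3 , v0 ⟩ᵗ ∈̇ con (u c))))

          openF : Fm 2
          openF = witF true ∨̇ witF false

          wit : ∀ c {k f} → Sat (witF c) (k ∷ f ∷ []) → Sat openF (k ∷ f ∷ [])
          wit true h = η (inj₁ h)
          wit false h = η (inj₂ h)

          char-∈ : ∀ {f x m} → x ⊆ ω → Char f x → m ∈ x → ⟨ m , one ⟩ ∈ f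
          char-∈ x⊆ c m∈ = proj₁ (proj₂ c _ (x⊆ _ m∈)) m∈

          ∈-char : ∀ {f x m} → Char f x → ⟨ m , one ⟩ ∈ f → m ∈ x
          ∈-char {f} c h = proj₂ (proj₂ c _ (proj₁ (fn-in {f} {ω} {two} (proj₁ c) h))) h

          wit-other : ∀ c {k f i} → i ∈ I → Char f (Part c i) → ¬ Sat (witF (not c)) (k ∷ f ∷ [])
          wit-other c {i = i} i∈ ch h = h λ { (m , h) → h λ { (m′ , h) → h λ { (t , _ , f∋ , _ , l , _) → unseen c i i∈ m (∈-char ch f∋) l } } }

          wit-same : ∀ c {k f i} → i ∈ I → Char f (Part c i) → Sat (witF c) (k ∷ f ∷ []) ↔ ∃ λ t → t ∈ J × ⟨ i , t ⟩ ∈ R × ⟨ k , t ⟩ ∈ u c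
          wit-same c {k} {f} {i} i∈ ch =
            (λ h ret → h λ { (m , h) → h λ { (m′ , h) → h λ { (t , t∈ , _ , f∋ , _ , l , uk) → ret (t , t∈ , proj₁ (sees c i t i∈ t∈) (η (m′ , ∈-char ch f∋ , l)) , uk) } } })
            , λ h ret → h λ { (t , t∈ , r , uk) → proj₂ (sees c i t₀ i∈ t₀∈) (t₀-top i i∈) λ { (m , m∈ , l) → proj₂ (sees c i t i∈ t∈) r λ { (m′ , m′∈ , l′) →
                ret (m , η (m′ , η (t , t∈ , char-∈ (part⊆ω c i) ch m∈ , char-∈ (part⊆ω c i) ch m′∈ , l , l′ , uk))) } } }

          -- A witness of sign d contains an element labelled t₀ with sign d, which only parts of
          -- sign d have. So for f from part c the witnesses of the other sign disappear, and those
          -- of sign c reveal a t with R(i,t).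
          openF-spec : ∀ c {k f i} → i ∈ I → Char f (Part c i) → Sat openF (k ∷ f ∷ []) ↔ ∃ λ t → t ∈ J × ⟨ i , t ⟩ ∈ R × ⟨ k , t ⟩ ∈ u c
          openF-spec c i∈ ch = (λ h → h >>= λ { (inj₁ w) → only c i∈ ch true w ; (inj₂ w) → only c i∈ ch false w }) , λ h → wit c (proj₂ (wit-same c i∈ ch) h)
            where
            only : ∀ c {k f i} → i ∈ I → Char f (Part c i) → ∀ d → Sat (witF d) (k ∷ f ∷ []) → ∃ λ t → t ∈ J × ⟨ i , t ⟩ ∈ R × ⟨ k , t ⟩ ∈ u c
            only true i∈ ch true w = proj₁ (wit-same true i∈ ch) w
            only false i∈ ch false w = proj₁ (wit-same false i∈ ch) w
            only true i∈ ch false w = ⊥-elim (wit-other true i∈ ch w)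
            only false i∈ ch true w = ⊥-elim (wit-other false i∈ ch w)

          VF : M → Fm 1
          VF k = lt (con two) (lt (con ω) (sub fnF (2F ∷ 0F ∷ 1F ∷ []))) ∧̇ lt (con k) (sub openF (0F ∷ 1F ∷ []))
          V : M → M
          V k = sep (𝒫 (ω ×ˢ two)) (VF k)

          V-intro : ∀ k f → Fn f ω two → Sat openF (k ∷ f ∷ []) → f ∈ V k
          V-intro k f fn s = proj₂ (∈-sep (VF k) f) (proj₂ (∈-𝒫 f) (proj₁ fn) , fn , s)

          -- A witness depends only on f having value 1 at two numbers, so every g agreeing with f
          -- at these two has it as well.
          witness-open : ∀ c k f → Fn f ω two → Sat (witF c) (k ∷ f ∷ []) → ∃ λ F → F ⊆ ω × Finite F × (∀ g → Near f F g → g ∈ V k)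
          witness-open c k f fn s ret = s λ { (m , s) → s λ { (m′ , s) → s λ { (t , t∈ , f∋ , f∋′ , rest) →
            ret (upair m m′ , (λ z z∈ → proj₁ (∈-upair z) z∈ >>= λ { (inj₁ e) → ∈ˡ (Q-sym e) (dm f∋) ; (inj₂ e) → ∈ˡ (Q-sym e) (dm f∋′) })
              , fin⇒finite (fin-⊆ (fin-+̂ (fin-+̂ fin-∅)) λ z z∈ → proj₁ (∈-upair z) z∈ >>= λ { (inj₁ e) → ∈ˡ (Q-sym e) (+̂-old (+̂-new {∅})) ; (inj₂ e) → ∈ˡ (Q-sym e) +̂-new })
              , λ g (gn , near) → V-intro k g gn (wit c (η (m , η (m′ , η (t , t∈ , move near upairˡ f∋ , move near upairʳ f∋′ , rest)))))) } } }
            where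
            dm : ∀ {m} → ⟨ m , one ⟩ ∈ f → m ∈ ω
            dm h = proj₁ (fn-in {f} {ω} {two} fn h)
            move : ∀ {F g m} → (∀ m → m ∈ F → ∃ λ y → ⟨ m , y ⟩ ∈ f × ⟨ m , y ⟩ ∈ g) → m ∈ F → ⟨ m , one ⟩ ∈ f → ⟨ m , one ⟩ ∈ g
            move {m = m} near m∈ h = near m m∈ >>= λ { (y , a , b) → ∈ˡ (pair-cong Q-refl (proj₁ (proj₂ fn) m y one a h)) b }

          V-open : ∀ k → IsOpen (V k)
          V-open k = (λ f m → proj₁ (proj₂ (proj₁ (∈-sep (VF k) f) m))) , λ f m → let (_ , fn , s) = proj₁ (∈-sep (VF k) f) m in
            s >>= λ { (inj₁ w) → witness-open true k f fn w ; (inj₂ w) → witness-open false k f fn w }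

          isOF : Fm 2 -- O , k
          isOF = v1 ∈̇ con ω ∧̇ ∀̇ (v0 ∈̇ v1 ⇔̇ v0 ∈̇ con X ∧̇ sub openF (2F ∷ 0F ∷ []))

          𝒪 : M
          𝒪 = sep (𝒫 X) (∃̇ (sub isOF (1F ∷ 0F ∷ [])))

          𝒪-elim : ∀ {O} → O ∈ 𝒪 → ∃ λ k → Sat isOF (O ∷ k ∷ [])
          𝒪-elim {O} m = proj₂ (proj₁ (∈-sep (∃̇ (sub isOF (1F ∷ 0F ∷ []))) O) m)

          OF : M → Fm 1
          OF k = lt (con k) (sub openF (0F ∷ 1F ∷ []))

          O∈𝒪 : ∀ {k} → k ∈ ω → sep X (OF k) ∈ 𝒪
          O∈𝒪 {k} k∈ = proj₂ (∈-sep (∃̇ (sub isOF (1F ∷ 0F ∷ []))) _) (proj₂ (∈-𝒫 _) (λ f m → proj₁ (proj₁ (∈-sep (OF k) f) m)) , η (k , k∈ , λ f → ∈-sep (OF k) f))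

          -- Any choice of an index k for each O is injective, because k determines O.
          𝒪-countable : ∃ λ h → Inj h 𝒪 ω
          𝒪-countable ret = choice-function isOF 𝒪 (λ O → 𝒪-elim) λ { (F , fn , sp , tot) →
            let φ : Fm 2
                φ = ⟨ v0 , v1 ⟩ᵗ ∈̇ con F
            in ret (graph 𝒪 ω φ , (graph-⊆ φ , (λ O k k′ m m′ → fn O k k′ (proj₂ (proj₁ (∈-graph φ) m)) (proj₂ (proj₁ (∈-graph φ) m′)))
              , λ O O∈ → tot O O∈ >>¬ λ { (k , m) → η (k , proj₂ (∈-graph φ) ((O∈ , proj₁ (proj₂ (sp O k m))) , m)) })
              , λ O _ O′ _ k (m , m′) → ext λ f → ↔-trans (proj₂ (proj₂ (sp O k (proj₂ (proj₁ (∈-graph φ) m)))) f) (↔-sym (proj₂ (proj₂ (sp O′ k (proj₂ (proj₁ (∈-graph φ) m′)))) f))) }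

          𝒪-open : ∀ O → O ∈ 𝒪 → ∃ λ V → IsOpen V × (∀ f → f ∈ O ↔ (f ∈ X × f ∈ V))
          𝒪-open O O∈ ret = 𝒪-elim O∈ λ { (k , k∈ , h) → ret (V k , V-open k , λ f → ↔-trans (h f)
            ((λ { (f∈ , s) → f∈ , V-intro k f (X-fn f f∈) s }) , λ { (f∈ , v) → f∈ , proj₂ (proj₂ (proj₁ (∈-sep (VF k) f) v)) })) }

          in-Y : ∀ c {f i} → i ∈ I → Char f (Part c i) → i ∈ Ind′ c ↔ (f ∈ Y)
          in-Y c {f} {i} i∈ ch = (λ m → proj₂ (proj₁ (∈-sep (indF c) i) m) >>= λ { (f′ , f′∈ , ch′) → ∈ˡ (char-unique ch′ ch) f′∈ })
            , λ f∈ → proj₂ (∈-sep (indF c) i) (i∈ , η (f , f∈ , ch))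

          all-open : ∀ c {f i} → f ∈ X → i ∈ I → Char f (Part c i) → (f ∈ Y) ↔ (∀ O → O ∈ 𝒪 → f ∈ O)
          all-open c {f} {i} f∈ i∈ ch = ↔-trans (↔-sym (in-Y c i∈ ch)) (↔-trans (u-spec c i i∈)
            ( (λ h O O∈ → 𝒪-elim O∈ >>= λ { (k , k∈ , q) → proj₂ (q f) (f∈ , proj₂ (openF-spec c i∈ ch) (h k k∈)) })
            , (λ h k k∈ → proj₁ (openF-spec c i∈ ch) (proj₂ (proj₁ (∈-sep (OF k) f) (h _ (O∈𝒪 k∈))))) ))

          𝒪-inter : ∀ f → f ∈ Y ↔ (f ∈ X × (∀ O → O ∈ 𝒪 → f ∈ O))
          𝒪-inter f = (λ m → Y⊆ f m , λ O O∈ → at (Y⊆ f m) >>= λ { (c , i , i∈ , ch) → proj₁ (all-open c (Y⊆ f m) i∈ ch) m O O∈ })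
            , λ { (f∈ , h) → at f∈ >>= λ { (c , i , i∈ , ch) → proj₂ (all-open c f∈ i∈ ch) h } }
            where
            at : f ∈ X → ¬ ¬ Σ Bool λ c → Σ M λ i → i ∈ I × Char f (Part c i)
            at f∈ ret = proj₁ (∈-X f) f∈ λ { (x , x∈ , ch) → 𝒜-elim x∈ λ { (c , i , i∈ , e) → ret (c , i , i∈ , char-cong Q-refl e ch) } }

        Gδ : IsGδ X Y
        Gδ ret = coded (Ind′ true) (λ i m → proj₁ (proj₁ (∈-sep (indF true) i) m)) λ { (u₁ , s₁) → coded (Ind′ false) (λ i m → proj₁ (proj₁ (∈-sep (indF false) i) m)) λ { (u₀ , s₀) →
          let u : Bool → M
              u = λ { true → u₁ ; false → u₀ }
              s : ∀ c i → i ∈ I → i ∈ Ind′ c ↔ (∀ k → k ∈ ω → ∃ λ t → t ∈ J × ⟨ i , t ⟩ ∈ R × ⟨ k , t ⟩ ∈ u c)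
              s = λ { true → s₁ ; false → s₀ }
          in ret (𝒪 u s , 𝒪-countable u s , 𝒪-open u s , 𝒪-inter u s) } }

  -- From the combinatorial statement to the official sentence

  module Conclusion where
    open CharacteristicFunctions

    module FromΨ (w I J R a L₁ L₀ : M) where
      e₇ : Vec M 7
      e₇ = L₀ ∷ L₁ ∷ a ∷ R ∷ J ∷ I ∷ w ∷ []

      module _ (least : S.⟦ Ψ.least ⟧ e₇) (minimal : S.⟦ Ψ.minimal ⟧ e₇) (natural : S.⟦ Ψ.nat⊆I ⟧ e₇)
               (fun₁ : S.⟦ Ψ.labelFun 1F ⟧ e₇) (fun₀ : S.⟦ Ψ.labelFun 0F ⟧ e₇) (disj : S.⟦ Ψ.labelDisj ⟧ e₇)
               (meets₁ : S.⟦ Ψ.meets 1F ⟧ e₇) (meets₀ : S.⟦ Ψ.meets 0F ⟧ e₇) (ad : S.⟦ Ψ.ad ⟧ e₇) (mad : S.⟦ Ψ.mad ⟧ e₇)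
               (coded : S.⟦ Ψ.coded ⟧ e₇) (t : M) (t∈ : t ∈ J) (top : ∀ i → i ∈ I → ⟨ i , t ⟩ ∈ R) where

        ω⊆w : ω ⊆ w
        ω⊆w = ω-least (proj₁ (S-Inductive 6F {e₇}) least)

        w⊆ω : w ⊆ ω
        w⊆ω = minimal ω (proj₂ (S-Inductive 0F {ω ∷ e₇}) ω-Ind)

        L : Bool → M
        L true = L₁
        L false = L₀

        labelled : Labelled I J R a L
        labelled = record
          { nat⊆I = λ n n∈ → natural n (ω⊆w n n∈)
          ; lab-fun = λ
            { true m t t′ m∈ t∈ t′∈ l l′ → fun₁ m (ω⊆w m m∈) t t∈ t′ t′∈ (proj₂ (S-Maps 4F 2F 1F {t′ ∷ t ∷ m ∷ e₇}) l) (proj₂ (S-Maps 4F 2F 0F {t′ ∷ t ∷ m ∷ e₇}) l′)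
            ; false m t t′ m∈ t∈ t′∈ l l′ → fun₀ m (ω⊆w m m∈) t t∈ t′ t′∈ (proj₂ (S-Maps 3F 2F 1F {t′ ∷ t ∷ m ∷ e₇}) l) (proj₂ (S-Maps 3F 2F 0F {t′ ∷ t ∷ m ∷ e₇}) l′) }
          ; lab-disj = λ m t t′ m∈ t∈ t′∈ l l′ → disj m (ω⊆w m m∈) t t∈ t′ t′∈ (proj₂ (S-Maps 4F 2F 1F {t′ ∷ t ∷ m ∷ e₇}) l) (proj₂ (S-Maps 3F 2F 0F {t′ ∷ t ∷ m ∷ e₇}) l′)
          ; meets = λ
            { true i t n i∈ t∈ n∈ ret → meets₁ i i∈ t t∈ n (ω⊆w n n∈) λ m m∈ m∉ am l →
                ret (m , w⊆ω m m∈ , m∉ , proj₁ (S-Maps 6F 3F 0F {m ∷ n ∷ t ∷ i ∷ e₇}) am , proj₁ (S-Maps 5F 0F 2F {m ∷ n ∷ t ∷ i ∷ e₇}) l)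
            ; false i t n i∈ t∈ n∈ ret → meets₀ i i∈ t t∈ n (ω⊆w n n∈) λ m m∈ m∉ am l →
                ret (m , w⊆ω m m∈ , m∉ , proj₁ (S-Maps 6F 3F 0F {m ∷ n ∷ t ∷ i ∷ e₇}) am , proj₁ (S-Maps 4F 0F 2F {m ∷ n ∷ t ∷ i ∷ e₇}) l) }
          ; ad = λ i j i∈ j∈ ne ret → ad i i∈ j j∈ ne λ n n∈ h → ret (n , w⊆ω n n∈ , λ m m∈ ai aj →
              h m (ω⊆w m m∈) (proj₂ (S-Maps 6F 3F 0F {m ∷ n ∷ j ∷ i ∷ e₇}) ai) (proj₂ (S-Maps 6F 2F 0F {m ∷ n ∷ j ∷ i ∷ e₇}) aj))
          ; mad = λ z z⊆ u ret → mad z (λ m m∈ → ω⊆w m (z⊆ m m∈)) (λ n n∈ k → u n (w⊆ω n n∈) λ { (m , m∈ , m∉) → k m m∈ m∉ }) λ i i∈ h →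
              ret (i , i∈ , λ n n∈ ret → h n (ω⊆w n n∈) λ m m∈ m∉ am → ret (m , m∈ , m∉ , proj₁ (S-Maps 6F 2F 0F {m ∷ n ∷ i ∷ z ∷ e₇}) am))
          ; t₀ = t
          ; t₀∈ = t∈
          ; t₀-top = top
          ; coded = λ Y Y⊆ ret → coded Y Y⊆ λ u h h′ → ret (u , λ i i∈ →
              (λ i∈Y k k∈ ret → h i i∈ i∈Y k (ω⊆w k k∈) λ t t∈ r m → ret (t , t∈ , proj₁ (S-Maps 8F 2F 0F {t ∷ k ∷ i ∷ u ∷ Y ∷ e₇}) r , proj₁ (S-Maps 3F 1F 0F {t ∷ k ∷ i ∷ u ∷ Y ∷ e₇}) m))
              , λ c → h′ i i∈ λ k k∈ no → c k (w⊆ω k k∈) λ { (t , t∈ , r , m) → no t t∈ (proj₂ (S-Maps 8F 2F 0F {t ∷ k ∷ i ∷ u ∷ Y ∷ e₇}) r) (proj₂ (S-Maps 3F 1F 0F {t ∷ k ∷ i ∷ u ∷ Y ∷ e₇}) m) })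
          }

    S-IsOne : ∀ {n} (o : Fin n) {e} → S.⟦ D.IsOne o ⟧ e ↔ (lookup e o ≈ one)
    S-IsOne o {e} = ↔-trans (S-ex e (D.IsEmpty 0F D.∧ D.IsSucc (suc o) 0F) λ z → S-∧′ (z ∷ e) (D.IsEmpty 0F) (D.IsSucc (suc o) 0F) (S-IsEmpty 0F {z ∷ e}) (S-IsSucc (suc o) 0F {z ∷ e}))
      ((λ h → h >>= λ { (z , z≈ , q) → Q-trans q (suc-cong z≈) }) , λ q → η (∅ , Q-refl , q))

    S-IsTwo : ∀ {n} (t : Fin n) {e} → S.⟦ D.IsTwo t ⟧ e ↔ (lookup e t ≈ two)
    S-IsTwo t {e} = ↔-trans (S-ex e (D.IsOne 0F D.∧ D.IsSucc (suc t) 0F) λ z → S-∧′ (z ∷ e) (D.IsOne 0F) (D.IsSucc (suc t) 0F) (S-IsOne 0F {z ∷ e}) (S-IsSucc (suc t) 0F {z ∷ e}))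
      ((λ h → h >>= λ { (z , z≈ , q) → Q-trans q (suc-cong z≈) }) , λ q → η (one , Q-refl , q))

    S-IsInter : ∀ {n} (z x y : Fin n) {e} → S.⟦ D.IsInter z x y ⟧ e ↔ (∀ u → u ∈ lookup e z ↔ (u ∈ lookup e x × u ∈ lookup e y))
    S-IsInter z x y {e} = S-all e (0F D.∈ suc z D.⇔ 0F D.∈ suc x D.∧ 0F D.∈ suc y) λ u →
      S-⇔′ (u ∷ e) (0F D.∈ suc z) (0F D.∈ suc x D.∧ 0F D.∈ suc y) ↔-refl (S-∧ (0F D.∈ suc x) (0F D.∈ suc y) {u ∷ e})

    S-IsCharFun : ∀ {n} (w t f x : Fin n) {e} → S.⟦ D.IsCharFun w t f x ⟧ e ↔
                  (Fn (lookup e f) (lookup e w) (lookup e t) × (∀ m → m ∈ lookup e w → m ∈ lookup e x ↔ (⟨ m , one ⟩ ∈ lookup e f)))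
    S-IsCharFun {n} w t f x {e} = S-∧′ e (D.Function f w t) (D.all∈ w (0F D.∈ suc x D.⇔ D.ex φ)) (S-Function f w t {e}) (S-all∈ e w (0F D.∈ suc x D.⇔ D.ex φ) λ m →
        S-⇔′ (m ∷ e) (0F D.∈ suc x) (D.ex φ) ↔-refl (↔-trans
          (S-ex (m ∷ e) φ λ o → S-∧′ (o ∷ m ∷ e) (D.IsOne 0F) (D.Maps (suc (suc f)) 1F 0F) (S-IsOne 0F {o ∷ m ∷ e}) (S-Maps (suc (suc f)) 1F 0F {o ∷ m ∷ e}))
          ((λ h → h >>= λ { (o , q , h) → ∈ˡ (pair-cong Q-refl q) h }) , λ h → η (one , Q-refl , h))))
      where
      φ : Formula (suc (suc n))
      φ = D.IsOne 0F D.∧ D.Maps (suc (suc f)) 1F 0F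

    NearIn : M → M → M → M → M → Set
    NearIn w t f F g = Fn g w t × (∀ m → m ∈ F → ∃ λ y → ⟨ m , y ⟩ ∈ f × ⟨ m , y ⟩ ∈ g)

    OpenIn : M → M → M → Set
    OpenIn w t V = (∀ f → f ∈ V → Fn f w t) × (∀ f → f ∈ V → ∃ λ F → F ⊆ w × FiniteIn w F × (∀ g → NearIn w t f F g → g ∈ V))

    S-Open : ∀ {n} (w t U : Fin n) {e} → S.⟦ D.Open w t U ⟧ e ↔ OpenIn (lookup e w) (lookup e t) (lookup e U)
    S-Open {n} w t U {e} = S-∧′ e (D.all∈ U (D.Function 0F (suc w) (suc t))) (D.all∈ U (D.ex φ))
      (S-all∈ e U (D.Function 0F (suc w) (suc t)) λ f → S-Function 0F (suc w) (suc t) {f ∷ e})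
      (S-all∈ e U (D.ex φ) λ f → S-ex (f ∷ e) φ λ F → S-∧′ (F ∷ f ∷ e) (0F D.⊆ suc (suc w)) (D.Finite (suc (suc w)) 0F D.∧ D.all ψ) ↔-refl
        (S-∧′ (F ∷ f ∷ e) (D.Finite (suc (suc w)) 0F) (D.all ψ) (S-Finite (suc (suc w)) 0F {F ∷ f ∷ e}) (S-all (F ∷ f ∷ e) ψ λ g →
          ↔-→ (S-∧′ (g ∷ F ∷ f ∷ e) (D.Function 0F w₃ t₃) (D.all∈ 1F (D.ex χ)) (S-Function 0F w₃ t₃ {g ∷ F ∷ f ∷ e})
            (S-all∈ (g ∷ F ∷ f ∷ e) 1F (D.ex χ) λ m → S-ex (m ∷ g ∷ F ∷ f ∷ e) χ λ y →
              S-∧′ (y ∷ m ∷ g ∷ F ∷ f ∷ e) (D.Maps 4F 1F 0F) (D.Maps 2F 1F 0F) (S-Maps 4F 1F 0F {y ∷ m ∷ g ∷ F ∷ f ∷ e}) (S-Maps 2F 1F 0F {y ∷ m ∷ g ∷ F ∷ f ∷ e}))) ↔-refl)))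
      where
      w₃ t₃ : Fin (suc (suc (suc n)))
      w₃ = suc (suc (suc w))
      t₃ = suc (suc (suc t))
      χ : Formula (suc (suc (suc (suc (suc n)))))
      χ = D.Maps 4F 1F 0F D.∧ D.Maps 2F 1F 0F
      ψ : Formula (suc (suc (suc n)))
      ψ = D.Function 0F w₃ t₃ D.∧ D.all∈ 1F (D.ex χ) D.⇒ 0F D.∈ suc (suc (suc U))
      φ : Formula (suc (suc n))
      φ = 0F D.⊆ suc (suc w) D.∧ D.Finite (suc (suc w)) 0F D.∧ D.all ψ

    module Witness {I J R a : M} {L : Bool → M} (𝓛 : Labelled I J R a L) where
      open QSet 𝓛

      e₄ : Vec M 4
      e₄ = X ∷ 𝒜 ∷ two ∷ ω ∷ []

      omega : S.⟦ D.IsOmega 3F ⟧ e₄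
      omega = proj₂ (S-∧ (D.Inductive 3F) (D.all (D.Inductive 0F D.⇒ 4F D.⊆ 0F)) {e₄})
        (proj₂ (S-Inductive 3F {e₄}) ω-Ind , λ x ind → ω-least (proj₁ (S-Inductive 0F {x ∷ e₄}) ind))

      interFin interInf : Formula 6
      interFin = D.ex (D.IsInter 0F 2F 1F D.∧ D.Finite 6F 0F)
      interInf = D.ex (D.IsInter 0F 2F 1F D.∧ D.Infinite 6F 0F)
      sub₁ madOf : Formula 5
      sub₁ = D.InfiniteSubset 4F 0F
      madOf = sub₁ D.⇒ D.ex∈ 2F interInf
      adOf : Formula 5
      adOf = D.all∈ 2F (D.~ 1F D.≐ 0F D.⇒ interFin)

      infinite-subset : ∀ x → x ⊆ ω → Unbounded x → S.⟦ sub₁ ⟧ (x ∷ e₄)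
      infinite-subset x x⊆ u = proj₂ (S-∧ (0F D.⊆ 4F) (D.Infinite 4F 0F) {x ∷ e₄}) (x⊆ , λ f → unbounded⇒infinite x⊆ u (proj₁ (S-Finite 4F 0F {x ∷ e₄}) f))

      ad′ : S.⟦ D.all∈ 1F adOf ⟧ e₄
      ad′ x x∈ y y∈ ne = proj₂ (S-ex (y ∷ x ∷ e₄) (D.IsInter 0F 2F 1F D.∧ D.Finite 6F 0F) λ z →
          S-∧′ (z ∷ y ∷ x ∷ e₄) (D.IsInter 0F 2F 1F) (D.Finite 6F 0F) (S-IsInter 0F 2F 1F {z ∷ y ∷ x ∷ e₄}) (S-Finite 6F 0F {z ∷ y ∷ x ∷ e₄}))
        λ ret → almost-disjoint x∈ y∈ ne λ { (b , b∈ , h) → ret (x ∩ y , ∈-∩ , bounded⇒finite b∈ λ m m∈ → let (p , q) = proj₁ (∈-∩ m) m∈ in h m p q) }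

      mad′ : S.⟦ D.all madOf ⟧ e₄
      mad′ z zi = proj₂ (S-ex∈′ (z ∷ e₄) 2F interInf λ x → S-ex (x ∷ z ∷ e₄) (D.IsInter 0F 2F 1F D.∧ D.Infinite 6F 0F) λ v →
          S-∧′ (v ∷ x ∷ z ∷ e₄) (D.IsInter 0F 2F 1F) (D.Infinite 6F 0F) (S-IsInter 0F 2F 1F {v ∷ x ∷ z ∷ e₄}) (↔-→ (S-Finite 6F 0F {v ∷ x ∷ z ∷ e₄}) ↔-refl))
        λ ret → let (z⊆ , inf) = proj₁ (S-∧ (0F D.⊆ 4F) (D.Infinite 4F 0F) {z ∷ e₄}) zi in
          maximal z z⊆ (infinite⇒unbounded λ f → inf (proj₂ (S-Finite 4F 0F {z ∷ e₄}) f)) λ { (x , x∈ , h) →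
          ret (x , x∈ , η (z ∩ x , ∈-∩ , unbounded⇒infinite (λ m m∈ → z⊆ m (proj₁ (proj₁ (∈-∩ m) m∈)))
            λ n n∈ → h n n∈ >>¬ λ { (m , m∈x , m∈z , m∉) → η (m , proj₂ (∈-∩ m) (m∈z , m∈x) , m∉) })) }

      madFamily : S.⟦ D.MAD 3F 1F ⟧ e₄
      madFamily = proj₂ (S-∧ (D.Infinite 3F 1F) (D.all∈ 1F sub₁ D.∧ D.all∈ 1F adOf D.∧ D.all madOf) {e₄})
        ( (λ f → 𝒜-infinite (finite⇒fin (proj₁ (S-Finite 3F 1F {e₄}) f)))
        , proj₂ (S-∧ (D.all∈ 1F sub₁) (D.all∈ 1F adOf D.∧ D.all madOf) {e₄})
          ( (λ x x∈ → infinite-subset x (𝒜⊆ x∈) (𝒜-unbounded x∈)) , proj₂ (S-∧ (D.all∈ 1F adOf) (D.all madOf) {e₄}) (ad′ , mad′) ) )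

      charImage : S.⟦ D.IsCharImage 3F 2F 0F 1F ⟧ e₄
      charImage f = proj₂ (S-⇔′ (f ∷ e₄) (0F D.∈ 1F) (D.ex∈ 2F (D.IsCharFun 5F 4F 1F 0F)) ↔-refl
        (S-ex∈′ (f ∷ e₄) 2F (D.IsCharFun 5F 4F 1F 0F) λ x → S-IsCharFun 5F 4F 1F 0F {x ∷ f ∷ e₄})) (∈-X f)

      relOpen : Formula 7
      relOpen = D.RelativelyOpen 6F 5F 3F 0F
      inAll : Formula 7
      inAll = 0F D.∈ 2F D.⇔ 0F D.∈ 3F D.∧ D.all∈ 1F (1F D.∈ 0F)
      gδ : Formula 6
      gδ = D.Countable 5F 0F D.∧ D.all∈ 0F relOpen D.∧ D.all inAll

      relativelyGδ : S.⟦ D.all (0F D.⊆ 1F D.⇒ D.RelativelyGδ 4F 3F 1F 0F) ⟧ e₄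
      relativelyGδ Y Y⊆ = proj₂ (S-ex (Y ∷ e₄) gδ λ 𝒪 → S-∧′ (𝒪 ∷ Y ∷ e₄) (D.Countable 5F 0F) (D.all∈ 0F relOpen D.∧ D.all inAll)
          (S-ex (𝒪 ∷ Y ∷ e₄) (D.Injection 0F 1F 6F) λ h → S-Injection 0F 1F 6F {h ∷ 𝒪 ∷ Y ∷ e₄})
          (S-∧′ (𝒪 ∷ Y ∷ e₄) (D.all∈ 0F relOpen) (D.all inAll)
            (S-all∈ (𝒪 ∷ Y ∷ e₄) 0F relOpen λ O → S-ex (O ∷ 𝒪 ∷ Y ∷ e₄) (D.Open 7F 6F 0F D.∧ D.IsInter 1F 4F 0F) λ V →
              S-∧′ (V ∷ O ∷ 𝒪 ∷ Y ∷ e₄) (D.Open 7F 6F 0F) (D.IsInter 1F 4F 0F) (S-Open 7F 6F 0F {V ∷ O ∷ 𝒪 ∷ Y ∷ e₄}) (S-IsInter 1F 4F 0F {V ∷ O ∷ 𝒪 ∷ Y ∷ e₄}))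
            (S-all (𝒪 ∷ Y ∷ e₄) inAll λ f → S-⇔′ (f ∷ 𝒪 ∷ Y ∷ e₄) (0F D.∈ 2F) (0F D.∈ 3F D.∧ D.all∈ 1F (1F D.∈ 0F)) ↔-refl
              (S-∧′ (f ∷ 𝒪 ∷ Y ∷ e₄) (0F D.∈ 3F) (D.all∈ 1F (1F D.∈ 0F)) ↔-refl ↔-refl))))
        (Gδ Y Y⊆)

      qSet : S.⟦ D.QSet 3F 2F 0F ⟧ e₄
      qSet = proj₂ (S-∧ (D.all∈ 0F (D.Function 0F 4F 3F)) (D.~ D.Countable 3F 0F D.∧ D.all (0F D.⊆ 1F D.⇒ D.RelativelyGδ 4F 3F 1F 0F)) {e₄})
        ( (λ f f∈ → proj₂ (S-Function 0F 4F 3F {f ∷ e₄}) (X-fn f f∈))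
        , proj₂ (S-∧ (D.~ D.Countable 3F 0F) (D.all (0F D.⊆ 1F D.⇒ D.RelativelyGδ 4F 3F 1F 0F)) {e₄})
          ( (λ c → X-uncountable (proj₁ (S-ex e₄ (D.Injection 0F 1F 4F) λ h → S-Injection 0F 1F 4F {h ∷ e₄}) c)) , relativelyGδ ) )

      witness : S.⟦ D.existsMADQSet ⟧ []
      witness k = k ω λ k → k two λ k → k 𝒜 λ k → k X
        (proj₂ (S-∧ (D.IsOmega 3F) (D.IsTwo 2F D.∧ D.MAD 3F 1F D.∧ D.IsCharImage 3F 2F 0F 1F D.∧ D.QSet 3F 2F 0F) {e₄}) (omega ,
         proj₂ (S-∧ (D.IsTwo 2F) (D.MAD 3F 1F D.∧ D.IsCharImage 3F 2F 0F 1F D.∧ D.QSet 3F 2F 0F) {e₄}) (proj₂ (S-IsTwo 2F {e₄}) Q-refl ,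
         proj₂ (S-∧ (D.MAD 3F 1F) (D.IsCharImage 3F 2F 0F 1F D.∧ D.QSet 3F 2F 0F) {e₄}) (madFamily ,
         proj₂ (S-∧ (D.IsCharImage 3F 2F 0F 1F) (D.QSet 3F 2F 0F) {e₄}) (charImage , qSet)))))

    madQSet : S.⟦ Ψ.Ψ ⟧ [] → S.⟦ D.existsMADQSet ⟧ []
    madQSet ψ k = ψ λ w I J R a L₁ L₀ least minimal natural fun₁ fun₀ disj meets₁ meets₀ ad mad topLabel coded → topLabel λ t t∈ top →
      Witness.witness (FromΨ.labelled w I J R a L₁ L₀ least minimal natural fun₁ fun₀ disj meets₁ meets₀ ad mad coded t t∈
        (λ i i∈ → proj₁ (S-Maps 5F 0F 1F {i ∷ t ∷ FromΨ.e₇ w I J R a L₁ L₀}) (top i i∈))) k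

-- The elements of the Henkin model are natural numbers, so the identity enumerates them.
consistent-Ψ : D.Consistent ZFC → D.Consistent (ZFC ＋ Ψ.Ψ)
consistent-Ψ con d = SetTheory.Levels.universe 𝔐 λ { (B , U) → SetTheory.Conditions.Generic.consistent 𝔐 B U (λ k → k) (λ x → x , refl) d }
  where
  𝔐 : Model ZFC
  𝔐 = Henkin.model ZFC D.infinity-ax con

forget : ∀ {σ} → Model (ZFC ＋ σ) → Model ZFC
forget 𝔐 = record { structure = structure ; holds = λ z → holds (inj₁ z) ; ε = ε ; ε-spec = ε-spec }
  where open Model 𝔐

open import Defs
open import Relation.Unary using (_∪_; ｛_｝)

theorem1 : Consistent ZFC → Consistent (ZFC ∪ ｛ existsMADQSet ｝)
theorem1 con = Semantics.sound⇒consistent (Model.structure 𝔐) λ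
  { (inj₁ z) → Model.holds 𝔐 z ; (inj₂ refl) → SetTheory.Conclusion.madQSet 𝔐 (Model.holds 𝔐Ψ (inj₂ refl)) }
  where
  -- Completeness is applied a second time: the extension was used only for consistency, while the
  -- combinatorial half works in a model equipped with `ε`.
  𝔐Ψ : Model (ZFC ＋ Ψ.Ψ)
  𝔐Ψ = Henkin.model (ZFC ＋ Ψ.Ψ) (inj₁ infinity-ax) (consistent-Ψ con)
  𝔐 : Model ZFC
  𝔐 = forget 𝔐Ψ
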